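{- Let $k\ge1$, $r\ge1$, $\mu\in\mathrm{Par}^{k-r+1}_r$ and $\nu\in\mathrm{Par}^k$ be such that the concatenation $\mu\nu$ is a partition. Let $U=(k-r+1)^r$. Then \[ \mathcal B_\mu\,\mathfrak s^{(k)}_\nu=\sum_{T\in\mathrm{SSYT}_{U/\mu}([r])}\mathfrak s^{(k)}_{U\nu}\cdot u_{\mathrm{creading}(T)}. \]
   Context: Let $t$ be an indeterminate and $\Lambda=\mathbb Z[t][h_1,h_2,\dots]$ the ring of symmetric functions in $\mathbf x$ over $\mathbb Z[t]$ ($h_0=1$, $h_d=0$ for $d<0$). For $\gamma\in\mathbb Z^\ell$, $s_\gamma=\det(h_{\gamma_i+j-i})_{1\le i,j\le\ell}$. A root ideal is an upper order ideal $\Psi$ of $\Delta^+_\ell=\{(i,j):1\le i<j\le\ell\}$ (order: $(a,b)\le(c,d)$ iff $a\ge c$, $b\le d$). The Catalan function of $(\Psi,\gamma)$, $\gamma\in\mathbb Z^\ell$, is $H(\Psi;\gamma)=\sum_{m:\Psi\to\mathbb Z_{\ge0}}t^{\sum m}s_{\gamma+\sum_{(i,j)\in\Psi}m_{ij}(\epsilon_i-\epsilon_j)}\in\Lambda$ ($\epsilon_i$ unit vectors), i.e. $\prod_{(i,j)\in\Psi}(1-tR_{ij})^{ -1}s_\gamma$ with raising operators $R_{ij}s_\beta=s_{\beta+\epsilon_i-\epsilon_j}$. $\mathrm{Par}^k_\ell=\{\mu\in\mathbb Z^\ell:k\ge\mu_1\ge\dots\ge\mu_\ell\ge0\}$; $\mathrm{Par}^k$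 = partitions with parts $\le k$. For $\mu\in\mathrm{Par}^k_\ell$, $\Delta^k(\mu)=\{(i,j)\in\Delta^+_\ell:k-\mu_i+i<j\}$ and the $k$-Schur Catalan function is $\mathfrak s^{(k)}_\mu=H(\Delta^k(\mu);\mu)$ (unchanged by appending zeros). $\Lambda^k$ is the $\mathbb Z[t]$-span of the modified Hall–Littlewood polynomials $H(\Delta^+_{\ell(\mu)};\mu)$, $\mu\in\mathrm{Par}^k$, and $\{\mathfrak s^{(k)}_\mu\}_{\mu\in\mathrm{Par}^k}$ is a basis of it. Operators: for $m\in\mathbb Z$, $\mathcal B_m=\sum_{i,j\ge0}(-1)^it^jh_{m+i+j}e_i^\perp h_j^\perp$, where $f^\perp$ is the adjoint of multiplication by $f$ for the Hall inner product and $h_{m+i+j}$ acts by multiplication. For $\alpha\in\mathbb Z^\ell$, $\tilde{\mathcal B}_\alpha=\mathcal B_{\alpha_1}\cdots\mathcal B_{\alpha_\ell}$, and $\mathcal B_\alpha=\prod_{1\le i<j\le\ell}(1-t\mathbf R_{ij})\tilde{\mathcal B}_\alpha$, where the product is expanded and $\mathbf R_{ij}\tilde{\mathcal B}_\beta=\tilde{\mathcal B}_{\beta+\epsilon_i-\epsilon_j}$. Strong Pieri operators: a $(k+1)$-core is a partition with no box of hook length $k+1$; $\mathfrak p$ maps a $(k+1)$-core $\kappa$ to the partition whose $r$-th part is the number of boxes in row $r$ of $\kappa$ with hook length $\le k$ (a bijection onto $\mathrm{Par}^k$). A strong marked cover $\tau\xRightarrow{r}\kappa$ consists of $(k+1)$-cores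 $\tau\subseteq\kappa$ with $|\mathfrak p(\tau)|+1=|\mathfrak p(\kappa)|$ and a positive integer $r$ which is the smallest row index of some connected component of $\kappa/\tau$; its spin is $c(h-1)+N$ with $c$ the number of components of $\kappa/\tau$, $h$ their common height, $N$ the number of components entirely in rows $>r$. The operators $u_p$ act on the right on $\Lambda^k$ by $\mathfrak s^{(k)}_\mu\cdot u_p=\sum t^{\mathrm{spin}}\mathfrak s^{(k)}_{\mathfrak p(\tau)}$, summed over strong marked covers $\tau\xRightarrow{p}\kappa$ with $\mathfrak p(\kappa)=\mu$; for a word $w=w_1\cdots w_d$, $f\cdot u_w=(\cdots(f\cdot u_{w_1})\cdots)\cdot u_{w_d}$. $\mathrm{SSYT}_{\theta}([r])$ is the set of semistandard Young tableaux of skew shape $\theta$ with entries in $\{1,\dots,r\}$ (rows weakly increasing, columns strictly increasing). $\mathrm{creading}(T)$ concatenates the columns of $T$ left to right, each read bottom to top. $U\nu$ denotes concatenation. -}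

module Defs where

open import Data.Nat using (ℕ; zero; suc; _+_; _*_; _∸_; _^_; _≤_; _<ᵇ_; _≤ᵇ_; _≡ᵇ_; _⊔_; _⊓_)
open import Data.Integer as ℤ using (ℤ; +_; -[1+_])
open import Data.List using (List; []; _∷_; _++_; map; concatMap; foldr; foldl; length; upTo; replicate; reverse; filterᵇ)
open import Data.Bool using (Bool; true; false; if_then_else_; _∧_; _∨_; not)
open import Data.Product using (_×_; _,_; proj₁; proj₂)
open import Data.Maybe using (Maybe; just; nothing)
open import Relation.Binary.PropositionalEquality using (_≡_)
open import Data.List.Relation.Unary.Linked using (Linked)
open import Data.List.Relation.Unary.All using (All)

sum : List ℕ → ℕ
sum = foldr _+_ 0

all : {A : Set} → (A → Bool) → List A → Bool
all p = foldr (λ x b → p x ∧ b) true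

any : {A : Set} → (A → Bool) → List A → Bool
any p = foldr (λ x b → p x ∨ b) false

range : ℕ → ℕ → List ℕ
range a b = map (λ x → a + x) (upTo (suc b ∸ a))

nthN : List ℕ → ℕ → ℕ
nthN []       _       = 0
nthN (x ∷ _)  zero    = x
nthN (_ ∷ xs) (suc i) = nthN xs i

nthZ : List ℤ → ℕ → ℤ
nthZ []       _       = + 0
nthZ (x ∷ _)  zero    = x
nthZ (_ ∷ xs) (suc i) = nthZ xs i

nthL : List (List ℕ) → ℕ → List ℕ
nthL []       _       = []
nthL (x ∷ _)  zero    = x
nthL (_ ∷ xs) (suc i) = nthL xs i

dropZeros : List ℕ → List ℕ
dropZeros []           = []
dropZeros (zero ∷ xs)  = dropZeros xs
dropZeros (suc x ∷ xs) = suc x ∷ dropZeros xs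

countB : {A : Set} → (A → Bool) → List A → ℕ
countB p = foldr (λ x n → if p x then suc n else n) 0

eqList : List ℕ → List ℕ → Bool
eqList []       []       = true
eqList (x ∷ xs) (y ∷ ys) = (x ≡ᵇ y) ∧ eqList xs ys
eqList _        _        = false

Decreasing : List ℕ → Set
Decreasing = Linked (λ a b → b ≤ a)

IsPartition : List ℕ → Set
IsPartition ν = Decreasing ν × All (λ x → 1 ≤ x) ν

decr : ℕ → ℕ → List (List ℕ)
decr zero    m = [] ∷ []
decr (suc n) m = concatMap (λ a → map (a ∷_) (decr n a)) (upTo (suc m))

incr : ℕ → ℕ → ℕ → List (List ℕ)
incr zero    lo hi = [] ∷ []
incr (suc n) lo hi = concatMap (λ a → map (a ∷_) (incr n a hi)) (range lo hi)

vecsLe : ℕ → ℕ → List (List ℕ)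
vecsLe zero    N = [] ∷ []
vecsLe (suc c) N = concatMap (λ a → map (a ∷_) (vecsLe c (N ∸ a))) (upTo (suc N))

subsets : {A : Set} → List A → List (List A)
subsets []       = [] ∷ []
subsets (x ∷ xs) = subsets xs ++ map (x ∷_) (subsets xs)

cartesian : {A : Set} → List (List A) → List (List A)
cartesian []         = [] ∷ []
cartesian (xs ∷ xss) = concatMap (λ x → map (x ∷_) (cartesian xss)) xs

-- ℤ[t] as coefficient lists (constant term first)

Poly : Set
Poly = List ℤ

addP : Poly → Poly → Poly
addP []      q       = q
addP (a ∷ p) []      = a ∷ p
addP (a ∷ p) (b ∷ q) = (a ℤ.+ b) ∷ addP p q

mulP : Poly → Poly → Poly
mulP []      q = []
mulP (a ∷ p) q = addP (map (a ℤ.*_) q) (+ 0 ∷ mulP p q)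

coeffP : ℕ → Poly → ℤ
coeffP _       []      = + 0
coeffP zero    (a ∷ _) = a
coeffP (suc n) (_ ∷ p) = coeffP n p

oneP : Poly
oneP = + 1 ∷ []

tpow : ℕ → Poly
tpow n = replicate n (+ 0) ++ oneP

signP : ℕ → Poly
signP zero    = oneP
signP (suc n) = map ℤ.-_ (signP n)

-- Λ = ℤ[t][h₁,h₂,…]: an element is a formal ℤ[t]-combination of
-- monomials h_{m₁}⋯h_{mₙ}, a monomial given by the list (m₁,…,mₙ)
-- (order irrelevant, parts 0 stand for h₀ = 1).

Sym : Set
Sym = List (Poly × List ℕ)

countN : ℕ → List ℕ → ℕ
countN x = countB (λ y → x ≡ᵇ y)

sameMono : List ℕ → List ℕ → Bool
sameMono a b = all (λ x → (x ≡ᵇ 0) ∨ (countN x a ≡ᵇ countN x b)) (a ++ b)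

coeffS : Sym → List ℕ → ℕ → ℤ
coeffS f mono n =
  foldr (λ { (p , m) acc → if sameMono m mono then coeffP n p ℤ.+ acc else acc }) (+ 0) f

-- equality in Λ (the h-monomials form a ℤ[t]-basis of Λ)
infix 4 _≈S_
_≈S_ : Sym → Sym → Set
f ≈S g = ∀ (mono : List ℕ) (n : ℕ) → coeffS f mono n ≡ coeffS g mono n

zeroS : Sym
zeroS = []

oneS : Sym
oneS = (oneP , []) ∷ []

_+S_ : Sym → Sym → Sym
f +S g = f ++ g

sumS : List Sym → Sym
sumS = foldr _+S_ zeroS

scaleS : Poly → Sym → Sym
scaleS p = map (λ { (q , m) → (mulP p q , m) })

_*S_ : Sym → Sym → Sym
f *S g = concatMap (λ { (p , m) → map (λ { (q , m') → (mulP p q , m ++ m') }) g }) f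

hS : ℤ → Sym
hS (+ zero)  = oneS
hS (+ suc n) = (oneP , suc n ∷ []) ∷ []
hS -[1+ n ]  = zeroS

skip : ℕ → ℕ → ℕ
skip j b = if b <ᵇ j then b else suc b

det : ℕ → (ℕ → ℕ → Sym) → Sym
det zero    M = oneS
det (suc n) M =
  sumS (map (λ j → scaleS (signP j) (M 0 j *S det n (λ a b → M (suc a) (skip j b))))
            (upTo (suc n)))

schurS : List ℤ → Sym
schurS γ = det (length γ) (λ i j → hS (nthZ γ i ℤ.+ ((+ j) ℤ.- (+ i))))

addAt : ℕ → ℤ → List ℤ → List ℤ
addAt _       a []       = []
addAt zero    a (x ∷ xs) = (x ℤ.+ a) ∷ xs
addAt (suc i) a (x ∷ xs) = x ∷ addAt i a xs

-- γ + Σ m_ij (ε_i - ε_j), pairs (i , j) 1-indexed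
raise : List (ℕ × ℕ) → List ℕ → List ℤ → List ℤ
raise ((i , j) ∷ Ψ) (a ∷ m) γ = raise Ψ m (addAt (i ∸ 1) (+ a) (addAt (j ∸ 1) (ℤ.- (+ a)) γ))
raise _              _       γ = γ

-- Truncation bound for the sum defining H(Ψ;γ): for Ψ ⊆ Δ⁺_ℓ every term
-- with Σ m larger than this bound has s_β = 0 (some row of the
-- Jacobi–Trudi matrix vanishes).
catBound : List ℤ → ℕ
catBound γ = suc (length γ) * sum (map ℤ.∣_∣ γ) + length γ ^ 3

-- H(Ψ;γ) = Σ_{m : Ψ → ℤ≥0} t^{Σ m} s_{γ + Σ m_ij (ε_i - ε_j)}
catalan : List (ℕ × ℕ) → List ℤ → Sym
catalan Ψ γ =
  sumS (map (λ m → scaleS (tpow (sum m)) (schurS (raise Ψ m γ)))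
            (vecsLe (length Ψ) (catBound γ)))

kRoots : ℕ → List ℕ → List (ℕ × ℕ)
kRoots k μ =
  concatMap (λ i → concatMap (λ j →
      if (i <ᵇ j) ∧ (((k ∸ nthN μ (i ∸ 1)) + i) <ᵇ j) then (i , j) ∷ [] else [])
    (range 1 (length μ))) (range 1 (length μ))

kSchur : ℕ → List ℕ → Sym
kSchur k μ = catalan (kRoots k μ) (map (λ x → + x) μ)

-- Skewing operators h_j^⊥ and e_i^⊥ on the h-monomial basis
-- (h_j^⊥ h_n = h_{n-j}, e_1^⊥ h_n = h_{n-1}, e_i^⊥ h_n = 0 for i ≥ 2,
--  extended through the coproduct Δh_n = Σ h_a ⊗ h_{n-a}, Δe_n = Σ e_a ⊗ e_{n-a})

hperpM : ℕ → List ℕ → List (List ℕ)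
hperpM j []       = if j ≡ᵇ 0 then [] ∷ [] else []
hperpM j (x ∷ xs) = concatMap (λ a → map ((x ∸ a) ∷_) (hperpM (j ∸ a) xs)) (upTo (suc (x ⊓ j)))

-- input: monomial without zero parts
eperpM : ℕ → List ℕ → List (List ℕ)
eperpM zero    xs       = xs ∷ []
eperpM (suc i) []       = []
eperpM (suc i) (x ∷ xs) = map ((x ∸ 1) ∷_) (eperpM i xs) ++ map (x ∷_) (eperpM (suc i) xs)

liftPerp : (List ℕ → List (List ℕ)) → Sym → Sym
liftPerp F = concatMap (λ { (p , m) → map (λ m' → (p , m')) (F (dropZeros m)) })

hperp : ℕ → Sym → Sym
hperp j = liftPerp (hperpM j)

eperp : ℕ → Sym → Sym
eperp i = liftPerp (eperpM i)

degS : Sym → ℕ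
degS = foldr (λ { (_ , m) d → sum m ⊔ d }) 0

-- The operators 𝓑_m, 𝓑̃_α, 𝓑_α
-- 𝓑_m f = Σ_{i,j ≥ 0} (-1)^i t^j h_{m+i+j} e_i^⊥ h_j^⊥ f ; terms with
-- i > deg f or j > deg f vanish.

Bop : ℤ → Sym → Sym
Bop m f =
  sumS (concatMap (λ i → map (λ j →
          scaleS (mulP (signP i) (tpow j))
                 (hS (m ℤ.+ (+ i) ℤ.+ (+ j)) *S eperp i (hperp j f)))
        (upTo (suc (degS f)))) (upTo (suc (degS f))))

Btilde : List ℤ → Sym → Sym
Btilde []      f = f
Btilde (a ∷ α) f = Bop a (Btilde α f)

posPairs : ℕ → List (ℕ × ℕ)
posPairs ℓ = concatMap (λ i → concatMap (λ j → if i <ᵇ j then (i , j) ∷ [] else [])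
                                        (range 1 ℓ)) (range 1 ℓ)

applyR : List (ℕ × ℕ) → List ℤ → List ℤ
applyR S α = foldr (λ { (i , j) γ → addAt (i ∸ 1) (+ 1) (addAt (j ∸ 1) (ℤ.- (+ 1)) γ) }) α S

-- 𝓑_α = Π_{i<j} (1 - t 𝐑_ij) 𝓑̃_α, expanded over subsets of pairs
Bcal : List ℤ → Sym → Sym
Bcal α f =
  sumS (map (λ S → scaleS (mulP (signP (length S)) (tpow (length S)))
                          (Btilde (applyR S α) f))
            (subsets (posPairs (length α))))

-- Cores and strong marked covers (partitions as lists, rows 1-indexed)

countGe : ℕ → List ℕ → ℕ        -- length of column c
countGe c = countB (λ x → c ≤ᵇ x)

hook : List ℕ → ℕ → ℕ → ℕ
hook κ i c = (nthN κ (i ∸ 1) ∸ c) + (countGe c κ ∸ i) + 1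

isCore : ℕ → List ℕ → Bool
isCore k κ = all (λ i → all (λ c → not (hook κ i c ≡ᵇ suc k))
                            (range 1 (nthN κ (i ∸ 1))))
                 (range 1 (length κ))

-- the map 𝔭 from (k+1)-cores to k-bounded partitions
pmap : ℕ → List ℕ → List ℕ
pmap k κ = dropZeros (map (λ i → countB (λ c → hook κ i c ≤ᵇ k) (range 1 (nthN κ (i ∸ 1))))
                          (range 1 (length κ)))

partsBox : ℕ → ℕ → List (List ℕ)
partsBox n m = map dropZeros (decr n m)

-- the (k+1)-cores κ with 𝔭(κ) = μ  (such κ has ≤ |μ| rows and parts ≤ |μ|)
coresFor : ℕ → List ℕ → List (List ℕ)
coresFor k μ = filterᵇ (λ κ → isCore k κ ∧ eqList (pmap k κ) (dropZeros μ))
                       (partsBox (sum μ) (sum μ))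

contained : List ℕ → List ℕ → Bool
contained τ κ = all (λ i → nthN τ (i ∸ 1) ≤ᵇ nthN κ (i ∸ 1)) (range 1 (length τ ⊔ length κ))

subParts : List ℕ → List (List ℕ)
subParts κ = filterᵇ (λ τ → contained τ κ) (partsBox (length κ) (nthN κ 0))

-- connected components of the skew shape κ/τ, as (top row, bottom row)
closeC : Maybe (ℕ × ℕ × ℕ) → List (ℕ × ℕ)
closeC nothing            = []
closeC (just (a , b , _)) = (a , b) ∷ []

compsGo : List (ℕ × ℕ × ℕ) → Maybe (ℕ × ℕ × ℕ) → List (ℕ × ℕ)
compsGo []                  o = closeC o
compsGo ((i , t , c) ∷ rs) nothing =
  if t <ᵇ c then compsGo rs (just (i , i , t)) else compsGo rs nothing
compsGo ((i , t , c) ∷ rs) (just (a , b , tp)) =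
  if t <ᵇ c
  then (if tp <ᵇ c then compsGo rs (just (a , i , t))
                   else (a , b) ∷ compsGo rs (just (i , i , t)))
  else (a , b) ∷ compsGo rs nothing

comps : List ℕ → List ℕ → List (ℕ × ℕ)
comps τ κ = compsGo (map (λ i → (i , nthN τ (i ∸ 1) , nthN κ (i ∸ 1))) (range 1 (length κ))) nothing

-- τ ⇒_r κ is a strong marked cover (τ ⊆ κ assumed, κ a (k+1)-core)
coverOK : ℕ → ℕ → List ℕ → List ℕ → Bool
coverOK k r τ κ = isCore k τ ∧ (suc (sum (pmap k τ)) ≡ᵇ sum (pmap k κ))
                  ∧ any (λ { (a , _) → a ≡ᵇ r }) (comps τ κ)

spin : ℕ → List ℕ → List ℕ → ℕ
spin r τ κ = length cs * (h ∸ 1) + countB (λ { (a , _) → r <ᵇ a }) cs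
  where
  cs = comps τ κ
  h  = foldr (λ { (a , b) acc → if a ≡ᵇ r then suc b ∸ a else acc }) 0 cs

-- formal ℤ[t]-combinations of k-Schur functions 𝔰^(k)_λ
KComb : Set
KComb = List (Poly × List ℕ)

uAct : ℕ → ℕ → KComb → KComb
uAct k p = concatMap (λ { (q , μ) →
  concatMap (λ κ → concatMap (λ τ →
      if coverOK k p τ κ then (mulP q (tpow (spin p τ κ)) , pmap k τ) ∷ [] else [])
    (subParts κ)) (coresFor k μ) })

uWord : ℕ → List ℕ → KComb → KComb
uWord k w f = foldl (λ g p → uAct k p g) f w

evalK : ℕ → KComb → Sym
evalK k f = sumS (map (λ { (q , lam) → scaleS q (kSchur k lam) }) f)

-- Semistandard tableaux of shape U/μ, U = W^r, entries in [r]
-- (T = list of rows; row i holds the entries in columns μ_i+1..W)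

entry : List (List ℕ) → List ℕ → ℕ → ℕ → ℕ
entry T μ i c = nthN (nthL T (i ∸ 1)) (c ∸ nthN μ (i ∸ 1) ∸ 1)

colStrict : ℕ → ℕ → List ℕ → List (List ℕ) → Bool
colStrict r W μ T =
  all (λ i → all (λ c → if nthN μ (i ∸ 1) <ᵇ c
                         then entry T μ i c <ᵇ entry T μ (suc i) c else true)
                 (range 1 W))
      (range 1 (r ∸ 1))

-- SSYT_{U/μ}([r]) (rows weakly increasing by construction)
ssyt : ℕ → ℕ → List ℕ → List (List (List ℕ))
ssyt r W μ = filterᵇ (colStrict r W μ) (cartesian (map (λ m → incr (W ∸ m) 1 r) μ))

creading : ℕ → ℕ → List ℕ → List (List ℕ) → List ℕ
creading r W μ T =
  concatMap (λ c → concatMap (λ i → if nthN μ (i ∸ 1) <ᵇ c then entry T μ i c ∷ [] else [])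
                             (reverse (range 1 r)))
            (range 1 W)

{-# OPTIONS --safe #-}
module Submission where

-- Both sides are tested against the functionals "coefficient of an h-monomial".  The vertex operator formula turns
-- 𝓑_μ 𝔰^(k)_ν into the Catalan function of weight μν whose first r rows contain all columns beyond r.
-- Replacing μ by μ - ε_p, p ≤ r, in a k-Schur function and reflecting the root ideal leaves a sum over a path of
-- removable rows; read on (k+1)-cores these are the strong covers marked in row p, so u_p lowers the p-th entry of
-- the weight of any antisymmetric Catalan-type sum.  Distant u_p commute, and so do the elementary symmetric sums of
-- the u_p, which is all that is needed (Fomin–Greene) to write the sum over tableaux as a determinant in these
-- elementary sums by peeling off the smallest letter.  The determinant can then be computed on weights: there the
-- sum over tableaux of an antisymmetric function collapses to the weight μ by a sign-reversing involution, and
-- the root ideal of Uν may be enlarged to full rows because the first r entries of Uν are equal.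

open import Defs
open import Data.Nat using (ℕ; zero; suc; _+_; _*_; _∸_; _≤_; _<_; z≤n; s≤s; z<s; _≤?_; _<?_; _≟_; _⊔_; _⊓_; _≤ᵇ_; _<ᵇ_; _≡ᵇ_)
open import Data.Nat.Properties using (*-distribʳ-+; *-distribˡ-+; *-monoʳ-≤; *-monoˡ-≤; *-zeroʳ; +-assoc; +-cancelʳ-≡; +-cancelʳ-≤; +-cancelˡ-≡; +-cancelˡ-≤; +-comm; +-identityʳ; +-mono-<-≤; +-mono-≤; +-mono-≤-<; +-monoʳ-<; +-monoʳ-≤; +-monoˡ-≤; +-suc; +-∸-assoc; +-∸-comm; 0∸n≡0; <-cmp; <-irrefl; <-trans; <-≤-trans; <ᵇ⇒<; <⇒<ᵇ; <⇒≢; <⇒≤; <⇒≱; >⇒≢; [m+n]∸[m+o]≡n∸o; m+[n∸m]≡n; m+n∸m≡n; m+n∸n≡m; m+n≡0⇒m≡0; m+n≡0⇒n≡0; m<n⇒0<n∸m; m<n⇒m<1+n; module ≤-Reasoning; m∸n+n≡m; m∸n≢0⇒n<m; m∸n≤m; m≢1+n+m; m≤m+n; m≤m⊔n; m≤n+m; m≤n+m∸n; m≤n⇒m<n∨m≡n; m≤n⇒m∸n≡0; m≤n⇒m≤1+n; m≤n⇒m⊓n≡m; m≤n⊔m; m≥n⇒m⊓n≡n; m⊓n≤m; m⊓n≤n; n<1+n; n∸n≡0; n≤0⇒n≡0; n≤1+n; n≮0; suc-injective; ∸-+-assoc; ∸-monoʳ-<; ∸-monoʳ-≤; ∸-monoˡ-<;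 ∸-monoˡ-≤; ≡ᵇ⇒≡; ≤-<-trans; ≤-antisym; ≤-pred; ≤-refl; ≤-reflexive; ≤-total; ≤-trans; ≤ᵇ⇒≤; ≤⇒≤ᵇ; ≤∧≢⇒<; ≮⇒≥; ≰⇒>; ⊓-zeroʳ)
import Data.Integer as Z
open import Data.Integer using (ℤ; +_; -[1+_])
import Data.Integer.Properties as ZP
open import Data.Integer.Properties using () renaming (+-identityʳ to +0ʳ; +-identityˡ to +0ˡ)
open import Data.Integer.Tactic.RingSolver using (solve-∀)
import Data.Nat.Tactic.RingSolver as NRing
open import Data.Bool using (Bool; true; false; if_then_else_; _∧_; _∨_; not; T)
open import Data.Bool.Properties using (T?)
open import Data.Maybe using (just; nothing)
open import Data.List using (List; []; _∷_; _++_; map; concatMap; foldr; length; upTo; applyUpTo; replicate; reverse; filterᵇ)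
import Data.List.Properties as LP
open import Data.List.Relation.Unary.All as All using (All; []; _∷_)
open import Data.List.Relation.Unary.Any using (here; there)
open import Data.List.Relation.Unary.Linked using (Linked; []; [-]; _∷_)
open import Data.List.Membership.Propositional using (_∈_)
import Data.List.Membership.Propositional.Properties as MP
open import Data.List.Relation.Binary.Permutation.Propositional using (_↭_)
import Data.List.Relation.Binary.Permutation.Propositional as Perm
open import Data.List.Relation.Unary.Unique.Propositional using (Unique)
import Data.List.Relation.Unary.AllPairs as AllPairs
open import Data.Product using (_×_; _,_; proj₁; proj₂; Σ; ∃; ∃-syntax)
open import Data.Sum using (_⊎_; inj₁; inj₂)
open import Data.Empty using (⊥; ⊥-elim)
open import Data.Unit using (⊤; tt)
open import Function using (_∘_; id)
open import Relation.Nullary using (¬_; Dec; yes; no)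
open import Relation.Binary.PropositionalEquality using (_≡_; _≢_; refl; sym; trans; cong; cong₂; subst; subst₂; module ≡-Reasoning)
import Data.List.Relation.Unary.Unique.Propositional.Properties as UP
import Data.List.Relation.Binary.BagAndSetEquality as BS
import Data.List.Membership.Propositional.Properties.WithK as MK
open import Function.Bundles using (mk⇔)
open import Relation.Binary.Definitions using (tri<; tri≈; tri>)
import Data.List.Relation.Unary.Any.Properties as AnyP

-- That `u_p` lowers entry p of the weight rests on antisymmetry in rows p and p+1, and lowering one
-- of these rows destroys it. The argument therefore covers strictly decreasing words, and
-- elementary symmetric sums over them are antisymmetric again, but it does not cover an arbitrary
-- word. This forces column words and a determinant instead of a tableau-by-tableau comparison.
-- Letters are peeled inside longer words, so the commutations are needed in front of an arbitrary
-- tail, as identities of formal combinations. Triangularity provides them: at t = 0 the coefficient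
-- of h_λ in the function indexed by μ is 0 for λ lexicographically below μ and 1 for λ = μ, so a
-- relation seen by all coefficient functionals holds formally. With W = k+1-r and J = W-μ_r, only J
-- columns of U/μ are nonempty, so a letter occurs at most J times and the first r rows, starting at
-- W, stay at least μ_r, which bounds the parts of ν. Rows of length at most W have their first root
-- beyond column r, so a path leaves the first r rows after one step.

infixr 2 _&_ _&≤_
_&_ : {A : Set} {x y z : A} -> x ≡ y -> y ≡ z -> x ≡ z
_&_ = trans

_&≤_ : {i j k : ℕ} -> i ≤ j -> j ≤ k -> i ≤ k
_&≤_ = ≤-trans

eq≤ : {m n : ℕ} -> m ≡ n -> m ≤ n
eq≤ = ≤-reflexive

0z 1z : ℤ
0z = + 0
1z = + 1

-- Finite sums

∑ : {A : Set} -> List A -> (A -> ℤ) -> ℤ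
∑ [] f = 0z
∑ (x ∷ xs) f = f x Z.+ ∑ xs f

module _ {A : Set} where

 ∑-cong : ∀ (xs : List A) {f g : A -> ℤ} -> (∀ x -> f x ≡ g x) -> ∑ xs f ≡ ∑ xs g
 ∑-cong [] e = refl
 ∑-cong (x ∷ xs) e = cong₂ Z._+_ (e x) (∑-cong xs e)

 ∑-cong∈ : ∀ (xs : List A) {f g : A -> ℤ} -> (∀ x -> x ∈ xs -> f x ≡ g x) -> ∑ xs f ≡ ∑ xs g
 ∑-cong∈ [] e = refl
 ∑-cong∈ (x ∷ xs) e = cong₂ Z._+_ (e x (here refl)) (∑-cong∈ xs (\ y i -> e y (there i)))

 ∑-++ : ∀ (xs ys : List A) (f : A -> ℤ) -> ∑ (xs ++ ys) f ≡ ∑ xs f Z.+ ∑ ys f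
 ∑-++ [] ys f = sym (+0ˡ _)
 ∑-++ (x ∷ xs) ys f = cong (\ z -> f x Z.+ z) (∑-++ xs ys f) & sym (ZP.+-assoc (f x) _ _)

 ∑-0 : ∀ (xs : List A) -> ∑ xs (\ _ -> 0z) ≡ 0z
 ∑-0 [] = refl
 ∑-0 (x ∷ xs) = +0ˡ _ & ∑-0 xs

 ∑-0∈ : ∀ (xs : List A) {f : A -> ℤ} -> (∀ x -> x ∈ xs -> f x ≡ 0z) -> ∑ xs f ≡ 0z
 ∑-0∈ xs e = ∑-cong∈ xs e & ∑-0 xs

 ∑-+ : ∀ (xs : List A) (f g : A -> ℤ) -> ∑ xs (\ x -> f x Z.+ g x) ≡ ∑ xs f Z.+ ∑ xs g
 ∑-+ [] f g = refl
 ∑-+ (x ∷ xs) f g = cong (\ z -> (f x Z.+ g x) Z.+ z) (∑-+ xs f g) & lem (f x) (g x) _ _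
  where lem : ∀ a b c d -> (a Z.+ b) Z.+ (c Z.+ d) ≡ (a Z.+ c) Z.+ (b Z.+ d)
        lem = solve-∀

 ∑-* : ∀ (c : ℤ) (xs : List A) (f : A -> ℤ) -> ∑ xs (\ x -> c Z.* f x) ≡ c Z.* ∑ xs f
 ∑-* c [] f = sym (ZP.*-zeroʳ c)
 ∑-* c (x ∷ xs) f = cong (\ z -> c Z.* f x Z.+ z) (∑-* c xs f) & sym (ZP.*-distribˡ-+ c (f x) _)

 ∑-neg : ∀ (xs : List A) (f : A -> ℤ) -> ∑ xs (\ x -> Z.- f x) ≡ Z.- ∑ xs f
 ∑-neg [] f = refl
 ∑-neg (x ∷ xs) f = cong (\ z -> Z.- f x Z.+ z) (∑-neg xs f) & sym (ZP.neg-distrib-+ (f x) _)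

 ∑-↭ : ∀ {xs ys : List A} (f : A -> ℤ) -> xs ↭ ys -> ∑ xs f ≡ ∑ ys f
 ∑-↭ f Perm.refl = refl
 ∑-↭ f (Perm.prep x p) = cong (\ z -> f x Z.+ z) (∑-↭ f p)
 ∑-↭ f (Perm.swap x y p) = cong (\ z -> f x Z.+ (f y Z.+ z)) (∑-↭ f p) & lem (f x) (f y) _
  where lem : ∀ a b c -> a Z.+ (b Z.+ c) ≡ b Z.+ (a Z.+ c)
        lem = solve-∀
 ∑-↭ f (Perm.trans p q) = ∑-↭ f p & ∑-↭ f q

 ∑-filterᵇ : ∀ (p : A -> Bool) (xs : List A) (f : A -> ℤ) ->
  ∑ (filterᵇ p xs) f ≡ ∑ xs (\ x -> if p x then f x else 0z)
 ∑-filterᵇ p [] f = refl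
 ∑-filterᵇ p (x ∷ xs) f with p x
 ... | true = cong (\ z -> f x Z.+ z) (∑-filterᵇ p xs f)
 ... | false = ∑-filterᵇ p xs f & sym (+0ˡ _)

module _ {A B : Set} where

 ∑-swap : ∀ (xs : List A) (ys : List B) (f : A -> B -> ℤ) ->
  ∑ xs (\ x -> ∑ ys (f x)) ≡ ∑ ys (\ y -> ∑ xs (\ x -> f x y))
 ∑-swap [] ys f = sym (∑-0 ys)
 ∑-swap (x ∷ xs) ys f = cong (\ z -> ∑ ys (f x) Z.+ z) (∑-swap xs ys f) & sym (∑-+ ys (f x) _)

 ∑-map : ∀ (g : A -> B) (xs : List A) (f : B -> ℤ) -> ∑ (map g xs) f ≡ ∑ xs (f ∘ g)
 ∑-map g [] f = refl
 ∑-map g (x ∷ xs) f = cong (\ z -> f (g x) Z.+ z) (∑-map g xs f)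

 ∑-concatMap : ∀ (g : A -> List B) (xs : List A) (f : B -> ℤ) ->
  ∑ (concatMap g xs) f ≡ ∑ xs (\ x -> ∑ (g x) f)
 ∑-concatMap g [] f = refl
 ∑-concatMap g (x ∷ xs) f = ∑-++ (g x) _ f & cong (\ z -> ∑ (g x) f Z.+ z) (∑-concatMap g xs f)

∑-upTo : ∀ n (f : ℕ -> ℤ) -> ∑ (upTo (suc n)) f ≡ f 0 Z.+ ∑ (upTo n) (f ∘ suc)
∑-upTo n f = cong (\ z -> f 0 Z.+ z) (cong (\ l -> ∑ l f) (sym (LP.map-upTo suc n)) & ∑-map suc (upTo n) f)

∑-upTo-last : ∀ n (f : ℕ -> ℤ) -> ∑ (upTo (suc n)) f ≡ ∑ (upTo n) f Z.+ f n
∑-upTo-last zero f = ZP.+-comm (f 0) 0z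
∑-upTo-last (suc n) f = ∑-upTo (suc n) f &
 cong (\ z -> f 0 Z.+ z) (∑-upTo-last n (f ∘ suc)) &
 sym (ZP.+-assoc (f 0) _ _) &
 cong (\ z -> z Z.+ f (suc n)) (sym (∑-upTo n f))
 where open ≡-Reasoning

-- Sequences ℕ -> ℤ stand for power series in t; sh a is multiplication by t^a.

Seq : Set
Seq = ℕ -> ℤ

sh : ℕ -> Seq -> Seq
sh zero s n = s n
sh (suc a) s zero = 0z
sh (suc a) s (suc n) = sh a s n

sh-cong : ∀ a {s s' : Seq} n -> (∀ m -> s m ≡ s' m) -> sh a s n ≡ sh a s' n
sh-cong zero n e = e n
sh-cong (suc a) zero e = refl
sh-cong (suc a) (suc n) e = sh-cong a n e

sh-sh : ∀ a b (s : Seq) n -> sh a (sh b s) n ≡ sh (a + b) s n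
sh-sh zero b s n = refl
sh-sh (suc a) b s zero = refl
sh-sh (suc a) b s (suc n) = sh-sh a b s n

sh-+ : ∀ a (s s' : Seq) n -> sh a (\ m -> s m Z.+ s' m) n ≡ sh a s n Z.+ sh a s' n
sh-+ zero s s' n = refl
sh-+ (suc a) s s' zero = refl
sh-+ (suc a) s s' (suc n) = sh-+ a s s' n

sh-0 : ∀ a n -> sh a (\ _ -> 0z) n ≡ 0z
sh-0 zero n = refl
sh-0 (suc a) zero = refl
sh-0 (suc a) (suc n) = sh-0 a n

sh-* : ∀ a c (s : Seq) n -> sh a (\ m -> c Z.* s m) n ≡ c Z.* sh a s n
sh-* zero c s n = refl
sh-* (suc a) c s zero = sym (ZP.*-zeroʳ c)
sh-* (suc a) c s (suc n) = sh-* a c s n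

sh-∑ : ∀ {A : Set} a (xs : List A) (s : A -> Seq) n -> sh a (\ m -> ∑ xs (\ x -> s x m)) n ≡ ∑ xs (\ x -> sh a (s x) n)
sh-∑ zero xs s n = refl
sh-∑ (suc a) xs s zero = sym (∑-0 xs)
sh-∑ (suc a) xs s (suc n) = sh-∑ a xs s n

sh-beyond : ∀ a (s : Seq) n -> n < a -> sh a s n ≡ 0z
sh-beyond (suc a) s zero _ = refl
sh-beyond (suc a) s (suc n) (s≤s p) = sh-beyond a s n p

sgn : ℕ -> ℤ
sgn zero = 1z
sgn (suc n) = Z.- sgn n

-- Multiplication of a series by a polynomial. Functionals have values in series, so that factors of
-- t produced by an operator can be moved into the functional.
act : Poly -> Seq -> Seq
act [] s n = 0z
act (a ∷ p) s n = a Z.* s n Z.+ sh 1 (act p s) n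

act-cong : ∀ p {s s' : Seq} n -> (∀ m -> s m ≡ s' m) -> act p s n ≡ act p s' n
act-cong [] n e = refl
act-cong (a ∷ p) n e = cong₂ (\ x y -> a Z.* x Z.+ y) (e n) (sh-cong 1 n (\ m -> act-cong p m e))

act-addP : ∀ p q s n -> act (addP p q) s n ≡ act p s n Z.+ act q s n
act-addP [] q s n = sym (+0ˡ _)
act-addP (a ∷ p) [] s n = sym (+0ʳ _)
act-addP (a ∷ p) (b ∷ q) s n = cong (\ z -> (a Z.+ b) Z.* s n Z.+ z) (sh-cong 1 n (act-addP p q s) & sh-+ 1 (act p s) (act q s) n) &
 lem a b (s n) _ _
 where lem : ∀ a b x u v -> (a Z.+ b) Z.* x Z.+ (u Z.+ v) ≡ (a Z.* x Z.+ u) Z.+ (b Z.* x Z.+ v)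
       lem = solve-∀

act-map* : ∀ c p s n -> act (map (c Z.*_) p) s n ≡ c Z.* act p s n
act-map* c [] s n = sym (ZP.*-zeroʳ c)
act-map* c (a ∷ p) s n = cong (\ z -> (c Z.* a) Z.* s n Z.+ z) (sh-cong 1 n (act-map* c p s) & sh-* 1 c (act p s) n) &
 lem c a (s n) _
 where lem : ∀ c a x u -> (c Z.* a) Z.* x Z.+ c Z.* u ≡ c Z.* (a Z.* x Z.+ u)
       lem = solve-∀

act-map- : ∀ p s n -> act (map Z.-_ p) s n ≡ Z.- act p s n
act-map- [] s n = refl
act-map- (a ∷ p) s n = cong (\ z -> (Z.- a) Z.* s n Z.+ z) (sh-cong 1 n (act-map- p s) & neg n) &
 lem a (s n) _
 where lem : ∀ a x u -> (Z.- a) Z.* x Z.+ (Z.- u) ≡ Z.- (a Z.* x Z.+ u)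
       lem = solve-∀
       neg : ∀ n -> sh 1 (\ m -> Z.- act p s m) n ≡ Z.- sh 1 (act p s) n
       neg zero = refl
       neg (suc n) = refl

act-mulP : ∀ p q s n -> act (mulP p q) s n ≡ act p (act q s) n
act-mulP [] q s n = refl
act-mulP (a ∷ p) q s n = act-addP (map (a Z.*_) q) (+ 0 ∷ mulP p q) s n &
 cong₂ Z._+_ (act-map* a q s n) (+0ˡ _ & sh-cong 1 n (act-mulP p q s))

act-oneP : ∀ s n -> act oneP s n ≡ s n
act-oneP s n = cong (\ z -> 1z Z.* s n Z.+ z) (sh-0 1 n) & +0ʳ _ & ZP.*-identityˡ _

act-tpow : ∀ a s n -> act (tpow a) s n ≡ sh a s n
act-tpow zero s n = act-oneP s n
act-tpow (suc a) s zero = refl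
act-tpow (suc a) s (suc n) = +0ˡ _ & act-tpow a s n

act-signP : ∀ a s n -> act (signP a) s n ≡ sgn a Z.* s n
act-signP zero s n = act-oneP s n & sym (ZP.*-identityˡ _)
act-signP (suc a) s n = act-map- (signP a) s n & cong Z.-_ (act-signP a s n) & ZP.neg-distribˡ-* (sgn a) (s n)

act-∑ : ∀ {A : Set} p (xs : List A) (s : A -> Seq) n -> act p (\ m -> ∑ xs (\ x -> s x m)) n ≡ ∑ xs (\ x -> act p (s x) n)
act-∑ [] xs s n = sym (∑-0 xs)
act-∑ (a ∷ p) xs s n = cong₂ Z._+_ (sym (∑-* a xs (\ x -> s x n))) (sh-cong 1 n (act-∑ p xs s) & sh-∑ 1 xs (\ x -> act p (s x)) n) &
 sym (∑-+ xs (\ x -> a Z.* s x n) (\ x -> sh 1 (act p (s x)) n))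

act-0 : ∀ p n -> act p (\ _ -> 0z) n ≡ 0z
act-0 p n = act-∑ {⊤} p [] (\ _ _ -> 0z) n

-- Linear functionals on Λ: a functional is given by its values on h-monomials.

Fun : Set
Fun = List ℕ -> Seq

evalS : Sym -> Fun -> Seq
evalS f ψ n = ∑ f (\ pm -> act (proj₁ pm) (ψ (proj₂ pm)) n)

evalS-cong : ∀ f {ψ χ : Fun} n -> (∀ m i -> ψ m i ≡ χ m i) -> evalS f ψ n ≡ evalS f χ n
evalS-cong f n e = ∑-cong f (\ pm -> act-cong (proj₁ pm) n (e (proj₂ pm)))

evalS-++ : ∀ f g ψ n -> evalS (f ++ g) ψ n ≡ evalS f ψ n Z.+ evalS g ψ n
evalS-++ f g ψ n = ∑-++ f g _

evalS-sumS : ∀ fs ψ n -> evalS (sumS fs) ψ n ≡ ∑ fs (\ f -> evalS f ψ n)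
evalS-sumS [] ψ n = refl
evalS-sumS (f ∷ fs) ψ n = evalS-++ f (sumS fs) ψ n & cong (\ z -> evalS f ψ n Z.+ z) (evalS-sumS fs ψ n)

evalS-scaleS : ∀ p f ψ n -> evalS (scaleS p f) ψ n ≡ act p (evalS f ψ) n
evalS-scaleS p f ψ n = ∑-map _ f _ &
 ∑-cong f (\ qm -> act-mulP p (proj₁ qm) (ψ (proj₂ qm)) n) &
  sym (act-∑ p f (\ qm -> act (proj₁ qm) (ψ (proj₂ qm))) n)

-- ψ composed with multiplication by h_z, with h_0 = 1 and h_z = 0 for negative z.
consZ : ℤ -> Fun -> Fun
consZ (+ zero) ψ m = ψ m
consZ (+ suc a) ψ m = ψ (suc a ∷ m)
consZ -[1+ a ] ψ m = \ _ -> 0z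

-- the value of a functional on the product of the h_z, z ∈ l
ext : Fun -> List ℤ -> Seq
ext ψ [] = ψ []
ext ψ (z ∷ l) = ext (consZ z ψ) l

consZ-cong : ∀ z {ψ χ : Fun} -> (∀ m i -> ψ m i ≡ χ m i) -> ∀ m i -> consZ z ψ m i ≡ consZ z χ m i
consZ-cong (+ zero) e m i = e m i
consZ-cong (+ suc a) e m i = e (suc a ∷ m) i
consZ-cong -[1+ a ] e m i = refl

ext-cong : ∀ l {ψ χ : Fun} -> (∀ m i -> ψ m i ≡ χ m i) -> ∀ i -> ext ψ l i ≡ ext χ l i
ext-cong [] e i = e [] i
ext-cong (z ∷ l) e i = ext-cong l (consZ-cong z e) i

evalS-hS* : ∀ z f ψ n -> evalS (hS z *S f) ψ n ≡ evalS f (consZ z ψ) n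
evalS-hS* (+ zero) f ψ n = cong (\ l -> evalS l ψ n) (LP.++-identityʳ (map _ f)) &
 ∑-map _ f _ & ∑-cong f (\ qm -> act-mulP oneP (proj₁ qm) (ψ (proj₂ qm)) n & act-oneP (act (proj₁ qm) (ψ (proj₂ qm))) n)
evalS-hS* (+ suc a) f ψ n = cong (\ l -> evalS l ψ n) (LP.++-identityʳ (map _ f)) &
 ∑-map _ f _ & ∑-cong f (\ qm -> act-mulP oneP (proj₁ qm) (ψ (suc a ∷ proj₂ qm)) n & act-oneP (act (proj₁ qm) (ψ (suc a ∷ proj₂ qm))) n)
evalS-hS* -[1+ a ] f ψ n = sym (∑-cong f (\ pm -> act-0 (proj₁ pm) n) & ∑-0 f)

-- Concentrated in degree 0: `act p` then spreads the coefficients of p over the degrees, so the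
-- index n of the series selects the power of t.
coeffFun : List ℕ -> Fun
coeffFun mono m zero = if sameMono m mono then 1z else 0z
coeffFun mono m (suc n) = 0z

δ₀ : Seq
δ₀ zero = 1z
δ₀ (suc n) = 0z

act-δ₀ : ∀ p n -> act p δ₀ n ≡ coeffP n p
act-δ₀ [] zero = refl
act-δ₀ [] (suc n) = refl
act-δ₀ (a ∷ p) zero = +0ʳ _ & ZP.*-identityʳ a
act-δ₀ (a ∷ p) (suc n) = cong (\ z -> z Z.+ act p δ₀ n) (ZP.*-zeroʳ a) & +0ˡ _ & act-δ₀ p n

coeffS-evalS : ∀ f mono n -> coeffS f mono n ≡ evalS f (coeffFun mono) n
coeffS-evalS [] mono n = refl
coeffS-evalS ((p , m) ∷ f) mono n with sameMono m mono in eq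
... | true = cong₂ Z._+_ (sym (act-cong p n one & act-δ₀ p n)) (coeffS-evalS f mono n)
 where one : ∀ i -> coeffFun mono m i ≡ δ₀ i
       one zero rewrite eq = refl
       one (suc i) = refl
... | false = coeffS-evalS f mono n & sym (cong (\ z -> z Z.+ evalS f (coeffFun mono) n) (act-cong p n nil & act-0 p n) & +0ˡ _)
 where nil : ∀ i -> coeffFun mono m i ≡ 0z
       nil zero rewrite eq = refl
       nil (suc i) = refl

-- Alternating sums

-- ∑± cs G = Σ_j (-1)^j G c_j (cs without c_j)
∑± : List ℤ -> (ℤ -> List ℤ -> ℤ) -> ℤ
∑± [] G = 0z
∑± (c ∷ cs) G = G c cs Z.+ Z.- ∑± cs (\ d r -> G d (c ∷ r))

∑±-cong : ∀ cs {G H : ℤ -> List ℤ -> ℤ} -> (∀ c r -> suc (length r) ≡ length cs -> G c r ≡ H c r) -> ∑± cs G ≡ ∑± cs H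
∑±-cong [] e = refl
∑±-cong (c ∷ cs) e = cong₂ (\ x y -> x Z.+ Z.- y) (e c cs refl) (∑±-cong cs (\ d r q -> e d (c ∷ r) (cong suc q)))

∑±-+ : ∀ cs (G H : ℤ -> List ℤ -> ℤ) -> ∑± cs (\ c r -> G c r Z.+ H c r) ≡ ∑± cs G Z.+ ∑± cs H
∑±-+ [] G H = refl
∑±-+ (c ∷ cs) G H = cong (\ z -> (G c cs Z.+ H c cs) Z.+ Z.- z) (∑±-+ cs (\ d r -> G d (c ∷ r)) (\ d r -> H d (c ∷ r))) &
 lem (G c cs) (H c cs) (∑± cs (\ d r -> G d (c ∷ r))) (∑± cs (\ d r -> H d (c ∷ r)))
 where lem : ∀ a b c d -> (a Z.+ b) Z.+ Z.- (c Z.+ d) ≡ (a Z.+ Z.- c) Z.+ (b Z.+ Z.- d)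
       lem = solve-∀

∑±-0 : ∀ cs -> ∑± cs (\ _ _ -> 0z) ≡ 0z
∑±-0 [] = refl
∑±-0 (c ∷ cs) = cong (\ z -> 0z Z.+ Z.- z) (∑±-0 cs)

∑±-* : ∀ x cs (G : ℤ -> List ℤ -> ℤ) -> ∑± cs (\ c r -> x Z.* G c r) ≡ x Z.* ∑± cs G
∑±-* x [] G = sym (ZP.*-zeroʳ x)
∑±-* x (c ∷ cs) G = cong (\ z -> x Z.* G c cs Z.+ Z.- z) (∑±-* x cs (\ d r -> G d (c ∷ r))) &
 lem x (G c cs) (∑± cs (\ d r -> G d (c ∷ r)))
 where lem : ∀ x a b -> x Z.* a Z.+ Z.- (x Z.* b) ≡ x Z.* (a Z.+ Z.- b)
       lem = solve-∀

∑±-neg : ∀ cs (G : ℤ -> List ℤ -> ℤ) -> ∑± cs (\ c r -> Z.- G c r) ≡ Z.- ∑± cs G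
∑±-neg [] G = refl
∑±-neg (c ∷ cs) G = cong (\ z -> Z.- G c cs Z.+ Z.- z) (∑±-neg cs (\ d r -> G d (c ∷ r))) &
 lem (G c cs) (∑± cs (\ d r -> G d (c ∷ r)))
 where lem : ∀ a b -> Z.- a Z.+ Z.- (Z.- b) ≡ Z.- (a Z.+ Z.- b)
       lem = solve-∀

∑±-∑ : ∀ {A : Set} cs (xs : List A) (G : A -> ℤ -> List ℤ -> ℤ) ->
 ∑± cs (\ c r -> ∑ xs (\ x -> G x c r)) ≡ ∑ xs (\ x -> ∑± cs (G x))
∑±-∑ cs [] G = ∑±-0 cs
∑±-∑ cs (x ∷ xs) G = ∑±-+ cs (G x) (\ c r -> ∑ xs (\ y -> G y c r)) & cong (\ z -> ∑± cs (G x) Z.+ z) (∑±-∑ cs xs G)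

∑±-map : ∀ (f : ℤ -> ℤ) cs G -> ∑± (map f cs) G ≡ ∑± cs (\ c r -> G (f c) (map f r))
∑±-map f [] G = refl
∑±-map f (c ∷ cs) G = cong (\ z -> G (f c) (map f cs) Z.+ Z.- z) (∑±-map f cs (\ d r -> G d (f c ∷ r)))

∑±-snoc : ∀ cs e G -> ∑± (cs ++ e ∷ []) G ≡ ∑± cs (\ c r -> G c (r ++ e ∷ [])) Z.+ sgn (length cs) Z.* G e cs
∑±-snoc [] e G = lem (G e [])
 where lem : ∀ a -> a Z.+ Z.- 0z ≡ 0z Z.+ 1z Z.* a
       lem = solve-∀
∑±-snoc (c ∷ cs) e G = cong (\ z -> G c (cs ++ e ∷ []) Z.+ Z.- z) (∑±-snoc cs e (\ d r -> G d (c ∷ r))) &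
 lem (G c (cs ++ e ∷ [])) (∑± cs (\ d r -> G d (c ∷ r ++ e ∷ []))) (sgn (length cs)) (G e (c ∷ cs))
 where lem : ∀ a b s g -> a Z.+ Z.- (b Z.+ s Z.* g) ≡ (a Z.+ Z.- b) Z.+ (Z.- s) Z.* g
       lem = solve-∀

-- Taking two columns in the opposite order changes the sign once, because removing the earlier one
-- moves the later one by a place.
∑±∑±-antisym : ∀ cs (G : ℤ -> ℤ -> List ℤ -> ℤ) ->
 ∑± cs (\ c r -> ∑± r (\ d r' -> G d c r')) ≡ Z.- ∑± cs (\ c r -> ∑± r (\ d r' -> G c d r'))
∑±∑±-antisym [] G = refl
∑±∑±-antisym (c ∷ cs) G = cong (\ z -> X Z.+ Z.- z) (∑±-+ cs (\ d r -> G c d r) (\ d r -> Z.- ∑± r (\ e r' -> G e d (c ∷ r')))) &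
 cong (\ z -> X Z.+ Z.- (Y Z.+ z)) (∑±-neg cs (\ d r -> ∑± r (\ e r' -> G e d (c ∷ r'))) & cong Z.-_ (∑±∑±-antisym cs (\ d e r -> G d e (c ∷ r)))) &
 lem X Y D &
 cong (\ z -> Z.- (Y Z.+ Z.- (X Z.+ z))) (sym (∑±-neg cs (\ d r -> ∑± r (\ e r' -> G d e (c ∷ r'))))) &
 cong (\ z -> Z.- (Y Z.+ Z.- z)) (sym (∑±-+ cs (\ d r -> G d c r) (\ d r -> Z.- ∑± r (\ e r' -> G d e (c ∷ r')))))
 where
 X = ∑± cs (\ d r -> G d c r)
 Y = ∑± cs (\ d r -> G c d r)
 D = ∑± cs (\ d r -> ∑± r (\ e r' -> G d e (c ∷ r')))
 lem : ∀ x y d -> x Z.+ Z.- (y Z.+ Z.- (Z.- d)) ≡ Z.- (y Z.+ Z.- (x Z.+ Z.- d))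
 lem = solve-∀

-- alt cs g F = Σ_w sgn(w) F(g_1 + c_{w(1)}, g_2 + c_{w(2)}, …)
alt : List ℤ -> List ℤ -> (List ℤ -> ℤ) -> ℤ
alt cs [] F = F []
alt cs (g ∷ γ) F = ∑± cs (\ c r -> alt r γ (\ l -> F (g Z.+ c ∷ l)))

alt-cong : ∀ cs γ {F G : List ℤ -> ℤ} -> (∀ l -> F l ≡ G l) -> alt cs γ F ≡ alt cs γ G
alt-cong cs [] e = e []
alt-cong cs (g ∷ γ) e = ∑±-cong cs (\ c r _ -> alt-cong r γ (\ l -> e (g Z.+ c ∷ l)))

alt-+ : ∀ cs γ (F G : List ℤ -> ℤ) -> alt cs γ (\ l -> F l Z.+ G l) ≡ alt cs γ F Z.+ alt cs γ G
alt-+ cs [] F G = refl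
alt-+ cs (g ∷ γ) F G = ∑±-cong cs (\ c r _ -> alt-+ r γ (\ l -> F (g Z.+ c ∷ l)) (\ l -> G (g Z.+ c ∷ l))) & ∑±-+ cs (\ c r -> alt r γ (\ l -> F (g Z.+ c ∷ l))) (\ c r -> alt r γ (\ l -> G (g Z.+ c ∷ l)))

alt-* : ∀ x cs γ (F : List ℤ -> ℤ) -> alt cs γ (\ l -> x Z.* F l) ≡ x Z.* alt cs γ F
alt-* x cs [] F = refl
alt-* x cs (g ∷ γ) F = ∑±-cong cs (\ c r _ -> alt-* x r γ (\ l -> F (g Z.+ c ∷ l))) & ∑±-* x cs (\ c r -> alt r γ (\ l -> F (g Z.+ c ∷ l)))

alt-0 : ∀ cs γ -> alt cs γ (\ _ -> 0z) ≡ 0z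
alt-0 cs [] = refl
alt-0 cs (g ∷ γ) = ∑±-cong cs (\ c r _ -> alt-0 r γ) & ∑±-0 cs

alt-∑ : ∀ {A : Set} cs γ (xs : List A) (F : A -> List ℤ -> ℤ) ->
 alt cs γ (\ l -> ∑ xs (\ x -> F x l)) ≡ ∑ xs (\ x -> alt cs γ (F x))
alt-∑ cs γ [] F = alt-0 cs γ
alt-∑ cs γ (x ∷ xs) F = alt-+ cs γ (F x) (\ l -> ∑ xs (\ y -> F y l)) & cong (\ z -> alt cs γ (F x) Z.+ z) (alt-∑ cs γ xs F)

swapAt : ℕ -> List ℤ -> List ℤ
swapAt zero (x ∷ y ∷ l) = y ∷ x ∷ l
swapAt (suc i) (x ∷ l) = x ∷ swapAt i l
swapAt _ l = l

alt-swapAt : ∀ i cs γ (F : List ℤ -> ℤ) -> suc i < length γ -> (∀ l -> F (swapAt i l) ≡ F l) ->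
 alt cs (swapAt i γ) F ≡ Z.- alt cs γ F
alt-swapAt zero cs (a ∷ b ∷ γ) F _ s = ∑±-cong cs (\ c r _ -> ∑±-cong r (\ d r' _ -> alt-cong r' γ (\ l -> s (a Z.+ d ∷ b Z.+ c ∷ l)))) &
 ∑±∑±-antisym cs (\ c d r -> alt r γ (\ l -> F (a Z.+ c ∷ b Z.+ d ∷ l)))
alt-swapAt zero cs (a ∷ []) F (s≤s ()) s
alt-swapAt (suc i) cs (g ∷ γ) F (s≤s p) s = ∑±-cong cs (\ c r _ -> alt-swapAt i r γ (\ l -> F (g Z.+ c ∷ l)) p (\ l -> s (g Z.+ c ∷ l))) &
 ∑±-neg cs (\ c r -> alt r γ (\ l -> F (g Z.+ c ∷ l)))

alt-map : ∀ x cs γ (F : List ℤ -> ℤ) -> alt (map (Z._+ x) cs) (map (Z._+ (Z.- x)) γ) F ≡ alt cs γ F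
alt-map x cs [] F = refl
alt-map x cs (g ∷ γ) F = ∑±-map (Z._+ x) cs _ &
 ∑±-cong cs (\ c r _ -> alt-map x r γ _ & alt-cong r γ (\ l -> cong (\ z -> F (z ∷ l)) (lem g x c)))
 where lem : ∀ g x c -> (g Z.+ Z.- x) Z.+ (c Z.+ x) ≡ g Z.+ c
       lem = solve-∀

∈-∑± : ∀ cs {G H : ℤ -> List ℤ -> ℤ} -> (∀ c r -> c ∈ cs -> (∀ {d} -> d ∈ r -> d ∈ cs) -> G c r ≡ H c r) -> ∑± cs G ≡ ∑± cs H
∈-∑± [] e = refl
∈-∑± (c ∷ cs) e = cong₂ (\ x y -> x Z.+ Z.- y) (e c cs (here refl) there)
 (∈-∑± cs (\ d r i s -> e d (c ∷ r) (there i) (\ { (here q) -> here q ; (there j) -> there (s j) })))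

-- Every term of the alternating sum gives some column to row i, and all of them are bad.
alt-bad : ∀ (Bad : ℤ -> Set) i cs γ (F : List ℤ -> ℤ) -> i < length γ ->
 (∀ {c} -> c ∈ cs -> Bad (nthZ γ i Z.+ c)) -> (∀ l -> i < length l -> Bad (nthZ l i) -> F l ≡ 0z) -> alt cs γ F ≡ 0z
alt-bad Bad zero cs (g ∷ γ) F _ b v = ∈-∑± cs (\ c r i _ -> alt-cong r γ (\ l -> v (g Z.+ c ∷ l) z<s (b i)) & alt-0 r γ) & ∑±-0 cs
alt-bad Bad (suc i) cs (g ∷ γ) F (s≤s p) b v = ∈-∑± cs (\ c r _ s -> alt-bad Bad i r γ (\ l -> F (g Z.+ c ∷ l)) p (b ∘ s) (\ l q -> v (g Z.+ c ∷ l) (s≤s q))) & ∑±-0 cs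

nthZ-snoc : ∀ γ g -> nthZ (γ ++ g ∷ []) (length γ) ≡ g
nthZ-snoc [] g = refl
nthZ-snoc (x ∷ γ) g = nthZ-snoc γ g

length-snoc : ∀ {A : Set} (γ : List A) g -> length (γ ++ g ∷ []) ≡ suc (length γ)
length-snoc γ g = LP.length-++ γ & +-comm (length γ) 1

-- If another row takes the last column, the last row must take a bad one; so only terms with the
-- last row in the last column remain.
alt-snoc : ∀ (Bad : ℤ -> Set) cs e γ g (F : List ℤ -> ℤ) -> length cs ≡ length γ ->
 (∀ {c} -> c ∈ cs -> Bad (g Z.+ c)) -> (∀ l -> length γ < length l -> Bad (nthZ l (length γ)) -> F l ≡ 0z) ->
 alt (cs ++ e ∷ []) (γ ++ g ∷ []) F ≡ alt cs γ (\ l -> F (l ++ (g Z.+ e) ∷ []))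
alt-snoc Bad [] e [] g F _ b v = +0ʳ _
alt-snoc Bad (c ∷ cs) e (h ∷ γ) g F q b v = ∑±-snoc (c ∷ cs) e (\ d r -> alt r (γ ++ g ∷ []) (\ l -> F (h Z.+ d ∷ l))) &
 cong₂ Z._+_ first (cong (\ z -> sgn (suc (length cs)) Z.* z) last0 & ZP.*-zeroʳ (sgn (suc (length cs)))) & +0ʳ _
 where
 last0 : alt (c ∷ cs) (γ ++ g ∷ []) (\ l -> F (h Z.+ e ∷ l)) ≡ 0z
 last0 = alt-bad Bad (length γ) (c ∷ cs) (γ ++ g ∷ []) _ (subst (length γ <_) (sym (length-snoc γ g)) (n<1+n _))
  (\ i -> subst Bad (cong (Z._+ _) (sym (nthZ-snoc γ g))) (b i)) (\ l p -> v (h Z.+ e ∷ l) (s≤s p))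
 step : ∀ d r -> length r ≡ length γ -> (∀ {x} -> x ∈ r -> Bad (g Z.+ x)) ->
  alt (r ++ e ∷ []) (γ ++ g ∷ []) (\ l -> F (h Z.+ d ∷ l)) ≡ alt r γ (\ l -> F (h Z.+ d ∷ l ++ (g Z.+ e) ∷ []))
 step d r lr br = alt-snoc Bad r e γ g (\ l -> F (h Z.+ d ∷ l)) lr br (\ l p -> v (h Z.+ d ∷ l) (s≤s p))
 both : ∀ ds {G H : ℤ -> List ℤ -> ℤ} -> (∀ d r -> suc (length r) ≡ length ds -> (∀ {x} -> x ∈ r -> x ∈ ds) -> G d r ≡ H d r) -> ∑± ds G ≡ ∑± ds H
 both [] e = refl
 both (d ∷ ds) e = cong₂ (\ x y -> x Z.+ Z.- y) (e d ds refl there)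
  (both ds (\ d' r l s -> e d' (d ∷ r) (cong suc l) (\ { (here q) -> here q ; (there j) -> there (s j) })))
 first : ∑± (c ∷ cs) (\ d r -> alt (r ++ e ∷ []) (γ ++ g ∷ []) (\ l -> F (h Z.+ d ∷ l)))
  ≡ ∑± (c ∷ cs) (\ d r -> alt r γ (\ l -> F (h Z.+ d ∷ l ++ (g Z.+ e) ∷ [])))
 first = both (c ∷ cs) (\ d r l s -> step d r (suc-injective (l & q)) (b ∘ s))

data AdjEq : List ℤ -> Set where
 here : ∀ {c cs} -> AdjEq (c ∷ c ∷ cs)
 there : ∀ {c cs} -> AdjEq cs -> AdjEq (c ∷ cs)

-- Choosing either of the two equal neighbours gives cancelling terms; every other choice leaves
-- them adjacent.
∑±-AdjEq : ∀ cs {G : ℤ -> List ℤ -> ℤ} -> AdjEq cs -> (∀ c r -> suc (length r) ≡ length cs -> AdjEq r -> G c r ≡ 0z) -> ∑± cs G ≡ 0z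
∑±-AdjEq (c ∷ c ∷ cs) {G} here v = lem (G c (c ∷ cs)) _ &
 ∑±-cong cs (\ d r q -> v d (c ∷ c ∷ r) (cong (suc ∘ suc) q) here) & ∑±-0 cs
 where lem : ∀ a b -> a Z.+ Z.- (a Z.+ Z.- b) ≡ b
       lem = solve-∀
∑±-AdjEq (c ∷ cs) {G} (there a) v = cong₂ (\ x y -> x Z.+ Z.- y) (v c cs refl a)
 (∑±-AdjEq cs a (\ d r q a' -> v d (c ∷ r) (cong suc q) (there a')))

alt-AdjEq : ∀ cs γ (F : List ℤ -> ℤ) -> length cs ≡ length γ -> AdjEq cs -> alt cs γ F ≡ 0z
alt-AdjEq [] [] F q ()
alt-AdjEq (c ∷ cs) (g ∷ γ) F q a = ∑±-AdjEq (c ∷ cs) a (\ d r l a' -> alt-AdjEq r γ _ (suc-injective (l & q)) a')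

bits : ℕ -> List (List ℕ)
bits zero = [] ∷ []
bits (suc n) = map (0 ∷_) (bits n) ++ map (1 ∷_) (bits n)

∑-bits : ∀ n (f : List ℕ -> ℤ) -> ∑ (bits (suc n)) f ≡ ∑ (bits n) (\ b -> f (0 ∷ b)) Z.+ ∑ (bits n) (\ b -> f (1 ∷ b))
∑-bits n f = ∑-++ (map (0 ∷_) (bits n)) _ f & cong₂ Z._+_ (∑-map (0 ∷_) (bits n) f) (∑-map (1 ∷_) (bits n) f)

subZ : List ℤ -> List ℕ -> List ℤ
subZ (x ∷ xs) (b ∷ bs) = (x Z.- + b) ∷ subZ xs bs
subZ xs _ = xs

-- Lowering a set of columns and then choosing one amounts to choosing a column together with its
-- mark and then marking the others; the positions, hence the signs, do not depend on the marks.
∑±-subZ : ∀ cs (K : ℕ -> ℤ -> List ℤ -> ℤ) m -> length cs ≡ suc m ->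
 ∑ (bits (length cs)) (\ T -> ∑± (subZ cs T) (K (sum T)))
 ≡ ∑± cs (\ c r -> ∑ (bits m) (\ T -> K (sum T) (c Z.- + 0) (subZ r T)) Z.+ ∑ (bits m) (\ T -> K (suc (sum T)) (c Z.- + 1) (subZ r T)))
∑±-subZ (c ∷ []) K zero q = lem (K 0 (c Z.- + 0) []) (K 1 (c Z.- + 1) [])
 where lem : ∀ a b -> (a Z.+ Z.- 0z) Z.+ ((b Z.+ Z.- 0z) Z.+ 0z) ≡ (a Z.+ 0z) Z.+ (b Z.+ 0z) Z.+ Z.- 0z
       lem = solve-∀
∑±-subZ (c ∷ cs@(_ ∷ _)) K (suc m) q = ∑-bits (length cs) _ &
 cong₂ Z._+_ (half 0) (half 1) &
 lem (∑ B (P 0)) (R 0) (∑ B (P 1)) (R 1) &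
 cong₂ (\ x y -> x Z.+ Z.- y) (cong (\ k -> ∑ (bits k) (P 0) Z.+ ∑ (bits k) (P 1)) (suc-injective q))
   (sym (∑±-+ cs (V 0) (V 1)) & ∑±-cong cs (\ d r _ -> rearr d r))
 where
 B = bits (length cs)
 P : ℕ -> List ℕ -> ℤ
 P b T = K (b + sum T) (c Z.- + b) (subZ cs T)
 Q : ℕ -> List ℕ -> ℤ
 Q b T = ∑± (subZ cs T) (\ d r -> K (b + sum T) d ((c Z.- + b) ∷ r))
 V : ℕ -> ℤ -> List ℤ -> ℤ
 V b d r = ∑ (bits m) (\ T -> K (b + sum T) (d Z.- + 0) ((c Z.- + b) ∷ subZ r T)) Z.+ ∑ (bits m) (\ T -> K (b + suc (sum T)) (d Z.- + 1) ((c Z.- + b) ∷ subZ r T))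
 R : ℕ -> ℤ
 R b = ∑± cs (V b)
 half : ∀ b -> ∑ B (\ T -> P b T Z.+ Z.- Q b T) ≡ ∑ B (P b) Z.+ Z.- R b
 half b = ∑-+ B (P b) (\ T -> Z.- Q b T) & cong (\ z -> ∑ B (P b) Z.+ z)
  (∑-neg B (Q b) & cong Z.-_ (∑±-subZ cs (\ t d r -> K (b + t) d ((c Z.- + b) ∷ r)) m (suc-injective q)))
 lem : ∀ a b c d -> (a Z.+ Z.- b) Z.+ (c Z.+ Z.- d) ≡ (a Z.+ c) Z.+ Z.- (b Z.+ d)
 lem = solve-∀
 lem2 : ∀ a b c d -> (a Z.+ b) Z.+ (c Z.+ d) ≡ (a Z.+ c) Z.+ (b Z.+ d)
 lem2 = solve-∀
 rearr : ∀ d r -> V 0 d r Z.+ V 1 d r ≡ ∑ (bits (suc m)) (\ T -> K (sum T) (d Z.- + 0) (subZ (c ∷ r) T)) Z.+ ∑ (bits (suc m)) (\ T -> K (suc (sum T)) (d Z.- + 1) (subZ (c ∷ r) T))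
 rearr d r = lem2 (∑ (bits m) (\ T -> K (sum T) (d Z.- + 0) ((c Z.- + 0) ∷ subZ r T))) (∑ (bits m) (\ T -> K (suc (sum T)) (d Z.- + 1) ((c Z.- + 0) ∷ subZ r T)))
  (∑ (bits m) (\ T -> K (suc (sum T)) (d Z.- + 0) ((c Z.- + 1) ∷ subZ r T))) (∑ (bits m) (\ T -> K (suc (suc (sum T))) (d Z.- + 1) ((c Z.- + 1) ∷ subZ r T))) &
  cong₂ Z._+_ (sym (∑-bits m _)) (sym (∑-bits m _))

-- lowering a set of rows is the same as lowering a set of columns, on average over sets of given size
alt-subZ : ∀ cs γ (F : ℕ -> List ℤ -> ℤ) -> length cs ≡ length γ ->
 ∑ (bits (length γ)) (\ S -> alt cs (subZ γ S) (F (sum S))) ≡ ∑ (bits (length cs)) (\ T -> alt (subZ cs T) γ (F (sum T)))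
alt-subZ [] [] F q = refl
alt-subZ (c ∷ cs) (g ∷ γ) F q = ∑-bits (length γ) _ &
 cong₂ Z._+_ (sym (∑±-∑ (c ∷ cs) B (X 0))) (sym (∑±-∑ (c ∷ cs) B (X 1))) &
 sym (∑±-+ (c ∷ cs) (\ d r -> ∑ B (\ S -> X 0 S d r)) (\ d r -> ∑ B (\ S -> X 1 S d r))) &
 ∑±-cong (c ∷ cs) (\ d r l -> cong₂ Z._+_ (half 0 d r l) (half 1 d r l)) &
 sym (∑±-subZ (c ∷ cs) K (length cs) refl)
 where
 B = bits (length γ)
 X : ℕ -> List ℕ -> ℤ -> List ℤ -> ℤ
 X b S d r = alt r (subZ γ S) (\ l -> F (b + sum S) ((g Z.- + b) Z.+ d ∷ l))
 K : ℕ -> ℤ -> List ℤ -> ℤ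
 K t d r = alt r γ (\ l -> F t (g Z.+ d ∷ l))
 lem : ∀ g b d -> (g Z.- b) Z.+ d ≡ g Z.+ (d Z.- b)
 lem = solve-∀
 half : ∀ b d r -> suc (length r) ≡ length (c ∷ cs) -> ∑ B (\ S -> X b S d r) ≡ ∑ (bits (length cs)) (\ T -> K (b + sum T) (d Z.- + b) (subZ r T))
 half b d r l = alt-subZ r γ (\ t l -> F (b + t) ((g Z.- + b) Z.+ d ∷ l)) (suc-injective (l & q)) &
  cong (\ k -> ∑ (bits k) (\ T -> alt (subZ r T) γ (\ l -> F (b + sum T) ((g Z.- + b) Z.+ d ∷ l)))) (suc-injective l) &
   ∑-cong (bits (length cs)) (\ T -> alt-cong (subZ r T) γ (\ l -> cong (\ z -> F (b + sum T) (z ∷ l)) (lem g (+ b) d)))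

iota : ℤ -> ℕ -> List ℤ
iota s zero = []
iota s (suc n) = s ∷ iota (s Z.+ 1z) n

length-iota : ∀ s n -> length (iota s n) ≡ n
length-iota s zero = refl
length-iota s (suc n) = cong suc (length-iota (s Z.+ 1z) n)

iota-map : ∀ s x n -> map (Z._+ x) (iota s n) ≡ iota (s Z.+ x) n
iota-map s x zero = refl
iota-map s x (suc n) = cong (s Z.+ x ∷_) (iota-map (s Z.+ 1z) x n & cong (\ z -> iota z n) (lem s x))
 where lem : ∀ s x -> (s Z.+ 1z) Z.+ x ≡ (s Z.+ x) Z.+ 1z
       lem = solve-∀

-- The first lowered entry becomes equal to its unlowered predecessor, so every nonempty T produces
-- two equal adjacent columns.
iota-collapse : ∀ n x (L : ℕ -> List ℤ -> ℤ) -> (∀ t r -> length r ≡ suc n -> AdjEq r -> L t r ≡ 0z) ->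
 ∑ (bits n) (\ T -> L (sum T) (x ∷ subZ (iota (x Z.+ 1z) n) T)) ≡ L 0 (x ∷ iota (x Z.+ 1z) n)
iota-collapse zero x L v = +0ʳ _
iota-collapse (suc n) x L v = ∑-bits n _ & cong₂ Z._+_ first second & +0ʳ _
 where
 y = x Z.+ 1z
 lem0 : ∀ y -> y Z.- + 0 ≡ y
 lem0 = solve-∀
 lem1 : ∀ x -> (x Z.+ 1z) Z.- + 1 ≡ x
 lem1 = solve-∀
 first = ∑-cong (bits n) (\ T -> cong (\ z -> L (sum T) (x ∷ z ∷ subZ (iota (y Z.+ 1z) n) T)) (lem0 y)) &
  iota-collapse n y (\ t r -> L t (x ∷ r)) (\ t r q a -> v t (x ∷ r) (cong suc q) (there a))
 len : ∀ n s (T : List ℕ) -> length (subZ (iota s n) T) ≡ n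
 len zero s T = refl
 len (suc n) s [] = cong suc (length-iota _ n)
 len (suc n) s (b ∷ T) = cong suc (len n (s Z.+ 1z) T)
 second = ∑-cong (bits n) (\ T -> cong (\ z -> L (suc (sum T)) (x ∷ z ∷ subZ (iota (y Z.+ 1z) n) T)) (lem1 x) &
  v (suc (sum T)) _ (cong (suc ∘ suc) (len n _ T)) here) & ∑-0 (bits n)

-- Deleting column s+j leaves the list s+1, s+2, ... with its first j entries lowered. Any other T
-- lowers an entry right after an unlowered one and gives equal neighbours, so the sum may run over
-- all T, with j = |T|.
∑±-iota : ∀ n s (K : ℤ -> List ℤ -> ℤ) -> (∀ c r -> length r ≡ n -> AdjEq r -> K c r ≡ 0z) ->
 ∑± (iota s (suc n)) K ≡ ∑ (bits n) (\ T -> sgn (sum T) Z.* K (s Z.+ + sum T) (subZ (iota (s Z.+ 1z) n) T))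
∑±-iota zero s K v = lem (K s []) & cong (\ z -> 1z Z.* K z [] Z.+ 0z) (sym (+0ʳ s))
 where lem : ∀ a -> a Z.+ Z.- 0z ≡ 1z Z.* a Z.+ 0z
       lem = solve-∀
∑±-iota (suc n) s K v = cong₂ (\ a b -> a Z.+ Z.- b) (sym first) (∑±-iota n y (\ d r -> K d (s ∷ r)) (\ c r q a -> v c (s ∷ r) (cong suc q) (there a))) &
 cong₂ Z._+_ (∑-cong (bits n) (\ T -> cong (\ z -> sgn (sum T) Z.* K (s Z.+ + sum T) (z ∷ subZ (iota (y Z.+ 1z) n) T)) (sym (lem0 y))))
   (sym (∑-neg (bits n) (\ T -> sgn (sum T) Z.* K (y Z.+ + sum T) (s ∷ subZ (iota (y Z.+ 1z) n) T))) & ∑-cong (bits n) second) &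
 sym (∑-bits n (\ T -> sgn (sum T) Z.* K (s Z.+ + sum T) (subZ (iota y (suc n)) T)))
 where
 y = s Z.+ 1z
 lem0 : ∀ y -> y Z.- + 0 ≡ y
 lem0 = solve-∀
 lem1 : ∀ x -> (x Z.+ 1z) Z.- + 1 ≡ x
 lem1 = solve-∀
 first : ∑ (bits n) (\ T -> sgn (sum T) Z.* K (s Z.+ + sum T) (y ∷ subZ (iota (y Z.+ 1z) n) T)) ≡ K s (y ∷ iota (y Z.+ 1z) n)
 first = iota-collapse n y (\ t r -> sgn t Z.* K (s Z.+ + t) r) (\ t r q a -> cong (sgn t Z.*_) (v (s Z.+ + t) r q a) & ZP.*-zeroʳ (sgn t)) &
  ZP.*-identityˡ _ & cong (\ z -> K z (y ∷ iota (y Z.+ 1z) n)) (+0ʳ s)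
 second : ∀ T -> Z.- (sgn (sum T) Z.* K (y Z.+ + sum T) (s ∷ subZ (iota (y Z.+ 1z) n) T))
  ≡ sgn (suc (sum T)) Z.* K (s Z.+ + suc (sum T)) ((y Z.- + 1) ∷ subZ (iota (y Z.+ 1z) n) T)
 second T = ZP.neg-distribˡ-* (sgn (sum T)) _ &
  cong₂ (\ a b -> (Z.- sgn (sum T)) Z.* K a (b ∷ subZ (iota (y Z.+ 1z) n) T)) (ZP.+-assoc s 1z (+ sum T)) (sym (lem1 s))

-- Jacobi–Trudi functionals

offs : ℤ -> List ℤ -> List ℤ
offs s [] = []
offs s (g ∷ γ) = (g Z.- s) ∷ offs (s Z.+ 1z) γ

length-offs : ∀ s γ -> length (offs s γ) ≡ length γ
length-offs s [] = refl
length-offs s (g ∷ γ) = cong suc (length-offs _ γ)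

sG : List ℤ -> (List ℤ -> ℤ) -> ℤ
sG γ F = alt (iota 0z (length γ)) (offs 0z γ) F

-- The dot action of a simple reflection: a plain exchange of the numbers γ_i - i.
dotAt : ℕ -> List ℤ -> List ℤ
dotAt zero (x ∷ y ∷ l) = (y Z.- 1z) ∷ (x Z.+ 1z) ∷ l
dotAt (suc i) (x ∷ l) = x ∷ dotAt i l
dotAt _ l = l

length-dotAt : ∀ i l -> length (dotAt i l) ≡ length l
length-dotAt zero [] = refl
length-dotAt zero (x ∷ []) = refl
length-dotAt zero (x ∷ y ∷ l) = refl
length-dotAt (suc i) [] = refl
length-dotAt (suc i) (x ∷ l) = cong suc (length-dotAt i l)

offs-dotAt : ∀ i s γ -> offs s (dotAt i γ) ≡ swapAt i (offs s γ)
offs-dotAt zero s [] = refl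
offs-dotAt zero s (x ∷ []) = refl
offs-dotAt zero s (x ∷ y ∷ γ) = cong₂ (\ a b -> a ∷ b ∷ offs (s Z.+ 1z Z.+ 1z) γ) (lem1 y s) (lem2 x s)
 where lem1 : ∀ y s -> (y Z.- 1z) Z.- s ≡ y Z.- (s Z.+ 1z)
       lem1 = solve-∀
       lem2 : ∀ x s -> (x Z.+ 1z) Z.- (s Z.+ 1z) ≡ x Z.- s
       lem2 = solve-∀
offs-dotAt (suc i) s [] = refl
offs-dotAt (suc i) s (x ∷ γ) = cong (x Z.- s ∷_) (offs-dotAt i (s Z.+ 1z) γ)

sG-cong : ∀ γ {F G : List ℤ -> ℤ} -> (∀ l -> F l ≡ G l) -> sG γ F ≡ sG γ G
sG-cong γ = alt-cong (iota 0z (length γ)) (offs 0z γ)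

sG-dotAt : ∀ i γ (F : List ℤ -> ℤ) -> suc i < length γ -> (∀ l -> F (swapAt i l) ≡ F l) -> sG (dotAt i γ) F ≡ Z.- sG γ F
sG-dotAt i γ F p s = cong₂ (\ a b -> alt (iota 0z a) b F) (length-dotAt i γ) (offs-dotAt i 0z γ) &
 alt-swapAt i (iota 0z (length γ)) (offs 0z γ) F (subst (suc i <_) (sym (length-offs 0z γ)) p) s

offs-subZ : ∀ s γ S -> subZ (offs s γ) S ≡ offs s (subZ γ S)
offs-subZ s [] S = refl
offs-subZ s (g ∷ γ) [] = refl
offs-subZ s (g ∷ γ) (b ∷ S) = cong₂ _∷_ (lem g s (+ b)) (offs-subZ (s Z.+ 1z) γ S)
 where lem : ∀ g s b -> (g Z.- s) Z.- b ≡ (g Z.- b) Z.- s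
       lem = solve-∀

length-subZ : ∀ γ S -> length (subZ γ S) ≡ length γ
length-subZ [] S = refl
length-subZ (g ∷ γ) [] = refl
length-subZ (g ∷ γ) (b ∷ S) = cong suc (length-subZ γ S)

offs-shift : ∀ s x γ -> map (Z._+ (Z.- x)) (offs s γ) ≡ offs (s Z.+ x) γ
offs-shift s x [] = refl
offs-shift s x (g ∷ γ) = cong₂ _∷_ (lem g s x) (offs-shift (s Z.+ 1z) x γ & cong (\ z -> offs z γ) (lem2 s x))
 where lem : ∀ g s x -> (g Z.- s) Z.+ Z.- x ≡ g Z.- (s Z.+ x)
       lem = solve-∀
       lem2 : ∀ s x -> (s Z.+ 1z) Z.+ x ≡ (s Z.+ x) Z.+ 1z
       lem2 = solve-∀

alt-shift : ∀ s n γ F -> alt (iota (s Z.+ 1z) n) (offs (s Z.+ 1z) γ) F ≡ alt (iota s n) (offs s γ) F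
alt-shift s n γ F = cong₂ (\ a b -> alt a b F) (sym (iota-map s 1z n)) (sym (offs-shift s 1z γ)) &
 alt-map 1z (iota s n) (offs s γ) F

-- the vertex operator formula Σ_i (-1)^i h_{m+i} e_i^⊥ s_γ = s_{mγ}
sG-cons : ∀ m γ (F : List ℤ -> ℤ) ->
 sG (m ∷ γ) F ≡ ∑ (bits (length γ)) (\ S -> sgn (sum S) Z.* sG (subZ γ S) (\ l -> F (m Z.+ + sum S ∷ l)))
sG-cons m γ F = ∑±-iota n 0z (\ c r -> alt r rows (\ l -> F ((m Z.- 0z) Z.+ c ∷ l)))
   (\ c r q a -> alt-AdjEq r rows _ (q & sym (length-offs _ γ)) a) &
 ∑-cong (bits n) (\ T -> sym (alt-cong (subZ cols T) rows (\ l -> cong (\ z -> sgn (sum T) Z.* F (z ∷ l)) (lem m (+ sum T))) &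
   alt-* (sgn (sum T)) (subZ cols T) rows _)) &
 cong (\ k -> ∑ (bits k) (\ T -> alt (subZ cols T) rows (G (sum T)))) (sym (length-iota _ n)) &
 sym (alt-subZ cols rows G (length-iota _ n & sym (length-offs _ γ))) &
 cong (\ k -> ∑ (bits k) (\ S -> alt cols (subZ rows S) (G (sum S)))) (length-offs _ γ) &
 ∑-cong (bits n) (\ S -> cong (\ z -> alt cols z (G (sum S))) (offs-subZ _ γ S) &
   alt-shift 0z n (subZ γ S) (G (sum S)) &
   cong (\ k -> alt (iota 0z k) (offs 0z (subZ γ S)) (G (sum S))) (sym (length-subZ γ S)) &
    alt-* (sgn (sum S)) (iota 0z (length (subZ γ S))) (offs 0z (subZ γ S)) _)
 where
 n = length γ
 cols = iota (0z Z.+ 1z) n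
 rows = offs (0z Z.+ 1z) γ
 G : ℕ -> List ℤ -> ℤ
 G t l = sgn t Z.* F (m Z.+ + t ∷ l)
 lem : ∀ m t -> m Z.+ t ≡ (m Z.- 0z) Z.+ (0z Z.+ t)
 lem = solve-∀

Neg : ℤ -> Set
Neg z = z Z.< 0z

ext-Neg : ∀ ψ l i n -> i < length l -> Neg (nthZ l i) -> ext ψ l n ≡ 0z
ext-Neg ψ (-[1+ a ] ∷ l) zero n p q = nil l
 where nil : ∀ l -> ext (\ _ _ -> 0z) l n ≡ 0z
       nil [] = refl
       nil (z ∷ l) = ext-cong l (\ m i -> consZ-0 z m i) n & nil l
        where consZ-0 : ∀ z m i -> consZ z (\ _ _ -> 0z) m i ≡ 0z
              consZ-0 (+ zero) m i = refl
              consZ-0 (+ suc a) m i = refl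
              consZ-0 -[1+ a ] m i = refl
ext-Neg ψ (+ a ∷ l) zero n p (Z.+<+ ())
ext-Neg ψ (z ∷ l) (suc i) n (s≤s p) q = ext-Neg (consZ z ψ) l i n p q

∈-iota : ∀ {c} s n -> c ∈ iota s n -> c Z.< s Z.+ + n
∈-iota s (suc n) (here refl) = subst (Z._< s Z.+ + suc n) (+0ʳ s) (ZP.+-monoʳ-< s (Z.+<+ z<s))
∈-iota s (suc n) (there i) = subst (_ Z.<_) (ZP.+-assoc s 1z (+ n)) (∈-iota (s Z.+ 1z) n i)

nthZ-offs : ∀ i s γ -> i < length γ -> nthZ (offs s γ) i ≡ nthZ γ i Z.- (s Z.+ + i)
nthZ-offs zero s (g ∷ γ) _ = cong (\ z -> g Z.- z) (sym (+0ʳ s))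
nthZ-offs (suc i) s (g ∷ γ) (s≤s p) = nthZ-offs i (s Z.+ 1z) γ p & cong (\ z -> nthZ γ i Z.- z) (ZP.+-assoc s 1z (+ i))

sF : Fun -> List ℤ -> Seq
sF ψ γ n = sG γ (\ l -> ext ψ l n)

-- The largest index in row i of the determinant is γ_i - i + ℓ - 1, which is negative here.
sG-rowNeg : ∀ γ i (F : List ℤ -> ℤ) -> i < length γ -> nthZ γ i Z.+ + length γ Z.≤ + i -> (∀ l -> i < length l -> nthZ l i Z.< 0z -> F l ≡ 0z) -> sG γ F ≡ 0z
sG-rowNeg γ i F p q v = alt-bad Neg i (iota 0z (length γ)) (offs 0z γ) F (subst (i <_) (sym (length-offs 0z γ)) p)
 (\ {c} m -> subst (\ z -> Neg (z Z.+ c)) (sym (nthZ-offs i 0z γ p)) (neg (∈-iota 0z (length γ) m))) v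
 where
 g = nthZ γ i
 neg : ∀ {c} -> c Z.< 0z Z.+ + length γ -> Neg ((g Z.- (0z Z.+ + i)) Z.+ c)
 neg {c} lt = ZP.<-≤-trans (ZP.+-monoʳ-< (g Z.- (0z Z.+ + i)) lt)
  (subst (Z._≤ 0z) (sym (lem g (+ i) (+ length γ))) (ZP.i≤j⇒i-j≤0 q))
  where lem : ∀ g i l -> (g Z.- (0z Z.+ i)) Z.+ (0z Z.+ l) ≡ (g Z.+ l) Z.- i
        lem = solve-∀

sF-rowNeg : ∀ ψ γ i n -> i < length γ -> nthZ γ i Z.+ + length γ Z.≤ + i -> sF ψ γ n ≡ 0z
sF-rowNeg ψ γ i n p q = sG-rowNeg γ i _ p q (\ l -> ext-Neg ψ l i n)

iota-snoc : ∀ s n -> iota s (suc n) ≡ iota s n ++ (s Z.+ + n) ∷ []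
iota-snoc s zero = cong (_∷ []) (sym (+0ʳ s))
iota-snoc s (suc n) = cong (s ∷_) (iota-snoc (s Z.+ 1z) n & cong (\ z -> iota (s Z.+ 1z) n ++ z ∷ []) (ZP.+-assoc s 1z (+ n)))

offs-snoc : ∀ s γ g -> offs s (γ ++ g ∷ []) ≡ offs s γ ++ (g Z.- (s Z.+ + length γ)) ∷ []
offs-snoc s [] g = cong (\ z -> (g Z.- z) ∷ []) (sym (+0ʳ s))
offs-snoc s (x ∷ γ) g = cong ((x Z.- s) ∷_) (offs-snoc (s Z.+ 1z) γ g &
 cong (\ z -> offs (s Z.+ 1z) γ ++ (g Z.- z) ∷ []) (ZP.+-assoc s 1z (+ length γ)))

ext-snoc0 : ∀ ψ l n -> ext ψ (l ++ 0z ∷ []) n ≡ ext ψ l n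
ext-snoc0 ψ [] n = refl
ext-snoc0 ψ (z ∷ l) n = ext-snoc0 (consZ z ψ) l n

-- In the added row the indices are negative except for the 0 on the diagonal.
sG-snoc0 : ∀ γ (F : List ℤ -> ℤ) -> (∀ l -> length γ < length l -> nthZ l (length γ) Z.< 0z -> F l ≡ 0z) -> sG (γ ++ 0z ∷ []) F ≡ sG γ (\ l -> F (l ++ 0z ∷ []))
sG-snoc0 γ F v = cong₂ (\ a b -> alt a b F) (cong (iota 0z) (length-snoc γ 0z) & iota-snoc 0z L) (offs-snoc 0z γ 0z) &
 alt-snoc Neg (iota 0z L) (0z Z.+ + L) (offs 0z γ) (0z Z.- (0z Z.+ + L)) F (length-iota 0z L & sym (length-offs 0z γ))
   (\ {c} m -> subst (0z Z.- (0z Z.+ + L) Z.+ c Z.<_) (lem (+ L)) (ZP.+-monoʳ-< (0z Z.- (0z Z.+ + L)) (∈-iota 0z L m)))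
   (\ l p q -> v l (subst (_< length l) (length-offs 0z γ) p) (subst (\ i -> nthZ l i Z.< 0z) (length-offs 0z γ) q)) &
 alt-cong (iota 0z L) (offs 0z γ) (\ l -> cong (\ z -> F (l ++ z ∷ [])) (lem (+ L)))
 where
 L = length γ
 lem : ∀ x -> 0z Z.- (0z Z.+ x) Z.+ (0z Z.+ x) ≡ 0z
 lem = solve-∀

sF-snoc0 : ∀ ψ γ n -> sF ψ (γ ++ 0z ∷ []) n ≡ sF ψ γ n
sF-snoc0 ψ γ n = sG-snoc0 γ _ (\ l -> ext-Neg ψ l (length γ) n) & sG-cong γ (\ l -> ext-snoc0 ψ l n)

Symm : Fun -> Set
Symm ψ = ∀ pre a b m n -> ψ (pre ++ a ∷ b ∷ m) n ≡ ψ (pre ++ b ∷ a ∷ m) n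

Symm-consZ : ∀ z ψ -> Symm ψ -> Symm (consZ z ψ)
Symm-consZ (+ zero) ψ s = s
Symm-consZ (+ suc x) ψ s = \ pre -> s (suc x ∷ pre)
Symm-consZ -[1+ x ] ψ s = \ _ _ _ _ _ -> refl

ext-swapAt : ∀ ψ -> Symm ψ -> ∀ i l n -> ext ψ (swapAt i l) n ≡ ext ψ l n
ext-swapAt ψ s zero [] n = refl
ext-swapAt ψ s zero (x ∷ []) n = refl
ext-swapAt ψ s zero (x ∷ y ∷ l) n = ext-cong l (\ m i -> two x y m i) n
 where two : ∀ x y m i -> consZ x (consZ y ψ) m i ≡ consZ y (consZ x ψ) m i
       two (+ zero) (+ zero) m i = refl
       two (+ zero) (+ suc b) m i = refl
       two (+ zero) -[1+ b ] m i = refl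
       two (+ suc a) (+ zero) m i = refl
       two (+ suc a) (+ suc b) m i = s [] (suc b) (suc a) m i
       two (+ suc a) -[1+ b ] m i = refl
       two -[1+ a ] (+ zero) m i = refl
       two -[1+ a ] (+ suc b) m i = refl
       two -[1+ a ] -[1+ b ] m i = refl
ext-swapAt ψ s (suc i) [] n = refl
ext-swapAt ψ s (suc i) (x ∷ l) n = ext-swapAt (consZ x ψ) (Symm-consZ x ψ s) i l n

sF-dotAt : ∀ ψ -> Symm ψ -> ∀ i γ n -> suc i < length γ -> sF ψ (dotAt i γ) n ≡ Z.- sF ψ γ n
sF-dotAt ψ s i γ n p = sG-dotAt i γ _ p (\ l -> ext-swapAt ψ s i l n)

skip-suc : ∀ j b -> skip (suc j) (suc b) ≡ suc (skip j b)
skip-suc j b with b <ᵇ j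
... | true = refl
... | false = refl

-- Translates the deletion of an index through `skip`, as in `det`, into removal from a list of
-- columns.
∑±-upTo : ∀ n (c : ℕ -> ℤ) G ->
 ∑± (map c (upTo (suc n))) G ≡ ∑ (upTo (suc n)) (\ j -> sgn j Z.* G (c j) (map (c ∘ skip j) (upTo n)))
∑±-upTo n c G = cong (\ l -> ∑± (c 0 ∷ l) G) (tabS c n) & go n c G & sym (∑-upTo n (\ j -> sgn j Z.* G (c j) (map (c ∘ skip j) (upTo n))) & cong (\ z -> z Z.+ rest) (first))
 where
 tabS : ∀ (c : ℕ -> ℤ) n -> map c (applyUpTo suc n) ≡ map (c ∘ suc) (upTo n)
 tabS c n = cong (map c) (sym (LP.map-upTo suc n)) & sym (LP.map-∘ (upTo n))
 first : 1z Z.* G (c 0) (map (c ∘ skip 0) (upTo n)) ≡ G (c 0) (map (c ∘ suc) (upTo n))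
 first = ZP.*-identityˡ _
 rest = ∑ (upTo n) (\ j -> sgn (suc j) Z.* G (c (suc j)) (map (c ∘ skip (suc j)) (upTo n)))
 go : ∀ n (c : ℕ -> ℤ) G -> ∑± (c 0 ∷ map (c ∘ suc) (upTo n)) G
  ≡ G (c 0) (map (c ∘ suc) (upTo n)) Z.+ ∑ (upTo n) (\ j -> sgn (suc j) Z.* G (c (suc j)) (map (c ∘ skip (suc j)) (upTo n)))
 go zero c G = refl
 go (suc n) c G = cong (\ z -> G (c 0) (map (c ∘ suc) (upTo (suc n))) Z.+ z) (cong Z.-_ (∑±-upTo n (c ∘ suc) (\ d r -> G d (c 0 ∷ r))) &
  sym (∑-neg (upTo (suc n)) (\ j -> sgn j Z.* G (c (suc j)) (c 0 ∷ map (c ∘ suc ∘ skip j) (upTo n)))) &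
  ∑-cong (upTo (suc n)) (\ j -> ZP.neg-distribˡ-* (sgn j) _ & cong (\ l -> (Z.- sgn j) Z.* G (c (suc j)) (c 0 ∷ l))
    (LP.map-cong (\ b -> cong c (sym (skip-suc j b))) (upTo n) & sym (tabS (c ∘ skip (suc j)) n))))

evalS-det : ∀ n M g (c : ℕ -> ℤ) ψ i -> length g ≡ n -> (∀ a b -> a < n -> M a b ≡ hS (nthZ g a Z.+ c b)) ->
 evalS (det n M) ψ i ≡ alt (map c (upTo n)) g (\ l -> ext ψ l i)
evalS-det zero M [] c ψ i q e = +0ʳ _ & act-oneP (ψ []) i
evalS-det (suc n) M (x ∷ g) c ψ i q e = evalS-sumS (map D (upTo (suc n))) ψ i &
 ∑-map D (upTo (suc n)) (\ f -> evalS f ψ i) &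
 ∑-cong (upTo (suc n)) term &
 sym (∑±-upTo n c (\ d r -> alt r g (\ l -> ext ψ (x Z.+ d ∷ l) i)))
 where
 minor : ℕ -> ℕ -> ℕ -> Sym
 minor j a b = M (suc a) (skip j b)
 D : ℕ -> Sym
 D j = scaleS (signP j) (M 0 j *S det n (minor j))
 term : ∀ j -> evalS (D j) ψ i ≡ sgn j Z.* alt (map (c ∘ skip j) (upTo n)) g (\ l -> ext ψ (x Z.+ c j ∷ l) i)
 term j = evalS-scaleS (signP j) (M 0 j *S det n (minor j)) ψ i & act-signP j (evalS (M 0 j *S det n (minor j)) ψ) i & cong (sgn j Z.*_)
  (cong (\ h -> evalS (h *S det n (minor j)) ψ i) (e 0 j z<s) &
  evalS-hS* (x Z.+ c j) (det n (minor j)) ψ i &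
   evalS-det n (minor j) g (c ∘ skip j) (consZ (x Z.+ c j) ψ) i (suc-injective q) (\ a b p -> e (suc a) (skip j b) (s≤s p)))

iota-upTo : ∀ n -> map +_ (upTo n) ≡ iota 0z n
iota-upTo n = go n 0
 where
 go : ∀ n s -> map (\ x -> + (s + x)) (upTo n) ≡ iota (+ s) n
 go zero s = refl
 go (suc n) s = cong₂ _∷_ (cong +_ (+-identityʳ s))
  (cong (map (\ x -> + (s + x))) (sym (LP.map-upTo suc n)) & sym (LP.map-∘ (upTo n)) &
  LP.map-cong (\ x -> cong +_ (+-suc s x & cong (_+ x) (+-comm 1 s))) (upTo n) & go n (s + 1))

evalS-schurS : ∀ γ ψ n -> evalS (schurS γ) ψ n ≡ sF ψ γ n
evalS-schurS γ ψ n = evalS-det (length γ) _ (offs 0z γ) +_ ψ n (length-offs 0z γ)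
 (\ a b p -> cong hS (lem (nthZ γ a) (+ a) (+ b) & cong (Z._+ + b) (sym (nthZ-offs a 0z γ p)))) &
 cong (\ l -> alt l (offs 0z γ) (\ l -> ext ψ l n)) (iota-upTo (length γ))
 where lem : ∀ g a b -> g Z.+ (b Z.- a) ≡ (g Z.- (0z Z.+ a)) Z.+ b
       lem = solve-∀

-- Raising operators

GF : Set
GF = List ℤ -> Seq

addAt-comm : ∀ i j a b γ -> addAt i a (addAt j b γ) ≡ addAt j b (addAt i a γ)
addAt-comm i j a b [] = refl
addAt-comm zero zero a b (x ∷ γ) = cong (_∷ γ) (lem x a b)
 where lem : ∀ x a b -> (x Z.+ b) Z.+ a ≡ (x Z.+ a) Z.+ b
       lem = solve-∀
addAt-comm zero (suc j) a b (x ∷ γ) = refl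
addAt-comm (suc i) zero a b (x ∷ γ) = refl
addAt-comm (suc i) (suc j) a b (x ∷ γ) = cong (x ∷_) (addAt-comm i j a b γ)

addAt-+ : ∀ i a b γ -> addAt i a (addAt i b γ) ≡ addAt i (b Z.+ a) γ
addAt-+ i a b [] = refl
addAt-+ zero a b (x ∷ γ) = cong (_∷ γ) (ZP.+-assoc x b a)
addAt-+ (suc i) a b (x ∷ γ) = cong (x ∷_) (addAt-+ i a b γ)

addAt-0 : ∀ i γ -> addAt i 0z γ ≡ γ
addAt-0 i [] = refl
addAt-0 zero (x ∷ γ) = cong (_∷ γ) (+0ʳ x)
addAt-0 (suc i) (x ∷ γ) = cong (x ∷_) (addAt-0 i γ)

length-addAt : ∀ i a γ -> length (addAt i a γ) ≡ length γ
length-addAt i a [] = refl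
length-addAt zero a (x ∷ γ) = refl
length-addAt (suc i) a (x ∷ γ) = cong suc (length-addAt i a γ)

Root : Set
Root = ℕ × ℕ

mv : Root -> ℕ -> List ℤ -> List ℤ
mv (i , j) a γ = addAt (i ∸ 1) (+ a) (addAt (j ∸ 1) (Z.- (+ a)) γ)

length-mv : ∀ β a γ -> length (mv β a γ) ≡ length γ
length-mv (i , j) a γ = length-addAt (i ∸ 1) (+ a) (addAt (j ∸ 1) (Z.- (+ a)) γ) & length-addAt (j ∸ 1) (Z.- (+ a)) γ

mv-comm : ∀ β β' a b γ -> mv β a (mv β' b γ) ≡ mv β' b (mv β a γ)
mv-comm (i , j) (i' , j') a b γ = cong (addAt I (+ a)) (addAt-comm J I' _ _ _ & cong (addAt I' (+ b)) (addAt-comm J J' _ _ γ)) &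
 addAt-comm I I' _ _ _ & cong (addAt I' (+ b)) (addAt-comm I J' _ _ _)
 where
 I = i ∸ 1
 J = j ∸ 1
 I' = i' ∸ 1
 J' = j' ∸ 1

mv-0 : ∀ β γ -> mv β 0 γ ≡ γ
mv-0 (i , j) γ = addAt-0 (i ∸ 1) _ & addAt-0 (j ∸ 1) γ

mv-suc : ∀ β a γ -> mv β (suc a) γ ≡ mv β a (mv β 1 γ)
mv-suc (i , j) a γ = sym (cong (addAt I (+ a)) (addAt-comm J I _ _ _) &
 addAt-+ I (+ a) (+ 1) _ &
 cong (addAt I (+ suc a)) (addAt-+ J _ _ γ & cong (\ z -> addAt J z γ) (sym (ZP.neg-distrib-+ (+ 1) (+ a)))))
 where
 I = i ∸ 1
 J = j ∸ 1

-- Geo β = (1 - t R_β)^{-1}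
Geo : Root -> GF -> GF
Geo β Φ γ zero = Φ γ zero
Geo β Φ γ (suc n) = Φ γ (suc n) Z.+ Geo β Φ (mv β 1 γ) n

H : List Root -> GF -> GF
H [] Φ = Φ
H (β ∷ Ψ) Φ = Geo β (H Ψ Φ)

Geo-cong : ∀ β {Φ Φ' : GF} ℓ -> (∀ γ -> length γ ≡ ℓ -> ∀ n -> Φ γ n ≡ Φ' γ n) -> ∀ γ -> length γ ≡ ℓ -> ∀ n -> Geo β Φ γ n ≡ Geo β Φ' γ n
Geo-cong β ℓ e γ q zero = e γ q zero
Geo-cong β ℓ e γ q (suc n) = cong₂ Z._+_ (e γ q (suc n)) (Geo-cong β ℓ e (mv β 1 γ) (length-mv β 1 γ & q) n)

H-cong : ∀ Ψ {Φ Φ' : GF} ℓ -> (∀ γ -> length γ ≡ ℓ -> ∀ n -> Φ γ n ≡ Φ' γ n) -> ∀ γ -> length γ ≡ ℓ -> ∀ n -> H Ψ Φ γ n ≡ H Ψ Φ' γ n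
H-cong [] ℓ e = e
H-cong (β ∷ Ψ) ℓ e = Geo-cong β ℓ (H-cong Ψ ℓ e)

-- The outer series unrolls by definition; `star` shows by induction on the degree in t that the
-- inner series can be unrolled in the same way.
Geo-comm : ∀ β β' Φ γ n -> Geo β (Geo β' Φ) γ n ≡ Geo β' (Geo β Φ) γ n
Geo-comm β β' Φ γ zero = refl
Geo-comm β β' Φ γ (suc n) = cong (\ z -> Geo β' Φ γ (suc n) Z.+ z) (Geo-comm β β' Φ (mv β 1 γ) n) & sym (star γ n)
 where
 X = Geo β' (Geo β Φ)
 lem : ∀ a b c -> (a Z.+ b) Z.+ c ≡ (a Z.+ c) Z.+ b
 lem = solve-∀
 star : ∀ γ n -> X γ (suc n) ≡ Geo β' Φ γ (suc n) Z.+ X (mv β 1 γ) n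
 star γ zero = lem (Φ γ 1) (Φ (mv β 1 γ) 0) (Φ (mv β' 1 γ) 0)
 star γ (suc n) = cong (\ z -> (Φ γ (suc (suc n)) Z.+ Geo β Φ (mv β 1 γ) (suc n)) Z.+ z) (star (mv β' 1 γ) n) &
  cong (\ z -> (Φ γ (suc (suc n)) Z.+ Geo β Φ (mv β 1 γ) (suc n)) Z.+ (Geo β' Φ (mv β' 1 γ) (suc n) Z.+ X z n)) (mv-comm β β' 1 1 γ) &
  lem' (Φ γ (suc (suc n))) (Geo β Φ (mv β 1 γ) (suc n)) _ _
  where
  lem' : ∀ a b c d -> (a Z.+ b) Z.+ (c Z.+ d) ≡ (a Z.+ c) Z.+ (b Z.+ d)
  lem' = solve-∀

H-↭ : ∀ {Ψ Ψ'} Φ -> Ψ ↭ Ψ' -> ∀ γ n -> H Ψ Φ γ n ≡ H Ψ' Φ γ n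
H-↭ Φ Perm.refl γ n = refl
H-↭ Φ (Perm.prep β p) γ n = Geo-cong β (length γ) (\ γ' _ -> H-↭ Φ p γ') γ refl n
H-↭ {Ψ' = _ ∷ _ ∷ Ψ'} Φ (Perm.swap β β' p) γ n = Geo-comm β β' _ γ n &
 Geo-cong β' (length γ) (\ γ' _ -> Geo-cong β (length γ') (\ γ'' _ -> H-↭ Φ p γ'') γ' refl) γ refl n
H-↭ Φ (Perm.trans p q) γ n = H-↭ Φ p γ n & H-↭ Φ q γ n

H-++ : ∀ Ψ Ψ' Φ γ n -> H (Ψ ++ Ψ') Φ γ n ≡ H Ψ (H Ψ' Φ) γ n
H-++ [] Ψ' Φ γ n = refl
H-++ (β ∷ Ψ) Ψ' Φ γ n = Geo-cong β (length γ) (\ γ' _ -> H-++ Ψ Ψ' Φ γ') γ refl n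

Geo-lin : ∀ β (x y : ℤ) (Φ Φ' : GF) γ n -> Geo β (\ γ n -> x Z.* Φ γ n Z.+ y Z.* Φ' γ n) γ n ≡ x Z.* Geo β Φ γ n Z.+ y Z.* Geo β Φ' γ n
Geo-lin β x y Φ Φ' γ zero = refl
Geo-lin β x y Φ Φ' γ (suc n) = cong (\ z -> (x Z.* Φ γ (suc n) Z.+ y Z.* Φ' γ (suc n)) Z.+ z) (Geo-lin β x y Φ Φ' (mv β 1 γ) n) &
 lem x y (Φ γ (suc n)) (Φ' γ (suc n)) _ _
 where lem : ∀ x y a b c d -> (x Z.* a Z.+ y Z.* b) Z.+ (x Z.* c Z.+ y Z.* d) ≡ x Z.* (a Z.+ c) Z.+ y Z.* (b Z.+ d)
       lem = solve-∀

H-lin : ∀ Ψ (x y : ℤ) (Φ Φ' : GF) γ n -> H Ψ (\ γ n -> x Z.* Φ γ n Z.+ y Z.* Φ' γ n) γ n ≡ x Z.* H Ψ Φ γ n Z.+ y Z.* H Ψ Φ' γ n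
H-lin [] x y Φ Φ' γ n = refl
H-lin (β ∷ Ψ) x y Φ Φ' γ n = Geo-cong β (length γ) (\ γ' _ -> H-lin Ψ x y Φ Φ' γ') γ refl n & Geo-lin β x y (H Ψ Φ) (H Ψ Φ') γ n

H-0 : ∀ Ψ γ n -> H Ψ (\ _ _ -> 0z) γ n ≡ 0z
H-0 Ψ γ n = H-lin Ψ 0z 0z (\ _ _ -> 0z) (\ _ _ -> 0z) γ n

H-∑ : ∀ {A : Set} Ψ (xs : List A) (Φ : A -> GF) γ n -> H Ψ (\ γ n -> ∑ xs (\ x -> Φ x γ n)) γ n ≡ ∑ xs (\ x -> H Ψ (Φ x) γ n)
H-∑ Ψ [] Φ γ n = H-0 Ψ γ n
H-∑ Ψ (x ∷ xs) Φ γ n = H-cong Ψ (length γ) (\ γ' _ n -> lem (Φ x γ' n) (∑ xs (\ y -> Φ y γ' n))) γ refl n &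
 H-lin Ψ 1z 1z (Φ x) (\ γ n -> ∑ xs (\ y -> Φ y γ n)) γ n &
 sym (lem (H Ψ (Φ x) γ n) _) &
 cong (\ z -> H Ψ (Φ x) γ n Z.+ z) (H-∑ Ψ xs Φ γ n)
 where
 lem : ∀ a b -> a Z.+ b ≡ 1z Z.* a Z.+ 1z Z.* b
 lem = solve-∀

-- Transports raising operators along a translation of the weight, a prefixed entry or an inserted
-- entry.
H-natural : ∀ (σ : List ℤ -> List ℤ) (f : Root -> Root) Ψ Φ ->
 (∀ β -> β ∈ Ψ -> ∀ γ -> σ (mv β 1 γ) ≡ mv (f β) 1 (σ γ)) -> ∀ γ n -> H Ψ (Φ ∘ σ) γ n ≡ H (map f Ψ) Φ (σ γ) n
H-natural σ f [] Φ e γ n = refl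
H-natural σ f (β ∷ Ψ) Φ e γ n = Geo-cong β (length γ) (\ γ' _ -> H-natural σ f Ψ Φ (\ β' i -> e β' (there i)) γ') γ refl n & go γ n
 where
 go : ∀ γ n -> Geo β (H (map f Ψ) Φ ∘ σ) γ n ≡ Geo (f β) (H (map f Ψ) Φ) (σ γ) n
 go γ zero = refl
 go γ (suc n) = cong (\ z -> H (map f Ψ) Φ (σ γ) (suc n) Z.+ z)
  (go (mv β 1 γ) n & cong (\ z -> Geo (f β) (H (map f Ψ) Φ) z n) (e β (here refl) γ))

Geo-∑ : ∀ β Φ γ n M -> n < M -> Geo β Φ γ n ≡ ∑ (upTo M) (\ a -> sh a (Φ (mv β a γ)) n)
Geo-∑ β Φ γ zero (suc M) p = sym (∑-upTo M (\ a -> sh a (Φ (mv β a γ)) 0) &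
 cong₂ Z._+_ (cong (\ z -> Φ z 0) (mv-0 β γ)) (∑-0 (upTo M)) & +0ʳ _)
Geo-∑ β Φ γ (suc n) (suc M) (s≤s p) = sym (∑-upTo M (\ a -> sh a (Φ (mv β a γ)) (suc n)) &
 cong₂ Z._+_ (cong (\ z -> Φ z (suc n)) (mv-0 β γ))
  (∑-cong (upTo M) (\ a -> cong (\ z -> sh a (Φ z) n) (mv-suc β a γ)) & sym (Geo-∑ β Φ (mv β 1 γ) n M p)))

∑-upTo-+ : ∀ a b (f : ℕ -> ℤ) -> ∑ (upTo (a + b)) f ≡ ∑ (upTo a) f Z.+ ∑ (upTo b) (\ x -> f (a + x))
∑-upTo-+ zero b f = sym (+0ˡ _)
∑-upTo-+ (suc a) b f = ∑-upTo (a + b) f & cong (\ z -> f 0 Z.+ z) (∑-upTo-+ a b (f ∘ suc)) &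
 sym (ZP.+-assoc (f 0) _ _) & cong (\ z -> z Z.+ ∑ (upTo b) (\ x -> f (suc a + x))) (sym (∑-upTo a f))

H-vanish : ∀ Ψ Φ γ -> (∀ m -> length m ≡ length Ψ -> ∀ n -> Φ (raise Ψ m γ) n ≡ 0z) -> ∀ n -> H Ψ Φ γ n ≡ 0z
H-vanish [] Φ γ v n = v [] refl n
H-vanish (β ∷ Ψ) Φ γ v n = Geo-∑ β (H Ψ Φ) γ n (suc n) ≤-refl &
 ∑-cong (upTo (suc n)) (\ a -> sh-cong a n (H-vanish Ψ Φ (mv β a γ) (\ m q -> v (a ∷ m) (cong suc q))) & sh-0 a n) &
  ∑-0 (upTo (suc n))

∈-upTo⁻ : ∀ {i n} -> i ∈ upTo n -> i < n
∈-upTo⁻ = MP.∈-upTo⁻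

-- Terms of total exponent above N vanish by hypothesis, so the truncated sum over exponents already
-- is the full series; the bound for the remaining roots shrinks by the exponent already spent.
H-vecsLe : ∀ N Ψ Φ γ -> (∀ m -> length m ≡ length Ψ -> N < sum m -> ∀ n -> Φ (raise Ψ m γ) n ≡ 0z) -> ∀ n ->
 ∑ (vecsLe (length Ψ) N) (\ m -> sh (sum m) (Φ (raise Ψ m γ)) n) ≡ H Ψ Φ γ n
H-vecsLe N [] Φ γ v n = +0ʳ _
H-vecsLe N (β ∷ Ψ) Φ γ v n = ∑-concatMap (\ a -> map (a ∷_) (vecsLe c (N ∸ a))) (upTo (suc N)) f &
 ∑-cong∈ (upTo (suc N)) (\ a i -> ∑-map (a ∷_) (vecsLe c (N ∸ a)) f & term a (≤-pred (∈-upTo⁻ i))) &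
 sym (+0ʳ _) &
 -- The range is padded by n+1 vanishing terms, so that it exceeds n as the expansion of the
 -- geometric series in degree n requires.
 cong (\ z -> ∑ (upTo (suc N)) g Z.+ z) (sym (∑-cong (upTo (suc n)) (\ x -> beyond (suc N + x) (s≤s (m≤m+n N x))) & ∑-0 (upTo (suc n)))) &
 sym (∑-upTo-+ (suc N) (suc n) g) &
 sym (Geo-∑ β (H Ψ Φ) γ n (suc N + suc n) (m≤n+m (suc n) (suc N)))
 where
 c = length Ψ
 f : List ℕ -> ℤ
 f m = sh (sum m) (Φ (raise (β ∷ Ψ) m γ)) n
 g : ℕ -> ℤ
 g a = sh a (H Ψ Φ (mv β a γ)) n
 term : ∀ a -> a ≤ N -> ∑ (vecsLe c (N ∸ a)) (\ m -> f (a ∷ m)) ≡ g a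
 term a p = ∑-cong (vecsLe c (N ∸ a)) (\ m -> sym (sh-sh a (sum m) (Φ (raise Ψ m (mv β a γ))) n)) &
  sym (sh-∑ a (vecsLe c (N ∸ a)) (\ m -> sh (sum m) (Φ (raise Ψ m (mv β a γ)))) n) &
   sh-cong a n (H-vecsLe (N ∸ a) Ψ Φ (mv β a γ)
    (\ m q lt -> v (a ∷ m) (cong suc q) (s≤s (eq≤ (sym (m+[n∸m]≡n p))) &≤ eq≤ (sym (+-suc a (N ∸ a))) &≤ +-monoʳ-≤ a lt)))
 beyond : ∀ a -> N < a -> g a ≡ 0z
 beyond a p = sh-cong a n (H-vanish Ψ Φ (mv β a γ) (\ m q -> v (a ∷ m) (cong suc q) (p &≤ m≤m+n a (sum m)))) & sh-0 a n

evalS-catalan : ∀ Ψ γ ψ n -> (∀ m -> length m ≡ length Ψ -> catBound γ < sum m -> ∀ n -> sF ψ (raise Ψ m γ) n ≡ 0z) ->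
 evalS (catalan Ψ γ) ψ n ≡ H Ψ (sF ψ) γ n
evalS-catalan Ψ γ ψ n v = evalS-sumS (map term ms) ψ n & ∑-map term ms (\ f -> evalS f ψ n) &
 ∑-cong ms (\ m -> evalS-scaleS (tpow (sum m)) (schurS (raise Ψ m γ)) ψ n &
  act-tpow (sum m) (evalS (schurS (raise Ψ m γ)) ψ) n & sh-cong (sum m) n (evalS-schurS (raise Ψ m γ) ψ)) &
  H-vecsLe (catBound γ) Ψ (sF ψ) γ v n
 where
 ms = vecsLe (length Ψ) (catBound γ)
 term : List ℕ -> Sym
 term m = scaleS (tpow (sum m)) (schurS (raise Ψ m γ))

-- The weights ℓ-1, …, 1, 0 make every positive root have positive height.
ht tot : List ℤ -> ℤ
ht [] = 0z
ht (x ∷ γ) = + length γ Z.* x Z.+ ht γ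
tot [] = 0z
tot (x ∷ γ) = x Z.+ tot γ

tot-addAt : ∀ i a γ -> i < length γ -> tot (addAt i a γ) ≡ tot γ Z.+ a
tot-addAt zero a (x ∷ γ) _ = lem x a (tot γ)
 where lem : ∀ x a t -> (x Z.+ a) Z.+ t ≡ (x Z.+ t) Z.+ a
       lem = solve-∀
tot-addAt (suc i) a (x ∷ γ) (s≤s p) = cong (\ z -> x Z.+ z) (tot-addAt i a γ p) & sym (ZP.+-assoc x (tot γ) a)

ht-addAt : ∀ i a γ -> i < length γ -> ht (addAt i a γ) ≡ ht γ Z.+ + (length γ ∸ suc i) Z.* a
ht-addAt zero a (x ∷ γ) _ = lem (+ length γ) x a (ht γ)
 where lem : ∀ l x a t -> l Z.* (x Z.+ a) Z.+ t ≡ (l Z.* x Z.+ t) Z.+ l Z.* a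
       lem = solve-∀
ht-addAt (suc i) a (x ∷ γ) (s≤s p) = cong₂ (\ u v -> + u Z.* x Z.+ v) (length-addAt i a γ) (ht-addAt i a γ p) &
 sym (ZP.+-assoc (+ length γ Z.* x) (ht γ) (+ (length γ ∸ suc i) Z.* a))

PosRoot : ℕ -> Root -> Set
PosRoot ℓ (i , j) = 1 ≤ i × i < j × j ≤ ℓ

tot-mv : ∀ β a γ -> PosRoot (length γ) β -> tot (mv β a γ) ≡ tot γ
tot-mv (suc i , suc j) a γ (_ , s≤s p , q) = tot-addAt i (+ a) (addAt j (Z.- (+ a)) γ) (subst (i <_) (sym (length-addAt j (Z.- (+ a)) γ)) (<-trans p q)) &
 cong (\ z -> z Z.+ + a) (tot-addAt j (Z.- (+ a)) γ q) & lem (tot γ) (+ a)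
 where lem : ∀ t a -> (t Z.+ Z.- a) Z.+ a ≡ t
       lem = solve-∀

-- With the weights ℓ-1, ..., 0, one unit moved along the root (i,j) adds j-i ≥ 1.
ht-mv : ∀ β a γ -> PosRoot (length γ) β -> ht γ Z.+ + a Z.≤ ht (mv β a γ)
ht-mv (suc i , suc j) a γ (_ , s≤s p , q) = subst (ht γ Z.+ + a Z.≤_) (sym eq) (ZP.+-monoʳ-≤ (ht γ) le)
 where
 L = length γ
 u = L ∸ suc i
 w = L ∸ suc j
 uw : suc w ≤ u
 uw = ∸-monoʳ-< (s≤s p) q
 lem : ∀ h u w a -> (h Z.+ w Z.* (Z.- a)) Z.+ u Z.* a ≡ h Z.+ (u Z.* a Z.- w Z.* a)
 lem = solve-∀
 eq : ht (mv (suc i , suc j) a γ) ≡ ht γ Z.+ (+ u Z.* + a Z.- + w Z.* + a)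
 eq = ht-addAt i (+ a) (addAt j (Z.- (+ a)) γ) (subst (i <_) (sym (length-addAt j (Z.- (+ a)) γ)) (<-trans p q)) &
  cong₂ (\ x y -> x Z.+ + (y ∸ suc i) Z.* + a) (ht-addAt j (Z.- (+ a)) γ q) (length-addAt j (Z.- (+ a)) γ) & lem (ht γ) (+ u) (+ w) (+ a)
 le : + a Z.≤ + u Z.* + a Z.- + w Z.* + a
 le = subst₂ Z._≤_ (lem1 (+ w) (+ a)) (lem2 (+ u) (+ w) (+ a)) (ZP.+-monoˡ-≤ (Z.- (+ w Z.* + a)) (ZP.*-monoʳ-≤-nonNeg (+ a) (Z.+≤+ uw)))
  where
  lem1 : ∀ w a -> (1z Z.+ w) Z.* a Z.+ Z.- (w Z.* a) ≡ a
  lem1 = solve-∀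
  lem2 : ∀ u w a -> u Z.* a Z.+ Z.- (w Z.* a) ≡ u Z.* a Z.- w Z.* a
  lem2 = solve-∀

raise-facts : ∀ Ψ m γ -> (∀ {β} -> β ∈ Ψ -> PosRoot (length γ) β) -> length m ≡ length Ψ ->
 length (raise Ψ m γ) ≡ length γ × tot (raise Ψ m γ) ≡ tot γ × ht γ Z.+ + sum m Z.≤ ht (raise Ψ m γ)
raise-facts [] [] γ P q = refl , refl , ZP.≤-reflexive (+0ʳ _)
raise-facts (β ∷ Ψ) (a ∷ m) γ P q with raise-facts Ψ m (mv β a γ) (\ i -> subst (\ l -> PosRoot l _) (sym (length-mv β a γ)) (P (there i))) (suc-injective q)
... | l , t , h = trans l (length-mv β a γ) , trans t (tot-mv β a γ (P (here refl))) ,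
 ZP.≤-trans (ZP.≤-reflexive (sym (ZP.+-assoc (ht γ) (+ a) (+ sum m)))) (ZP.≤-trans (ZP.+-monoˡ-≤ (+ sum m) (ht-mv β a γ (P (here refl)))) h)

-- Sets of roots

∈-range⁻ : ∀ {x} b -> x ∈ range 1 b -> 1 ≤ x × x ≤ b
∈-range⁻ b i with MP.∈-map⁻ suc i
... | y , j , refl = z<s , ∈-upTo⁻ j

∈-range⁺ : ∀ {x} b -> 1 ≤ x -> x ≤ b -> x ∈ range 1 b
∈-range⁺ {suc x} b _ p = MP.∈-map⁺ suc (MP.∈-upTo⁺ p)

Unique-range : ∀ b -> Unique (range 1 b)
Unique-range b = UP.map⁺ suc-injective (UP.upTo⁺ b)

module _ {A B : Set} (f : A -> List B) where

 ∈-concatMap⁻ : ∀ xs {y} -> y ∈ concatMap f xs -> ∃[ x ] x ∈ xs × y ∈ f x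
 ∈-concatMap⁻ (x ∷ xs) i with MP.∈-++⁻ (f x) i
 ... | inj₁ j = x , here refl , j
 ... | inj₂ j with ∈-concatMap⁻ xs j
 ... | x' , k , l = x' , there k , l

 ∈-concatMap⁺ : ∀ {xs x y} -> x ∈ xs -> y ∈ f x -> y ∈ concatMap f xs
 ∈-concatMap⁺ {x ∷ xs} (here refl) j = MP.∈-++⁺ˡ j
 ∈-concatMap⁺ {x ∷ xs} (there i) j = MP.∈-++⁺ʳ (f x) (∈-concatMap⁺ i j)

 Unique-concatMap : ∀ {xs} -> Unique xs -> (∀ x -> Unique (f x)) ->
  (∀ {x x' y} -> y ∈ f x -> y ∈ f x' -> x ≡ x') -> Unique (concatMap f xs)
 Unique-concatMap {[]} _ u d = AllPairs.[]
 Unique-concatMap {x ∷ xs} (n AllPairs.∷ us) u d = UP.++⁺ (u x) (Unique-concatMap us u d)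
  (\ { (i , j) -> case∈ i (∈-concatMap⁻ xs j) })
  where
  case∈ : ∀ {y} -> y ∈ f x -> ∃[ x' ] x' ∈ xs × y ∈ f x' -> ⊥
  case∈ i (x' , k , l) = All.lookup n k (d i l)

roots : (ℕ -> ℕ -> Bool) -> ℕ -> List Root
roots p ℓ = concatMap (\ i -> concatMap (\ j -> if p i j then (i , j) ∷ [] else []) (range 1 ℓ)) (range 1 ℓ)

∈-roots⁻ : ∀ p ℓ {i j} -> (i , j) ∈ roots p ℓ -> 1 ≤ i × i ≤ ℓ × 1 ≤ j × j ≤ ℓ × p i j ≡ true
∈-roots⁻ p ℓ m with ∈-concatMap⁻ _ (range 1 ℓ) m
... | i , mi , m' with ∈-concatMap⁻ _ (range 1 ℓ) m'
... | j , mj , m'' with p i j in eq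
... | true with m''
... | here refl = proj₁ (∈-range⁻ ℓ mi) , proj₂ (∈-range⁻ ℓ mi) , proj₁ (∈-range⁻ ℓ mj) , proj₂ (∈-range⁻ ℓ mj) , eq

∈-roots⁺ : ∀ p ℓ {i j} -> 1 ≤ i -> i ≤ ℓ -> 1 ≤ j -> j ≤ ℓ -> p i j ≡ true -> (i , j) ∈ roots p ℓ
∈-roots⁺ p ℓ {i} {j} a b c d e = ∈-concatMap⁺ _ (∈-range⁺ ℓ a b) (∈-concatMap⁺ _ (∈-range⁺ ℓ c d)
 (subst (\ z -> (i , j) ∈ (if z then (i , j) ∷ [] else [])) (sym e) (here refl)))

if-∈ : ∀ {A : Set} b {x y : A} -> y ∈ (if b then x ∷ [] else []) -> y ≡ x
if-∈ true (here q) = q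

Unique-if : ∀ {A : Set} b (x : A) -> Unique (if b then x ∷ [] else [])
Unique-if true x = [] AllPairs.∷ AllPairs.[]
Unique-if false x = AllPairs.[]

Unique-roots : ∀ p ℓ -> Unique (roots p ℓ)
Unique-roots p ℓ = Unique-concatMap _ (Unique-range ℓ)
 (\ i -> Unique-concatMap _ (Unique-range ℓ) (\ j -> Unique-if (p i j) (i , j))
  (\ {j} {j'} a b -> cong proj₂ (sym (if-∈ (p i j) a) & if-∈ (p i j') b)))
 (\ {i} {i'} a b -> sym (fst i a) & fst i' b)
 where
 fst : ∀ i {y} -> y ∈ concatMap (\ j -> if p i j then (i , j) ∷ [] else []) (range 1 ℓ) -> proj₁ y ≡ i
 fst i m with ∈-concatMap⁻ _ (range 1 ℓ) m
 ... | j , _ , m' = cong proj₁ (if-∈ (p i j) m')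

unique-↭ : ∀ {A : Set} {xs ys : List A} -> Unique xs -> Unique ys -> (∀ {x} -> x ∈ xs -> x ∈ ys) -> (∀ {x} -> x ∈ ys -> x ∈ xs) -> xs ↭ ys
unique-↭ u v f g = BS.∼bag⇒↭ (MK.unique∧set⇒bag u v (mk⇔ f g))

-- k-Schur functions as functionals

kRoot : ℕ -> List ℕ -> ℕ -> ℕ -> Bool
kRoot k μ i j = (i <ᵇ j) ∧ (((k ∸ nthN μ (i ∸ 1)) + i) <ᵇ j)

∧-trueˡ : ∀ {a b} -> a ∧ b ≡ true -> a ≡ true
∧-trueˡ {true} _ = refl

∧-trueʳ : ∀ {a b} -> a ∧ b ≡ true -> b ≡ true
∧-trueʳ {true} e = e

∧-true : ∀ {a b} -> a ≡ true -> b ≡ true -> a ∧ b ≡ true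
∧-true refl refl = refl

<ᵇ-true⁻ : ∀ {m n} -> (m <ᵇ n) ≡ true -> m < n
<ᵇ-true⁻ {m} {n} e = <ᵇ⇒< m n (subst T (sym e) tt)

<ᵇ-true⁺ : ∀ {m n} -> m < n -> (m <ᵇ n) ≡ true
<ᵇ-true⁺ {m} {n} p with m <ᵇ n | <⇒<ᵇ p
... | true | _ = refl

<ᵇ-false⁻ : ∀ {m n} -> (m <ᵇ n) ≡ false -> n ≤ m
<ᵇ-false⁻ {m} {n} e = ≮⇒≥ (\ p -> case-ff (sym (<ᵇ-true⁺ p) & e))
 where case-ff : true ≡ false -> ⊥
       case-ff ()

<ᵇ-false⁺ : ∀ {m n} -> n ≤ m -> (m <ᵇ n) ≡ false
<ᵇ-false⁺ {m} {n} p with m <ᵇ n in e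
... | false = refl
... | true = ⊥-elim (<⇒≱ (<ᵇ-true⁻ {m} {n} e) p)

toZ : List ℕ -> List ℤ
toZ = map (\ x -> + x)

-- The last index in each Jacobi-Trudi row is nonnegative; if this fails in some row, that row
-- consists of zeros.
AllOK : List ℤ -> Set
AllOK [] = ⊤
AllOK (x ∷ γ) = 0z Z.≤ x Z.+ + length γ × AllOK γ

rowsOK? : ∀ γ -> (∃[ i ] (i < length γ × nthZ γ i Z.+ + length γ Z.≤ + i)) ⊎ AllOK γ
rowsOK? [] = inj₂ tt
rowsOK? (x ∷ γ) with rowsOK? γ
... | inj₁ (i , p , q) = inj₁ (suc i , s≤s p , subst (Z._≤ + suc i) (lem (nthZ γ i) (+ length γ)) (ZP.+-monoʳ-≤ 1z q))
 where lem : ∀ z l -> 1z Z.+ (z Z.+ l) ≡ z Z.+ (1z Z.+ l)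
       lem = solve-∀
... | inj₂ ok with 0z Z.≤? x Z.+ + length γ
... | yes p = inj₂ (p , ok)
... | no ¬p = inj₁ (0 , z<s , subst (Z._≤ 0z) (lem x (+ length γ)) (ZP.i<j⇒suc[i]≤j (ZP.≰⇒> ¬p)))
 where lem : ∀ z l -> 1z Z.+ (z Z.+ l) ≡ z Z.+ (1z Z.+ l)
       lem = solve-∀

triang : List ℤ -> ℕ
triang [] = 0
triang (x ∷ γ) = length γ + triang γ

triang-≤ : ∀ γ -> triang γ ≤ length γ * length γ
triang-≤ [] = z≤n
triang-≤ (x ∷ γ) = +-monoʳ-≤ (length γ) (triang-≤ γ) &≤ m≤n+m _ 1 &≤
 m≤m+n _ (length γ) &≤ eq≤ (lem (length γ))
 where lem : ∀ l -> (1 + (l + l * l)) + l ≡ (1 + l) * (1 + l)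
       lem = NRing.solve-∀

triang-length : ∀ γ γ' -> length γ ≡ length γ' -> triang γ ≡ triang γ'
triang-length [] [] q = refl
triang-length (x ∷ γ) (y ∷ γ') q = cong₂ _+_ (suc-injective q) (triang-length γ γ' (suc-injective q))

-- With l entries to its right, x satisfies l x ≤ l (x+l) ≤ L (x+l), the second step because x+l is
-- nonnegative; the l add up to `triang γ`.
ht-bound : ∀ L γ -> AllOK γ -> length γ ≤ L -> ht γ Z.≤ + L Z.* (tot γ Z.+ + triang γ)
ht-bound L [] _ _ = ZP.≤-reflexive (sym (ZP.*-zeroʳ (+ L)))
ht-bound L (x ∷ γ) (p , ok) q = ZP.≤-trans (ZP.+-mono-≤ (ZP.≤-trans a b) (ht-bound L γ ok (<⇒≤ q)))
 (ZP.≤-reflexive (lem (+ L) x (+ length γ) (tot γ) (+ triang γ)))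
 where
 l = + length γ
 a : l Z.* x Z.≤ l Z.* (x Z.+ l)
 a = ZP.*-monoˡ-≤-nonNeg l (ZP.≤-trans (ZP.≤-reflexive (sym (+0ʳ x))) (ZP.+-monoʳ-≤ x (Z.+≤+ z≤n)))
 b : l Z.* (x Z.+ l) Z.≤ + L Z.* (x Z.+ l)
 mono : ∀ z -> 0z Z.≤ z -> l Z.* z Z.≤ + L Z.* z
 mono (+ y) _ = ZP.*-monoʳ-≤-nonNeg (+ y) (Z.+≤+ (<⇒≤ q))
 b = mono (x Z.+ l) p
 lem : ∀ L x l t r -> L Z.* (x Z.+ l) Z.+ L Z.* (t Z.+ r) ≡ L Z.* ((x Z.+ t) Z.+ (l Z.+ r))
 lem = solve-∀

tot-toZ : ∀ μ -> tot (toZ μ) ≡ + sum μ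
tot-toZ [] = refl
tot-toZ (x ∷ μ) = cong (\ z -> + x Z.+ z) (tot-toZ μ)

abs-toZ : ∀ μ -> sum (map Z.∣_∣ (toZ μ)) ≡ sum μ
abs-toZ [] = refl
abs-toZ (x ∷ μ) = cong (\ z -> x + z) (abs-toZ μ)

ht-toZ : ∀ μ -> 0z Z.≤ ht (toZ μ)
ht-toZ [] = ZP.≤-refl
ht-toZ (x ∷ μ) = ZP.+-mono-≤ (ZP.≤-trans (Z.+≤+ z≤n) (ZP.≤-reflexive (ZP.pos-* (length (toZ μ)) x))) (ht-toZ μ)

-- Raising by m increases the height, nonnegative at the start, by at least Σ m and keeps the size.
-- If no Jacobi-Trudi row vanishes, the height is at most ℓ times (size plus `triang`), which is
-- below the truncation bound.
sF-raise-beyond : ∀ Ψ μ ψ m n -> (∀ {β} -> β ∈ Ψ -> PosRoot (length μ) β) -> length m ≡ length Ψ -> catBound (toZ μ) < sum m ->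
 sF ψ (raise Ψ m (toZ μ)) n ≡ 0z
sF-raise-beyond Ψ μ ψ m n P q lt with raise-facts Ψ m (toZ μ) (\ i -> subst (\ l -> PosRoot l _) (sym (LP.length-map _ μ)) (P i)) q
... | lq , tq , hq with rowsOK? (raise Ψ m (toZ μ))
... | inj₁ (i , p , neg) = sF-rowNeg ψ (raise Ψ m (toZ μ)) i n p neg
... | inj₂ ok = ⊥-elim (<⇒≱ lt (ZP.drop‿+≤+ chain &≤ bound))
 where
 γ = toZ μ
 γ' = raise Ψ m γ
 L = length γ
 open ZP.≤-Reasoning
 chain : + sum m Z.≤ + (L * (sum μ + triang γ))
 chain = begin
  + sum m ≡⟨ sym (+0ˡ _) ⟩
  0z Z.+ + sum m ≤⟨ ZP.+-monoˡ-≤ (+ sum m) (ht-toZ μ) ⟩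
  ht γ Z.+ + sum m ≤⟨ hq ⟩
  ht γ' ≤⟨ ht-bound L γ' ok (eq≤ lq) ⟩
  + L Z.* (tot γ' Z.+ + triang γ') ≡⟨ cong₂ (\ a b -> + L Z.* (a Z.+ + b)) (tq & tot-toZ μ) (triang-length γ' γ lq) ⟩
  + L Z.* + (sum μ + triang γ) ≡⟨ sym (ZP.pos-* L _) ⟩
  + (L * (sum μ + triang γ)) ∎
 bound : L * (sum μ + triang γ) ≤ catBound γ
 bound = eq≤ (*-distribˡ-+ L (sum μ) (triang γ)) &≤
  +-mono-≤ (eq≤ (cong (\ z -> L * z) (sym (abs-toZ μ))) &≤ m≤n+m _ (sum (map Z.∣_∣ γ)))
   (*-monoʳ-≤ L (triang-≤ γ) &≤ eq≤ (cube L))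
  where cube : ∀ l -> l * (l * l) ≡ l * (l * (l * 1))
        cube = NRing.solve-∀

kRoots-pos : ∀ k μ {β} -> β ∈ kRoots k μ -> PosRoot (length μ) β
kRoots-pos k μ {i , j} m with ∈-roots⁻ (kRoot k μ) (length μ) m
... | a , b , c , d , e = a , <ᵇ-true⁻ (∧-trueˡ e) , d

evalS-kSchur : ∀ k μ ψ n -> evalS (kSchur k μ) ψ n ≡ H (kRoots k μ) (sF ψ) (toZ μ) n
evalS-kSchur k μ ψ n = evalS-catalan (kRoots k μ) (toZ μ) ψ n
 (\ m q lt n -> sF-raise-beyond (kRoots k μ) μ ψ m n (kRoots-pos k μ) q lt)

-- The operators 𝓑_m

act-sh1 : ∀ p s n -> act p (sh 1 s) n ≡ sh 1 (act p s) n
act-sh1 [] s zero = refl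
act-sh1 [] s (suc n) = refl
act-sh1 (c ∷ p) s zero = +0ʳ _ & ZP.*-zeroʳ c
act-sh1 (c ∷ p) s (suc n) = cong (\ z -> c Z.* s n Z.+ z) (act-sh1 p s n)

act-sh : ∀ a p s n -> act p (sh a s) n ≡ sh a (act p s) n
act-sh zero p s n = refl
act-sh (suc a) p s n = act-cong p n (\ m -> sym (sh-sh 1 a s m)) &
 act-sh1 p (sh a s) n & sh-cong 1 n (act-sh a p s) & sh-sh 1 a (act p s) n

act-* : ∀ p c s n -> act p (\ m -> c Z.* s m) n ≡ c Z.* act p s n
act-* [] c s n = sym (ZP.*-zeroʳ c)
act-* (a ∷ p) c s n = cong (\ z -> a Z.* (c Z.* s n) Z.+ z) (sh-cong 1 n (act-* p c s) & sh-* 1 c (act p s) n) &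
 lem a c (s n) _
 where lem : ∀ a c x y -> a Z.* (c Z.* x) Z.+ c Z.* y ≡ c Z.* (a Z.* x Z.+ y)
       lem = solve-∀

evalS-∑ : ∀ {A : Set} f (xs : List A) (ψ : A -> Fun) n -> evalS f (\ m i -> ∑ xs (\ x -> ψ x m i)) n ≡ ∑ xs (\ x -> evalS f (ψ x) n)
evalS-∑ f xs ψ n = ∑-cong f (\ pm -> act-∑ (proj₁ pm) xs (\ x -> ψ x (proj₂ pm)) n) &
 ∑-swap f xs (\ pm x -> act (proj₁ pm) (ψ x (proj₂ pm)) n)

evalS-* : ∀ f c (ψ : Fun) n -> evalS f (\ m i -> c Z.* ψ m i) n ≡ c Z.* evalS f ψ n
evalS-* f c ψ n = ∑-cong f (\ pm -> act-* (proj₁ pm) c (ψ (proj₂ pm)) n) & ∑-* c f (\ pm -> act (proj₁ pm) (ψ (proj₂ pm)) n)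

evalS-sh : ∀ f a (ψ : Fun) n -> evalS f (\ m -> sh a (ψ m)) n ≡ sh a (evalS f ψ) n
evalS-sh f a ψ n = ∑-cong f (\ pm -> act-sh a (proj₁ pm) (ψ (proj₂ pm)) n) &
 sym (sh-∑ a f (\ pm -> act (proj₁ pm) (ψ (proj₂ pm))) n)

evalS-liftPerp : ∀ F f ψ n -> evalS (liftPerp F f) ψ n ≡ evalS f (\ m i -> ∑ (F (dropZeros m)) (\ m' -> ψ m' i)) n
evalS-liftPerp F f ψ n = ∑-concatMap (\ { (p , m) -> map (\ m' -> (p , m')) (F (dropZeros m)) }) f (\ pm -> act (proj₁ pm) (ψ (proj₂ pm)) n) & ∑-cong f (\ pm ->
 ∑-map (\ m' -> (proj₁ pm , m')) (F (dropZeros (proj₂ pm))) (\ pm -> act (proj₁ pm) (ψ (proj₂ pm)) n) & sym (act-∑ (proj₁ pm) (F (dropZeros (proj₂ pm))) ψ n))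

ZI : Fun -> Set
ZI ψ = ∀ pre m n -> ψ (pre ++ 0 ∷ m) n ≡ ψ (pre ++ m) n

ZI-consZ : ∀ z {ψ} -> ZI ψ -> ZI (consZ z ψ)
ZI-consZ (+ zero) zi = zi
ZI-consZ (+ suc x) zi = \ pre -> zi (suc x ∷ pre)
ZI-consZ -[1+ x ] zi = \ _ _ _ -> refl

consZ-ZI : ∀ x {ψ} -> ZI ψ -> ∀ m n -> consZ (+ x) ψ m n ≡ ψ (x ∷ m) n
consZ-ZI zero zi m n = sym (zi [] m n)
consZ-ZI (suc x) zi m n = refl

-- f m' is the functional on the remaining factors once the first one is h_{m'}
RE : (ℤ -> Fun) -> ℤ -> List ℤ -> Seq
RE f m [] n = f m [] n
RE f m (z ∷ l) n = RE (\ m' -> consZ z (f m')) m l n Z.- RE (\ m' -> consZ (z Z.- 1z) (f m')) (m Z.+ 1z) l n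

-- As `RE`, but each factor first gives a units, with weight t^a, to the leading index: the part of
-- h_j^⊥ in 𝓑_m.
RX : (ℤ -> Fun) -> ℤ -> List ℤ -> Seq
RX f m [] n = f m [] n
RX f m (+ x ∷ l) n = ∑ (upTo (suc x)) (\ a -> sh a (\ n -> RX (\ m' -> consZ (+ x Z.- + a) (f m')) (m Z.+ + a) l n
 Z.- RX (\ m' -> consZ ((+ x Z.- + a) Z.- 1z) (f m')) ((m Z.+ + a) Z.+ 1z) l n) n)
RX f m (-[1+ x ] ∷ l) n = 0z

THr : (ℤ -> Fun) -> ℤ -> List ℕ -> Seq
THr F m [] n = F m [] n
THr F m (x ∷ r) n = ∑ (upTo (suc x)) (\ a -> sh a (THr (\ m' m1 -> F m' ((x ∸ a) ∷ m1)) (m Z.+ + a) r) n)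

RE-cong : ∀ l {f g : ℤ -> Fun} m n -> (∀ m' x i -> f m' x i ≡ g m' x i) -> RE f m l n ≡ RE g m l n
RE-cong [] m n e = e m [] n
RE-cong (z ∷ l) m n e = cong₂ Z._-_ (RE-cong l m n (\ m' -> consZ-cong z (e m'))) (RE-cong l (m Z.+ 1z) n (\ m' -> consZ-cong (z Z.- 1z) (e m')))

RX-cong : ∀ l {f g : ℤ -> Fun} m n -> (∀ m' x i -> f m' x i ≡ g m' x i) -> RX f m l n ≡ RX g m l n
RX-cong [] m n e = e m [] n
RX-cong (+ x ∷ l) m n e = ∑-cong (upTo (suc x)) (\ a -> sh-cong a n (\ i -> cong₂ Z._-_
 (RX-cong l _ i (\ m' -> consZ-cong (+ x Z.- + a) (e m'))) (RX-cong l _ i (\ m' -> consZ-cong ((+ x Z.- + a) Z.- 1z) (e m')))))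
RX-cong (-[1+ x ] ∷ l) m n e = refl

consZ-0 : ∀ z m i -> consZ z (\ _ _ -> 0z) m i ≡ 0z
consZ-0 (+ zero) m i = refl
consZ-0 (+ suc a) m i = refl
consZ-0 -[1+ a ] m i = refl

RX-0 : ∀ l m n -> RX (\ _ _ _ -> 0z) m l n ≡ 0z
RX-0 [] m n = refl
RX-0 (+ x ∷ l) m n = ∑-cong (upTo (suc x)) (\ a -> sh-cong a n (\ i -> cong₂ Z._-_
 (RX-cong l _ i (\ _ -> consZ-0 (+ x Z.- + a)) & RX-0 l _ i) (RX-cong l _ i (\ _ -> consZ-0 ((+ x Z.- + a) Z.- 1z)) & RX-0 l _ i)) & sh-0 a n) &
 ∑-0 (upTo (suc x))
RX-0 (-[1+ x ] ∷ l) m n = refl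

consZ-Neg : ∀ z ψ m i -> Neg z -> consZ z ψ m i ≡ 0z
consZ-Neg -[1+ x ] ψ m i _ = refl
consZ-Neg (+ x) ψ m i (Z.+<+ ())

RX-Neg : ∀ z (f : ℤ -> Fun) m l n -> Neg z -> RX (\ m' -> consZ z (f m')) m l n ≡ 0z
RX-Neg z f m l n q = RX-cong l m n (\ m' x i -> consZ-Neg z (f m') x i q) & RX-0 l m n

THr-− : ∀ r (F G : ℤ -> Fun) m n -> THr (\ m' x i -> F m' x i Z.- G (m' Z.+ 1z) x i) m r n ≡ THr F m r n Z.- THr G (m Z.+ 1z) r n
THr-− [] F G m n = refl
THr-− (x ∷ r) F G m n = ∑-cong (upTo (suc x)) (\ a -> sh-cong a n (\ i ->
 THr-− r (\ m' m1 -> F m' ((x ∸ a) ∷ m1)) (\ m' m1 -> G m' ((x ∸ a) ∷ m1)) (m Z.+ + a) i &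
  cong (\ z -> THr (\ m' m1 -> F m' ((x ∸ a) ∷ m1)) (m Z.+ + a) r i Z.- THr (\ m' m1 -> G m' ((x ∸ a) ∷ m1)) z r i) (lem m (+ a)) &
   cong (\ z -> THr (\ m' m1 -> F m' ((x ∸ a) ∷ m1)) (m Z.+ + a) r i Z.+ z) (sym (ZP.-1*i≡-i _))) &
 sh-+ a (THr (\ m' m1 -> F m' ((x ∸ a) ∷ m1)) (m Z.+ + a) r) (\ i -> Z.- 1z Z.* THr (\ m' m1 -> G m' ((x ∸ a) ∷ m1)) ((m Z.+ 1z) Z.+ + a) r i) n &
  cong (\ z -> sh a (THr (\ m' m1 -> F m' ((x ∸ a) ∷ m1)) (m Z.+ + a) r) n Z.+ z) (sh-* a (Z.- 1z) (THr (\ m' m1 -> G m' ((x ∸ a) ∷ m1)) ((m Z.+ 1z) Z.+ + a) r) n & ZP.-1*i≡-i _)) &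
 ∑-+ (upTo (suc x)) (\ a -> sh a (THr (\ m' m1 -> F m' ((x ∸ a) ∷ m1)) (m Z.+ + a) r) n) (\ a -> Z.- sh a (THr (\ m' m1 -> G m' ((x ∸ a) ∷ m1)) ((m Z.+ 1z) Z.+ + a) r) n) &
  cong (\ z -> THr F m (x ∷ r) n Z.+ z) (∑-neg (upTo (suc x)) (\ a -> sh a (THr (\ m' m1 -> G m' ((x ∸ a) ∷ m1)) ((m Z.+ 1z) Z.+ + a) r) n))
 where lem : ∀ m a -> (m Z.+ a) Z.+ 1z ≡ (m Z.+ 1z) Z.+ a
       lem = solve-∀

pos-∸ : ∀ x a -> a ≤ x -> + (x ∸ a) ≡ + x Z.- + a
pos-∸ x a p = sym (ZP.m-n≡m⊖n x a & ZP.⊖-≥ p)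

-- The operators h^⊥ and e^⊥ both act factor by factor, so the two passes over the monomial merge
-- into one.
THr-RE : ∀ x f m n -> THr (\ m' m1 -> RE f m' (toZ m1)) m x n ≡ RX f m (toZ x) n
THr-RE [] f m n = refl
THr-RE (x ∷ r) f m n = ∑-cong∈ (upTo (suc x)) (\ a i -> sh-cong a n (\ j -> THr-− r (\ m' m1 -> RE (\ m' -> consZ (+ (x ∸ a)) (f m')) m' (toZ m1)) (\ m' m1 -> RE (\ m' -> consZ (+ (x ∸ a) Z.- 1z) (f m')) m' (toZ m1)) (m Z.+ + a) j &
 cong₂ Z._-_ (THr-RE r (\ m' -> consZ (+ (x ∸ a)) (f m')) (m Z.+ + a) j & cong (\ z -> RX (\ m' -> consZ z (f m')) (m Z.+ + a) (toZ r) j) (pos-∸ x a (≤-pred (∈-upTo⁻ i))))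
  (THr-RE r (\ m' -> consZ (+ (x ∸ a) Z.- 1z) (f m')) ((m Z.+ + a) Z.+ 1z) j & cong (\ z -> RX (\ m' -> consZ (z Z.- 1z) (f m')) ((m Z.+ + a) Z.+ 1z) (toZ r) j) (pos-∸ x a (≤-pred (∈-upTo⁻ i))))))

TE : ℕ -> (ℤ -> Fun) -> ℤ -> Fun
TE D f m m1 n = ∑ (upTo (suc D)) (\ i -> sgn i Z.* ∑ (eperpM i (dropZeros m1)) (\ m2 -> f (m Z.+ + i) m2 n))

TE-RE : ∀ D m1 f m n -> (∀ m' -> ZI (f m')) -> length m1 ≤ D -> TE D f m m1 n ≡ RE f m (toZ m1) n
TE-RE D [] f m n zi p = ∑-upTo D (\ i -> sgn i Z.* ∑ (eperpM i []) (\ m2 -> f (m Z.+ + i) m2 n)) & cong₂ Z._+_ (ZP.*-identityˡ _ & +0ʳ _ & cong (\ z -> f z [] n) (+0ʳ m))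
 (∑-cong (upTo D) (\ i -> ZP.*-zeroʳ (sgn (suc i))) & ∑-0 (upTo D)) & +0ʳ _
TE-RE D (zero ∷ m1) f m n zi p = TE-RE D m1 f m n zi (<⇒≤ p) & sym (cong (\ z -> RE f m (toZ m1) n Z.- z) (RE-0 (toZ m1) (m Z.+ 1z) n) & +0ʳ _)
 where
 RE-0 : ∀ l m n -> RE (\ _ _ _ -> 0z) m l n ≡ 0z
 RE-0 [] m n = refl
 RE-0 (z ∷ l) m n = cong₂ Z._-_ (RE-cong l m n (\ _ -> consZ-0 z) & RE-0 l m n) (RE-cong l (m Z.+ 1z) n (\ _ -> consZ-0 (z Z.- 1z)) & RE-0 l (m Z.+ 1z) n)
TE-RE (suc D) (suc y ∷ m1) f m n zi (s≤s p) = ∑-upTo (suc D) (\ i -> sgn i Z.* E i) &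
 cong₂ Z._+_ (cong (1z Z.*_) (refl {x = X 0})) (∑-cong (upTo (suc D)) (\ i -> cong ((Z.- sgn i) Z.*_) (split i) & lem1 (sgn i) (Y i) (X (suc i)))) &
 cong (\ z -> 1z Z.* X 0 Z.+ z) (∑-+ (upTo (suc D)) (\ i -> (Z.- sgn i) Z.* X (suc i)) (\ i -> Z.- (sgn i Z.* Y i)) & cong (\ z -> ∑ (upTo (suc D)) (\ i -> (Z.- sgn i) Z.* X (suc i)) Z.+ z) (∑-neg (upTo (suc D)) (\ i -> sgn i Z.* Y i))) &
 sym (ZP.+-assoc (1z Z.* X 0) _ _) &
 cong₂ Z._+_ (sym (∑-upTo (suc D) (\ i -> sgn i Z.* X i)) & TE-RE (suc D) m1 (\ m' -> consZ (+ suc y) (f m')) m n (\ m' -> ZI-consZ (+ suc y) {f m'} (zi m')) (p &≤ n≤1+n D))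
   (cong Z.-_ (∑-cong (upTo (suc D)) (\ i -> cong (sgn i Z.*_) (∑-cong (eperpM i (dropZeros m1)) (\ m2 -> sym (consZ-ZI y {f (m Z.+ + suc i)} (zi (m Z.+ + suc i)) m2 n) & cong (\ z -> consZ (+ y) (f z) m2 n) (sym (ZP.+-assoc m 1z (+ i)))))) &
    TE-RE D m1 (\ m' -> consZ (+ y) (f m')) (m Z.+ 1z) n (\ m' -> ZI-consZ (+ y) {f m'} (zi m')) p))
 where
 E X Y : ℕ -> ℤ
 E i = ∑ (eperpM i (suc y ∷ dropZeros m1)) (\ m2 -> f (m Z.+ + i) m2 n)
 X i = ∑ (eperpM i (dropZeros m1)) (\ m2 -> f (m Z.+ + i) (suc y ∷ m2) n)
 Y i = ∑ (eperpM i (dropZeros m1)) (\ m2 -> f (m Z.+ + suc i) (y ∷ m2) n)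
 split : ∀ i -> E (suc i) ≡ Y i Z.+ X (suc i)
 split i = ∑-++ (map (y ∷_) (eperpM i (dropZeros m1))) (map (suc y ∷_) (eperpM (suc i) (dropZeros m1))) g & cong₂ Z._+_ (∑-map (y ∷_) (eperpM i (dropZeros m1)) g) (∑-map (suc y ∷_) (eperpM (suc i) (dropZeros m1)) g)
  where g = \ m2 -> f (m Z.+ + suc i) m2 n
 lem1 : ∀ s a b -> (Z.- s) Z.* (a Z.+ b) ≡ (Z.- s) Z.* b Z.+ Z.- (s Z.* a)
 lem1 = solve-∀

TH : ℕ -> (ℤ -> Fun) -> ℤ -> List ℕ -> Seq
TH D F m x n = ∑ (upTo (suc D)) (\ j -> sh j (\ i -> ∑ (hperpM j x) (\ m1 -> F (m Z.+ + j) m1 i)) n)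

-- The total j is distributed over the factors; summing over j up to the degree D leaves each factor
-- a free choice of its share.
TH-THr : ∀ D x F m n -> sum x ≤ D -> TH D F m x n ≡ THr F m x n
TH-THr D [] F m n p = ∑-upTo D (\ j -> sh j (\ i -> ∑ (hperpM j []) (\ m1 -> F (m Z.+ + j) m1 i)) n) & cong₂ Z._+_ (+0ʳ _ & cong (\ z -> F z [] n) (+0ʳ m))
 (∑-cong (upTo D) (\ j -> sh-0 (suc j) n) & ∑-0 (upTo D)) & +0ʳ _
TH-THr D (x ∷ r) F m n p = ∑-cong (upTo (suc D)) (\ j -> sh-cong j n (\ i -> ∑-concatMap (\ a -> map ((x ∸ a) ∷_) (hperpM (j ∸ a) r)) (upTo (suc (x ⊓ j))) (\ m1 -> F (m Z.+ + j) m1 i) &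
   ∑-cong (upTo (suc (x ⊓ j))) (\ a -> ∑-map ((x ∸ a) ∷_) (hperpM (j ∸ a) r) (\ m1 -> F (m Z.+ + j) m1 i)) & widen j i) &
   sh-∑ j (upTo (suc x)) (\ a i -> if a ≤ᵇ j then K a (j ∸ a) i else 0z) n) &
 ∑-swap (upTo (suc D)) (upTo (suc x)) (\ j a -> sh j (\ i -> if a ≤ᵇ j then K a (j ∸ a) i else 0z) n) &
 ∑-cong∈ (upTo (suc x)) (\ a i -> inner a (≤-pred (∈-upTo⁻ i)))
 where
 K : ℕ -> ℕ -> Seq
 K a j' i = ∑ (hperpM j' r) (\ m1 -> F (m Z.+ + (a + j')) ((x ∸ a) ∷ m1) i)
 ≤ᵇ-t : ∀ {a j} -> a ≤ j -> (a ≤ᵇ j) ≡ true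
 ≤ᵇ-t {a} {j} q with a ≤ᵇ j | ≤⇒≤ᵇ q
 ... | true | _ = refl
 ≤ᵇ-f : ∀ {a j} -> j < a -> (a ≤ᵇ j) ≡ false
 ≤ᵇ-f {a} {j} q with a ≤ᵇ j in e
 ... | false = refl
 ... | true = ⊥-elim (<⇒≱ q (≤ᵇ⇒≤ a j (subst T (sym e) tt)))
 widen : ∀ j i -> ∑ (upTo (suc (x ⊓ j))) (\ a -> ∑ (hperpM (j ∸ a) r) (\ m1 -> F (m Z.+ + j) ((x ∸ a) ∷ m1) i))
  ≡ ∑ (upTo (suc x)) (\ a -> if a ≤ᵇ j then K a (j ∸ a) i else 0z)
 widen j i = sym (cong (\ k -> ∑ (upTo k) g) (cong suc (sym (m+[n∸m]≡n (m⊓n≤m x j)))) &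
  ∑-upTo-+ (suc (x ⊓ j)) (x ∸ (x ⊓ j)) g &
  cong₂ Z._+_ (∑-cong∈ (upTo (suc (x ⊓ j))) (\ a q -> low a (≤-pred (∈-upTo⁻ q) &≤ m⊓n≤n x j)))
   (∑-cong∈ (upTo (x ∸ (x ⊓ j))) (\ b q -> high b (∈-upTo⁻ q)) & ∑-0 (upTo (x ∸ (x ⊓ j)))) & +0ʳ _)
  where
  g : ℕ -> ℤ
  g a = if a ≤ᵇ j then K a (j ∸ a) i else 0z
  low : ∀ a -> a ≤ j -> g a ≡ ∑ (hperpM (j ∸ a) r) (\ m1 -> F (m Z.+ + j) ((x ∸ a) ∷ m1) i)
  low a q = cong (\ b -> if b then K a (j ∸ a) i else 0z) (≤ᵇ-t q) &
   cong (\ k -> ∑ (hperpM (j ∸ a) r) (\ m1 -> F (m Z.+ + k) ((x ∸ a) ∷ m1) i)) (m+[n∸m]≡n q)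
  high : ∀ b -> b < x ∸ (x ⊓ j) -> g (suc (x ⊓ j) + b) ≡ 0z
  high b q with ≤-total x j
  ... | inj₁ x≤j = ⊥-elim (<⇒≱ q (subst (\ k -> x ∸ k ≤ b) (sym (m≤n⇒m⊓n≡m x≤j)) (subst (_≤ b) (sym (n∸n≡0 x)) z≤n)))
  ... | inj₂ j≤x = cong (\ c -> if c then K (suc (x ⊓ j) + b) (j ∸ (suc (x ⊓ j) + b)) i else 0z)
   (≤ᵇ-f (s≤s (eq≤ (sym (m≥n⇒m⊓n≡n j≤x)) &≤ m≤m+n _ b)))
 inner : ∀ a -> a ≤ x -> ∑ (upTo (suc D)) (\ j -> sh j (\ i -> if a ≤ᵇ j then K a (j ∸ a) i else 0z) n)
  ≡ sh a (THr (\ m' m1 -> F m' ((x ∸ a) ∷ m1)) (m Z.+ + a) r) n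
 inner a q = cong (\ k -> ∑ (upTo k) g) (cong suc (sym (m+[n∸m]≡n a≤D)) & sym (+-suc a (D ∸ a))) &
  ∑-upTo-+ a (suc (D ∸ a)) g &
  cong₂ Z._+_ (∑-cong∈ (upTo a) (\ j i -> sh-cong j n (\ i' -> cong (\ b -> if b then K a (j ∸ a) i' else 0z) (≤ᵇ-f (∈-upTo⁻ i))) & sh-0 j n) & ∑-0 (upTo a))
    (∑-cong (upTo (suc (D ∸ a))) (\ j' -> sh-cong (a + j') n (\ i' -> cong (\ b -> if b then K a (a + j' ∸ a) i' else 0z) (≤ᵇ-t (m≤m+n a j')) & cong (\ k -> K a k i') (m+n∸m≡n a j')) &
     sym (sh-sh a j' (K a j') n) & sh-cong a n (\ i -> sh-cong j' i (\ i' -> ∑-cong (hperpM j' r) (\ m1 -> cong (\ z -> F z ((x ∸ a) ∷ m1) i') (sym (ZP.+-assoc m (+ a) (+ j')))))))) &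
  +0ˡ _ & sym (sh-∑ a (upTo (suc (D ∸ a))) (\ j' -> sh j' (\ i' -> ∑ (hperpM j' r) (\ m1 -> F ((m Z.+ + a) Z.+ + j') ((x ∸ a) ∷ m1) i'))) n) &
  sh-cong a n (\ i -> TH-THr (D ∸ a) r (\ m' m1 -> F m' ((x ∸ a) ∷ m1)) (m Z.+ + a) i
    (eq≤ (sym (m+n∸m≡n a (sum r))) &≤ ∸-monoˡ-≤ a (+-monoˡ-≤ (sum r) q &≤ p)))
  where
  a≤D : a ≤ D
  a≤D = q &≤ m≤m+n x (sum r) &≤ p
  g : ℕ -> ℤ
  g j = sh j (\ i -> if a ≤ᵇ j then K a (j ∸ a) i else 0z) n

length-hperpM : ∀ j x {m1} -> m1 ∈ hperpM j x -> length m1 ≡ length x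
length-hperpM zero [] (here refl) = refl
length-hperpM j (x ∷ r) i with ∈-concatMap⁻ (\ a -> map ((x ∸ a) ∷_) (hperpM (j ∸ a) r)) (upTo (suc (x ⊓ j))) i
... | a , _ , i' with MP.∈-map⁻ ((x ∸ a) ∷_) i'
... | m' , k , refl = cong suc (length-hperpM (j ∸ a) r k)

sum-dropZeros : ∀ m -> sum (dropZeros m) ≡ sum m
sum-dropZeros [] = refl
sum-dropZeros (zero ∷ m) = sum-dropZeros m
sum-dropZeros (suc x ∷ m) = cong (\ z -> suc x + z) (sum-dropZeros m)

length-dropZeros : ∀ m -> length (dropZeros m) ≤ sum m
length-dropZeros [] = z≤n
length-dropZeros (zero ∷ m) = length-dropZeros m
length-dropZeros (suc x ∷ m) = s≤s (length-dropZeros m &≤ m≤n+m _ x)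

sum≤degS : ∀ f {p m} -> (p , m) ∈ f -> sum m ≤ degS f
sum≤degS ((p , m) ∷ f) (here refl) = m≤m⊔n (sum m) (degS f)
sum≤degS ((p , m) ∷ f) (there i) = sum≤degS f i &≤ m≤n⊔m (sum m) (degS f)

-- the adjoint of 𝓑_m on functionals
Bᵗ : ℤ -> Fun -> Fun
Bᵗ m ψ mono = RX (\ m' -> consZ m' ψ) m (toZ (dropZeros mono))

-- The truncation at the degree of f is harmless because e_i^⊥ and h_j^⊥ kill monomials of degree
-- below i or j; the rest is an exchange of sums that gathers everything into the functional.
evalS-Bop : ∀ m f ψ n -> ZI ψ -> evalS (Bop m f) ψ n ≡ evalS f (Bᵗ m ψ) n
evalS-Bop m f ψ n zi = evalS-sumS (concatMap row Ds) ψ n & ∑-concatMap row Ds (\ g -> evalS g ψ n) &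
   ∑-cong Ds (\ i -> ∑-map (cell i) Ds (\ g -> evalS g ψ n) & ∑-cong Ds (\ j -> evalCell i j)) &
 ∑-swap Ds Ds (\ i j -> sgn i Z.* sh j (W i j) n) &
 ∑-cong Ds (\ j -> ∑-cong Ds (\ i -> sym (sh-* j (sgn i) (W i j) n)) & sym (sh-∑ j Ds (\ i i' -> sgn i Z.* W i j i') n)) &
 ∑-cong Ds (\ j -> sh-cong j n (\ i' -> ∑-cong Ds (\ i -> cong (sgn i Z.*_) (evalS-cong f i' (\ mono i'' -> ∑-cong (hperpM j (dropZeros mono)) (\ m1 -> ∑-cong (eperpM i (dropZeros m1)) (\ m2 -> cong (\ z -> consZ z ψ m2 i'') (lem m (+ i) (+ j)))))) & sym (evalS-* f (sgn i) _ i')) &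
   sym (evalS-∑ f Ds (\ i mono i'' -> sgn i Z.* ∑ (hperpM j (dropZeros mono)) (\ m1 -> V i j m1 i'')) i') &
    evalS-cong f i' (\ mono i'' -> ∑-cong Ds (\ i -> sym (∑-* (sgn i) (hperpM j (dropZeros mono)) (\ m1 -> V i j m1 i''))) & ∑-swap Ds (hperpM j (dropZeros mono)) (\ i m1 -> sgn i Z.* V i j m1 i'')))) &
 ∑-cong Ds (\ j -> sym (evalS-sh f j (\ mono i' -> ∑ (hperpM j (dropZeros mono)) (\ m1 -> F (m Z.+ + j) m1 i')) n)) &
 sym (evalS-∑ f Ds (\ j mono -> sh j (\ i' -> ∑ (hperpM j (dropZeros mono)) (\ m1 -> F (m Z.+ + j) m1 i'))) n) &
 ∑-cong∈ f (\ { (p , mono) i -> act-cong p n (\ k -> final mono (sum≤degS f i) k) })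
 where
 D = degS f
 Ds = upTo (suc D)
 cell : ℕ -> ℕ -> Sym
 cell i j = scaleS (mulP (signP i) (tpow j)) (hS (m Z.+ (+ i) Z.+ (+ j)) *S eperp i (hperp j f))
 row : ℕ -> List Sym
 row i = map (cell i) Ds
 W : ℕ -> ℕ -> Seq
 W i j = evalS f (\ mono i' -> ∑ (hperpM j (dropZeros mono)) (\ m1 -> ∑ (eperpM i (dropZeros m1)) (\ m2 -> consZ (m Z.+ + i Z.+ + j) ψ m2 i')))
 V : ℕ -> ℕ -> Fun
 V i j m1 i' = ∑ (eperpM i (dropZeros m1)) (\ m2 -> consZ ((m Z.+ + j) Z.+ + i) ψ m2 i')
 F : ℤ -> Fun
 F m' = TE D (\ m'' -> consZ m'' ψ) m'
 lem : ∀ m i j -> m Z.+ i Z.+ j ≡ (m Z.+ j) Z.+ i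
 lem = solve-∀
 evalCell : ∀ i j -> evalS (cell i j) ψ n ≡ sgn i Z.* sh j (W i j) n
 evalCell i j = evalS-scaleS (mulP (signP i) (tpow j)) g ψ n & act-mulP (signP i) (tpow j) (evalS g ψ) n &
  act-signP i (act (tpow j) (evalS g ψ)) n & cong (sgn i Z.*_) (act-tpow j (evalS g ψ) n & sh-cong j n (\ k ->
   evalS-hS* z (eperp i (hperp j f)) ψ k & evalS-liftPerp (eperpM i) (hperp j f) (consZ z ψ) k &
    evalS-liftPerp (hperpM j) f (\ m1 i' -> ∑ (eperpM i (dropZeros m1)) (\ m2 -> consZ z ψ m2 i')) k))
  where z = m Z.+ (+ i) Z.+ (+ j)
        g = hS z *S eperp i (hperp j f)
 final : ∀ mono -> sum mono ≤ D -> ∀ k -> TH D F m (dropZeros mono) k ≡ Bᵗ m ψ mono k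
 final mono p k = ∑-cong Ds (\ j -> sh-cong j k (\ i' -> ∑-cong∈ (hperpM j x) (\ m1 q ->
  TE-RE D m1 (\ m'' -> consZ m'' ψ) (m Z.+ + j) i' (\ m'' -> ZI-consZ m'' zi) (eq≤ (length-hperpM j x q) &≤ length-dropZeros mono &≤ p)))) &
  TH-THr D x (\ m' m1 -> RE (\ m'' -> consZ m'' ψ) m' (toZ m1)) m k (eq≤ (sum-dropZeros mono) &≤ p) &
   THr-RE x (\ m'' -> consZ m'' ψ) m k
  where x = dropZeros mono

ext-toZ : ∀ ψ y n -> ext ψ (toZ y) n ≡ ψ (dropZeros y) n
ext-toZ ψ [] n = refl
ext-toZ ψ (zero ∷ y) n = ext-toZ ψ y n
ext-toZ ψ (suc x ∷ y) n = ext-toZ (consZ (+ suc x) ψ) y n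

nonneg? : ∀ l -> (∃[ y ] l ≡ toZ y) ⊎ (∃[ i ] (i < length l × Neg (nthZ l i)))
nonneg? [] = inj₁ ([] , refl)
nonneg? (-[1+ x ] ∷ l) = inj₂ (0 , z<s , Z.-<+)
nonneg? (+ x ∷ l) with nonneg? l
... | inj₁ (y , refl) = inj₁ (x ∷ y , refl)
... | inj₂ (i , p , q) = inj₂ (suc i , s≤s p , q)

RX-nthNeg : ∀ l i f m n -> i < length l -> Neg (nthZ l i) -> RX f m l n ≡ 0z
RX-nthNeg (+ x ∷ l) zero f m n p (Z.+<+ ())
RX-nthNeg (+ x ∷ l) (suc i) f m n (s≤s p) q = ∑-cong (upTo (suc x)) (\ a -> sh-cong a n (\ k ->
 cong₂ Z._-_ (RX-nthNeg l i _ _ k p q) (RX-nthNeg l i _ _ k p q)) & sh-0 a n) & ∑-0 (upTo (suc x))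
RX-nthNeg (-[1+ x ] ∷ l) i f m n p q = refl

RX-dropZeros : ∀ y f m n -> RX f m (toZ y) n ≡ RX f m (toZ (dropZeros y)) n
RX-dropZeros [] f m n = refl
RX-dropZeros (zero ∷ y) f m n = +0ʳ _ & cong₂ Z._-_ (cong (\ z -> RX f z (toZ y) n) (+0ʳ m))
 (RX-Neg -[1+ 0 ] f (m Z.+ + 0 Z.+ 1z) (toZ y) n Z.-<+) & +0ʳ _ & RX-dropZeros y f m n
RX-dropZeros (suc x ∷ y) f m n = ∑-cong (upTo (suc (suc x))) (\ a -> sh-cong a n (\ k -> cong₂ Z._-_ (RX-dropZeros y _ _ k) (RX-dropZeros y _ _ k)))

ext-Bᵗ : ∀ m ψ l n -> ext (Bᵗ m ψ) l n ≡ RX (\ m' -> consZ m' ψ) m l n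
ext-Bᵗ m ψ l n with nonneg? l
... | inj₁ (y , refl) = ext-toZ (Bᵗ m ψ) y n & cong (\ z -> RX (\ m' -> consZ m' ψ) m (toZ z) n) (idem y) & sym (RX-dropZeros y _ m n)
 where idem : ∀ y -> dropZeros (dropZeros y) ≡ dropZeros y
       idem [] = refl
       idem (zero ∷ y) = idem y
       idem (suc x ∷ y) = cong (suc x ∷_) (idem y)
... | inj₂ (i , p , q) = ext-Neg (Bᵗ m ψ) l i n p q & sym (RX-nthNeg l i _ m n p q)

ZI-Bᵗ : ∀ m ψ -> ZI (Bᵗ m ψ)
ZI-Bᵗ m ψ pre mono n = cong (\ z -> RX (\ m' -> consZ m' ψ) m (toZ z) n) (go pre)
 where go : ∀ pre -> dropZeros (pre ++ 0 ∷ mono) ≡ dropZeros (pre ++ mono)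
       go [] = refl
       go (zero ∷ pre) = go pre
       go (suc x ∷ pre) = cong (suc x ∷_) (go pre)

bump shift₁ : Root -> Root
bump (i , j) = i , suc j
shift₁ (i , j) = suc i , suc j

rowR : ℕ -> List Root
rowR zero = []
rowR (suc L) = (1 , 2) ∷ map bump (rowR L)

∈-rowR : ∀ L {β} -> β ∈ rowR L -> ∃[ j ] (β ≡ (1 , suc (suc j)) × j < L)
∈-rowR (suc L) (here refl) = 0 , refl , z<s
∈-rowR (suc L) (there i) with MP.∈-map⁻ bump i
... | β , k , refl with ∈-rowR L k
... | j , refl , p = suc j , refl , s≤s p

QF : (ℤ -> Fun) -> GF
QF f [] n = 0z
QF f (m ∷ l) n = RE f m l n

ins : ℤ -> List ℤ -> List ℤ
ins z [] = []
ins z (m ∷ l) = m ∷ z ∷ l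

-- Moving a units with weight t^a from one factor to the leading index is the geometric series of
-- the corresponding root in the first row.
RX-H : ∀ l f m n -> RX f m l n ≡ H (rowR (length l)) (QF f) (m ∷ l) n
RX-H [] f m n = refl
RX-H (z ∷ l) f m n = sym (Geo-∑ (1 , 2) (H (map bump R) (QF f)) (m ∷ z ∷ l) n (top z + suc n) (m≤n+m (suc n) (top z)) &
 ∑-cong (upTo (top z + suc n)) (\ a -> sh-cong a n (\ k -> cell (z Z.+ Z.- (+ a)) (m Z.+ + a) k)) &
 -- Taking more than z units out of h_z leaves a negative index, so the tail of the series vanishes.
 ∑-upTo-+ (top z) (suc n) g & cong₂ Z._+_ (low z) (∑-cong (upTo (suc n)) (\ b -> sh-cong (top z + b) n (\ k -> high z b k) & sh-0 (top z + b) n) & ∑-0 (upTo (suc n))) & +0ʳ _)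
 where
 R = rowR (length l)
 top : ℤ -> ℕ
 top (+ x) = suc x
 top -[1+ x ] = 0
 cellV : ℤ -> ℤ -> Seq
 cellV z' m' k = RX (\ m'' -> consZ z' (f m'')) m' l k Z.- RX (\ m'' -> consZ (z' Z.- 1z) (f m'')) (m' Z.+ 1z) l k
 g : ℕ -> ℤ
 g a = sh a (cellV (z Z.+ Z.- (+ a)) (m Z.+ + a)) n
 low : ∀ z -> ∑ (upTo (top z)) (\ a -> sh a (cellV (z Z.- + a) (m Z.+ + a)) n) ≡ RX f m (z ∷ l) n
 low (+ x) = refl
 low -[1+ x ] = refl
 high : ∀ z b k -> cellV (z Z.+ Z.- (+ (top z + b))) (m Z.+ + (top z + b)) k ≡ 0z
 high z b k = cong₂ Z._-_ (RX-Neg _ f _ l k (neg z)) (RX-Neg _ f _ l k (ZP.≤-<-trans (ZP.i-j≤i _ 1z) (neg z)))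
  where neg : ∀ z -> Neg (z Z.+ Z.- (+ (top z + b)))
        neg (+ x) = subst Neg (sym (ZP.m-n≡m⊖n x (suc x + b) & ZP.⊖-< (s≤s (m≤m+n x b))))
         (subst (\ k -> Neg (Z.- + k)) (sym (cong (_∸ x) (sym (+-suc x b)) & m+n∸m≡n x (suc b))) Z.-<+)
        neg -[1+ x ] = ZP.≤-<-trans (ZP.i-j≤i -[1+ x ] (+ b)) Z.-<+
 cell : ∀ z' m' k -> H (map bump R) (QF f) (m' ∷ z' ∷ l) k ≡ cellV z' m' k
 cell z' m' k = sym (H-natural (ins z') bump R (QF f) nat (m' ∷ l) k) &
  H-cong R (suc (length l)) split (m' ∷ l) refl k &
  H-lin R 1z (Z.- 1z) (QF (\ m'' -> consZ z' (f m''))) (QF (\ m'' -> consZ (z' Z.- 1z) (f m'')) ∘ addAt 0 1z) (m' ∷ l) k &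
  cong₂ (\ a b -> 1z Z.* a Z.+ (Z.- 1z) Z.* b) (sym (RX-H l _ m' k))
    (H-natural (addAt 0 1z) id R _ (\ { (i , j) _ γ -> trans (addAt-comm 0 (i ∸ 1) _ _ _) (cong (addAt (i ∸ 1) (+ 1)) (addAt-comm 0 (j ∸ 1) _ _ γ)) }) (m' ∷ l) k &
     cong (\ r -> H r (QF (\ m'' -> consZ (z' Z.- 1z) (f m''))) (m' Z.+ 1z ∷ l) k) (LP.map-id R) & sym (RX-H l _ (m' Z.+ 1z) k)) &
  lem (RX (\ m'' -> consZ z' (f m'')) m' l k) (RX (\ m'' -> consZ (z' Z.- 1z) (f m'')) (m' Z.+ 1z) l k)
  where
  lem : ∀ a b -> 1z Z.* a Z.+ (Z.- 1z) Z.* b ≡ a Z.- b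
  lem = solve-∀
  nat : ∀ β -> β ∈ R -> ∀ γ -> ins z' (mv β 1 γ) ≡ mv (bump β) 1 (ins z' γ)
  nat β i γ with ∈-rowR (length l) i
  nat β i [] | j , refl , _ = refl
  nat β i (x ∷ γ) | j , refl , _ = refl
  split : ∀ γ -> length γ ≡ suc (length l) -> ∀ n -> (QF f ∘ ins z') γ n ≡ 1z Z.* QF (\ m'' -> consZ z' (f m'')) γ n Z.+ (Z.- 1z) Z.* (QF (\ m'' -> consZ (z' Z.- 1z) (f m'')) ∘ addAt 0 1z) γ n
  split (x ∷ γ) _ n = sym (lem (RE (\ m'' -> consZ z' (f m'')) x γ n) (RE (\ m'' -> consZ (z' Z.- 1z) (f m'')) (x Z.+ 1z) γ n))

alt-congL : ∀ cs γ {F G : List ℤ -> ℤ} -> (∀ l -> length l ≡ length γ -> F l ≡ G l) -> alt cs γ F ≡ alt cs γ G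
alt-congL cs [] e = e [] refl
alt-congL cs (g ∷ γ) e = ∑±-cong cs (\ c r _ -> alt-congL r γ (\ l q -> e (g Z.+ c ∷ l) (cong suc q)))

RE-bits : ∀ f m l n -> RE f m l n ≡ ∑ (bits (length l)) (\ S -> sgn (sum S) Z.* ext (f (m Z.+ + sum S)) (subZ l S) n)
RE-bits f m [] n = sym (+0ʳ _ & ZP.*-identityˡ _ & cong (\ z -> f z [] n) (+0ʳ m))
RE-bits f m (z ∷ l) n = sym (∑-bits (length l) (\ S -> sgn (sum S) Z.* ext (f (m Z.+ + sum S)) (subZ (z ∷ l) S) n) & cong₂ Z._+_
 (∑-cong B (\ S -> cong (\ w -> sgn (sum S) Z.* ext (consZ w (f (m Z.+ + sum S))) (subZ l S) n) (+0ʳ z)) & sym (RE-bits (\ m' -> consZ z (f m')) m l n))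
 (∑-cong B (\ S -> sym (ZP.neg-distribˡ-* (sgn (sum S)) _) & cong (\ w -> Z.- (sgn (sum S) Z.* ext (consZ (z Z.- 1z) (f w)) (subZ l S) n)) (sym (ZP.+-assoc m 1z (+ sum S)))) &
  ∑-neg B _ & cong Z.-_ (sym (RE-bits (\ m' -> consZ (z Z.- 1z) (f m')) (m Z.+ 1z) l n))))
 where B = bits (length l)

alt-addAt : ∀ j a cs γ F -> alt cs (addAt j a γ) F ≡ alt cs γ (\ l -> F (addAt j a l))
alt-addAt j a cs [] F = refl
alt-addAt zero a cs (g ∷ γ) F = ∑±-cong cs (\ c r _ -> alt-cong r γ (\ l -> cong (\ z -> F (z ∷ l)) (lem g a c)))
 where lem : ∀ g a c -> (g Z.+ a) Z.+ c ≡ (g Z.+ c) Z.+ a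
       lem = solve-∀
alt-addAt (suc j) a cs (g ∷ γ) F = ∑±-cong cs (\ c r _ -> alt-addAt j a r γ (\ l -> F (g Z.+ c ∷ l)))

offs-addAt : ∀ j a s γ -> offs s (addAt j a γ) ≡ addAt j a (offs s γ)
offs-addAt j a s [] = refl
offs-addAt zero a s (g ∷ γ) = cong (_∷ offs (s Z.+ 1z) γ) (lem g a s)
 where lem : ∀ g a s -> (g Z.+ a) Z.- s ≡ (g Z.- s) Z.+ a
       lem = solve-∀
offs-addAt (suc j) a s (g ∷ γ) = cong ((g Z.- s) ∷_) (offs-addAt j a (s Z.+ 1z) γ)

sG-addAt : ∀ j a γ F -> sG (addAt j a γ) F ≡ sG γ (\ l -> F (addAt j a l))
sG-addAt j a γ F = cong₂ (\ k r -> alt (iota 0z k) r F) (length-addAt j a γ) (offs-addAt j a 0z γ) & alt-addAt j a (iota 0z (length γ)) (offs 0z γ) F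

alt-subZ-rows : ∀ S cs γ F -> alt cs (subZ γ S) F ≡ alt cs γ (\ l -> F (subZ l S))
alt-subZ-rows S cs [] F = refl
alt-subZ-rows [] cs (g ∷ γ) F = alt-cong cs (g ∷ γ) {F} {\ l -> F (subZ l [])} (\ { [] -> refl ; (x ∷ l) -> refl })
alt-subZ-rows (b ∷ S) cs (g ∷ γ) F = ∑±-cong cs (\ c r _ -> alt-subZ-rows S r γ _ & alt-cong r γ (\ l -> cong (\ z -> F (z ∷ subZ l S)) (lem g (+ b) c)))
 where lem : ∀ g b c -> (g Z.- b) Z.+ c ≡ (g Z.+ c) Z.- b
       lem = solve-∀

sG-subZ : ∀ S γ F -> sG (subZ γ S) F ≡ sG γ (\ l -> F (subZ l S))
sG-subZ S γ F = cong₂ (\ k r -> alt (iota 0z k) r F) (length-subZ γ S) (sym (offs-subZ 0z γ S)) & alt-subZ-rows S (iota 0z (length γ)) (offs 0z γ) F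

SG : GF -> GF
SG Φ [] n = 0z
SG Φ (m ∷ γ) n = sG γ (\ l -> Φ (m ∷ l) n)

-- A root of the first row shifts one row of the remaining determinant and leaves its columns alone,
-- so alternation and raising commute.
SG-H : ∀ R Φ -> (∀ {β} -> β ∈ R -> ∃[ j ] β ≡ (1 , suc (suc j))) -> ∀ m γ n -> sG γ (\ l -> H R Φ (m ∷ l) n) ≡ H R (SG Φ) (m ∷ γ) n
SG-H [] Φ P m γ n = refl
SG-H (β ∷ R) Φ P m γ n with P (here refl)
... | j , refl = go m γ n
 where
 go : ∀ m γ n -> sG γ (\ l -> Geo (1 , suc (suc j)) (H R Φ) (m ∷ l) n) ≡ Geo (1 , suc (suc j)) (H R (SG Φ)) (m ∷ γ) n
 go m γ zero = SG-H R Φ (P ∘ there) m γ zero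
 go m γ (suc n) = alt-+ (iota 0z (length γ)) (offs 0z γ) (\ l -> H R Φ (m ∷ l) (suc n)) (\ l -> Geo (1 , suc (suc j)) (H R Φ) (m Z.+ 1z ∷ addAt j (Z.- 1z) l) n) &
  cong₂ Z._+_ (SG-H R Φ (P ∘ there) m γ (suc n))
   (sym (sG-addAt j (Z.- 1z) γ (\ l -> Geo (1 , suc (suc j)) (H R Φ) (m Z.+ 1z ∷ l) n)) & go (m Z.+ 1z) (addAt j (Z.- 1z) γ) n)

-- The e^⊥ part of 𝓑_m turns s_γ into s_{mγ} by the vertex operator formula; the h^⊥ part becomes
-- the product over the roots of the new first row.
sF-Bᵗ : ∀ m ψ γ n -> sF (Bᵗ m ψ) γ n ≡ H (rowR (length γ)) (sF ψ) (m ∷ γ) n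
sF-Bᵗ m ψ γ n = alt-congL (iota 0z (length γ)) (offs 0z γ) (\ l q -> ext-Bᵗ m ψ l n & RX-H l f m n &
   cong (\ k -> H (rowR k) (QF f) (m ∷ l) n) (q & length-offs 0z γ)) &
 SG-H R (QF f) (\ i -> proj₁ (∈-rowR (length γ) i) , proj₁ (proj₂ (∈-rowR (length γ) i))) m γ n &
 H-cong R (suc (length γ)) SGQ (m ∷ γ) refl n
 where
 R = rowR (length γ)
 f : ℤ -> Fun
 f m' = consZ m' ψ
 SGQ : ∀ γ' -> length γ' ≡ suc (length γ) -> ∀ n -> SG (QF f) γ' n ≡ sF ψ γ' n
 SGQ (m' ∷ γ') _ n = sym (sG-cons m' γ' (\ l -> ext ψ l n) & ∑-cong (bits (length γ')) (\ S ->
  cong (sgn (sum S) Z.*_) (sG-subZ S γ' _) & sym (alt-* (sgn (sum S)) (iota 0z (length γ')) (offs 0z γ') _)) &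
  sym (alt-∑ (iota 0z (length γ')) (offs 0z γ') (bits (length γ')) (\ S l -> sgn (sum S) Z.* ext ψ (m' Z.+ + sum S ∷ subZ l S) n)) &
   alt-congL (iota 0z (length γ')) (offs 0z γ') (\ l q -> sym (RE-bits f m' l n &
    cong (\ k -> ∑ (bits k) (\ S -> sgn (sum S) Z.* ext ψ (m' Z.+ + sum S ∷ subZ l S) n)) (q & length-offs 0z γ'))))

-- Catalan functions under the operators 𝓑

Pos1 : Root -> Set
Pos1 (i , j) = 1 ≤ i × 1 ≤ j

-- f is the Catalan function of (Ψ, γ), tested against all functionals
record Rep (f : Sym) (Ψ : List Root) (γ : List ℤ) : Set where
 field
  pos : ∀ {β} -> β ∈ Ψ -> Pos1 β
  eval : ∀ ψ -> ZI ψ -> ∀ n -> evalS f ψ n ≡ H Ψ (sF ψ) γ n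

-- The functional is replaced by its image under the adjoint of 𝓑_m, which adds one row in front of
-- every s_γ; the old roots act on the rows below it.
Rep-Bop : ∀ m {f Ψ γ} -> Rep f Ψ γ -> Rep (Bop m f) (map shift₁ Ψ ++ rowR (length γ)) (m ∷ γ)
Rep-Bop m {f} {Ψ} {γ} rep = record { pos = P ; eval = E }
 where
 open Rep rep
 P : ∀ {β} -> β ∈ map shift₁ Ψ ++ rowR (length γ) -> Pos1 β
 P i with MP.∈-++⁻ (map shift₁ Ψ) i
 ... | inj₁ j with MP.∈-map⁻ shift₁ j
 ... | β , _ , refl = z<s , z<s
 P i | inj₂ j with ∈-rowR (length γ) j
 ... | _ , refl , _ = z<s , z<s
 nat : ∀ β -> β ∈ Ψ -> ∀ γ' -> m ∷ mv β 1 γ' ≡ mv (shift₁ β) 1 (m ∷ γ')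
 nat β i γ' with β | pos i
 ... | suc a , suc b | _ = refl
 E : ∀ ψ -> ZI ψ -> ∀ n -> evalS (Bop m f) ψ n ≡ H (map shift₁ Ψ ++ rowR (length γ)) (sF ψ) (m ∷ γ) n
 E ψ zi n = evalS-Bop m f ψ n zi & eval (Bᵗ m ψ) (ZI-Bᵗ m ψ) n &
  H-cong Ψ (length γ) (\ γ' q n' -> sF-Bᵗ m ψ γ' n' & cong (\ k -> H (rowR k) (sF ψ) (m ∷ γ') n') q) γ refl n &
  H-natural (m ∷_) shift₁ Ψ (H (rowR (length γ)) (sF ψ)) nat γ n & sym (H-++ (map shift₁ Ψ) (rowR (length γ)) (sF ψ) (m ∷ γ) n)

fullR : ℕ -> ℕ -> List Root -> List Root
fullR zero L Ψ = Ψ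
fullR (suc r) L Ψ = map shift₁ (fullR r L Ψ) ++ rowR (r + L)

Rep-Btilde : ∀ α {f Ψ γ} -> Rep f Ψ γ -> Rep (Btilde α f) (fullR (length α) (length γ) Ψ) (α ++ γ)
Rep-Btilde [] rep = rep
Rep-Btilde (a ∷ α) {f} {Ψ} {γ} rep = subst (\ k -> Rep (Bop a (Btilde α f)) (map shift₁ (fullR (length α) (length γ) Ψ) ++ rowR k) (a ∷ α ++ γ))
 (LP.length-++ α) (Rep-Bop a (Rep-Btilde α rep))

Geo-inv : ∀ β Φ γ n -> Geo β Φ γ n Z.- sh 1 (Geo β Φ (mv β 1 γ)) n ≡ Φ γ n
Geo-inv β Φ γ zero = +0ʳ _
Geo-inv β Φ γ (suc n) = lem (Φ γ (suc n)) (Geo β Φ (mv β 1 γ) n)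
 where lem : ∀ a b -> (a Z.+ b) Z.- b ≡ a
       lem = solve-∀

-- Expanding the product of 1 - tR over P cancels the geometric series of the roots in P.
∑-subsets-H : ∀ P Ψ Φ γ n ->
 ∑ (subsets P) (\ S -> sgn (length S) Z.* sh (length S) (H (P ++ Ψ) Φ (applyR S γ)) n) ≡ H Ψ Φ γ n
∑-subsets-H [] Ψ Φ γ n = +0ʳ _ & ZP.*-identityˡ _
∑-subsets-H (β ∷ P) Ψ Φ γ n = ∑-++ (subsets P) (map (β ∷_) (subsets P)) f & cong (\ z -> ∑ (subsets P) f Z.+ z) (∑-map (β ∷_) (subsets P) f) &
 sym (∑-+ (subsets P) f (\ S -> f (β ∷ S))) &
 ∑-cong (subsets P) step &
 ∑-subsets-H P Ψ Φ γ n
 where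
 X = H (P ++ Ψ) Φ
 f : List Root -> ℤ
 f S = sgn (length S) Z.* sh (length S) (Geo β X (applyR S γ)) n
 lem : ∀ s a b -> s Z.* a Z.+ (Z.- s) Z.* b ≡ s Z.* (a Z.+ (Z.- 1z) Z.* b)
 lem = solve-∀
 step : ∀ S -> f S Z.+ f (β ∷ S) ≡ sgn (length S) Z.* sh (length S) (X (applyR S γ)) n
 step S = lem (sgn a) (sh a (Geo β X δ) n) (sh (suc a) (Geo β X (mv β 1 δ)) n) & cong (sgn a Z.*_)
  (cong (\ z -> sh a (Geo β X δ) n Z.+ z) (cong ((Z.- 1z) Z.*_) (cong (\ k -> sh k (Geo β X (mv β 1 δ)) n) (+-comm 1 a) & sym (sh-sh a 1 (Geo β X (mv β 1 δ)) n)) & sym (sh-* a (Z.- 1z) (sh 1 (Geo β X (mv β 1 δ))) n)) &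
   sym (sh-+ a (Geo β X δ) (\ k -> (Z.- 1z) Z.* sh 1 (Geo β X (mv β 1 δ)) k) n) &
    sh-cong a n (\ k -> cong (\ z -> Geo β X δ k Z.+ z) (ZP.-1*i≡-i _) & Geo-inv β X δ k))
  where a = length S
        δ = applyR S γ

applyR-++ : ∀ S α γ -> (∀ {β} -> β ∈ S -> PosRoot (length α) β) -> applyR S α ++ γ ≡ applyR S (α ++ γ)
applyR-++ [] α γ P = refl
applyR-++ ((i , j) ∷ S) α γ P = addAt-++ (i ∸ 1) (+ 1) (addAt (j ∸ 1) (Z.- (+ 1)) δ) γ (lt₁ (P (here refl))) &
 cong (addAt (i ∸ 1) (+ 1)) (addAt-++ (j ∸ 1) (Z.- (+ 1)) δ γ (lt₂ (P (here refl))) & cong (addAt (j ∸ 1) (Z.- (+ 1))) (applyR-++ S α γ (P ∘ there)))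
 where
 δ = applyR S α
 addAt-++ : ∀ i a α γ -> i < length α -> addAt i a α ++ γ ≡ addAt i a (α ++ γ)
 addAt-++ zero a (x ∷ α) γ p = refl
 addAt-++ (suc i) a (x ∷ α) γ (s≤s p) = cong (x ∷_) (addAt-++ i a α γ p)
 len : ∀ S -> length (applyR S α) ≡ length α
 len [] = refl
 len ((i , j) ∷ S) = length-mv (i , j) 1 (applyR S α) & len S
 lt₂ : PosRoot (length α) (i , j) -> j ∸ 1 < length δ
 lt₂ (a , b , c) = subst (j ∸ 1 <_) (sym (len S)) (pred< j b c)
  where pred< : ∀ j -> i < j -> j ≤ length α -> j ∸ 1 < length α
        pred< (suc j) _ c = c
 lt₁ : PosRoot (length α) (i , j) -> i ∸ 1 < length (addAt (j ∸ 1) (Z.- (+ 1)) δ)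
 lt₁ (a , b , c) = subst (i ∸ 1 <_) (sym (length-addAt (j ∸ 1) (Z.- (+ 1)) δ & len S)) (s≤s (m∸n≤m i 1) &≤ b &≤ c)

-- the roots of the Catalan function 𝓑_μ 𝔰^(k)_ν
fullRoot : ℕ -> ℕ -> List ℕ -> ℕ -> ℕ -> Bool
fullRoot k r ν i j = if i ≤ᵇ r then r <ᵇ j else kRoot k ν (i ∸ r) (j ∸ r)

∈-fullR⁻ : ∀ r L Ψ {i j} -> (i , j) ∈ fullR r L Ψ -> (1 ≤ i × i ≤ r × i < j × j ≤ r + L) ⊎ (r ≤ i × r ≤ j × (i ∸ r , j ∸ r) ∈ Ψ)
∈-fullR⁻ zero L Ψ m = inj₂ (z≤n , z≤n , m)
∈-fullR⁻ (suc r) L Ψ m with MP.∈-++⁻ (map shift₁ (fullR r L Ψ)) m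
... | inj₁ m' with MP.∈-map⁻ shift₁ m'
... | (i , j) , m'' , refl with ∈-fullR⁻ r L Ψ m''
... | inj₁ (a , b , c , d) = inj₁ (z<s , s≤s b , s≤s c , s≤s d)
... | inj₂ (a , b , c) = inj₂ (s≤s a , s≤s b , c)
∈-fullR⁻ (suc r) L Ψ m | inj₂ m' with ∈-rowR (r + L) m'
... | j , refl , p = inj₁ (z<s , z<s , s≤s z<s , s≤s p)

∈-rowR⁺ : ∀ L j -> j < L -> (1 , suc (suc j)) ∈ rowR L
∈-rowR⁺ (suc L) zero p = here refl
∈-rowR⁺ (suc L) (suc j) (s≤s p) = there (MP.∈-map⁺ bump (∈-rowR⁺ L j p))

∈-fullR⁺₁ : ∀ r L Ψ i j -> i ≤ r -> 1 ≤ i -> i < j -> j ≤ r + L -> (i , j) ∈ fullR r L Ψ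
∈-fullR⁺₁ (suc r) L Ψ (suc zero) (suc (suc j)) p _ _ (s≤s d) = MP.∈-++⁺ʳ (map shift₁ (fullR r L Ψ)) (∈-rowR⁺ (r + L) j d)
∈-fullR⁺₁ (suc r) L Ψ (suc zero) (suc zero) p _ (s≤s ()) _
∈-fullR⁺₁ (suc r) L Ψ (suc (suc i)) (suc j) (s≤s p) _ (s≤s c) (s≤s d) = MP.∈-++⁺ˡ (MP.∈-map⁺ shift₁ (∈-fullR⁺₁ r L Ψ (suc i) j p z<s c d))

∈-fullR⁺₂ : ∀ r L Ψ i j -> (i , j) ∈ Ψ -> (r + i , r + j) ∈ fullR r L Ψ
∈-fullR⁺₂ zero L Ψ i j m = m
∈-fullR⁺₂ (suc r) L Ψ i j m = MP.∈-++⁺ˡ (MP.∈-map⁺ shift₁ (∈-fullR⁺₂ r L Ψ i j m))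

Unique-fullR : ∀ r L Ψ -> (∀ {β} -> β ∈ Ψ -> Pos1 β) -> Unique Ψ -> Unique (fullR r L Ψ)
Unique-fullR zero L Ψ P u = u
Unique-fullR (suc r) L Ψ P u = UP.++⁺ (UP.map⁺ (\ { {a , b} {.a , .b} refl -> refl }) (Unique-fullR r L Ψ P u)) (uR (r + L)) disj
 where
 uR : ∀ L -> Unique (rowR L)
 uR zero = AllPairs.[]
 uR (suc L) = All.tabulate ne AllPairs.∷ UP.map⁺ (\ { {a , b} {.a , .b} refl -> refl }) (uR L)
  where ne : ∀ {β} -> β ∈ map bump (rowR L) -> (1 , 2) ≢ β
        ne m refl with MP.∈-map⁻ bump m
        ... | (_ , 1) , k , refl with ∈-rowR L k
        ... | _ , () , _
 pos : ∀ {j} -> (zero , j) ∈ fullR r L Ψ -> ⊥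
 pos m with ∈-fullR⁻ r L Ψ m
 ... | inj₁ (() , _)
 ... | inj₂ (z≤n , _ , m') with P m'
 ... | () , _
 disj : ∀ {β} -> ¬ (β ∈ map shift₁ (fullR r L Ψ) × β ∈ rowR (r + L))
 disj (m , m') with MP.∈-map⁻ shift₁ m | ∈-rowR (r + L) m'
 ... | (zero , _) , k , refl | _ , refl , _ = pos k

-- The operators 𝓑̃ create every root in the first r rows; those with both indices at most r are
-- exactly the factors that the passage from 𝓑̃ to 𝓑 removes.
fullR-split : ∀ k r ν -> fullR r (length ν) (kRoots k ν) ↭ posPairs r ++ roots (fullRoot k r ν) (r + length ν)
fullR-split k r ν = unique-↭ (Unique-fullR r L Ψ (\ m -> pos (kRoots-pos k ν m)) (Unique-roots (kRoot k ν) L))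
 (UP.++⁺ (Unique-roots _<ᵇ_ r) (Unique-roots (fullRoot k r ν) (r + L)) disj) to from
 where
 L = length ν
 Ψ = kRoots k ν
 pos : ∀ {β} -> PosRoot L β -> Pos1 β
 pos (a , b , c) = a , ≤-trans a (<⇒≤ b)
 ≤ᵇ-true : ∀ {i} -> i ≤ r -> (i ≤ᵇ r) ≡ true
 ≤ᵇ-true {i} q with i ≤ᵇ r | ≤⇒≤ᵇ q
 ... | true | _ = refl
 ≤ᵇ-false : ∀ {i} -> r < i -> (i ≤ᵇ r) ≡ false
 ≤ᵇ-false {i} q with i ≤ᵇ r in e
 ... | false = refl
 ... | true = ⊥-elim (<⇒≱ q (≤ᵇ⇒≤ i r (subst T (sym e) tt)))
 disj : ∀ {β} -> ¬ (β ∈ posPairs r × β ∈ roots (fullRoot k r ν) (r + L))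
 disj {i , j} (m , m') with ∈-roots⁻ _<ᵇ_ r m | ∈-roots⁻ (fullRoot k r ν) (r + L) m'
 ... | a , b , c , d , e | a' , b' , c' , d' , e' rewrite ≤ᵇ-true b = <⇒≱ (<ᵇ-true⁻ e') d
 to : ∀ {β} -> β ∈ fullR r L Ψ -> β ∈ posPairs r ++ roots (fullRoot k r ν) (r + L)
 to {i , j} m with ∈-fullR⁻ r L Ψ m
 ... | inj₁ (a , b , c , d) with j ≤? r
 ... | yes q = MP.∈-++⁺ˡ (∈-roots⁺ _<ᵇ_ r a b (a &≤ <⇒≤ c) q (<ᵇ-true⁺ c))
 ... | no ¬q = MP.∈-++⁺ʳ (posPairs r) (∈-roots⁺ (fullRoot k r ν) (r + L) a (b &≤ m≤m+n r L) (a &≤ <⇒≤ c) d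
  (cong (\ z -> if z then r <ᵇ j else kRoot k ν (i ∸ r) (j ∸ r)) (≤ᵇ-true b) & <ᵇ-true⁺ (≰⇒> ¬q)))
 to {i , j} m | inj₂ (a , b , c) with ∈-roots⁻ (kRoot k ν) L c
 ... | p , q , u , v , e = MP.∈-++⁺ʳ (posPairs r) (∈-roots⁺ (fullRoot k r ν) (r + L) (z<s &≤ r<i) (up i a q) (z<s &≤ low j b u) (up j b v)
  (cong (\ z -> if z then r <ᵇ j else kRoot k ν (i ∸ r) (j ∸ r)) (≤ᵇ-false r<i) & e))
  where
  low : ∀ i -> r ≤ i -> 1 ≤ i ∸ r -> r < i
  low i a p = eq≤ (+-comm 1 r) &≤ +-monoʳ-≤ r p &≤ eq≤ (m+[n∸m]≡n a)
  r<i : r < i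
  r<i = low i a p
  up : ∀ i -> r ≤ i -> i ∸ r ≤ L -> i ≤ r + L
  up i a q = eq≤ (sym (m+[n∸m]≡n a)) &≤ +-monoʳ-≤ r q
 from : ∀ {β} -> β ∈ posPairs r ++ roots (fullRoot k r ν) (r + L) -> β ∈ fullR r L Ψ
 from {i , j} m with MP.∈-++⁻ (posPairs r) m
 ... | inj₁ m' with ∈-roots⁻ _<ᵇ_ r m'
 ... | a , b , c , d , e = ∈-fullR⁺₁ r L Ψ i j b a (<ᵇ-true⁻ e) (d &≤ m≤m+n r L)
 from {i , j} m | inj₂ m' with ∈-roots⁻ (fullRoot k r ν) (r + L) m'
 ... | a , b , c , d , e with i ≤ᵇ r in eq
 ... | true = ∈-fullR⁺₁ r L Ψ i j (≤ᵇ⇒≤ i r (subst T (sym eq) tt)) a (≤-<-trans (≤ᵇ⇒≤ i r (subst T (sym eq) tt)) (<ᵇ-true⁻ e)) d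
 ... | false = subst₂ (\ x y -> (x , y) ∈ fullR r L Ψ) (m+[n∸m]≡n r≤i) (m+[n∸m]≡n r≤j)
  (∈-fullR⁺₂ r L Ψ (i ∸ r) (j ∸ r) (∈-roots⁺ (kRoot k ν) L (m<n⇒0<n∸m r<i) (dn i b) (z<s &≤ <ᵇ-true⁻ (∧-trueˡ e)) (dn j d) e))
  where
  r<i : r < i
  r<i with i ≤? r
  ... | no ¬q = ≰⇒> ¬q
  ... | yes q with trans (sym (≤ᵇ-true q)) eq
  ... | ()
  r≤i = <⇒≤ r<i
  r≤j : r ≤ j
  r≤j with r ≤? j
  ... | yes q = q
  ... | no ¬q with subst (\ z -> i ∸ r < z) (m≤n⇒m∸n≡0 (<⇒≤ (≰⇒> ¬q))) (<ᵇ-true⁻ (∧-trueˡ e))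
  ... | ()
  dn : ∀ i -> i ≤ r + L -> i ∸ r ≤ L
  dn i p = ∸-monoˡ-≤ r p &≤ eq≤ (m+n∸m≡n r L)

evalS-Bcal : ∀ k μ ν ψ n -> ZI ψ ->
 evalS (Bcal (toZ μ) (kSchur k ν)) ψ n ≡ H (roots (fullRoot k (length μ) ν) (length μ + length ν)) (sF ψ) (toZ μ ++ toZ ν) n
evalS-Bcal k μ ν ψ n zi = evalS-sumS (map term Ss) ψ n & ∑-map term Ss (\ g -> evalS g ψ n) &
 ∑-cong∈ Ss step &
 ∑-subsets-H (posPairs (length α)) Ψ' (sF ψ) (α ++ γ) n
 where
 α = toZ μ
 γ = toZ ν
 f = kSchur k ν
 r = length μ
 L = length ν
 Ψ' = roots (fullRoot k r ν) (r + L)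
 Ss = subsets (posPairs (length α))
 term : List Root -> Sym
 term S = scaleS (mulP (signP (length S)) (tpow (length S))) (Btilde (applyR S α) f)
 lα : length α ≡ r
 lα = LP.length-map _ μ
 rep : Rep f (kRoots k ν) γ
 rep = record { pos = \ m -> pos1 (kRoots-pos k ν m) ; eval = \ ψ _ n -> evalS-kSchur k ν ψ n }
  where pos1 : ∀ {β} -> PosRoot L β -> Pos1 β
        pos1 (a , b , c) = a , ≤-trans a (<⇒≤ b)
 subsets-⊆ : ∀ {A : Set} (P : List A) {S x} -> S ∈ subsets P -> x ∈ S -> x ∈ P
 subsets-⊆ [] (here refl) ()
 subsets-⊆ (y ∷ P) m i with MP.∈-++⁻ (subsets P) m
 ... | inj₁ m' = there (subsets-⊆ P m' i)
 ... | inj₂ m' with MP.∈-map⁻ (y ∷_) m'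
 subsets-⊆ (y ∷ P) m (here q) | inj₂ m' | S , k , refl = here q
 subsets-⊆ (y ∷ P) m (there i) | inj₂ m' | S , k , refl = there (subsets-⊆ P k i)
 posP : ∀ {β} -> β ∈ posPairs (length α) -> PosRoot (length α) β
 posP {i , j} m with ∈-roots⁻ _<ᵇ_ (length α) m
 ... | a , b , c , d , e = a , <ᵇ-true⁻ e , d
 lenR : ∀ S -> length (applyR S α) ≡ length α
 lenR [] = refl
 lenR ((i , j) ∷ S) = length-mv (i , j) 1 (applyR S α) & lenR S
 perm : fullR (length α) (length γ) (kRoots k ν) ↭ posPairs (length α) ++ Ψ'
 perm = (subst₂ (\ a b -> fullR a b (kRoots k ν) ↭ posPairs a ++ roots (fullRoot k r ν) (r + L)) (sym lα) (sym (LP.length-map _ ν)) (fullR-split k r ν))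
 step : ∀ S -> S ∈ Ss -> evalS (term S) ψ n ≡ sgn (length S) Z.* sh (length S) (H (posPairs (length α) ++ Ψ') (sF ψ) (applyR S (α ++ γ))) n
 step S m = evalS-scaleS (mulP (signP a) (tpow a)) g ψ n & act-mulP (signP a) (tpow a) (evalS g ψ) n &
  act-signP a (act (tpow a) (evalS g ψ)) n & cong (sgn a Z.*_) (act-tpow a (evalS g ψ) n & sh-cong a n (\ i ->
   Rep.eval (Rep-Btilde (applyR S α) rep) ψ zi i &
   cong₂ (\ z w -> H (fullR z (length γ) (kRoots k ν)) (sF ψ) w i) (lenR S) (applyR-++ S α γ (\ i -> posP (subsets-⊆ (posPairs (length α)) m i))) &
    H-↭ (sF ψ) perm (applyR S (α ++ γ)) i))
  where a = length S
        g = Btilde (applyR S α) f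

-- Antisymmetry and the mirror lemma

Anti : ℕ -> GF -> ℕ -> Set
Anti ℓ Φ i = ∀ γ -> length γ ≡ ℓ -> ∀ n -> Φ (dotAt i γ) n ≡ Z.- Φ γ n

tr : ℕ -> ℕ -> ℕ
tr zero zero = 1
tr zero (suc zero) = 0
tr zero (suc (suc b)) = suc (suc b)
tr (suc i) zero = zero
tr (suc i) (suc b) = suc (tr i b)

tr-invol : ∀ i b -> tr i (tr i b) ≡ b
tr-invol zero zero = refl
tr-invol zero (suc zero) = refl
tr-invol zero (suc (suc b)) = refl
tr-invol (suc i) zero = refl
tr-invol (suc i) (suc b) = cong suc (tr-invol i b)

tr-l : ∀ i -> tr i i ≡ suc i
tr-l zero = refl
tr-l (suc i) = cong suc (tr-l i)

tr-r : ∀ i -> tr i (suc i) ≡ i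
tr-r i = cong (tr i) (sym (tr-l i)) & tr-invol i i

tr-o : ∀ i b -> b ≢ i -> b ≢ suc i -> tr i b ≡ b
tr-o zero zero p q = ⊥-elim (p refl)
tr-o zero (suc zero) p q = ⊥-elim (q refl)
tr-o zero (suc (suc b)) p q = refl
tr-o (suc i) zero p q = refl
tr-o (suc i) (suc b) p q = cong suc (tr-o i b (p ∘ cong suc) (q ∘ cong suc))

tr-cases : ∀ i b -> (b ≡ i) ⊎ ((b ≡ suc i) ⊎ (tr i b ≡ b))
tr-cases i b with b ≟ i | b ≟ suc i
... | yes p | _ = inj₁ p
... | no _ | yes q = inj₂ (inj₁ q)
... | no p | no q = inj₂ (inj₂ (tr-o i b p q))

dotAt-addAt : ∀ i p a γ -> suc i < length γ -> dotAt i (addAt p a γ) ≡ addAt (tr i p) a (dotAt i γ)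
dotAt-addAt zero p a (x ∷ []) (s≤s ())
dotAt-addAt zero zero a (x ∷ y ∷ γ) _ = cong (\ z -> y Z.- 1z ∷ z ∷ γ) (lem x a)
 where lem : ∀ x a -> (x Z.+ a) Z.+ 1z ≡ (x Z.+ 1z) Z.+ a
       lem = solve-∀
dotAt-addAt zero (suc zero) a (x ∷ y ∷ γ) _ = cong (\ z -> z ∷ x Z.+ 1z ∷ γ) (lem y a)
 where lem : ∀ x a -> (x Z.+ a) Z.- 1z ≡ (x Z.- 1z) Z.+ a
       lem = solve-∀
dotAt-addAt zero (suc (suc p)) a (x ∷ y ∷ γ) _ = refl
dotAt-addAt (suc i) zero a (x ∷ γ) _ = refl
dotAt-addAt (suc i) (suc p) a (x ∷ γ) (s≤s q) = cong (x ∷_) (dotAt-addAt i p a γ q)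

trR : ℕ -> Root -> Root
trR i (a , b) = tr (suc i) a , tr (suc i) b

H-neg : ∀ Ψ (Φ : GF) γ n -> H Ψ (\ γ n -> Z.- Φ γ n) γ n ≡ Z.- H Ψ Φ γ n
H-neg Ψ Φ γ n = H-cong Ψ (length γ) (\ γ' _ m -> lem (Φ γ' m)) γ refl n & H-lin Ψ (Z.- 1z) 0z Φ Φ γ n & sym (lem _)
 where lem : ∀ a -> Z.- a ≡ (Z.- 1z) Z.* a Z.+ 0z Z.* a
       lem = solve-∀

-- The reflection carries the raising operator of a root to that of the reflected root, and the set
-- of roots is preserved.
H-Anti : ∀ ℓ Ψ Φ i -> suc i < ℓ -> Anti ℓ Φ i -> Unique Ψ -> (∀ {β} -> β ∈ Ψ -> Pos1 β) -> (∀ {β} -> β ∈ Ψ -> trR i β ∈ Ψ) -> Anti ℓ (H Ψ Φ) i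
H-Anti ℓ Ψ Φ i p an u pos cl γ refl n = H-↭ Φ perm (dotAt i γ) n &
 sym (nat Ψ pos γ p n) &
 H-cong Ψ ℓ an γ refl n &
 H-neg Ψ Φ γ n
 where
 inv : ∀ β -> trR i (trR i β) ≡ β
 inv (a , b) = cong₂ _,_ (tr-invol (suc i) a) (tr-invol (suc i) b)
 perm : Ψ ↭ map (trR i) Ψ
 perm = unique-↭ u (UP.map⁺ (\ {x} {y} e -> sym (inv x) & cong (trR i) e & inv y) u)
  (\ {x} m -> subst (_∈ map (trR i) Ψ) (inv x) (MP.∈-map⁺ (trR i) (cl m)))
  (\ m -> case m (MP.∈-map⁻ (trR i) m))
  where case : ∀ {x} -> x ∈ map (trR i) Ψ -> (∃[ y ] (y ∈ Ψ × x ≡ trR i y)) -> x ∈ Ψ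
        case m (y , k , refl) = cl k
 mvE : ∀ β -> Pos1 β -> ∀ γ -> suc i < length γ -> dotAt i (mv β 1 γ) ≡ mv (trR i β) 1 (dotAt i γ)
 mvE (suc a , suc b) _ γ q = dotAt-addAt i a (+ 1) (addAt b (Z.- (+ 1)) γ) (subst (suc i <_) (sym (length-addAt b _ γ)) q) &
  cong (addAt (tr i a) (+ 1)) (dotAt-addAt i b (Z.- (+ 1)) γ q)
 nat : ∀ Ψ -> (∀ {β} -> β ∈ Ψ -> Pos1 β) -> ∀ γ -> suc i < length γ -> ∀ n -> H Ψ (Φ ∘ dotAt i) γ n ≡ H (map (trR i) Ψ) Φ (dotAt i γ) n
 nat [] P γ q n = refl
 nat (β ∷ Ψ) P γ q n = go γ q n
  where go : ∀ γ -> suc i < length γ -> ∀ n -> Geo β (H Ψ (Φ ∘ dotAt i)) γ n ≡ Geo (trR i β) (H (map (trR i) Ψ) Φ) (dotAt i γ) n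
        go γ q zero = nat Ψ (P ∘ there) γ q 0
        go γ q (suc n) = cong₂ Z._+_ (nat Ψ (P ∘ there) γ q (suc n))
         (go (mv β 1 γ) (subst (suc i <_) (sym (length-mv β 1 γ)) q) n & cong (\ z -> Geo (trR i β) (H (map (trR i) Ψ) Φ) z n) (mvE β (P (here refl)) γ q))

self-neg : ∀ x -> x ≡ Z.- x -> x ≡ 0z
self-neg (+ zero) e = refl
self-neg (+ suc x) ()
self-neg -[1+ x ] ()

dotAt-fix : ∀ i γ -> suc i < length γ -> nthZ γ (suc i) ≡ nthZ γ i Z.+ 1z -> dotAt i γ ≡ γ
dotAt-fix zero (x ∷ []) (s≤s ()) e
dotAt-fix zero (x ∷ y ∷ γ) _ refl = cong (\ z -> z ∷ x Z.+ 1z ∷ γ) (lem x)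
 where lem : ∀ x -> (x Z.+ 1z) Z.- 1z ≡ x
       lem = solve-∀
dotAt-fix (suc i) (x ∷ γ) (s≤s p) e = cong (x ∷_) (dotAt-fix i γ p e)

Anti-zero : ∀ ℓ Φ i γ n -> suc i < ℓ -> length γ ≡ ℓ -> Anti ℓ Φ i -> nthZ γ (suc i) ≡ nthZ γ i Z.+ 1z -> Φ γ n ≡ 0z
Anti-zero ℓ Φ i γ n p refl an e = self-neg _ (cong (\ z -> Φ z n) (sym (dotAt-fix i γ p e)) & an γ refl n)

-- RS st: row i (from 0) has its roots in the columns j with st i ≤ j (from 0).
rs : (ℕ -> ℕ) -> ℕ -> ℕ -> Bool
rs st a b = st (a ∸ 1) <ᵇ b

RS : (ℕ -> ℕ) -> ℕ -> List Root
RS st ℓ = roots (rs st) ℓ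

RS-pos : ∀ st ℓ {β} -> β ∈ RS st ℓ -> Pos1 β
RS-pos st ℓ {i , j} m with ∈-roots⁻ (rs st) ℓ m
... | a , _ , b , _ = a , b

upd : ℕ -> ℕ -> (ℕ -> ℕ) -> ℕ -> ℕ
upd x v st i with i ≟ x
... | yes _ = v
... | no _ = st i

upd-≡ : ∀ x v st -> upd x v st x ≡ v
upd-≡ x v st with x ≟ x
... | yes _ = refl
... | no p = ⊥-elim (p refl)

upd-≢ : ∀ x v st i -> i ≢ x -> upd x v st i ≡ st i
upd-≢ x v st i p with i ≟ x
... | yes q = ⊥-elim (p q)
... | no _ = refl

RS-upd : ∀ st st' ℓ x z -> x < ℓ -> z < ℓ -> st x ≡ suc z -> st' x ≡ z -> (∀ i -> i ≢ x -> st' i ≡ st i) ->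
 RS st' ℓ ↭ (suc x , suc z) ∷ RS st ℓ
RS-upd st st' ℓ x z p q e e' o = unique-↭ (Unique-roots _ ℓ) (All.tabulate ne AllPairs.∷ Unique-roots _ ℓ) to from
 where
 ne : ∀ {β} -> β ∈ RS st ℓ -> (suc x , suc z) ≢ β
 ne m refl with ∈-roots⁻ (rs st) ℓ m
 ... | _ , _ , _ , _ , t = <-irrefl refl (subst (_< suc z) e (<ᵇ-true⁻ t))
 to : ∀ {β} -> β ∈ RS st' ℓ -> β ∈ (suc x , suc z) ∷ RS st ℓ
 to {i' , j} m with ∈-roots⁻ (rs st') ℓ m
 to {suc i , j} m | a , b , c , d , t with i ≟ x
 ... | no ¬q = there (∈-roots⁺ (rs st) ℓ a b c d (cong (_<ᵇ j) (sym (o i ¬q)) & t))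
 ... | yes refl with m≤n⇒m<n∨m≡n (subst (_< j) e' (<ᵇ-true⁻ t))
 ... | inj₂ refl = here refl
 ... | inj₁ lt = there (∈-roots⁺ (rs st) ℓ a b c d (<ᵇ-true⁺ (subst (_< j) (sym e) lt)))
 from : ∀ {β} -> β ∈ (suc x , suc z) ∷ RS st ℓ -> β ∈ RS st' ℓ
 from (here refl) = ∈-roots⁺ (rs st') ℓ z<s p z<s q (<ᵇ-true⁺ (subst (_< suc z) (sym e') (n<1+n z)))
 from {i' , j} (there m) with ∈-roots⁻ (rs st) ℓ m
 from {suc i , j} (there m) | a , b , c , d , t = ∈-roots⁺ (rs st') ℓ a b c d (<ᵇ-true⁺ lt)
  where lt : st' i < j
        lt with i ≟ x
        ... | no ¬q = subst (_< j) (sym (o i ¬q)) (<ᵇ-true⁻ t)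
        ... | yes refl = subst (_< j) (sym e') (<-trans (n<1+n z) (subst (_< j) e (<ᵇ-true⁻ t)))

RS-ext : ∀ st st' ℓ -> (∀ i j -> i < ℓ -> j < ℓ -> st i ≤ j -> st' i ≤ j) -> (∀ i j -> i < ℓ -> j < ℓ -> st' i ≤ j -> st i ≤ j) -> RS st ℓ ↭ RS st' ℓ
RS-ext st st' ℓ f g = unique-↭ (Unique-roots _ ℓ) (Unique-roots _ ℓ) (go st st' f) (go st' st g)
 where go : ∀ st st' -> (∀ i j -> i < ℓ -> j < ℓ -> st i ≤ j -> st' i ≤ j) -> ∀ {β} -> β ∈ RS st ℓ -> β ∈ RS st' ℓ
       go st st' f {i' , j'} m with ∈-roots⁻ (rs st) ℓ m
       go st st' f {suc i , suc j} m | a , b , c , d , t = ∈-roots⁺ (rs st') ℓ a b c d (<ᵇ-true⁺ (s≤s (f i j b d (≤-pred (<ᵇ-true⁻ t)))))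

-- Rows z and z+1 have the same roots, and columns z and z+1 too because no row starts in column
-- z+1; so the transposition permutes the ideal.
RS-Anti : ∀ ℓ st z Φ -> suc z < ℓ -> Anti ℓ Φ z -> st z ≡ st (suc z) -> (∀ i -> st i ≢ suc z) -> Anti ℓ (H (RS st ℓ) Φ) z
RS-Anti ℓ st z Φ p an e c = H-Anti ℓ (RS st ℓ) Φ z p an (Unique-roots _ ℓ) (RS-pos st ℓ) cl
 where
 rowE : ∀ a -> st (tr (suc z) (suc a) ∸ 1) ≡ st a
 rowE a with tr-cases z a
 ... | inj₁ refl = cong st (tr-l z) & sym e
 ... | inj₂ (inj₁ refl) = cong st (tr-r z) & e
 ... | inj₂ (inj₂ q) = cong st q
 colE : ∀ s b -> s ≢ suc z -> s < suc b -> s < suc (tr z b)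
 colE s b q lt with tr-cases z b
 ... | inj₁ refl = subst (\ w -> s < suc w) (sym (tr-l z)) (m<n⇒m<1+n lt)
 ... | inj₂ (inj₁ refl) = subst (\ w -> s < suc w) (sym (tr-r z)) (≤∧≢⇒< (≤-pred lt) q)
 ... | inj₂ (inj₂ q') = subst (\ w -> s < suc w) (sym q') lt
 bd : ∀ b -> suc b ≤ ℓ -> suc (tr z b) ≤ ℓ
 bd b q with tr-cases z b
 ... | inj₁ refl = subst (\ w -> suc w ≤ ℓ) (sym (tr-l z)) p
 ... | inj₂ (inj₁ refl) = subst (\ w -> suc w ≤ ℓ) (sym (tr-r z)) (<⇒≤ q)
 ... | inj₂ (inj₂ q') = subst (\ w -> suc w ≤ ℓ) (sym q') q
 cl : ∀ {β} -> β ∈ RS st ℓ -> trR z β ∈ RS st ℓ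
 cl {suc a , suc b} m with ∈-roots⁻ (rs st) ℓ m
 ... | _ , b' , _ , d' , t = ∈-roots⁺ (rs st) ℓ z<s (bd a b') z<s (bd b d')
  (<ᵇ-true⁺ (subst (_< suc (tr z b)) (sym (rowE a)) (colE (st a) b (c a) (<ᵇ-true⁻ t))))
 cl {zero , _} m with ∈-roots⁻ (rs st) ℓ m
 ... | () , _
 cl {suc a , zero} m with ∈-roots⁻ (rs st) ℓ m
 ... | _ , _ , () , _

-- A chain x₀ -> x₁ -> … -> z of rows with st x_i = x_{i+1} and st (x_i + 1) = x_{i+1} + 1
data Chain (ℓ : ℕ) (Φ : GF) (st : ℕ -> ℕ) : ℕ -> List ℕ -> List ℤ -> Set where
 top : ∀ {z γ} -> Anti ℓ Φ z -> (∀ i -> st i ≢ suc z) -> Chain ℓ Φ st z [] γ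
 link : ∀ {z x c γ} -> Anti ℓ Φ z -> st x ≡ z -> st (suc x) ≡ suc z -> (∀ i -> i ≢ suc x -> st i ≢ suc z) ->
  suc x < z -> nthZ γ (suc x) ≡ nthZ γ x -> Chain ℓ Φ st x c γ -> Chain ℓ Φ st z (x ∷ c) γ

nthZ-addAt-≡ : ∀ i a γ -> i < length γ -> nthZ (addAt i a γ) i ≡ nthZ γ i Z.+ a
nthZ-addAt-≡ zero a (x ∷ γ) _ = refl
nthZ-addAt-≡ (suc i) a (x ∷ γ) (s≤s p) = nthZ-addAt-≡ i a γ p

nthZ-addAt-≢ : ∀ i j a γ -> i ≢ j -> nthZ (addAt j a γ) i ≡ nthZ γ i
nthZ-addAt-≢ i j a [] p = refl
nthZ-addAt-≢ zero zero a (x ∷ γ) p = ⊥-elim (p refl)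
nthZ-addAt-≢ zero (suc j) a (x ∷ γ) p = refl
nthZ-addAt-≢ (suc i) zero a (x ∷ γ) p = refl
nthZ-addAt-≢ (suc i) (suc j) a (x ∷ γ) p = nthZ-addAt-≢ i j a γ (p ∘ cong suc)

H-unroll : ∀ Ψ Ψ' β Φ γ n -> Ψ' ↭ β ∷ Ψ -> H Ψ Φ γ n ≡ H Ψ' Φ γ n Z.- sh 1 (H Ψ' Φ (mv β 1 γ)) n
H-unroll Ψ Ψ' β Φ γ n p = sym (cong₂ Z._-_ (H-↭ Φ p γ n) (sh-cong 1 n (H-↭ Φ p (mv β 1 γ))) & Geo-inv β (H Ψ Φ) γ n)

-- Adding the roots (x_i + 1, x_{i+1}) makes the ideal symmetric at every row of the chain; expanding
-- Π (1 - t R) over the added roots leaves only weights fixed by one of the reflections.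
mirror : ∀ ℓ Φ st z c γ n -> Chain ℓ Φ st z c γ -> suc z < ℓ -> length γ ≡ ℓ -> st z ≡ st (suc z) ->
 nthZ γ (suc z) ≡ nthZ γ z Z.+ 1z -> H (RS st ℓ) Φ γ n ≡ 0z
mirror ℓ Φ st z [] γ n (top an c) p q e d = Anti-zero ℓ _ z γ n p q (RS-Anti ℓ st z Φ p an e c) d
mirror ℓ Φ st z (x ∷ c) γ n (link an sx sx' ne lt eq ch) p q e d =
 H-unroll (RS st ℓ) (RS st' ℓ) β Φ γ n (RS-upd st st' ℓ (suc x) z x<ℓ z<ℓ sx' (upd-≡ (suc x) z st) (upd-≢ (suc x) z st)) &
  -- With the root added the ideal is symmetric at z and the weight is fixed there, so the first
  -- term vanishes. In the second the root is spent on the weight, which creates the same situation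
  -- at x, with a shorter chain.
  cong₂ Z._-_ (Anti-zero ℓ _ z γ n p q (RS-Anti ℓ st' z Φ p an e' ne') d)
   (sh-cong 1 n (\ m -> mirror ℓ Φ st' x c γ' m (conv ch) x<ℓ (length-mv β 1 γ & q) wall d') & sh-0 1 n)
 where
 z<ℓ = <-trans (n<1+n z) p
 x<ℓ = <-trans lt z<ℓ
 β : Root
 β = suc (suc x) , suc z
 st' = upd (suc x) z st
 δ = addAt z (Z.- (+ 1)) γ
 γ' = mv β 1 γ
 e' : st' z ≡ st' (suc z)
 e' = upd-≢ (suc x) z st z (>⇒≢ lt) & e & sym (upd-≢ (suc x) z st (suc z) (>⇒≢ (m<n⇒m<1+n lt)))
 ne' : ∀ i -> st' i ≢ suc z
 ne' i w with i ≟ suc x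
 ... | yes _ = m≢1+n+m z {0} w
 ... | no ¬q = ne i ¬q w
 wall : st' x ≡ st' (suc x)
 wall = upd-≢ (suc x) z st x (\ w -> m≢1+n+m x {0} w) & sx & sym (upd-≡ (suc x) z st)
 at : ∀ y -> y ≢ suc x -> y ≢ z -> nthZ γ' y ≡ nthZ γ y
 at y a b = nthZ-addAt-≢ y (suc x) (+ 1) δ a & nthZ-addAt-≢ y z (Z.- (+ 1)) γ b
 d' : nthZ γ' (suc x) ≡ nthZ γ' x Z.+ 1z
 d' = nthZ-addAt-≡ (suc x) (+ 1) δ (subst (suc x <_) (sym (length-addAt z (Z.- (+ 1)) γ & q)) x<ℓ) &
  cong (Z._+ 1z) (nthZ-addAt-≢ (suc x) z (Z.- (+ 1)) γ (<⇒≢ lt) & eq & sym (at x (\ w -> m≢1+n+m x {0} w) (<⇒≢ (<-trans (n<1+n x) lt))))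
 conv' : ∀ {y c'} -> y ≤ x -> Chain ℓ Φ st y c' γ -> Chain ℓ Φ st' y c' γ'
 conv' {y} le (top an c) = top an c''
  where c'' : ∀ i -> st' i ≢ suc y
        c'' i w with i ≟ suc x
        ... | yes _ = <⇒≢ (≤-<-trans (s≤s le) lt) (sym w)
        ... | no _ = c i w
 conv' {y} le (link {x = x'} an a b c l g ch) = link an
  (upd-≢ _ _ st x' (<⇒≢ (<-trans (n<1+n x') lx)) & a) (upd-≢ _ _ st (suc x') (<⇒≢ lx) & b) c'' l
  (at (suc x') (<⇒≢ lx) (<⇒≢ (<-trans lx lt)) & g & sym (at x' (<⇒≢ (<-trans (n<1+n x') lx)) (<⇒≢ (<-trans (<-trans (n<1+n x') lx) lt))))
  (conv' ((n≤1+n x' &≤ <⇒≤ l) &≤ le) ch)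
  where
  lx : suc x' < suc x
  lx = <-≤-trans l (le &≤ n≤1+n x)
  c'' : ∀ i -> i ≢ suc x' -> st' i ≢ suc y
  c'' i v w with i ≟ suc x
  ... | yes _ = <⇒≢ (≤-<-trans (s≤s le) lt) (sym w)
  ... | no _ = c i v w
 conv = conv' {x} {c} ≤-refl

-- One box removal on k-Schur Catalan functions

-- The column of the first root in row z of Δ^k(μ), rows and columns counted from 0.
dn : ℕ -> List ℕ -> ℕ -> ℕ
dn k μ z = z + suc (k ∸ nthN μ z)

decAt : ℕ -> List ℕ -> List ℕ
decAt _ [] = []
decAt zero (x ∷ μ) = (x ∸ 1) ∷ μ
decAt (suc i) (x ∷ μ) = x ∷ decAt i μ

Sk : ℕ -> GF -> List ℕ -> Seq
Sk k Φ μ = H (kRoots k μ) Φ (toZ μ)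

Rm : (List ℕ -> Seq) -> List ℕ -> ℕ -> Seq
Rm f μ z n = if nthN μ (suc z) <ᵇ nthN μ z then f (decAt z μ) n else 0z

-- Σ_j t^j f(μ - ε_{z_j}) over the removable rows z_j of the path z, dn z, dn (dn z), …
PS : ℕ -> (List ℕ -> Seq) -> List ℕ -> ℕ -> Seq
PS k f μ z zero = Rm f μ z zero
PS k f μ z (suc n) = Rm f μ z (suc n) Z.+ (if dn k μ z <ᵇ length μ then PS k f μ (dn k μ z) n else 0z)

length-decAt : ∀ i μ -> length (decAt i μ) ≡ length μ
length-decAt i [] = refl
length-decAt zero (x ∷ μ) = refl
length-decAt (suc i) (x ∷ μ) = cong suc (length-decAt i μ)

nthN-decAt-≡ : ∀ i μ -> nthN (decAt i μ) i ≡ nthN μ i ∸ 1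
nthN-decAt-≡ i [] = refl
nthN-decAt-≡ zero (x ∷ μ) = refl
nthN-decAt-≡ (suc i) (x ∷ μ) = nthN-decAt-≡ i μ

nthN-decAt-≢ : ∀ i j μ -> i ≢ j -> nthN (decAt j μ) i ≡ nthN μ i
nthN-decAt-≢ i j [] p = refl
nthN-decAt-≢ zero zero (x ∷ μ) p = ⊥-elim (p refl)
nthN-decAt-≢ zero (suc j) (x ∷ μ) p = refl
nthN-decAt-≢ (suc i) zero (x ∷ μ) p = refl
nthN-decAt-≢ (suc i) (suc j) (x ∷ μ) p = nthN-decAt-≢ i j μ (p ∘ cong suc)

nthZ-toZ : ∀ μ i -> nthZ (toZ μ) i ≡ + nthN μ i
nthZ-toZ [] i = refl
nthZ-toZ (x ∷ μ) zero = refl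
nthZ-toZ (x ∷ μ) (suc i) = nthZ-toZ μ i

toZ-decAt : ∀ z μ -> 0 < nthN μ z -> toZ (decAt z μ) ≡ addAt z (Z.- 1z) (toZ μ)
toZ-decAt zero (suc x ∷ μ) p = refl
toZ-decAt (suc z) (x ∷ μ) p = cong (+ x ∷_) (toZ-decAt z μ p)

nthN-beyond : ∀ μ i -> length μ ≤ i -> nthN μ i ≡ 0
nthN-beyond [] i p = refl
nthN-beyond (x ∷ μ) (suc i) (s≤s p) = nthN-beyond μ i p

-- Stands in for antisymmetry at the last row: lowering an empty last row gives a negative entry.
LastNeg : ℕ -> GF -> Set
LastNeg ℓ Φ = ∀ γ -> length γ ≡ suc ℓ -> nthZ γ ℓ Z.< 0z -> ∀ n -> Φ γ n ≡ 0z

-- No root raises the last entry, so a negative one stays negative.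
H-LastNeg : ∀ ℓ Ψ Φ -> (∀ {i j} -> (i , j) ∈ Ψ -> 1 ≤ i × i ≤ ℓ) -> LastNeg ℓ Φ -> LastNeg ℓ (H Ψ Φ)
H-LastNeg ℓ [] Φ P ln = ln
H-LastNeg ℓ ((suc i , j) ∷ Ψ) Φ P ln = go
 where
 go : LastNeg ℓ (Geo (suc i , j) (H Ψ Φ))
 go γ q lt zero = H-LastNeg ℓ Ψ Φ (P ∘ there) ln γ q lt zero
 go γ q lt (suc n) = cong₂ Z._+_ (H-LastNeg ℓ Ψ Φ (P ∘ there) ln γ q lt (suc n))
  (go (mv (suc i , j) 1 γ) (length-mv (suc i , j) 1 γ & q) (subst (Z._< 0z) (sym (nthZ-addAt-≢ ℓ i (+ 1) (addAt (j ∸ 1) (Z.- 1z) γ) (>⇒≢ (proj₂ (P (here refl)))))) low) n)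
  where low : nthZ (addAt (j ∸ 1) (Z.- 1z) γ) ℓ Z.< 0z
        low with ℓ ≟ j ∸ 1
        ... | no ¬p = subst (Z._< 0z) (sym (nthZ-addAt-≢ ℓ (j ∸ 1) (Z.- 1z) γ ¬p)) lt
        ... | yes p = subst (\ z -> nthZ (addAt z (Z.- 1z) γ) ℓ Z.< 0z) p (subst (Z._< 0z) (sym (nthZ-addAt-≡ ℓ (Z.- 1z) γ (subst (ℓ <_) (sym q) (n<1+n ℓ)))) (ZP.≤-<-trans (ZP.i-j≤i _ 1z) lt))
H-LastNeg ℓ ((zero , j) ∷ Ψ) Φ P ln with P (here refl)
... | () , _

record Par (k ℓ : ℕ) (μ : List ℕ) : Set where
 field
  len : length μ ≡ ℓ
  mono : ∀ i -> nthN μ (suc i) ≤ nthN μ i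
  bound : ∀ i -> nthN μ i ≤ k

kRoots↭ : ∀ k μ -> RS (dn k μ) (length μ) ↭ kRoots k μ
kRoots↭ k μ = unique-↭ (Unique-roots (rs (dn k μ)) (length μ)) (Unique-roots (kRoot k μ) (length μ)) to from
 where
 L = length μ
 to : ∀ {β} -> β ∈ RS (dn k μ) L -> β ∈ kRoots k μ
 to {i' , j} m with ∈-roots⁻ (rs (dn k μ)) L m
 to {suc i , j} m | a , b , c , d , t = ∈-roots⁺ (kRoot k μ) L a b c d (∧-true (<ᵇ-true⁺ (≤-<-trans (eq≤ (+-comm 1 i) &≤ +-monoʳ-≤ i z<s) lt))
  (<ᵇ-true⁺ (subst (_< j) (+-suc i _ & cong suc (+-comm i _) & sym (+-suc _ i)) lt)))
  where lt : i + suc (k ∸ nthN μ i) < j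
        lt = <ᵇ-true⁻ t
 from : ∀ {β} -> β ∈ kRoots k μ -> β ∈ RS (dn k μ) L
 from {i' , j} m with ∈-roots⁻ (kRoot k μ) L m
 from {suc i , j} m | a , b , c , d , t = ∈-roots⁺ (rs (dn k μ)) L a b c d
  (<ᵇ-true⁺ (subst (_< j) (sym (+-suc i _ & cong suc (+-comm i _) & sym (+-suc _ i))) (<ᵇ-true⁻ (∧-trueʳ t))))

-- Computes H(Δ^k(μ); μ-ε_z) along the path of z. The hypothesis `flat` makes row x with μ_x =
-- μ_{x+1} have its first root beyond column x+1, so that the links of a chain do not overlap.
module OneStep (k ℓ' : ℕ) (μ : List ℕ) (par : Par k (suc ℓ') μ) (flat : ∀ i -> nthN μ (suc i) ≡ nthN μ i -> nthN μ i < k)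
 (Φ : GF) (ln : LastNeg ℓ' Φ) where
 open Par par
 ℓ = suc ℓ'
 st = dn k μ

 st> : ∀ z -> z < st z
 st> z = eq≤ (+-comm 1 z) &≤ +-monoʳ-≤ z z<s

 st-suc : ∀ z -> suc (st z) ≤ st (suc z)
 st-suc z = s≤s (+-monoʳ-≤ z (s≤s (∸-monoʳ-≤ k (mono z))))

 st-mono : ∀ {i j} -> i < j -> st i < st j
 st-mono {i} {suc j} (s≤s p) with m≤n⇒m<n∨m≡n p
 ... | inj₂ refl = st-suc i
 ... | inj₁ q = <-trans (st-mono q) (st-suc j)

 st-inj : ∀ {i j} -> st i ≡ st j -> i ≡ j
 st-inj {i} {j} e with <-cmp i j
 ... | tri< a _ _ = ⊥-elim (<⇒≢ (st-mono a) e)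
 ... | tri≈ _ b _ = b
 ... | tri> _ _ c = ⊥-elim (>⇒≢ (st-mono c) e)

 -- The part of the path behind the current row that runs through rows that are not removable; it
 -- becomes the chain of the mirror argument. It starts at a row z with no row of roots beginning in
 -- column z+1.
 data Hist : ℕ -> List ℕ -> Set where
  top : ∀ {z} -> (∀ i -> st i ≢ suc z) -> Hist z []
  link : ∀ {x c} -> nthN μ (suc x) ≡ nthN μ x -> Anti ℓ Φ x -> Hist x c -> Hist (st x) (x ∷ c)

 Cond : ℕ -> Set
 Cond z = nthN μ (suc z) ≡ nthN μ z -> suc z < ℓ -> Anti ℓ Φ z × ∃ (Hist z)

 γ : ℕ -> List ℤ
 γ z = addAt z (Z.- 1z) (toZ μ)

 lenγ : ∀ z -> length (γ z) ≡ ℓ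
 lenγ z = length-addAt z (Z.- 1z) (toZ μ) & LP.length-map _ μ & len

 module At (z : ℕ) (z<ℓ : z < ℓ) where
  -- The root in row z and column `st z` is deleted. What is left is the ideal of μ-ε_z if row z is
  -- removable.
  st' = upd z (suc (st z)) st

  H' : GF
  H' = H (RS st' ℓ) Φ

  nγ : ∀ i -> i ≢ z -> nthZ (γ z) i ≡ + nthN μ i
  nγ i p = nthZ-addAt-≢ i z (Z.- 1z) (toZ μ) p & nthZ-toZ μ i

  chain : ∀ y c -> y ≤ z -> Anti ℓ Φ y -> Hist y c -> Chain ℓ Φ st' y c (γ z)
  ne' : ∀ y -> y ≤ z -> ∀ i -> st i ≢ suc y -> st' i ≢ suc y
  ne' y le i p w with i ≟ z
  ... | yes _ = <⇒≢ (s≤s (≤-<-trans le (st> z))) (sym w)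
  ... | no _ = p w
  chain y .[] le an (top c) = top an (\ i -> ne' y le i (c i))
  chain .(st x) (x ∷ c) le an (link fl an' h) = link an (upd-≢ z _ st x (<⇒≢ x<z) & refl) (upd-≢ z _ st (suc x) (<⇒≢ (<-≤-trans lt le)) & stx)
   (\ i p -> ne' (st x) le i (\ w -> p (st-inj (w & sym stx)))) lt
   (nγ (suc x) (<⇒≢ (<-≤-trans lt le)) & cong +_ fl & sym (nγ x (<⇒≢ x<z))) (chain x c (<⇒≤ x<z) an' h)
   where
   lt : suc x < st x
   lt = subst (_≤ st x) (+-comm x 2) (+-monoʳ-≤ x (s≤s (m<n⇒0<n∸m (flat x fl))))
   x<z = <-≤-trans (st> x) le
   stx : st (suc x) ≡ suc (st x)
   stx = cong (\ w -> suc (x + suc (k ∸ w))) fl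

  -- Without the deleted root, rows z and z+1 start in the same column and the entries differ by
  -- one, so the mirror argument applies. In the last row the lowered entry is -1 instead.
  rigid : Cond z -> nthN μ (suc z) ≡ nthN μ z -> ∀ n -> H' (γ z) n ≡ 0z
  rigid cond e n with m≤n⇒m<n∨m≡n z<ℓ
  ... | inj₁ lt = mirror ℓ Φ st' z (proj₁ (proj₂ (cond e lt))) (γ z) n (chain z _ ≤-refl (proj₁ (cond e lt)) (proj₂ (proj₂ (cond e lt)))) lt (lenγ z)
   (upd-≡ z _ st & sym (cong (\ w -> suc (z + suc (k ∸ w))) e) & sym (upd-≢ z _ st (suc z) (\ w -> m≢1+n+m z {0} (sym w))))
   (nγ (suc z) (\ w -> m≢1+n+m z {0} (sym w)) & cong +_ e & lem (+ nthN μ z) & cong (Z._+ 1z)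
    (sym (nthZ-addAt-≡ z (Z.- 1z) (toZ μ) (subst (z <_) (sym (LP.length-map _ μ & len)) z<ℓ) & cong (Z._+ (Z.- 1z)) (nthZ-toZ μ z))))
   where lem : ∀ a -> a ≡ (a Z.+ (Z.- 1z)) Z.+ 1z
         lem = solve-∀
  ... | inj₂ refl = H-LastNeg ℓ' (RS st' ℓ) Φ P ln (γ z) (lenγ z)
   (subst (Z._< 0z) (sym (nthZ-addAt-≡ z (Z.- 1z) (toZ μ) (subst (z <_) (sym (LP.length-map _ μ & len)) z<ℓ) & cong (Z._+ (Z.- 1z)) (nthZ-toZ μ z &
    cong +_ (sym e & nthN-beyond μ (suc z) (eq≤ len))))) Z.-<+) n
   where P : ∀ {i j} -> (i , j) ∈ RS st' ℓ -> 1 ≤ i × i ≤ ℓ'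
         P {i'} m with ∈-roots⁻ (rs st') ℓ m
         P {suc i} m | a , b , c , d , t with i ≟ ℓ'
         ... | no ¬p = a , ≤∧≢⇒< (≤-pred b) ¬p
         ... | yes refl = ⊥-elim (<⇒≱ (<ᵇ-true⁻ t) (d &≤ st> ℓ' &≤ n≤1+n _))

  removable : nthN μ (suc z) < nthN μ z -> ∀ n -> H' (γ z) n ≡ Sk k Φ (decAt z μ) n
  removable lt n = H-↭ Φ (Perm.trans (RS-ext st' (dn k ν) ℓ (\ i j _ _ -> subst (_≤ j) (same i)) (\ i j _ _ -> subst (_≤ j) (sym (same i))))
   (subst (\ L -> RS (dn k ν) L ↭ kRoots k ν) (length-decAt z μ & len) (kRoots↭ k ν))) (γ z) n &
   cong (\ g -> H (kRoots k ν) Φ g n) (sym (toZ-decAt z μ (z<s &≤ lt)))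
   where
   ν = decAt z μ
   same : ∀ i -> st' i ≡ dn k ν i
   same i with i ≟ z
   ... | no ¬p = cong (\ w -> i + suc (k ∸ w)) (sym (nthN-decAt-≢ i z μ ¬p))
   ... | yes refl = sym (+-suc z _) & cong (\ w -> z + suc w) (k∸ (nthN μ z) (bound z) (z<s &≤ lt) & cong (k ∸_) (sym (nthN-decAt-≡ z μ)))
    where k∸ : ∀ x -> x ≤ k -> 1 ≤ x -> suc (k ∸ x) ≡ k ∸ (x ∸ 1)
          k∸ (suc x) p _ = sym (+-∸-assoc 1 p)

  H'≡Rm : Cond z -> ∀ n -> H' (γ z) n ≡ Rm (Sk k Φ) μ z n
  H'≡Rm cond n with nthN μ (suc z) <ᵇ nthN μ z in e
  ... | true = removable (<ᵇ-true⁻ e) n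
  ... | false = rigid cond (≤-antisym (mono z) (<ᵇ-false⁻ e)) n

  unroll-0 : H (RS st ℓ) Φ (γ z) 0 ≡ H' (γ z) 0
  -- The root (z, `st z`) is expanded once: it turns μ-ε_z into μ-ε_{st z} at the cost of one factor
  -- t, which is the next step of the path.
  unroll : ∀ n -> H (RS st ℓ) Φ (γ z) (suc n) ≡ H' (γ z) (suc n) Z.+ (if st z <ᵇ ℓ then H (RS st ℓ) Φ (γ (st z)) n else 0z)
  β : Root
  β = suc z , suc (st z)
  perm : st z < ℓ -> RS st ℓ ↭ β ∷ RS st' ℓ
  perm p = RS-upd st' st ℓ z (st z) z<ℓ p (upd-≡ z _ st) refl (\ i q -> sym (upd-≢ z _ st i q))
  out : ℓ ≤ st z -> RS st ℓ ↭ RS st' ℓ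
  out p = RS-ext st st' ℓ f g
   where
   f : ∀ i j -> i < ℓ -> j < ℓ -> st i ≤ j -> st' i ≤ j
   f i j a b le with i ≟ z
   ... | no _ = le
   ... | yes refl = ⊥-elim (<⇒≱ b (p &≤ le))
   g : ∀ i j -> i < ℓ -> j < ℓ -> st' i ≤ j -> st i ≤ j
   g i j a b le with i ≟ z
   ... | no _ = le
   ... | yes refl = n≤1+n _ &≤ le
  unroll-0 with st z <? ℓ
  ... | yes p = H-↭ Φ (perm p) (γ z) 0
  ... | no ¬p = H-↭ Φ (out (≮⇒≥ ¬p)) (γ z) 0
  unroll n with st z <? ℓ
  ... | no ¬p = H-↭ Φ (out (≮⇒≥ ¬p)) (γ z) (suc n) & sym (+0ʳ _) & cong (\ b -> H' (γ z) (suc n) Z.+ (if b then H (RS st ℓ) Φ (γ (st z)) n else 0z)) (sym (<ᵇ-false⁺ (≮⇒≥ ¬p)))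
  ... | yes p = H-↭ Φ (perm p) (γ z) (suc n) & cong (\ w -> H' (γ z) (suc n) Z.+ w)
   (sym (H-↭ Φ (perm p) (mv β 1 (γ z)) n) & cong (\ g -> H (RS st ℓ) Φ g n) mvγ & cong (\ b -> if b then H (RS st ℓ) Φ (γ (st z)) n else 0z) (sym (<ᵇ-true⁺ p)))
   where mvγ : mv β 1 (γ z) ≡ γ (st z)
         mvγ = cong (addAt z (+ 1)) (addAt-comm (st z) z (Z.- 1z) (Z.- 1z) (toZ μ)) & addAt-+ z (+ 1) (Z.- 1z) (γ (st z)) & addAt-0 z (γ (st z))

 -- After a row that is not removable the chain grows by one link. After a removable row the starts
 -- of rows z and z+1 differ by at least 2, so column `st z` + 1 is no start and a new chain begins.
 next : ∀ z -> Cond z -> (suc (st z) < ℓ -> Anti ℓ Φ (st z)) -> (suc z < ℓ) ⊎ (ℓ ≤ st z) -> Cond (st z)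
 next z cond an (inj₂ p) _ lt = ⊥-elim (<⇒≱ lt (p &≤ n≤1+n _))
 next z cond an (inj₁ p) _ lt with nthN μ (suc z) ≟ nthN μ z
 ... | yes e = an lt , z ∷ _ , link e (proj₁ (cond e p)) (proj₂ (proj₂ (cond e p)))
 ... | no ¬e = an lt , [] , top none
  where none : ∀ i -> st i ≢ suc (st z)
        none i w with ≤-total i z
        ... | inj₁ le = <⇒≢ (s≤s (le' le)) w
         where le' : i ≤ z -> st i ≤ st z
               le' le with m≤n⇒m<n∨m≡n le
               ... | inj₁ l = <⇒≤ (st-mono l)
               ... | inj₂ refl = ≤-refl
        ... | inj₂ le with m≤n⇒m<n∨m≡n le
        ... | inj₂ refl = m≢1+n+m (st z) {0} w
        ... | inj₁ l with m≤n⇒m<n∨m≡n l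
        ... | inj₂ refl = <⇒≢ big (sym w)
         where big : suc (st z) < st (suc z)
               big = s≤s (+-monoʳ-< z (s≤s (∸-monoʳ-< (≤∧≢⇒< (mono z) ¬e) (bound z))))
        ... | inj₁ l' = <⇒≢ (≤-<-trans (st-suc z) (st-mono l')) (sym w)

 oneStep : (∀ i -> st 0 ≤ i -> suc i < ℓ -> Anti ℓ Φ i) -> ∀ n z -> z < ℓ -> Cond z -> H (kRoots k μ) Φ (γ z) n ≡ PS k (Sk k Φ) μ z n
 oneStep an n z p c = sym (H-↭ Φ (subst (\ L -> RS st L ↭ kRoots k μ) len (kRoots↭ k μ)) (γ z) n) & go n z p c
  where
  st0≤ : ∀ z -> st 0 ≤ st z
  st0≤ zero = ≤-refl
  st0≤ (suc z) = st0≤ z &≤ <⇒≤ (st-suc z)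
  go : ∀ n z -> z < ℓ -> Cond z -> H (RS st ℓ) Φ (γ z) n ≡ PS k (Sk k Φ) μ z n
  go zero z p c = At.unroll-0 z p & At.H'≡Rm z p c 0
  go (suc n) z p c = At.unroll z p n & cong₂ Z._+_ (At.H'≡Rm z p c (suc n)) (cong (\ L -> if st z <ᵇ L then H (RS st ℓ) Φ (γ (st z)) n else 0z) (sym len) & tail)
   where
   tail : (if st z <ᵇ length μ then H (RS st ℓ) Φ (γ (st z)) n else 0z) ≡ (if st z <ᵇ length μ then PS k (Sk k Φ) μ (st z) n else 0z)
   tail with st z <ᵇ length μ in e
   ... | false = refl
   ... | true = go n (st z) lt (next z c (an (st z) (st0≤ z)) (side (m≤n⇒m<n∨m≡n p)))
    where
    lt : st z < ℓ
    lt = subst (st z <_) len (<ᵇ-true⁻ e)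
    side : suc z < ℓ ⊎ suc z ≡ ℓ -> suc z < ℓ ⊎ ℓ ≤ st z
    side (inj₁ q) = inj₁ q
    side (inj₂ q) = inj₂ (subst (_≤ st z) q (st> z))

-- Coefficients of h-monomials

countN-++ : ∀ x a b -> countN x (a ++ b) ≡ countN x a + countN x b
countN-++ x [] b = refl
countN-++ x (y ∷ a) b with x ≡ᵇ y
... | true = cong suc (countN-++ x a b)
... | false = countN-++ x a b

≡ᵇ-refl : ∀ x -> (x ≡ᵇ x) ≡ true
≡ᵇ-refl zero = refl
≡ᵇ-refl (suc x) = ≡ᵇ-refl x

≡ᵇ-true : ∀ {x y} -> (x ≡ᵇ y) ≡ true -> x ≡ y
≡ᵇ-true {x} {y} e = ≡ᵇ⇒≡ x y (subst T (sym e) tt)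

bool-ext : ∀ {a b} -> (a ≡ true -> b ≡ true) -> (b ≡ true -> a ≡ true) -> a ≡ b
bool-ext {true} {true} f g = refl
bool-ext {true} {false} f g = sym (f refl)
bool-ext {false} {true} f g = g refl
bool-ext {false} {false} f g = refl

SameCount : List ℕ -> List ℕ -> Set
SameCount a b = ∀ x -> countN (suc x) a ≡ countN (suc x) b

sameMono⁺ : ∀ a b -> SameCount a b -> sameMono a b ≡ true
sameMono⁺ a b s = go (a ++ b)
 where
 one : ∀ x -> (x ≡ᵇ 0) ∨ (countN x a ≡ᵇ countN x b) ≡ true
 one zero = refl
 one (suc x) = cong (_≡ᵇ countN (suc x) b) (s x) & ≡ᵇ-refl (countN (suc x) b)
 go : ∀ l -> all (\ x -> (x ≡ᵇ 0) ∨ (countN x a ≡ᵇ countN x b)) l ≡ true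
 go [] = refl
 go (x ∷ l) = ∧-true (one x) (go l)

sameMono⁻ : ∀ a b -> sameMono a b ≡ true -> SameCount a b
sameMono⁻ a b e x with countN (suc x) (a ++ b) in c
... | suc _ = go (a ++ b) e (subst (0 <_) (sym c) z<s)
 where
 go : ∀ l -> all (\ x -> (x ≡ᵇ 0) ∨ (countN x a ≡ᵇ countN x b)) l ≡ true -> 0 < countN (suc x) l -> countN (suc x) a ≡ countN (suc x) b
 go (y ∷ l) e p with suc x ≡ᵇ y in q
 ... | false = go l (∧-trueʳ {(y ≡ᵇ 0) ∨ (countN y a ≡ᵇ countN y b)} e) p
 ... | true with ≡ᵇ-true {suc x} {y} q
 ... | refl = ≡ᵇ-true (∧-trueˡ e)
... | zero = m+n≡0⇒m≡0 _ z' & sym (m+n≡0⇒n≡0 (countN (suc x) a) z')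
 where z' = sym (countN-++ (suc x) a b) & c

sameMono-cong : ∀ a b a' b' -> (SameCount a b -> SameCount a' b') -> (SameCount a' b' -> SameCount a b) -> sameMono a b ≡ sameMono a' b'
sameMono-cong a b a' b' f g = bool-ext (\ e -> sameMono⁺ a' b' (f (sameMono⁻ a b e))) (\ e -> sameMono⁺ a b (g (sameMono⁻ a' b' e)))

countN-swap : ∀ x pre (a b : ℕ) m -> countN x (pre ++ a ∷ b ∷ m) ≡ countN x (pre ++ b ∷ a ∷ m)
countN-swap x pre a b m = countN-++ x pre _ & cong (\ z -> countN x pre + z) (go (x ≡ᵇ a) (x ≡ᵇ b)) & sym (countN-++ x pre _)
 where go : ∀ p q -> (if p then suc (if q then suc (countN x m) else countN x m) else (if q then suc (countN x m) else countN x m))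
        ≡ (if q then suc (if p then suc (countN x m) else countN x m) else (if p then suc (countN x m) else countN x m))
       go true true = refl
       go true false = refl
       go false true = refl
       go false false = refl

coeffFun-cong : ∀ m m' mono mono' -> sameMono m mono ≡ sameMono m' mono' -> ∀ n -> coeffFun mono m n ≡ coeffFun mono' m' n
coeffFun-cong m m' mono mono' e zero = cong (\ b -> if b then 1z else 0z) e
coeffFun-cong m m' mono mono' e (suc n) = refl

Symm-coeff : ∀ mono -> Symm (coeffFun mono)
Symm-coeff mono pre a b m = coeffFun-cong (pre ++ a ∷ b ∷ m) (pre ++ b ∷ a ∷ m) mono mono (sameMono-cong (pre ++ a ∷ b ∷ m) mono (pre ++ b ∷ a ∷ m) mono
 (\ s x -> countN-swap (suc x) pre b a m & s x) (\ s x -> countN-swap (suc x) pre a b m & s x))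

ZI-coeff : ∀ mono -> ZI (coeffFun mono)
ZI-coeff mono pre m = coeffFun-cong (pre ++ 0 ∷ m) (pre ++ m) mono mono (sameMono-cong (pre ++ 0 ∷ m) mono (pre ++ m) mono (\ s x -> sym (eq x) & s x) (\ s x -> eq x & s x))
 where eq : ∀ x -> countN (suc x) (pre ++ 0 ∷ m) ≡ countN (suc x) (pre ++ m)
       eq x = countN-++ (suc x) pre (0 ∷ m) & sym (countN-++ (suc x) pre m)

Decr : List ℕ -> Set
Decr [] = ⊤
Decr (x ∷ μ) = All (_≤ x) μ × Decr μ

countN-0 : ∀ {x} μ y -> All (_≤ x) μ -> x < y -> countN y μ ≡ 0
countN-0 [] y _ _ = refl
countN-0 (z ∷ μ) y (p ∷ ps) q with y ≡ᵇ z in e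
... | false = countN-0 μ y ps q
... | true = ⊥-elim (<⇒≱ q (subst (_≤ _) (sym (≡ᵇ-true {y} {z} e)) p))

-- A factor larger than the largest part of the monomial cannot occur in it, whatever the other
-- factors are.
coeff-big : ∀ λ' x -> Decr (x ∷ λ') -> ∀ l -> 0 < length l -> + x Z.< nthZ l 0 -> ext (coeffFun (x ∷ λ')) l 0 ≡ 0z
coeff-big λ' x (ps , _) (+ suc y ∷ l) _ (Z.+<+ lt) with nonneg? l
... | inj₂ (i , p , q) = ext-Neg (coeffFun (x ∷ λ')) (+ suc y ∷ l) (suc i) 0 (s≤s p) q
... | inj₁ (m , refl) = ext-toZ (coeffFun (x ∷ λ')) (suc y ∷ m) 0 & cong (\ b -> if b then 1z else 0z) (neq (sameMono⁻ (suc y ∷ dropZeros m) (x ∷ λ')))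
 where
 neq : ∀ {b} -> (b ≡ true -> SameCount (suc y ∷ dropZeros m) (x ∷ λ')) -> b ≡ false
 neq {false} f = refl
 neq {true} f with trans (f refl y) (countN-0 (x ∷ λ') (suc y) (≤-refl ∷ ps) lt)
 ... | e rewrite ≡ᵇ-refl y with e
 ... | ()

coeff-cancel : ∀ x λ' l -> ext (coeffFun (x ∷ λ')) (+ x ∷ l) 0 ≡ ext (coeffFun λ') l 0
coeff-cancel x λ' l = ext-cong l (\ m i -> go x m i) 0
 where
 go : ∀ x m i -> consZ (+ x) (coeffFun (x ∷ λ')) m i ≡ coeffFun λ' m i
 go zero m i = coeffFun-cong m m (0 ∷ λ') λ' (sameMono-cong m (0 ∷ λ') m λ' (\ s -> s) (\ s -> s)) i
 go (suc y) m i = coeffFun-cong (suc y ∷ m) m (suc y ∷ λ') λ' (sameMono-cong (suc y ∷ m) (suc y ∷ λ') m λ' f g) i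
  where
  f : SameCount (suc y ∷ m) (suc y ∷ λ') -> SameCount m λ'
  f s x with suc x ≡ᵇ suc y | s x
  ... | true | e = suc-injective e
  ... | false | e = e
  g : SameCount m λ' -> SameCount (suc y ∷ m) (suc y ∷ λ')
  g s x with suc x ≡ᵇ suc y
  ... | true = cong suc (s x)
  ... | false = s x

data _<ₗ_ : List ℕ -> List ℕ -> Set where
 here : ∀ {x y a b} -> x < y -> (x ∷ a) <ₗ (y ∷ b)
 there : ∀ {x a b} -> a <ₗ b -> (x ∷ a) <ₗ (x ∷ b)

lex-cmp : ∀ a b -> length a ≡ length b -> (a <ₗ b) ⊎ ((a ≡ b) ⊎ (b <ₗ a))
lex-cmp [] [] q = inj₂ (inj₁ refl)
lex-cmp (x ∷ a) (y ∷ b) q with <-cmp x y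
... | tri< p _ _ = inj₁ (here p)
... | tri> _ _ p = inj₂ (inj₂ (here p))
... | tri≈ _ refl _ with lex-cmp a b (suc-injective q)
... | inj₁ p = inj₁ (there p)
... | inj₂ (inj₁ refl) = inj₂ (inj₁ refl)
... | inj₂ (inj₂ p) = inj₂ (inj₂ (there p))

lex-trans : ∀ {a b c} -> a <ₗ b -> b <ₗ c -> a <ₗ c
lex-trans (here p) (here q) = here (<-trans p q)
lex-trans (here p) (there q) = here p
lex-trans (there p) (here q) = here q
lex-trans (there p) (there q) = there (lex-trans p q)

∈-iota≥ : ∀ {c} s n -> c ∈ iota s n -> s Z.≤ c
∈-iota≥ s (suc n) (here refl) = ZP.≤-refl
∈-iota≥ s (suc n) (there i) = ZP.≤-trans (ZP.i≤i+j s 1z) (∈-iota≥ (s Z.+ 1z) n i)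

private
 sub-add : ∀ a s -> (a Z.- s) Z.+ s ≡ a
 sub-add = solve-∀

-- only the diagonal term of the first row can reach the monomial
alt-coeff-cons : ∀ x λ' s y μ -> Decr (x ∷ λ') -> x ≤ y ->
 alt (iota s (suc (length μ))) (offs s (toZ (y ∷ μ))) (\ l -> ext (coeffFun (x ∷ λ')) l 0)
 ≡ alt (iota (s Z.+ 1z) (length μ)) (offs (s Z.+ 1z) (toZ μ)) (\ l -> ext (coeffFun (x ∷ λ')) (+ y ∷ l) 0)
alt-coeff-cons x λ' s y μ d p = cong₂ (\ a b -> a Z.+ Z.- b)
 (cong (\ z -> alt (iota s1 L) rows (\ l -> ext (coeffFun (x ∷ λ')) (z ∷ l) 0)) (sub-add (+ y) s))
 (∈-∑± (iota s1 L) (\ c r i _ -> alt-cong (s ∷ r) rows (\ l -> coeff-big λ' x d ((+ y Z.- s) Z.+ c ∷ l) z<s (big c (∈-iota≥ s1 L i))) & alt-0 (s ∷ r) rows) & ∑±-0 (iota s1 L)) &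
 +0ʳ _
 where
 L = length μ
 s1 = s Z.+ 1z
 rows = offs s1 (toZ μ)
 big : ∀ c -> s1 Z.≤ c -> + x Z.< (+ y Z.- s) Z.+ c
 big c q = ZP.≤-<-trans (Z.+≤+ p) (ZP.<-≤-trans (subst (+ y Z.<_) (lem (+ y) s) (subst (Z._< + y Z.+ 1z) (+0ʳ (+ y)) (ZP.+-monoʳ-< (+ y) (Z.+<+ z<s)))) (ZP.+-monoʳ-≤ (+ y Z.- s) q))
  where lem : ∀ y s -> y Z.+ 1z ≡ (y Z.- s) Z.+ (s Z.+ 1z)
        lem = solve-∀

alt-coeff-< : ∀ λ' μ s -> length λ' ≡ length μ -> Decr λ' -> λ' <ₗ μ ->
 alt (iota s (length μ)) (offs s (toZ μ)) (\ l -> ext (coeffFun λ') l 0) ≡ 0z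
alt-coeff-< (x ∷ λ') (y ∷ μ) s q d (here p) = alt-coeff-cons x λ' s y μ d (<⇒≤ p) &
 alt-cong (iota (s Z.+ 1z) (length μ)) (offs (s Z.+ 1z) (toZ μ)) (\ l -> coeff-big λ' x d (+ y ∷ l) z<s (Z.+<+ p)) & alt-0 (iota (s Z.+ 1z) (length μ)) (offs (s Z.+ 1z) (toZ μ))
alt-coeff-< (x ∷ λ') (x ∷ μ) s q d (there p) = alt-coeff-cons x λ' s x μ d ≤-refl &
 alt-cong (iota (s Z.+ 1z) (length μ)) (offs (s Z.+ 1z) (toZ μ)) (coeff-cancel x λ') & alt-coeff-< λ' μ (s Z.+ 1z) (suc-injective q) (proj₂ d) p

alt-coeff-≡ : ∀ μ s -> Decr μ -> alt (iota s (length μ)) (offs s (toZ μ)) (\ l -> ext (coeffFun μ) l 0) ≡ 1z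
alt-coeff-≡ [] s d = refl
alt-coeff-≡ (x ∷ μ) s d = alt-coeff-cons x μ s x μ d ≤-refl &
 alt-cong (iota (s Z.+ 1z) (length μ)) (offs (s Z.+ 1z) (toZ μ)) (coeff-cancel x μ) & alt-coeff-≡ μ (s Z.+ 1z) (proj₂ d)

sF-coeff-< : ∀ λ' μ -> length λ' ≡ length μ -> Decr λ' -> λ' <ₗ μ -> sF (coeffFun λ') (toZ μ) 0 ≡ 0z
sF-coeff-< λ' μ q d p = cong (\ L -> alt (iota 0z L) (offs 0z (toZ μ)) (\ l -> ext (coeffFun λ') l 0)) (LP.length-map _ μ) & alt-coeff-< λ' μ 0z q d p

sF-coeff-≡ : ∀ μ -> Decr μ -> sF (coeffFun μ) (toZ μ) 0 ≡ 1z
sF-coeff-≡ μ d = cong (\ L -> alt (iota 0z L) (offs 0z (toZ μ)) (\ l -> ext (coeffFun μ) l 0)) (LP.length-map _ μ) & alt-coeff-≡ μ 0z d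

H-0th : ∀ Ψ Φ γ -> H Ψ Φ γ 0 ≡ Φ γ 0
H-0th [] Φ γ = refl
H-0th (β ∷ Ψ) Φ γ = H-0th Ψ Φ γ

H-sh : ∀ Ψ a Φ γ n -> H Ψ (\ γ -> sh a (Φ γ)) γ n ≡ sh a (H Ψ Φ γ) n
H-sh [] a Φ γ n = refl
H-sh (β ∷ Ψ) a Φ γ n = Geo-cong β (length γ) (\ γ' _ -> H-sh Ψ a Φ γ') γ refl n & go a γ n
 where
 go : ∀ a γ n -> Geo β (\ γ -> sh a (H Ψ Φ γ)) γ n ≡ sh a (Geo β (H Ψ Φ) γ) n
 go zero γ n = refl
 go (suc a) γ zero = refl
 go (suc a) γ (suc n) = cong (\ z -> sh a (H Ψ Φ γ) n Z.+ z) (go (suc a) (mv β 1 γ) n) & sym (unr a n)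
  where unr : ∀ a n -> sh a (Geo β (H Ψ Φ) γ) n ≡ sh a (H Ψ Φ γ) n Z.+ sh (suc a) (Geo β (H Ψ Φ) (mv β 1 γ)) n
        unr zero zero = sym (+0ʳ _)
        unr zero (suc n) = refl
        unr (suc a) zero = refl
        unr (suc a) (suc n) = unr a n

-- Linear relations between the 𝔰^(k)_μ hold formally.

Term : Set
Term = ℤ × List ℕ × ℕ

pair : List Term -> (List ℕ -> Seq) -> ℤ
pair L f = ∑ L (\ { (c , μ , i) -> c Z.* f μ i })

-- The largest terms have the highest degree in t and, among these, the lexicographically smallest
-- partition: the probe of the largest term then vanishes on all smaller ones.
_≼_ : Term -> Term -> Set
(_ , μ , i) ≼ (_ , λ' , a) = i < a ⊎ (i ≡ a × (λ' ≡ μ ⊎ λ' <ₗ μ))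

≼-total : ∀ {ℓ} p q -> length (proj₁ (proj₂ p)) ≡ ℓ -> length (proj₁ (proj₂ q)) ≡ ℓ -> (p ≼ q) ⊎ (q ≼ p)
≼-total (_ , μ , i) (_ , λ' , a) u v with <-cmp i a
... | tri< p _ _ = inj₁ (inj₁ p)
... | tri> _ _ p = inj₂ (inj₁ p)
... | tri≈ _ e _ with lex-cmp λ' μ (v & sym u)
... | inj₁ p = inj₁ (inj₂ (e , inj₂ p))
... | inj₂ (inj₁ p) = inj₁ (inj₂ (e , inj₁ p))
... | inj₂ (inj₂ p) = inj₂ (inj₂ (sym e , inj₂ p))

≼-trans : ∀ p q s -> p ≼ q -> q ≼ s -> p ≼ s
≼-trans p q s (inj₁ a) (inj₁ b) = inj₁ (<-trans a b)
≼-trans p q s (inj₁ a) (inj₂ (refl , _)) = inj₁ a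
≼-trans p q s (inj₂ (refl , _)) (inj₁ b) = inj₁ b
≼-trans p q s (inj₂ (refl , x)) (inj₂ (refl , inj₁ refl)) = inj₂ (refl , x)
≼-trans p q s (inj₂ (refl , inj₁ refl)) (inj₂ (refl , inj₂ y)) = inj₂ (refl , inj₂ y)
≼-trans p q s (inj₂ (refl , inj₂ x)) (inj₂ (refl , inj₂ y)) = inj₂ (refl , inj₂ (lex-trans y x))

maximal : ∀ {ℓ} x L -> All (\ t -> length (proj₁ (proj₂ t)) ≡ ℓ) (x ∷ L) -> ∃[ m ] (m ∈ x ∷ L × All (_≼ m) (x ∷ L))
maximal x [] _ = x , here refl , (inj₂ (refl , inj₁ refl)) ∷ []
maximal x (y ∷ L) (p ∷ ps@(q ∷ _)) with maximal y L ps
... | m , i , as with ≼-total x m p (All.lookup ps i)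
... | inj₁ le = m , there i , le ∷ as
... | inj₂ le = x , here refl , (inj₂ (refl , inj₁ refl)) ∷ All.map (\ {t} a -> ≼-trans t m x a le) as

≟L : (a b : List ℕ) -> Dec (a ≡ b)
≟L = LP.≡-dec _≟_

module Formal (k ℓ : ℕ) where

 OK : Term -> Set
 OK (_ , μ , _) = length μ ≡ ℓ × Decr μ

 -- The shift by t^a kills degrees below a and reads the constant term in degree a, where the
 -- raising operators disappear and only the coefficient of h_λ in s_μ is left.
 probe : List ℕ -> ℕ -> List ℕ -> Seq
 probe λ' a = Sk k (\ γ -> sh a (sF (coeffFun λ') γ))

 probe-sh : ∀ λ' a μ i -> probe λ' a μ i ≡ sh a (Sk k (sF (coeffFun λ')) μ) i
 probe-sh λ' a μ i = H-sh (kRoots k μ) a (sF (coeffFun λ')) (toZ μ) i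

 sh-exact : ∀ a s -> sh a s a ≡ s 0
 sh-exact zero s = refl
 sh-exact (suc a) s = sh-exact a s

 probe-self : ∀ μ i -> Decr μ -> probe μ i μ i ≡ 1z
 probe-self μ i d = probe-sh μ i μ i & sh-exact i _ & H-0th (kRoots k μ) _ (toZ μ) & sF-coeff-≡ μ d

 probe-≼ : ∀ c c' μ i λ' a -> OK (c , μ , i) -> OK (c' , λ' , a) -> (c , μ , i) ≼ (c' , λ' , a) -> (μ ≡ λ' × i ≡ a) ⊎ (probe λ' a μ i ≡ 0z)
 probe-≼ c c' μ i λ' a ok ok' (inj₁ p) = inj₂ (probe-sh λ' a μ i & sh-beyond a _ i p)
 probe-≼ c c' μ i λ' a ok ok' (inj₂ (refl , inj₁ refl)) = inj₁ (refl , refl)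
 probe-≼ c c' μ i λ' a ok ok' (inj₂ (refl , inj₂ p)) = inj₂ (probe-sh λ' a μ i & sh-exact a _ &
  H-0th (kRoots k μ) _ (toZ μ) & sF-coeff-< λ' μ (proj₁ ok' & sym (proj₁ ok)) (proj₂ ok') p)

 same? : ∀ μ i λ' a -> Dec (μ ≡ λ' × i ≡ a)
 same? μ i λ' a with ≟L μ λ' | i ≟ a
 ... | yes p | yes q = yes (p , q)
 ... | yes _ | no q = no (q ∘ proj₂)
 ... | no p | _ = no (p ∘ proj₁)

 rest : List ℕ -> ℕ -> List Term -> List Term
 rest λ' a [] = []
 rest λ' a ((c , μ , i) ∷ L) with same? μ i λ' a
 ... | yes _ = rest λ' a L
 ... | no _ = (c , μ , i) ∷ rest λ' a L

 mult : List ℕ -> ℕ -> List Term -> ℤ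
 mult λ' a [] = 0z
 mult λ' a ((c , μ , i) ∷ L) with same? μ i λ' a
 ... | yes _ = c Z.+ mult λ' a L
 ... | no _ = mult λ' a L

 private
  l1 : ∀ c f m r -> c Z.* f Z.+ (m Z.* f Z.+ r) ≡ (c Z.+ m) Z.* f Z.+ r
  l1 = solve-∀
  l2 : ∀ x m r -> x Z.+ (m Z.+ r) ≡ m Z.+ (x Z.+ r)
  l2 = solve-∀

 pair-split : ∀ λ' a L f -> pair L f ≡ mult λ' a L Z.* f λ' a Z.+ pair (rest λ' a L) f
 pair-split λ' a [] f = refl
 pair-split λ' a ((c , μ , i) ∷ L) f with same? μ i λ' a
 ... | yes (refl , refl) = cong (\ z -> c Z.* f μ i Z.+ z) (pair-split μ i L f) & l1 c (f μ i) (mult μ i L) (pair (rest μ i L) f)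
 ... | no _ = cong (\ z -> c Z.* f μ i Z.+ z) (pair-split λ' a L f) & l2 (c Z.* f μ i) (mult λ' a L Z.* f λ' a) (pair (rest λ' a L) f)

 rest-All : ∀ {P : Term -> Set} λ' a L -> All P L -> All P (rest λ' a L)
 rest-All λ' a [] [] = []
 rest-All λ' a ((c , μ , i) ∷ L) (p ∷ ps) with same? μ i λ' a
 ... | yes _ = rest-All λ' a L ps
 ... | no _ = p ∷ rest-All λ' a L ps

 rest-length : ∀ λ' a L -> length (rest λ' a L) ≤ length L
 rest-length λ' a [] = z≤n
 rest-length λ' a ((c , μ , i) ∷ L) with same? μ i λ' a
 ... | yes _ = m≤n⇒m≤1+n (rest-length λ' a L)
 ... | no _ = s≤s (rest-length λ' a L)

 rest-< : ∀ c λ' a L -> (c , λ' , a) ∈ L -> length (rest λ' a L) < length L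
 rest-< c λ' a ((_ , μ , i) ∷ L) (here refl) with same? λ' a λ' a
 ... | yes _ = s≤s (rest-length λ' a L)
 ... | no p = ⊥-elim (p (refl , refl))
 rest-< c λ' a ((_ , μ , i) ∷ L) (there m) with same? μ i λ' a
 ... | yes _ = m<n⇒m<1+n (rest-< c λ' a L m)
 ... | no _ = s≤s (rest-< c λ' a L m)

 rest-0 : ∀ λ' a c' L -> OK (c' , λ' , a) -> All OK L -> All (_≼ (c' , λ' , a)) L -> pair (rest λ' a L) (probe λ' a) ≡ 0z
 rest-0 λ' a c' [] ok [] [] = refl
 rest-0 λ' a c' ((c , μ , i) ∷ L) ok (o ∷ os) (p ∷ ps) with same? μ i λ' a | probe-≼ c c' μ i λ' a o ok p
 ... | yes _ | _ = rest-0 λ' a c' L ok os ps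
 ... | no q | inj₁ e = ⊥-elim (q e)
 ... | no _ | inj₂ z = cong₂ Z._+_ (cong (c Z.*_) z & ZP.*-zeroʳ c) (rest-0 λ' a c' L ok os ps)

 -- The term maximal for ≼ is detected by its own probe, so its total coefficient vanishes.
 formal : ∀ N L -> length L ≤ N -> All OK L -> (∀ λ' a -> pair L (probe λ' a) ≡ 0z) -> ∀ f -> pair L f ≡ 0z
 formal N [] _ _ h f = refl
 formal (suc N) (x ∷ L) b os h f with maximal x L (All.map proj₁ os)
 ... | (c , μ , i) , m , as = pair-split μ i (x ∷ L) f & cong (\ z -> z Z.* f μ i Z.+ pair R f) mult0 &
  +0ˡ _ & formal N R (≤-pred (rest-< c μ i (x ∷ L) m &≤ b)) (rest-All μ i (x ∷ L) os) h' f
  where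
  R = rest μ i (x ∷ L)
  M = mult μ i (x ∷ L)
  ok = All.lookup os m
  mult0 : M ≡ 0z
  mult0 = sym (cong₂ (\ u v -> M Z.* u Z.+ v) (probe-self μ i (proj₂ ok)) (rest-0 μ i c (x ∷ L) ok os as) & lem M) &
   sym (pair-split μ i (x ∷ L) (probe μ i)) &
   h μ i
   where open ≡-Reasoning
         lem : ∀ m -> m Z.* 1z Z.+ 0z ≡ m
         lem = solve-∀
  h' : ∀ λ' a -> pair R (probe λ' a) ≡ 0z
  h' λ' a = sym (pair-split μ i (x ∷ L) (probe λ' a) & cong (\ z -> z Z.* probe λ' a μ i Z.+ pair R (probe λ' a)) mult0 & +0ˡ _) & h λ' a

-- The operators u_p, p ≤ r, on formal combinations; letters count from 0.

Uw : ℕ -> List ℕ -> (List ℕ -> Seq) -> List ℕ -> Seq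
Uw k [] f = f
Uw k (z ∷ w) f μ n = PS k (Uw k w f) μ z n

Uw-++ : ∀ k w w' f μ n -> Uw k (w ++ w') f μ n ≡ Uw k w (Uw k w' f) μ n
Uw-++ k [] w' f μ n = refl
Uw-++ k (z ∷ w) w' f μ n = go z n
 where
 rm : ∀ z n -> Rm (Uw k (w ++ w') f) μ z n ≡ Rm (Uw k w (Uw k w' f)) μ z n
 rm z n = cong (\ x -> if nthN μ (suc z) <ᵇ nthN μ z then x else 0z) (Uw-++ k w w' f (decAt z μ) n)
 go : ∀ z n -> PS k (Uw k (w ++ w') f) μ z n ≡ PS k (Uw k w (Uw k w' f)) μ z n
 go z zero = rm z zero
 go z (suc n) = cong₂ Z._+_ (rm z (suc n)) (cong (\ x -> if dn k μ z <ᵇ length μ then x else 0z) (go (dn k μ z) n))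

sumT : List (List ℕ × ℕ) -> (List ℕ -> Seq) -> ℤ
sumT L f = ∑ L (\ νi -> f (proj₁ νi) (proj₂ νi))

LR : List ℕ -> ℕ -> ℕ -> List (List ℕ × ℕ)
LR μ z n = if nthN μ (suc z) <ᵇ nthN μ z then (decAt z μ , n) ∷ [] else []

LPS : ℕ -> List ℕ -> ℕ -> ℕ -> List (List ℕ × ℕ)
LPS k μ z zero = LR μ z zero
LPS k μ z (suc n) = LR μ z (suc n) ++ (if dn k μ z <ᵇ length μ then LPS k μ (dn k μ z) n else [])

-- The action of a word as a finite combination that does not depend on the function it is evaluated
-- on; the second component is the degree in t left for that function.
Lw : ℕ -> List ℕ -> List ℕ -> ℕ -> List (List ℕ × ℕ)
Lw k [] μ n = (μ , n) ∷ []
Lw k (z ∷ w) μ n = concatMap (\ νi -> Lw k w (proj₁ νi) (proj₂ νi)) (LPS k μ z n)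

sumT-LPS : ∀ k μ z n f -> PS k f μ z n ≡ sumT (LPS k μ z n) f
sumT-LPS k μ z n f = go z n
 where
 rm : ∀ z n -> Rm f μ z n ≡ sumT (LR μ z n) f
 rm z n with nthN μ (suc z) <ᵇ nthN μ z
 ... | true = sym (+0ʳ _)
 ... | false = refl
 go : ∀ z n -> PS k f μ z n ≡ sumT (LPS k μ z n) f
 go z zero = rm z zero
 go z (suc n) = cong₂ Z._+_ (rm z (suc n)) tl & sym (∑-++ (LR μ z (suc n)) (if dn k μ z <ᵇ length μ then LPS k μ (dn k μ z) n else []) _)
  where tl : (if dn k μ z <ᵇ length μ then PS k f μ (dn k μ z) n else 0z) ≡ sumT (if dn k μ z <ᵇ length μ then LPS k μ (dn k μ z) n else []) f
        tl with dn k μ z <ᵇ length μ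
        ... | true = go (dn k μ z) n
        ... | false = refl

sumT-Lw : ∀ k w μ n f -> Uw k w f μ n ≡ sumT (Lw k w μ n) f
sumT-Lw k [] μ n f = sym (+0ʳ _)
sumT-Lw k (z ∷ w) μ n f = sumT-LPS k μ z n (Uw k w f) & ∑-cong (LPS k μ z n) (\ νi -> sumT-Lw k w (proj₁ νi) (proj₂ νi) f) &
 sym (∑-concatMap (\ νi -> Lw k w (proj₁ νi) (proj₂ νi)) (LPS k μ z n) (\ νi -> f (proj₁ νi) (proj₂ νi)))

Uw-∑ : ∀ {A : Set} k w (xs : List A) (f : A -> List ℕ -> Seq) μ n -> Uw k w (\ ν i -> ∑ xs (\ x -> f x ν i)) μ n ≡ ∑ xs (\ x -> Uw k w (f x) μ n)
Uw-∑ k w xs f μ n = sumT-Lw k w μ n _ & ∑-swap (Lw k w μ n) xs (\ νi x -> f x (proj₁ νi) (proj₂ νi)) & ∑-cong xs (\ x -> sym (sumT-Lw k w μ n (f x)))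

Par-decAt : ∀ {k ℓ μ} x -> Par k ℓ μ -> nthN μ (suc x) < nthN μ x -> Par k ℓ (decAt x μ)
Par-decAt {k} {ℓ} {μ} x par lt = record { len = trans (length-decAt x μ) len ; mono = mono' ; bound = \ i -> ≤-trans (dec≤ i) (bound i) }
 where
 open Par par
 dec≤ : ∀ i -> nthN (decAt x μ) i ≤ nthN μ i
 dec≤ i with i ≟ x
 ... | yes refl = eq≤ (nthN-decAt-≡ x μ) &≤ m∸n≤m _ 1
 ... | no ¬p = eq≤ (nthN-decAt-≢ i x μ ¬p)
 mono' : ∀ i -> nthN (decAt x μ) (suc i) ≤ nthN (decAt x μ) i
 mono' i with i ≟ x
 ... | yes refl = dec≤ (suc x) &≤ ≤-pred (lt &≤ eq≤ (sym (m+[n∸m]≡n (z<s &≤ lt)))) &≤ eq≤ (sym (nthN-decAt-≡ x μ))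
 ... | no ¬p = dec≤ (suc i) &≤ mono i &≤ eq≤ (sym (nthN-decAt-≢ i x μ ¬p))

Par-Decr : ∀ μ -> (∀ i -> nthN μ (suc i) ≤ nthN μ i) -> Decr μ
Par-Decr [] m = tt
Par-Decr (x ∷ μ) m = go μ x m , Par-Decr μ (m ∘ suc)
 where go : ∀ μ x -> (∀ i -> nthN (x ∷ μ) (suc i) ≤ nthN (x ∷ μ) i) -> All (_≤ x) μ
       go [] x m = []
       go (y ∷ μ) x m = m 0 ∷ All.map (\ p -> p &≤ m 0) (go μ y (m ∘ suc))

Par-Lw : ∀ k ℓ w μ n -> Par k ℓ μ -> ∀ {νi} -> νi ∈ Lw k w μ n -> Par k ℓ (proj₁ νi)
Par-Lw k ℓ [] μ n par (here refl) = par
Par-Lw k ℓ (z ∷ w) μ n par m with ∈-concatMap⁻ (\ νi -> Lw k w (proj₁ νi) (proj₂ νi)) (LPS k μ z n) m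
... | (ν , i) , m1 , m2 = Par-Lw k ℓ w ν i (go z n m1) m2
 where
 rm : ∀ z n {νi} -> νi ∈ LR μ z n -> Par k ℓ (proj₁ νi)
 rm z n m with nthN μ (suc z) <ᵇ nthN μ z in e
 rm z n (here refl) | true = Par-decAt z par (<ᵇ-true⁻ e)
 go : ∀ z n {νi} -> νi ∈ LPS k μ z n -> Par k ℓ (proj₁ νi)
 go z zero m = rm z zero m
 go z (suc n) m with MP.∈-++⁻ (LR μ z (suc n)) m
 ... | inj₁ m' = rm z (suc n) m'
 ... | inj₂ m' with dn k μ z <ᵇ length μ
 ... | true = go (dn k μ z) n m'

-- Lowering operators on weights and their elementary symmetric sums

X : ℕ -> GF -> GF
X z Φ γ = Φ (addAt z (Z.- 1z) γ)

Xw : List ℕ -> GF -> GF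
Xw [] Φ = Φ
Xw (z ∷ w) Φ = X z (Xw w Φ)

Sk-X : ∀ k z Φ μ n -> Sk k (X z Φ) μ n ≡ H (kRoots k μ) Φ (addAt z (Z.- 1z) (toZ μ)) n
Sk-X k z Φ μ n = H-natural (addAt z (Z.- 1z)) id (kRoots k μ) Φ
 (\ { (i , j) _ γ -> trans (addAt-comm z (i ∸ 1) _ _ _) (cong (addAt (i ∸ 1) (+ 1)) (addAt-comm z (j ∸ 1) _ _ γ)) }) (toZ μ) n &
 cong (\ R -> H R Φ (addAt z (Z.- 1z) (toZ μ)) n) (LP.map-id (kRoots k μ))

Anti-X : ∀ ℓ Φ y i -> suc i < ℓ -> y ≢ i -> y ≢ suc i -> Anti ℓ Φ i -> Anti ℓ (X y Φ) i
Anti-X ℓ Φ y i p a b an γ refl n = cong (\ g -> Φ g n) (cong (\ t -> addAt t (Z.- 1z) (dotAt i γ)) (sym (tr-o i y a b)) & sym (dotAt-addAt i y (Z.- 1z) γ p)) &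
 an (addAt y (Z.- 1z) γ) (length-addAt y (Z.- 1z) γ) n

Dec↓ : List ℕ -> ℕ -> List (List ℕ)
Dec↓ ls zero = [] ∷ []
Dec↓ [] (suc m) = []
Dec↓ (z ∷ ls) (suc m) = Dec↓ ls (suc m) ++ map (\ w -> w ++ z ∷ []) (Dec↓ ls m)

-- The elementary symmetric polynomial of degree m in the commuting lowerings of the rows in `ls`.
EE : List ℕ -> ℕ -> GF -> GF
EE ls zero Φ = Φ
EE [] (suc m) Φ γ n = 0z
EE (z ∷ ls) (suc m) Φ γ n = EE ls (suc m) Φ γ n Z.+ EE ls m (X z Φ) γ n

seg : ℕ -> ℕ -> List ℕ
seg n zero = []
seg n (suc c) = n ∷ seg (suc n) c

∈-seg : ∀ {y} n c -> y ∈ seg n c -> n ≤ y × y < n + c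
∈-seg n (suc c) (here refl) = ≤-refl , ≤-trans (s≤s (m≤m+n n c)) (eq≤ (sym (+-suc n c)))
∈-seg n (suc c) (there i) with ∈-seg (suc n) c i
... | a , b = <⇒≤ a , ≤-trans b (eq≤ (sym (+-suc n c)))

Xw-snoc : ∀ w z Φ γ -> Xw (w ++ z ∷ []) Φ γ ≡ Xw w (X z Φ) γ
Xw-snoc [] z Φ γ = refl
Xw-snoc (y ∷ w) z Φ γ = Xw-snoc w z Φ (addAt y (Z.- 1z) γ)

∑-Dec↓ : ∀ ls m Φ γ n -> ∑ (Dec↓ ls m) (\ w -> Xw w Φ γ n) ≡ EE ls m Φ γ n
∑-Dec↓ ls zero Φ γ n = +0ʳ _
∑-Dec↓ [] (suc m) Φ γ n = refl
∑-Dec↓ (z ∷ ls) (suc m) Φ γ n = ∑-++ (Dec↓ ls (suc m)) _ _ & cong₂ Z._+_ (∑-Dec↓ ls (suc m) Φ γ n)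
 (∑-map (\ w -> w ++ z ∷ []) (Dec↓ ls m) (\ w -> Xw w Φ γ n) & ∑-cong (Dec↓ ls m) (\ w -> cong (\ s -> s n) (Xw-snoc w z Φ γ)) & ∑-Dec↓ ls m (X z Φ) γ n)

EE-cong : ∀ ls m ℓ {Φ Φ' : GF} -> (∀ γ -> length γ ≡ ℓ -> ∀ n -> Φ γ n ≡ Φ' γ n) -> ∀ γ -> length γ ≡ ℓ -> ∀ n -> EE ls m Φ γ n ≡ EE ls m Φ' γ n
EE-cong ls zero ℓ e = e
EE-cong [] (suc m) ℓ e γ q n = refl
EE-cong (z ∷ ls) (suc m) ℓ e γ q n = cong₂ Z._+_ (EE-cong ls (suc m) ℓ e γ q n)
 (EE-cong ls m ℓ (\ γ' q' -> e (addAt z (Z.- 1z) γ') (length-addAt z (Z.- 1z) γ' & q')) γ q n)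

EE-X : ∀ ls m y Φ γ n -> EE ls m (X y Φ) γ n ≡ X y (EE ls m Φ) γ n
EE-X ls zero y Φ γ n = refl
EE-X [] (suc m) y Φ γ n = refl
EE-X (z ∷ ls) (suc m) y Φ γ n = cong₂ Z._+_ (EE-X ls (suc m) y Φ γ n)
 (EE-cong ls m (length γ) (\ γ' _ n -> cong (\ g -> Φ g n) (addAt-comm y z _ _ γ')) γ refl n & EE-X ls m y (X z Φ) γ n)

EE-+ : ∀ ls m (Φ Φ' : GF) γ n -> EE ls m (\ γ n -> Φ γ n Z.+ Φ' γ n) γ n ≡ EE ls m Φ γ n Z.+ EE ls m Φ' γ n
EE-+ ls zero Φ Φ' γ n = refl
EE-+ [] (suc m) Φ Φ' γ n = refl
EE-+ (z ∷ ls) (suc m) Φ Φ' γ n = cong₂ Z._+_ (EE-+ ls (suc m) Φ Φ' γ n) (EE-+ ls m (X z Φ) (X z Φ') γ n) &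
 lem (EE ls (suc m) Φ γ n) (EE ls (suc m) Φ' γ n) (EE ls m (X z Φ) γ n) (EE ls m (X z Φ') γ n)
 where lem : ∀ a b c d -> (a Z.+ b) Z.+ (c Z.+ d) ≡ (a Z.+ c) Z.+ (b Z.+ d)
       lem = solve-∀

EE-comm : ∀ ls m l Φ γ n -> EE ls m (EE ls l Φ) γ n ≡ EE ls l (EE ls m Φ) γ n
EE-comm ls m l Φ γ n = go ls m γ
 where
 go : ∀ ls' m γ -> EE ls' m (EE ls l Φ) γ n ≡ EE ls l (EE ls' m Φ) γ n
 zr : ∀ ls l γ -> 0z ≡ EE ls l (\ _ _ -> 0z) γ n
 zr ls zero γ = refl
 zr [] (suc l) γ = refl
 zr (z ∷ ls) (suc l) γ = cong₂ Z._+_ (zr ls (suc l) γ) (zr ls l γ)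
 go ls' zero γ = refl
 go [] (suc m) γ = zr ls l γ
 go (z ∷ ls') (suc m) γ = cong₂ Z._+_ (go ls' (suc m) γ) (EE-X ls' m z (EE ls l Φ) γ n & go ls' m (addAt z (Z.- 1z) γ) &
  sym (EE-X ls l z (EE ls' m Φ) γ n) & EE-cong ls l (length γ) (\ γ' _ n' -> sym (EE-X ls' m z Φ γ' n')) γ refl n) &
  sym (EE-+ ls l (EE ls' (suc m) Φ) (EE ls' m (X z Φ)) γ n)

Anti-EE-far : ∀ ℓ ls m Φ i -> suc i < ℓ -> (∀ {y} -> y ∈ ls -> suc i < y ⊎ y < i) -> Anti ℓ Φ i -> Anti ℓ (EE ls m Φ) i
Anti-EE-far ℓ ls zero Φ i p far an = an
Anti-EE-far ℓ [] (suc m) Φ i p far an γ q n = refl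
Anti-EE-far ℓ (z ∷ ls) (suc m) Φ i p far an γ q n = cong₂ Z._+_ (Anti-EE-far ℓ ls (suc m) Φ i p (far ∘ there) an γ q n)
 (Anti-EE-far ℓ ls m (X z Φ) i p (far ∘ there) (Anti-X ℓ Φ z i p (ne (far (here refl))) (ne' (far (here refl))) an) γ q n) & sym (ZP.neg-distrib-+ (EE ls (suc m) Φ γ n) _)
 where
 ne : suc i < z ⊎ z < i -> z ≢ i
 ne (inj₁ a) refl = <⇒≱ a (n≤1+n z)
 ne (inj₂ a) refl = <-irrefl refl a
 ne' : suc i < z ⊎ z < i -> z ≢ suc i
 ne' (inj₁ a) refl = <-irrefl refl a
 ne' (inj₂ a) refl = <⇒≱ a (n≤1+n i)

Anti-+ : ∀ ℓ (Φ Φ' : GF) i -> Anti ℓ Φ i -> Anti ℓ Φ' i -> Anti ℓ (\ γ n -> Φ γ n Z.+ Φ' γ n) i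
Anti-+ ℓ Φ Φ' i a b γ q n = cong₂ Z._+_ (a γ q n) (b γ q n) & sym (ZP.neg-distrib-+ (Φ γ n) (Φ' γ n))

Anti-cong : ∀ ℓ {Φ Φ' : GF} i -> (∀ γ -> length γ ≡ ℓ -> ∀ n -> Φ γ n ≡ Φ' γ n) -> Anti ℓ Φ i -> Anti ℓ Φ' i
Anti-cong ℓ i e an γ q n = sym (e (dotAt i γ) (length-dotAt i γ & q) n) & an γ q n & cong Z.-_ (e γ q n)

-- The reflection exchanges the two lowerings, hence commutes with their sum and their product.
Anti-XX : ∀ ℓ Φ i -> suc i < ℓ -> Anti ℓ Φ i -> Anti ℓ (\ γ n -> X i Φ γ n Z.+ X (suc i) Φ γ n) i × Anti ℓ (X (suc i) (X i Φ)) i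
Anti-XX ℓ Φ i p an = one , two
 where
 d : ∀ y y' -> tr i y ≡ y' -> ∀ γ -> length γ ≡ ℓ -> addAt y' (Z.- 1z) (dotAt i γ) ≡ dotAt i (addAt y (Z.- 1z) γ)
 d y y' refl γ q = sym (dotAt-addAt i y (Z.- 1z) γ (subst (suc i <_) (sym q) p))
 la : ∀ y γ -> length γ ≡ ℓ -> length (addAt y (Z.- 1z) γ) ≡ ℓ
 la y γ q = length-addAt y (Z.- 1z) γ & q
 one : Anti ℓ (\ γ n -> X i Φ γ n Z.+ X (suc i) Φ γ n) i
 one γ q n = cong₂ Z._+_ (cong (\ g -> Φ g n) (d (suc i) i (tr-r i) γ q) & an _ (la (suc i) γ q) n) (cong (\ g -> Φ g n) (d i (suc i) (tr-l i) γ q) & an _ (la i γ q) n) &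
  lem (X (suc i) Φ γ n) (X i Φ γ n)
  where lem : ∀ a b -> Z.- a Z.+ Z.- b ≡ Z.- (b Z.+ a)
        lem = solve-∀
 two : Anti ℓ (X (suc i) (X i Φ)) i
 two γ q n = cong (\ g -> Φ (addAt i (Z.- 1z) g) n) (d i (suc i) (tr-l i) γ q) & cong (\ g -> Φ g n) (d (suc i) i (tr-r i) _ (la i γ q) & cong (dotAt i) (addAt-comm (suc i) i _ _ γ)) &
  an _ (la i (addAt (suc i) (Z.- 1z) γ) (la (suc i) γ q)) n

-- As a polynomial in the lowerings of rows i and i+1, e_m involves only their sum and product; the
-- other letters are away from both rows.
Anti-EE : ∀ ℓ n c m Φ i -> suc i < ℓ -> n ≤ i -> suc i < n + c -> (∀ j -> n ≤ j -> suc j < n + c -> Anti ℓ Φ j) -> Anti ℓ (EE (seg n c) m Φ) i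
Anti-EE ℓ n c zero Φ i p a b an = an i a b
Anti-EE ℓ n zero (suc m) Φ i p a b an γ q k = refl
Anti-EE ℓ n (suc c) (suc m) Φ i p a b an with m≤n⇒m<n∨m≡n a
... | inj₁ n<i = Anti-+ ℓ (EE (seg (suc n) c) (suc m) Φ) (EE (seg (suc n) c) m (X n Φ)) i
 (Anti-EE ℓ (suc n) c (suc m) Φ i p n<i b' (\ j u v -> an j (<⇒≤ u) (subst (suc j <_) (sym (+-suc n c)) v)))
 (Anti-EE-gen)
 where
 b' = subst (suc i <_) (+-suc n c) b
 Anti-EE-gen : Anti ℓ (EE (seg (suc n) c) m (X n Φ)) i
 Anti-EE-gen = Anti-cong ℓ i (\ γ _ k -> sym (EE-X (seg (suc n) c) m n Φ γ k))
  (Anti-X ℓ (EE (seg (suc n) c) m Φ) n i p (<⇒≢ n<i) (<⇒≢ (m<n⇒m<1+n n<i))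
   (Anti-EE ℓ (suc n) c m Φ i p n<i b' (\ j u v -> an j (<⇒≤ u) (subst (suc j <_) (sym (+-suc n c)) v))))
Anti-EE ℓ n (suc zero) (suc m) Φ i p a b an | inj₂ refl = ⊥-elim (<-irrefl refl (b &≤ eq≤ (+-comm n 1)))
Anti-EE ℓ n (suc (suc c)) (suc m) Φ i p a b an | inj₂ refl = case m
 where
 ls = seg (suc (suc n)) c
 ann = an n ≤-refl b
 far : ∀ {y} -> y ∈ ls -> suc n < y ⊎ y < n
 far i = inj₁ (proj₁ (∈-seg (suc (suc n)) c i))
 XX = \ (γ : List ℤ) k -> X n Φ γ k Z.+ X (suc n) Φ γ k
 case : ∀ m -> Anti ℓ (EE (n ∷ suc n ∷ ls) (suc m) Φ) n
 case zero = Anti-cong ℓ n (\ γ _ k -> lem (EE ls 1 Φ γ k) (X n Φ γ k) (X (suc n) Φ γ k)) (Anti-+ ℓ (EE ls 1 Φ) XX n (Anti-EE-far ℓ ls 1 Φ n p far ann) (proj₁ (Anti-XX ℓ Φ n p ann)))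
  where lem : ∀ a b c -> a Z.+ (b Z.+ c) ≡ (a Z.+ c) Z.+ b
        lem = solve-∀
 case (suc m) = Anti-cong ℓ n (\ γ _ k -> cong (\ z -> (EE ls (suc (suc m)) Φ γ k Z.+ z) Z.+ EE ls m (X (suc n) (X n Φ)) γ k) (EE-+ ls (suc m) (X n Φ) (X (suc n) Φ) γ k) &
  lem (EE ls (suc (suc m)) Φ γ k) (EE ls (suc m) (X n Φ) γ k) (EE ls (suc m) (X (suc n) Φ) γ k) (EE ls m (X (suc n) (X n Φ)) γ k))
  (Anti-+ ℓ _ (EE ls m (X (suc n) (X n Φ))) n (Anti-+ ℓ (EE ls (suc (suc m)) Φ) (EE ls (suc m) XX) n
   (Anti-EE-far ℓ ls (suc (suc m)) Φ n p far ann) (Anti-EE-far ℓ ls (suc m) XX n p far (proj₁ (Anti-XX ℓ Φ n p ann))))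
   (Anti-EE-far ℓ ls m (X (suc n) (X n Φ)) n p far (proj₂ (Anti-XX ℓ Φ n p ann))))
  where lem : ∀ a b c d -> (a Z.+ (b Z.+ c)) Z.+ d ≡ (a Z.+ c) Z.+ (b Z.+ d)
        lem = solve-∀

-- Words with bounded letter multiplicities acting on weights

_⊖_ : (ℕ -> ℕ) -> List ℕ -> ℕ -> ℕ
(B ⊖ w) y = B y ∸ countN y w

data Desc : List ℕ -> Set where
 [] : Desc []
 _∷_ : ∀ {z w} -> All (_< z) w -> Desc w -> Desc (z ∷ w)

Dec↓-spec : ∀ n c m {w} -> w ∈ Dec↓ (seg n c) m -> All (\ z -> n ≤ z × z < n + c) w × Desc w × (∀ y -> countN y w ≤ 1)
Dec↓-spec n c zero (here refl) = [] , [] , \ _ -> z≤n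
Dec↓-spec n (suc c) (suc m) i with MP.∈-++⁻ (Dec↓ (seg (suc n) c) (suc m)) i
... | inj₁ j with Dec↓-spec (suc n) c (suc m) j
... | a , d , u = All.map (\ (y : _ × _) -> <⇒≤ (proj₁ y) , ≤-trans (proj₂ y) (eq≤ (sym (+-suc n c)))) a , d , u
Dec↓-spec n (suc c) (suc m) i | inj₂ j with MP.∈-map⁻ (\ w -> w ++ n ∷ []) j
... | w , j' , refl with Dec↓-spec (suc n) c m j'
... | a , d , u = AP w a , DP w a d , UPs
 where
 AP : ∀ w -> All (\ z -> suc n ≤ z × z < suc n + c) w -> All (\ z -> n ≤ z × z < n + suc c) (w ++ n ∷ [])
 AP [] [] = (≤-refl , ≤-trans (s≤s (m≤m+n n c)) (eq≤ (sym (+-suc n c)))) ∷ []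
 AP (z ∷ w) (p ∷ ps) = (<⇒≤ (proj₁ p) , ≤-trans (proj₂ p) (eq≤ (sym (+-suc n c)))) ∷ AP w ps
 lt : ∀ {z} w -> n < z -> All (_< z) w -> All (_< z) (w ++ n ∷ [])
 lt [] p [] = p ∷ []
 lt (y ∷ w) p (q ∷ qs) = q ∷ lt w p qs
 DP : ∀ w -> All (\ z -> suc n ≤ z × z < suc n + c) w -> Desc w -> Desc (w ++ n ∷ [])
 DP [] [] [] = [] ∷ []
 DP (z ∷ w) (p ∷ ps) (q ∷ qs) = lt w (proj₁ p) q ∷ DP w ps qs
 none : ∀ w -> All (\ z -> suc n ≤ z × z < suc n + c) w -> countN n w ≡ 0
 none [] [] = refl
 none (z ∷ w) (p ∷ ps) with n ≡ᵇ z in e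
 ... | false = none w ps
 ... | true = ⊥-elim (<⇒≱ (proj₁ p) (eq≤ (sym (≡ᵇ-true {n} {z} e))))
 UPs : ∀ y -> countN y (w ++ n ∷ []) ≤ 1
 UPs y with y ≡ᵇ n in e
 ... | false = eq≤ (countN-++ y w (n ∷ []) & cong (\ t -> countN y w + (if t then 1 else 0)) e & +-identityʳ _) &≤ u y
 ... | true with ≡ᵇ-true {y} {n} e
 ... | refl = eq≤ (countN-++ y w (y ∷ []) & cong₂ _+_ (none w a) (cong (\ t -> if t then 1 else 0) (≡ᵇ-refl y)))

-- W bounds all rows and b the rows from index r on. The equation W + r = k+1 is what sends a path
-- beyond the first r rows after its first step.
module V (k r ℓ' W b : ℕ) (Wr : W + r ≡ suc k) (r≤ℓ : r ≤ suc ℓ') (b<k : b < k) where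
 ℓ = suc ℓ'

 -- B z is the number of times the letter z may still be applied. While it is positive, row z is
 -- longer than every row from r on, so rows r-1 and r never become equal when the letter r-1 is
 -- due.
 record St (B : ℕ -> ℕ) (μ : List ℕ) : Set where
  field
   par : Par k ℓ μ
   hd : nthN μ 0 ≤ W
   low : ∀ i -> r ≤ i -> nthN μ i ≤ b
   bud : ∀ z -> z < r -> b + B z ≤ nthN μ z
  open Par par public
  all≤ : ∀ i -> nthN μ i ≤ W
  all≤ zero = hd
  all≤ (suc i) = mono i &≤ all≤ i

 -- Antisymmetry between rows r-1 and r is deliberately not asked: lowering the first r rows does
 -- not preserve it, and the budget in `St` replaces it.
 record Good (z : ℕ) (Φ : GF) : Set where
  field
   anti≥ : ∀ i -> r ≤ i -> suc i < ℓ -> Anti ℓ Φ i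
   antiz : suc z < r -> Anti ℓ Φ z
   lneg : LastNeg ℓ' Φ

 -- A row of length at most W starts its roots at least k+1-W = r columns to the right.
 r≤dn : ∀ {B μ} -> St B μ -> ∀ x -> r ≤ dn k μ x
 r≤dn {B} {μ} s x = (eq≤ (sym (cong (_∸ W) (sym Wr) & m+n∸m≡n W r)) &≤ ∸-monoʳ-≤ (suc k) (St.all≤ s x) &≤
  eq≤ (+-∸-assoc 1 (St.bound s x))) &≤ m≤n+m _ x

 -- The path of z meets the first r rows only in z itself, so applying the letter z spends only the
 -- budget of z.
 St-decAt : ∀ {B μ} z x -> St B μ -> 1 ≤ B z -> x ≡ z ⊎ r ≤ x -> nthN μ (suc x) < nthN μ x -> St (B ⊖ (z ∷ [])) (decAt x μ)
 St-decAt {B} {μ} z x s bz xz lt = record { par = Par-decAt x (St.par s) lt ; hd = ≤-trans (dec≤ 0) (St.hd s)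
  ; low = \ i p -> ≤-trans (dec≤ i) (St.low s i p) ; bud = bud }
  where
  dec≤ : ∀ i -> nthN (decAt x μ) i ≤ nthN μ i
  dec≤ i with i ≟ x
  ... | yes refl = eq≤ (nthN-decAt-≡ x μ) &≤ m∸n≤m _ 1
  ... | no ¬p = eq≤ (nthN-decAt-≢ i x μ ¬p)
  bud : ∀ y -> y < r -> b + (B ⊖ (z ∷ [])) y ≤ nthN (decAt x μ) y
  bud y p with y ≟ x
  ... | no ¬q = +-monoʳ-≤ b (m∸n≤m (B y) (countN y (z ∷ []))) &≤ St.bud s y p &≤ eq≤ (sym (nthN-decAt-≢ y x μ ¬q))
  ... | yes refl = at xz
   where
   at : x ≡ z ⊎ r ≤ x -> b + (B ⊖ (z ∷ [])) x ≤ nthN (decAt x μ) x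
   at (inj₂ q) = ⊥-elim (<⇒≱ p q)
   at (inj₁ refl) = eq≤ (cong (\ t -> b + (B y ∸ (if t then 1 else 0))) (≡ᵇ-refl y) & sym (+-∸-assoc b bz)) &≤
    ∸-monoˡ-≤ 1 (St.bud s y p) &≤ eq≤ (sym (nthN-decAt-≡ y μ))

 PS-congr : ∀ {B μ} f g z -> St B μ -> 1 ≤ B z -> (∀ ν -> St (B ⊖ (z ∷ [])) ν -> ∀ n -> f ν n ≡ g ν n) -> ∀ n -> PS k f μ z n ≡ PS k g μ z n
 PS-congr {B} {μ} f g z s bz e n = go n z (inj₁ refl)
  where
  rm : ∀ x -> x ≡ z ⊎ r ≤ x -> ∀ n -> Rm f μ x n ≡ Rm g μ x n
  rm x h n with nthN μ (suc x) <ᵇ nthN μ x in q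
  ... | true = e (decAt x μ) (St-decAt z x s bz h (<ᵇ-true⁻ q)) n
  ... | false = refl
  go : ∀ n x -> x ≡ z ⊎ r ≤ x -> PS k f μ x n ≡ PS k g μ x n
  go zero x h = rm x h zero
  go (suc n) x h = cong₂ Z._+_ (rm x h (suc n)) (cong (\ y -> if dn k μ x <ᵇ length μ then y else 0z) (go n (dn k μ x) (inj₂ (r≤dn s x))))

 -- Inside the first r rows the chain behind z is empty, since no roots start before column r; for z
 -- = r-1 the budget makes the row removable. Two equal rows above r force r ≥ 2, hence W < k, as
 -- the path expansion requires.
 PS-Sk : ∀ {B μ} Φ z -> St B μ -> z < r -> 1 ≤ B z -> Good z Φ -> ∀ n -> PS k (Sk k Φ) μ z n ≡ Sk k (X z Φ) μ n
 PS-Sk {B} {μ} Φ z s z<r bz g n = sym (OneStep.oneStep k ℓ' μ par flat Φ lneg (\ i p q -> anti≥ i (r≤dn s 0 &≤ p) q) n z (<-≤-trans z<r r≤ℓ) cond) & sym (Sk-X k z Φ μ n)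
  where
  open St s
  open Good g
  flat : ∀ i -> nthN μ (suc i) ≡ nthN μ i -> nthN μ i < k
  flat i e with suc i <? r
  ... | no ¬p = ≤-<-trans (eq≤ (sym e) &≤ low (suc i) (≮⇒≥ ¬p)) b<k
  ... | yes p = s≤s (all≤ i) &≤ ≤-pred (eq≤ (+-comm 2 W) &≤ +-monoʳ-≤ W (s≤s z<s &≤ p) &≤ eq≤ Wr)
  cond : OneStep.Cond k ℓ' μ par flat Φ lneg z
  cond e lt with suc z <? r
  ... | yes p = antiz p , [] , OneStep.top (\ i q -> <⇒≱ p (r≤dn s i &≤ eq≤ q))
  ... | no ¬p = ⊥-elim (<⇒≱ (eq≤ (+-comm 1 b) &≤ +-monoʳ-≤ b bz &≤ bud z z<r) (eq≤ (sym e) &≤ low (suc z) (≮⇒≥ ¬p)))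

 Leg : (ℕ -> ℕ) -> List ℕ -> Set
 Leg B w = All (_< r) w × (∀ z -> countN z w ≤ B z)

 Leg-hd : ∀ B z w -> Leg B (z ∷ w) -> z < r × 1 ≤ B z × Leg (B ⊖ (z ∷ [])) w
 Leg-hd B z w (p ∷ ps , c) = p , ≤-trans z<s (subst (\ t -> (if t then suc (countN z w) else countN z w) ≤ B z) (≡ᵇ-refl z) (c z)) , ps ,
  \ y -> ≤-trans (eq≤ (sym (m+n∸m≡n (countN y (z ∷ [])) (countN y w)))) (∸-monoˡ-≤ (countN y (z ∷ [])) (eq≤ (sym (countN-++ y (z ∷ []) w)) &≤ c y))

 ⊖-∷ : ∀ B z w y -> ((B ⊖ (z ∷ [])) ⊖ w) y ≡ (B ⊖ (z ∷ w)) y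
 ⊖-∷ B z w y = ∸-+-assoc (B y) (countN y (z ∷ [])) (countN y w) & cong (B y ∸_) (sym (countN-++ y (z ∷ []) w))

 St-≗ : ∀ {B B' μ} -> (∀ y -> B' y ≡ B y) -> St B μ -> St B' μ
 St-≗ e s = record { par = par ; hd = hd ; low = low ; bud = \ z p -> subst (\ x -> b + x ≤ _) (sym (e z)) (bud z p) }
  where open St s

 Uw-congr : ∀ {B μ} w f g -> St B μ -> Leg B w -> (∀ ν -> St (B ⊖ w) ν -> ∀ n -> f ν n ≡ g ν n) -> ∀ n -> Uw k w f μ n ≡ Uw k w g μ n
 Uw-congr [] f g s l e n = e _ s n
 Uw-congr {B} (z ∷ w) f g s l e n with Leg-hd B z w l
 ... | _ , bz , l' = PS-congr (Uw k w f) (Uw k w g) z s bz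
  (\ ν sν -> Uw-congr w f g sν l' (\ ν' s' -> e ν' (St-≗ (\ y -> sym (⊖-∷ B z w y)) s'))) n

 GoodW : List ℕ -> GF -> Set
 GoodW [] Φ = ⊤
 GoodW (z ∷ w) Φ = Good z (Xw w Φ) × GoodW w Φ

 Uw-Sk : ∀ {B μ} w Φ -> St B μ -> Leg B w -> GoodW w Φ -> ∀ n -> Uw k w (Sk k Φ) μ n ≡ Sk k (Xw w Φ) μ n
 Uw-Sk [] Φ s l g n = refl
 Uw-Sk {B} (z ∷ w) Φ s l (g , gs) n with Leg-hd B z w l
 ... | z<r , bz , l' = PS-congr (Uw k w (Sk k Φ)) (Sk k (Xw w Φ)) z s bz (\ ν sν -> Uw-Sk w Φ sν l' gs) n & PS-Sk (Xw w Φ) z s z<r bz g n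

 -- Antisymmetry within the rows n..r-1 and within the rows from r on, but not across r: exactly
 -- what survives an elementary sum in the letters n..r-1.
 record Full (n : ℕ) (Φ : GF) : Set where
  field
   anti≥ : ∀ i -> r ≤ i -> suc i < ℓ -> Anti ℓ Φ i
   anti< : ∀ i -> n ≤ i -> suc i < r -> Anti ℓ Φ i
   lneg : LastNeg ℓ' Φ

 LastNeg-X : ∀ z Φ -> LastNeg ℓ' Φ -> LastNeg ℓ' (X z Φ)
 LastNeg-X z Φ ln γ q lt = ln _ (length-addAt z (Z.- 1z) γ & q) low
  where low : nthZ (addAt z (Z.- 1z) γ) ℓ' Z.< 0z
        low with ℓ' ≟ z
        ... | no ¬p = subst (Z._< 0z) (sym (nthZ-addAt-≢ ℓ' z (Z.- 1z) γ ¬p)) lt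
        ... | yes refl = subst (Z._< 0z) (sym (nthZ-addAt-≡ ℓ' (Z.- 1z) γ (eq≤ (sym q)))) (ZP.≤-<-trans (ZP.i-j≤i _ 1z) lt)

 -- In a decreasing word the letters applied after z are smaller, so their lowerings touch neither
 -- row z nor row z+1 and the antisymmetry needed at z is still there.
 Desc-GoodW : ∀ {n} w Φ -> Full n Φ -> All (\ z -> n ≤ z × z < r) w -> Desc w -> GoodW w Φ × LastNeg ℓ' (Xw w Φ) × (∀ i -> suc i < ℓ -> All (_< i) w -> Anti ℓ Φ i -> Anti ℓ (Xw w Φ) i)
 Desc-GoodW [] Φ fu _ _ = tt , Full.lneg fu , \ _ _ _ an -> an
 Desc-GoodW (z ∷ w) Φ fu ((n≤z , z<r) ∷ ps) (d ∷ ds) with Desc-GoodW w Φ fu ps ds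
 ... | gs , ln , far = (g , gs) , LastNeg-X z (Xw w Φ) ln , \ { i p (z<i ∷ w<i) an -> Anti-X ℓ (Xw w Φ) z i p (<⇒≢ z<i) (<⇒≢ (m<n⇒m<1+n z<i)) (far i p w<i an) }
  where
  g : Good z (Xw w Φ)
  g = record { anti≥ = \ i p q -> far i q (All.map (\ (y : _ × _) -> <-≤-trans (proj₂ y) p) ps) (Full.anti≥ fu i p q)
   ; antiz = \ p -> far z (<-≤-trans p r≤ℓ) d (Full.anti< fu z n≤z p) ; lneg = ln }

 Full-EE : ∀ n c m Φ -> n + c ≡ r -> Full n Φ -> Full n (EE (seg n c) m Φ)
 Full-EE n c m Φ q fu = record
  { anti≥ = \ i p lt -> Anti-EE-far ℓ (seg n c) m Φ i lt (\ j -> inj₂ (<-≤-trans (proj₂ (∈-seg n c j)) (eq≤ q &≤ p))) (Full.anti≥ fu i p lt)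
  ; anti< = \ i p lt -> Anti-EE ℓ n c m Φ i (<-≤-trans lt r≤ℓ) p (subst (suc i <_) (sym q) lt) (\ j u v -> Full.anti< fu j u (subst (suc j <_) q v))
  ; lneg = ln (seg n c) m Φ (Full.lneg fu) }
  where
  ln : ∀ ls m Φ -> LastNeg ℓ' Φ -> LastNeg ℓ' (EE ls m Φ)
  ln ls zero Φ h = h
  ln [] (suc m) Φ h γ _ _ _ = refl
  ln (z ∷ ls) (suc m) Φ h γ p q n = cong₂ Z._+_ (ln ls (suc m) Φ h γ p q n) (ln ls m (X z Φ) (LastNeg-X z Φ h) γ p q n)

 count≤ : ∀ {B : ℕ -> ℕ} {n w} -> All (\ z -> n ≤ z × z < r) w -> (∀ y -> countN y w ≤ 1) -> (∀ y -> n ≤ y -> y < r -> 1 ≤ B y) -> ∀ y -> countN y w ≤ B y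
 count≤ {B} {n} {w} a u bs y with countN y w in e
 ... | zero = z≤n
 ... | suc x = subst (_≤ 1) e (u y) &≤ go w a (subst (0 <_) (sym e) z<s)
  where go : ∀ w -> All (\ z -> n ≤ z × z < r) w -> 0 < countN y w -> 1 ≤ B y
        go (z ∷ w) (p ∷ ps) h with y ≡ᵇ z in e'
        ... | true = subst (\ t -> 1 ≤ B t) (sym (≡ᵇ-true {y} {z} e')) (bs z (proj₁ p) (proj₂ p))
        ... | false = go w ps h

 ∑U : List (List ℕ) -> (List ℕ -> Seq) -> List ℕ -> Seq
 ∑U Ws f μ n = ∑ Ws (\ w -> Uw k w f μ n)

 ∑U-Sk : ∀ {B μ} n c m Φ -> n + c ≡ r -> St B μ -> (∀ y -> n ≤ y -> y < r -> 1 ≤ B y) -> Full n Φ -> ∀ i ->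
  ∑U (Dec↓ (seg n c) m) (Sk k Φ) μ i ≡ Sk k (EE (seg n c) m Φ) μ i
 ∑U-Sk {B} {μ} n c m Φ q s bs fu i = ∑-cong∈ (Dec↓ (seg n c) m) (\ w j -> one w (Dec↓-spec n c m j)) &
  sym (H-∑ (kRoots k μ) (Dec↓ (seg n c) m) (\ w -> Xw w Φ) (toZ μ) i) &
   H-cong (kRoots k μ) (length (toZ μ)) (\ γ _ -> ∑-Dec↓ (seg n c) m Φ γ) (toZ μ) refl i
  where
  one : ∀ w -> All (\ z -> n ≤ z × z < n + c) w × Desc w × (∀ y -> countN y w ≤ 1) -> Uw k w (Sk k Φ) μ i ≡ Sk k (Xw w Φ) μ i
  one w (a , d , u) = Uw-Sk w Φ s (All.map proj₂ a' , cnt) (proj₁ (Desc-GoodW w Φ fu a' d)) i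
   where
   a' : All (\ z -> n ≤ z × z < r) w
   a' = All.map (\ (y : _ × _) -> proj₁ y , subst (_ <_) q (proj₂ y)) a
   cnt = count≤ {B} a' u bs

 probe-Full : ∀ λ' a -> Full 0 (\ γ -> sh a (sF (coeffFun λ') γ))
 probe-Full λ' a = record { anti≥ = \ i _ -> an i ; anti< = \ i _ p -> an i (<-≤-trans p r≤ℓ)
  ; lneg = \ γ q lt n -> trans (sh-cong a n (\ m -> sF-rowNeg (coeffFun λ') γ ℓ' m (eq≤ (sym q)) (neg γ q lt))) (sh-0 a n) }
  where
  an : ∀ i -> suc i < ℓ -> Anti ℓ (\ γ -> sh a (sF (coeffFun λ') γ)) i
  an i p γ q n = sh-cong a n (\ m -> sF-dotAt (coeffFun λ') (Symm-coeff λ') i γ m (subst (suc i <_) (sym q) p) & sym (ZP.-1*i≡-i _)) & sh-* a (Z.- 1z) (sF (coeffFun λ') γ) n & ZP.-1*i≡-i _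
  neg : ∀ γ -> length γ ≡ ℓ -> nthZ γ ℓ' Z.< 0z -> nthZ γ ℓ' Z.+ + length γ Z.≤ + ℓ'
  neg γ q lt = subst₂ Z._≤_ (lem (nthZ γ ℓ') (+ ℓ') & cong (\ x -> nthZ γ ℓ' Z.+ + x) (sym q)) (+0ˡ (+ ℓ')) (ZP.+-monoˡ-≤ (+ ℓ') (ZP.i<j⇒suc[i]≤j lt))
   where lem : ∀ z l -> (1z Z.+ z) Z.+ l ≡ z Z.+ (1z Z.+ l)
         lem = solve-∀

 -- The probes are themselves fully antisymmetric, so an identity checked on such functions makes
 -- all probes of the difference vanish, and the combination vanishes formally.
 formalU : ∀ Ws Ws' μ n -> Par k ℓ μ -> (∀ Φ -> Full 0 Φ -> ∑U Ws (Sk k Φ) μ n ≡ ∑U Ws' (Sk k Φ) μ n) -> ∀ f -> ∑U Ws f μ n ≡ ∑U Ws' f μ n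
 formalU Ws Ws' μ n par h f = ZP.i-j≡0⇒i≡j _ _ (sym (split f) & Formal.formal k ℓ (length L) L ≤-refl
  (All.tabulate ok) (\ λ' a -> split (Formal.probe k ℓ λ' a) & ZP.i≡j⇒i-j≡0 (h _ (probe-Full λ' a))) f)
  where
  tag : ℤ -> List (List ℕ) -> List Term
  tag c Ws = map (\ νi -> c , νi) (concatMap (\ w -> Lw k w μ n) Ws)
  L = tag 1z Ws ++ tag (Z.- 1z) Ws'
  pair-tag : ∀ c Ws f -> pair (tag c Ws) f ≡ c Z.* ∑U Ws f μ n
  pair-tag c Ws f = ∑-map (\ νi -> c , νi) (concatMap (\ w -> Lw k w μ n) Ws) _ & ∑-* c (concatMap (\ w -> Lw k w μ n) Ws) _ &
   cong (c Z.*_) (∑-concatMap (\ w -> Lw k w μ n) Ws _ & ∑-cong Ws (\ w -> sym (sumT-Lw k w μ n f)))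
  split : ∀ f -> pair L f ≡ ∑U Ws f μ n Z.- ∑U Ws' f μ n
  split f = ∑-++ (tag 1z Ws) _ _ & cong₂ Z._+_ (pair-tag 1z Ws f & ZP.*-identityˡ _) (pair-tag (Z.- 1z) Ws' f & ZP.-1*i≡-i _)
  okT : ∀ c Ws {t} -> t ∈ tag c Ws -> Formal.OK k ℓ t
  okT c Ws i with MP.∈-map⁻ (\ νi -> c , νi) i
  ... | νi , j , refl with ∈-concatMap⁻ (\ w -> Lw k w μ n) Ws j
  ... | w , _ , j' with Par-Lw k ℓ w μ n par j'
  ... | p = Par.len p , Par-Decr _ (Par.mono p)
  ok : ∀ {t} -> t ∈ L -> Formal.OK k ℓ t
  ok i with MP.∈-++⁻ (tag 1z Ws) i
  ... | inj₁ j = okT 1z Ws j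
  ... | inj₂ j = okT (Z.- 1z) Ws' j

 -- The lowering of a row at distance at least 2 does not disturb the antisymmetry needed for the
 -- other letter, so either order lowers the weight by ε_p + ε_q.
 far-comm : ∀ {B μ} p q -> St B μ -> suc p < q -> q < r -> 1 ≤ B p -> 1 ≤ B q -> ∀ f n -> Uw k (p ∷ q ∷ []) f μ n ≡ Uw k (q ∷ p ∷ []) f μ n
 far-comm {B} {μ} p q s lt q<r bp bq f n = sym (+0ʳ _) & formalU ((p ∷ q ∷ []) ∷ []) ((q ∷ p ∷ []) ∷ []) μ n (St.par s) h f & +0ʳ _
  where
  p<q = <-trans (n<1+n p) lt
  cnt : ∀ a b' -> a < b' ⊎ b' < a -> ∀ y -> 1 ≤ B a -> 1 ≤ B b' -> countN y (a ∷ b' ∷ []) ≤ B y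
  cnt a b' ne y u v with y ≡ᵇ a in e | y ≡ᵇ b' in e'
  ... | false | false = z≤n
  ... | false | true = subst (\ t -> 1 ≤ B t) (sym (≡ᵇ-true {y} {b'} e')) v
  ... | true | false = subst (\ t -> 1 ≤ B t) (sym (≡ᵇ-true {y} {a} e)) u
  ... | true | true with trans (sym (≡ᵇ-true {y} {a} e)) (≡ᵇ-true {y} {b'} e') | ne
  ... | refl | inj₁ x = ⊥-elim (<-irrefl refl x)
  ... | refl | inj₂ x = ⊥-elim (<-irrefl refl x)
  good : ∀ z y Φ -> z < r -> y < r -> Full 0 Φ -> z ≢ y -> suc z ≢ y -> GoodW (z ∷ y ∷ []) Φ
  good z y Φ z<r y<r fu ne ne' = record { anti≥ = \ i u v -> Anti-X ℓ Φ y i v (<⇒≢ (<-≤-trans y<r u)) (<⇒≢ (m<n⇒m<1+n (<-≤-trans y<r u))) (Full.anti≥ fu i u v)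
   ; antiz = \ u -> Anti-X ℓ Φ y z (<-≤-trans u r≤ℓ) (ne ∘ sym) (ne' ∘ sym) (Full.anti< fu z z≤n u) ; lneg = LastNeg-X y Φ (Full.lneg fu) }
   , record { anti≥ = Full.anti≥ fu ; antiz = Full.anti< fu y z≤n ; lneg = Full.lneg fu } , tt
  p<r = <-trans p<q q<r
  h : ∀ Φ -> Full 0 Φ -> ∑U ((p ∷ q ∷ []) ∷ []) (Sk k Φ) μ n ≡ ∑U ((q ∷ p ∷ []) ∷ []) (Sk k Φ) μ n
  h Φ fu = cong (\ z -> z Z.+ 0z) (Uw-Sk (p ∷ q ∷ []) Φ s (p<r ∷ q<r ∷ [] , \ y -> cnt p q (inj₁ p<q) y bp bq) (good p q Φ p<r q<r fu (<⇒≢ p<q) (<⇒≢ lt)) n &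
   H-cong (kRoots k μ) (length (toZ μ)) (\ γ _ i -> cong (\ g -> Φ g i) (addAt-comm q p _ _ γ)) (toZ μ) refl n &
    sym (Uw-Sk (q ∷ p ∷ []) Φ s (q<r ∷ p<r ∷ [] , \ y -> cnt q p (inj₂ p<q) y bq bp) (good q p Φ q<r p<r fu (>⇒≢ p<q) (>⇒≢ (<-trans p<q (n<1+n q)))) n))

 prod : List (List ℕ) -> List (List ℕ) -> List (List ℕ)
 prod Ws Ws' = concatMap (\ w -> map (w ++_) Ws') Ws

 ∑U-prod : ∀ Ws Ws' f μ n -> ∑U (prod Ws Ws') f μ n ≡ ∑U Ws (∑U Ws' f) μ n
 ∑U-prod Ws Ws' f μ n = ∑-concatMap (\ w -> map (w ++_) Ws') Ws _ & ∑-cong Ws (\ w -> ∑-map (w ++_) Ws' _ &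
  ∑-cong Ws' (\ w' -> Uw-++ k w w' f μ n) & sym (Uw-∑ k w Ws' (\ w' -> Uw k w' f) μ n))

 -- Each factor uses a letter at most once, whence the budget 2. The inner elementary sum is
 -- antisymmetric again, so the outer one also acts by lowering the weight, and lowerings commute.
 e-comm : ∀ {B μ} n c m l -> n + c ≡ r -> St B μ -> (∀ y -> n ≤ y -> y < r -> 2 ≤ B y) -> ∀ f i ->
  ∑U (prod (Dec↓ (seg n c) m) (Dec↓ (seg n c) l)) f μ i ≡ ∑U (prod (Dec↓ (seg n c) l) (Dec↓ (seg n c) m)) f μ i
 e-comm {B} {μ} n c m l q s bs f i = formalU (prod (Dec↓ ls m) (Dec↓ ls l)) (prod (Dec↓ ls l) (Dec↓ ls m)) μ i (St.par s) (\ Φ fu -> val m l Φ fu & H-cong (kRoots k μ) (length (toZ μ)) (\ γ _ -> EE-comm (seg n c) m l Φ γ) (toZ μ) refl i & sym (val l m Φ fu)) f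
  where
  ls = seg n c
  val : ∀ m l Φ -> Full 0 Φ -> ∑U (prod (Dec↓ ls m) (Dec↓ ls l)) (Sk k Φ) μ i ≡ Sk k (EE ls m (EE ls l Φ)) μ i
  val m l Φ fu = ∑U-prod (Dec↓ ls m) (Dec↓ ls l) (Sk k Φ) μ i & ∑-cong∈ (Dec↓ ls m) (\ w j -> inner w (Dec↓-spec n c m j)) &
   ∑U-Sk n c m (EE ls l Φ) q s (\ y u v -> z<s &≤ bs y u v) (Full-EE n c l Φ q fun) i
   where
   fun : Full n Φ
   fun = record { anti≥ = Full.anti≥ fu ; anti< = \ i _ -> Full.anti< fu i z≤n ; lneg = Full.lneg fu }
   inner : ∀ w -> All (\ z -> n ≤ z × z < n + c) w × Desc w × (∀ y -> countN y w ≤ 1) -> Uw k w (∑U (Dec↓ ls l) (Sk k Φ)) μ i ≡ Uw k w (Sk k (EE ls l Φ)) μ i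
   inner w (a , d , u) = Uw-congr w _ _ s (All.map (\ (y : _ × _) -> subst (_ <_) q (proj₂ y)) a , cnt) (\ ν sν i' -> ∑U-Sk n c l Φ q sν (\ y p p' -> ∸-monoˡ-≤ 1 (bs y p p') &≤ ∸-monoʳ-≤ (B y) (u y)) fun i') i
    where
    cnt = count≤ {B} (All.map (\ (y : _ × _) -> proj₁ y , subst (_ <_) q (proj₂ y)) a) u (\ y p p' -> z<s &≤ bs y p p')

-- Cores: coreL k μ lists the rows of the (k+1)-core κ with 𝔭(κ) = μ.  Row i of κ exceeds μ_i by
-- the length of row dn i, because the bead of row dn i lies k+1 below that of row i.

coreL : ℕ -> List ℕ -> List ℕ
coreL k [] = []
coreL k (x ∷ μ) = (x + nthN (coreL k μ) (k ∸ x)) ∷ coreL k μ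

core-eq : ∀ k μ i -> nthN (coreL k μ) i ≡ nthN μ i + nthN (coreL k μ) (dn k μ i)
core-eq k [] i = refl
core-eq k (x ∷ μ) zero = refl
core-eq k (x ∷ μ) (suc i) = core-eq k μ i

length-coreL : ∀ k μ -> length (coreL k μ) ≡ length μ
length-coreL k [] = refl
length-coreL k (x ∷ μ) = cong suc (length-coreL k μ)

i<dn : ∀ k μ i -> i < dn k μ i
i<dn k μ i = eq≤ (+-comm 1 i) &≤ +-monoʳ-≤ i z<s

module Core (k ℓ : ℕ) (μ : List ℕ) (par : Par k ℓ μ) where
 open Par par public
 M K d : ℕ -> ℕ
 M = nthN μ
 K = nthN (coreL k μ)
 d = dn k μ

 K-beyond : ∀ i -> ℓ ≤ i -> K i ≡ 0
 K-beyond i p = nthN-beyond (coreL k μ) i (eq≤ (length-coreL k μ & len) &≤ p)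

 M-beyond : ∀ i -> ℓ ≤ i -> M i ≡ 0
 M-beyond i p = nthN-beyond μ i (eq≤ len &≤ p)

 d+M : ∀ i -> d i + M i ≡ i + suc k
 d+M i = +-assoc i (suc (k ∸ M i)) (M i) & cong (\ x -> i + suc x) (m∸n+n≡m (bound i))

 M-anti : ∀ {i j} -> i ≤ j -> M j ≤ M i
 M-anti {i} {j} p with m≤n⇒m<n∨m≡n p
 ... | inj₂ refl = ≤-refl
 M-anti {i} {suc j} p | inj₁ (s≤s q) = mono j &≤ M-anti q

 d-mono : ∀ {i j} -> i ≤ j -> d i ≤ d j
 d-mono p = +-mono-≤ p (s≤s (∸-monoʳ-≤ k (M-anti p)))

 d-mono< : ∀ {i j} -> i < j -> d i < d j
 d-mono< {i} {j} p = +-mono-<-≤ p (s≤s (∸-monoʳ-≤ k (M-anti (<⇒≤ p))))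

 d-inj : ∀ {i j} -> d i ≡ d j -> i ≡ j
 d-inj {i} {j} e with <-cmp i j
 ... | tri< a _ _ = ⊥-elim (<⇒≢ (d-mono< a) e)
 ... | tri≈ _ b _ = b
 ... | tri> _ _ c = ⊥-elim (>⇒≢ (d-mono< c) e)

 K-anti : ∀ {i j} -> i ≤ j -> K j ≤ K i
 K-anti {i} p = go ℓ i _ (m≤n+m ℓ i) p
  where
  go : ∀ N i j -> ℓ ≤ i + N -> i ≤ j -> K j ≤ K i
  go zero i j b p = eq≤ (K-beyond j ((b &≤ eq≤ (+-identityʳ i)) &≤ p)) &≤ z≤n
  go (suc N) i j b p = subst₂ _≤_ (sym (core-eq k μ j)) (sym (core-eq k μ i)) (+-mono-≤ (M-anti p)
   (go N (d i) (d j) (b &≤ eq≤ (+-suc i N) &≤ +-monoˡ-≤ N (i<dn k μ i)) (d-mono p)))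

 M≤K : ∀ i -> M i ≤ K i
 M≤K i = m≤m+n (M i) (K (d i)) &≤ eq≤ (sym (core-eq k μ i))

 -- The beads K x - x are strictly decreasing in x.
 bead-inj : ∀ {x y} -> K x + y ≡ K y + x -> x ≡ y
 bead-inj {x} {y} e with <-cmp x y
 ... | tri≈ _ b _ = b
 ... | tri< a _ _ = ⊥-elim (<⇒≢ (+-mono-≤-< (K-anti (<⇒≤ a)) a) (sym e))
 ... | tri> _ _ c = ⊥-elim (<⇒≢ (+-mono-≤-< (K-anti (<⇒≤ c)) c) e)

 -- The bead of row d i lies k+1 below that of row i, written additively to avoid truncated
 -- subtraction.
 bead-d : ∀ i -> K (d i) + i + suc k ≡ K i + d i
 bead-d i = +-assoc (K (d i)) i (suc k) &
  cong (\ x -> K (d i) + x) (sym (d+M i)) &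
  lem (K (d i)) (d i) (M i) &
  cong (\ x -> x + d i) (sym (core-eq k μ i))
  where open ≡-Reasoning
        lem : ∀ a b c -> a + (b + c) ≡ c + a + b
        lem = NRing.solve-∀

 -- Row z is reached from row i by iterating d, that is, going down the runner of row i.
 data Up (z : ℕ) : ℕ -> Set where
  base : Up z z
  step : ∀ {i} -> Up z (d i) -> Up z i

 Up≤ : ∀ {z i} -> Up z i -> i ≤ z
 Up≤ base = ≤-refl
 Up≤ (step u) = <⇒≤ (i<dn k μ _) &≤ Up≤ u

 -- The row j steps further along d is the one whose bead is j(k+1) lower; as beads are distinct,
 -- this recognises it by its bead alone.
 climb : ∀ j i -> ∃[ y ] (i ≤ y × K y + i + j * suc k ≡ K i + y × (∀ z -> Up z y -> Up z i))
 climb zero i = i , ≤-refl , +-identityʳ _ , \ _ u -> u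
 climb (suc j) i with climb j (d i)
 ... | y , p , e , f = y , ≤-trans (<⇒≤ (i<dn k μ i)) p , +-cancelʳ-≡ (d i) _ _ eq , \ z u -> step (f z u)
  where
  eq : K y + i + (suc k + j * suc k) + d i ≡ K i + y + d i
  eq = lem (K y) i (suc k) (j * suc k) (d i) &
   cong (\ x -> x + i + suc k) e &
   lem2 (K (d i)) y i (suc k) &
   cong (\ x -> x + y) (bead-d i) &
   lem3 (K i) (d i) y
   where lem : ∀ a b c d e -> a + b + (c + d) + e ≡ a + e + d + b + c
         lem = NRing.solve-∀
         lem2 : ∀ a b c d -> a + b + c + d ≡ a + c + d + b
         lem2 = NRing.solve-∀
         lem3 : ∀ a b c -> a + b + c ≡ a + c + b
         lem3 = NRing.solve-∀

 Up-bead : ∀ {z i} -> Up z i -> ∃[ a ] (K z + i + a * suc k ≡ K i + z)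
 Up-bead base = 0 , +-identityʳ _
 Up-bead {z} {i} (step u) with Up-bead u
 ... | a , e = suc a , +-cancelʳ-≡ (d i) _ _ eq
  where
  eq : K z + i + (suc k + a * suc k) + d i ≡ K i + z + d i
  eq = lem (K z) i (suc k) (a * suc k) (d i) &
   cong (\ x -> x + i + suc k) e &
   lem2 (K (d i)) z i (suc k) &
   cong (\ x -> x + z) (bead-d i) &
   lem3 (K i) (d i) z
   where lem : ∀ a b c d e -> a + b + (c + d) + e ≡ a + e + d + b + c
         lem = NRing.solve-∀
         lem2 : ∀ a b c d -> a + b + c + d ≡ a + c + d + b
         lem2 = NRing.solve-∀
         lem3 : ∀ a b c -> a + b + c ≡ a + c + b
         lem3 = NRing.solve-∀

 -- Removing a box of μ in row z lowers the rows of κ above z on the same runner by s.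
 module Rem (z : ℕ) (lt : M (suc z) < M z) where
  μ' = decAt z μ
  par' = Par-decAt z par lt
  K' : ℕ -> ℕ
  K' = nthN (coreL k μ')
  -- Row z loses the removed box and now adds the length of row d z + 1 instead of row d z.
  s = suc (K (d z) ∸ K (suc (d z)))

  d'≢ : ∀ i -> i ≢ z -> dn k μ' i ≡ d i
  d'≢ i p = cong (\ x -> i + suc (k ∸ x)) (nthN-decAt-≢ i z μ p)

  K'≢ : ∀ i -> i ≢ z -> K' i ≡ M i + K' (d i)
  K'≢ i p = core-eq k μ' i & cong₂ (\ a b -> a + K' b) (nthN-decAt-≢ i z μ p) (d'≢ i p)

  d'z : dn k μ' z ≡ suc (d z)
  d'z = cong (\ x -> z + suc (k ∸ x)) (nthN-decAt-≡ z μ) & cong (\ x -> z + suc x) (go (M z) (z<s &≤ lt) (bound z)) & +-suc z _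
   where go : ∀ x -> 1 ≤ x -> x ≤ k -> k ∸ (x ∸ 1) ≡ suc (k ∸ x)
         go (suc x) _ p = +-∸-assoc 1 p

  K'> : ∀ i -> z < i -> K' i ≡ K i
  K'> i p = go ℓ i (m≤n+m ℓ i) p
   where
   go : ∀ N i -> ℓ ≤ i + N -> z < i -> K' i ≡ K i
   go zero i b p = nthN-beyond (coreL k μ') i (eq≤ (length-coreL k μ' & length-decAt z μ & len) &≤ b') & sym (K-beyond i b')
    where b' = b &≤ eq≤ (+-identityʳ i)
   go (suc N) i b p = K'≢ i (>⇒≢ p) & cong (\ x -> M i + x) (go N (d i) (b &≤ eq≤ (+-suc i N) &≤ +-monoˡ-≤ N (i<dn k μ i)) (<-trans p (i<dn k μ i))) &
    sym (core-eq k μ i)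

  K'z : suc (K' z) ≡ M z + K (suc (d z))
  K'z = cong suc (core-eq k μ' z & cong₂ (\ a b -> a + K' b) (nthN-decAt-≡ z μ) d'z) &
   cong (\ x -> suc (M z ∸ 1 + x)) (K'> (suc (d z)) (m<n⇒m<1+n (i<dn k μ z))) & cong (\ x -> x + K (suc (d z))) (m+[n∸m]≡n (z<s &≤ lt))

  at-z : K z ≡ K' z + s
  at-z = suc-injective (cong suc (core-eq k μ z) &
   cong (\ x -> suc (M z + x)) (sym (m+[n∸m]≡n (K-anti (n≤1+n (d z))))) &
   lem (M z) _ _ &
   cong (\ x -> x + s) (sym K'z))
   where open ≡-Reasoning
         lem : ∀ a b c -> suc (a + (b + c)) ≡ a + b + suc c
         lem = NRing.solve-∀

  -- The change at z propagates through K i = M i + K (d i), so it reaches exactly the rows whose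
  -- d-orbit passes through z, always with the same amount.
  dich : ∀ i -> (Up z i × K i ≡ K' i + s) ⊎ (K i ≡ K' i)
  dich i = go ℓ i (m≤n+m ℓ i)
   where
   go : ∀ N i -> ℓ ≤ i + N -> (Up z i × K i ≡ K' i + s) ⊎ (K i ≡ K' i)
   go N i b with <-cmp i z
   ... | tri> _ _ c = inj₂ (sym (K'> i c))
   ... | tri≈ _ refl _ = inj₁ (base , at-z)
   go zero i b | tri< a _ _ = ⊥-elim (<⇒≱ a (<⇒≤ z<ℓ &≤ b &≤ eq≤ (+-identityʳ i)))
    where z<ℓ : z < ℓ
          z<ℓ with z <? ℓ
          ... | yes p = p
          ... | no ¬p = ⊥-elim (<⇒≱ (z<s &≤ lt) (eq≤ (M-beyond z (≮⇒≥ ¬p))))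
   go (suc N) i b | tri< a _ _ with go N (d i) (b &≤ eq≤ (+-suc i N) &≤ +-monoˡ-≤ N (i<dn k μ i))
   ... | inj₁ (u , e) = inj₁ (step u , trans (core-eq k μ i) (cong (\ x -> M i + x) e & sym (+-assoc (M i) _ s) & cong (\ x -> x + s) (sym (K'≢ i (<⇒≢ a)))))
   ... | inj₂ e = inj₂ (core-eq k μ i & cong (\ x -> M i + x) e & sym (K'≢ i (<⇒≢ a)))

  K'≤K : ∀ i -> K' i ≤ K i
  K'≤K i with dich i
  ... | inj₁ (_ , e) = m≤m+n _ s &≤ eq≤ (sym e)
  ... | inj₂ e = eq≤ (sym e)

  Up-lower : ∀ {i} -> Up z i -> K i ≡ K' i + s
  Up-lower base = at-z
  Up-lower {i} (step u) = core-eq k μ i & cong (\ x -> M i + x) (Up-lower u) & sym (+-assoc (M i) _ s) & cong (\ x -> x + s) (sym (K'≢ i (<⇒≢ (<-≤-trans (i<dn k μ i) (Up≤ u)))))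

  -- The lowered row i is still at least as long as row i+1 was, so the removed pieces are
  -- horizontal and lie in separate components.
  isolated : ∀ {i} -> Up z i -> K (suc i) ≤ K' i
  isolated base = ≤-pred (subst₂ _≤_ (cong suc (sym (core-eq k μ (suc z)))) (sym K'z) (+-mono-≤ lt (K-anti (d-mono< ≤-refl))))
  isolated {i} (step u) = subst₂ _≤_ (sym (core-eq k μ (suc i))) (sym (K'≢ i (<⇒≢ (<-≤-trans (i<dn k μ i) (Up≤ u)))))
   (+-mono-≤ (mono i) (K-anti (d-mono< ≤-refl) &≤ isolated u))

  corner : ∀ {i} -> Up z i -> K (suc i) < K i
  corner u = s≤s (isolated u) &≤ (eq≤ (+-comm 1 _) &≤ +-monoʳ-≤ _ z<s) &≤ eq≤ (sym (Up-lower u))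

sum-decAt : ∀ z μ -> 0 < nthN μ z -> suc (sum (decAt z μ)) ≡ sum μ
sum-decAt zero (suc x ∷ μ) p = refl
sum-decAt (suc z) (x ∷ μ) p = sym (+-suc x _) & cong (\ y -> x + y) (sum-decAt z μ p)

nthN-ext : ∀ a b -> length a ≡ length b -> (∀ i -> nthN a i ≡ nthN b i) -> a ≡ b
nthN-ext [] [] q e = refl
nthN-ext (x ∷ a) (y ∷ b) q e = cong₂ _∷_ (e 0) (nthN-ext a b (suc-injective q) (e ∘ suc))

last-such : ∀ {P : ℕ -> Set} -> (∀ i -> Dec (P i)) -> ∀ N -> (∀ i -> i < N -> ¬ P i) ⊎ (∃[ m ] (m < N × P m × (∀ i -> i < N -> P i -> i ≤ m)))
last-such P? zero = inj₁ (\ _ ())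
last-such P? (suc N) with P? N
... | yes p = inj₂ (N , n<1+n N , p , \ i q _ -> ≤-pred q)
... | no ¬p with last-such P? N
... | inj₁ f = inj₁ \ i q h -> case i q h (m≤n⇒m<n∨m≡n (≤-pred q))
 where case : ∀ i -> i < suc N -> _ -> i < N ⊎ i ≡ N -> ⊥
       case i q h (inj₁ l) = f i l h
       case i q h (inj₂ refl) = ¬p h
... | inj₂ (m , l , h , g) = inj₂ (m , m<n⇒m<1+n l , h , \ i q h' -> case i h' (m≤n⇒m<n∨m≡n (≤-pred q)))
 where case : ∀ i -> _ -> i < N ⊎ i ≡ N -> i ≤ m
       case i h' (inj₁ l') = g i l' h'
       case i h' (inj₂ refl) = ⊥-elim (¬p h')

-- Containment of cores is monotone for |𝔭|, strictly: remove all corners of the residue of the last row.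
core-mono : ∀ N k ℓ μ η -> sum μ ≤ N -> Par k ℓ μ -> Par k ℓ η -> (∀ i -> nthN (coreL k η) i ≤ nthN (coreL k μ) i) ->
 sum η ≤ sum μ × (sum η ≡ sum μ -> η ≡ μ)
core-mono N k ℓ μ η b pμ pη le with last-such (\ i -> 0 <? nthN μ i) ℓ
... | inj₁ zero-μ = ≤-trans (eq≤ sη) z≤n , \ _ -> nthN-ext η μ (CE.len & sym CM.len) (\ i -> η0 i & sym (μ0 i))
 where
 module CM = Core k ℓ μ pμ
 module CE = Core k ℓ η pη
 μ0 : ∀ i -> nthN μ i ≡ 0
 μ0 i with i <? ℓ
 ... | yes p = n≤0⇒n≡0 (≮⇒≥ (zero-μ i p))
 ... | no ¬p = CM.M-beyond i (≮⇒≥ ¬p)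
 K0 : ∀ i -> CM.K i ≡ 0
 K0 i = go ℓ i (m≤n+m ℓ i)
  where
  go : ∀ N i -> ℓ ≤ i + N -> CM.K i ≡ 0
  go zero i q = CM.K-beyond i (q &≤ eq≤ (+-identityʳ i))
  go (suc N) i q = core-eq k μ i & cong₂ _+_ (μ0 i) (go N (CM.d i) (q &≤ eq≤ (+-suc i N) &≤ +-monoˡ-≤ N (i<dn k μ i)))
 η0 : ∀ i -> nthN η i ≡ 0
 η0 i = n≤0⇒n≡0 (CE.M≤K i &≤ le i &≤ eq≤ (K0 i))
 sum0 : ∀ l -> (∀ i -> nthN l i ≡ 0) -> sum l ≡ 0
 sum0 [] e = refl
 sum0 (x ∷ l) e = cong₂ _+_ (e 0) (sum0 l (e ∘ suc))
 sη = sum0 η η0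
core-mono N k ℓ μ η b pμ pη le | inj₂ (z , z<ℓ , Mz , lastz) = main N b
 where
 module CM = Core k ℓ μ pμ
 module CE = Core k ℓ η pη
 open CM using (M; K; d)
 L = CE.K
 M0 : ∀ i -> z < i -> M i ≡ 0
 M0 i p with i <? ℓ
 ... | no ¬q = CM.M-beyond i (≮⇒≥ ¬q)
 ... | yes q = n≤0⇒n≡0 (≮⇒≥ (\ h -> <⇒≱ p (lastz i q h)))
 lt : M (suc z) < M z
 lt = subst (_< M z) (sym (M0 (suc z) ≤-refl)) Mz
 module R = CM.Rem z lt
 K0 : ∀ i -> z < i -> K i ≡ 0
 K0 i p = go ℓ i (m≤n+m ℓ i) p
  where
  go : ∀ N i -> ℓ ≤ i + N -> z < i -> K i ≡ 0
  go zero i q p = CM.K-beyond i (q &≤ eq≤ (+-identityʳ i))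
  go (suc N) i q p = core-eq k μ i & cong₂ _+_ (M0 i p) (go N (d i) (q &≤ eq≤ (+-suc i N) &≤ +-monoˡ-≤ N (i<dn k μ i)) (<-trans p (i<dn k μ i)))
 -- z is the last nonempty row, so the rows d z and d z + 1 of the core are empty.
 s≡1 : R.s ≡ 1
 s≡1 = cong suc (cong (_∸ K (suc (d z))) (K0 (d z) (i<dn k μ z)) & 0∸n≡0 (K (suc (d z))))
 -- Rows that lose their corner in the core of μ while the core of η still contains it.
 Bad : ℕ -> Set
 Bad i = R.K' i < K i × L i ≡ K i
 Bad? : ∀ i -> Dec (Bad i)
 Bad? i with R.K' i <? K i | L i ≟ K i
 ... | yes p | yes q = yes (p , q)
 ... | no p | _ = no (p ∘ proj₁)
 ... | yes _ | no q = no (q ∘ proj₂)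
 sμ : suc (sum R.μ') ≡ sum μ
 sμ = sum-decAt z μ Mz
 ok : ∀ i -> ¬ Bad i -> L i ≤ R.K' i
 ok i ¬b with R.dich i
 ... | inj₂ e = le i &≤ eq≤ e
 ... | inj₁ (u , e) = ≤-pred (≤∧≢⇒< (le i) (\ t -> ¬b (lt' , t)) &≤ eq≤ (e & cong (\ x -> R.K' i + x) s≡1 & +-comm _ 1))
  where lt' : R.K' i < K i
        lt' = eq≤ (sym (e & cong (\ x -> R.K' i + x) s≡1 & +-comm _ 1))
 Bad<ℓ : ∀ i -> Bad i -> i < ℓ
 Bad<ℓ i (p , _) with i <? ℓ
 ... | yes q = q
 ... | no ¬q = ⊥-elim (<⇒≱ p (eq≤ (CM.K-beyond i (≮⇒≥ ¬q)) &≤ z≤n))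
 BadUp : ∀ i -> Bad i -> CM.Up z i
 BadUp i (p , _) with R.dich i
 ... | inj₁ (u , _) = u
 ... | inj₂ e = ⊥-elim (<-irrefl (sym e) p)
 -- Follows corners of the core of η down the runner to the last one; removing there takes a single
 -- box from each affected row.
 walk : ∀ F x -> ℓ ≤ x + F -> L (suc x) < L x -> ∃[ z' ] (x ≤ z' × CE.Up z' x × L (suc z') < L z' × L (CE.d z') ≡ L (suc (CE.d z')))
 walk zero x q c = ⊥-elim (<⇒≱ c (eq≤ (CE.K-beyond x (q &≤ eq≤ (+-identityʳ x))) &≤ z≤n))
 walk (suc F) x q c with L (suc (CE.d x)) <? L (CE.d x)
 ... | no ¬p = x , ≤-refl , CE.base , c , ≤-antisym (≮⇒≥ ¬p) (CE.K-anti (n≤1+n _))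
 ... | yes p with walk F (CE.d x) (q &≤ eq≤ (+-suc x F) &≤ +-monoˡ-≤ F (i<dn k η x)) p
 ... | z' , a , u , c' , e = z' , ≤-trans (<⇒≤ (i<dn k η x)) a , CE.step u , c' , e
 main : ∀ N -> sum μ ≤ N -> sum η ≤ sum μ × (sum η ≡ sum μ -> η ≡ μ)
 main zero b = ⊥-elim (<⇒≱ (subst (0 <_) sμ z<s) b)
 main (suc N) b with last-such Bad? ℓ
 -- The core of η fits into the smaller core, so its size is strictly below that of μ.
 ... | inj₁ none = <⇒≤ less , \ e -> ⊥-elim (<⇒≢ less e)
  where
  ih = core-mono N k ℓ R.μ' η (≤-pred (eq≤ sμ &≤ b)) R.par' pη (\ i -> ok i (\ h -> none i (Bad<ℓ i h) h))
  less : sum η < sum μ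
  less = s≤s (proj₁ ih) &≤ eq≤ sμ
 ... | inj₂ (m , m<ℓ , bad@(K'm , Tm) , lastm) = ≤-trans (eq≤ (sym sη)) (s≤s (proj₁ ih) &≤ eq≤ sμ) ,
  \ e -> fin (proj₂ ih (suc-injective (sη & e & sym sμ)))
  where
  Tcorner : L (suc m) < L m
  Tcorner = ≤-<-trans (le (suc m)) (subst (K (suc m) <_) (sym Tm) (R.corner (BadUp m bad)))
  w = walk ℓ m (m≤n+m ℓ m) Tcorner
  z' = proj₁ w
  m≤z' = proj₁ (proj₂ w)
  upm = proj₁ (proj₂ (proj₂ w))
  flat = proj₂ (proj₂ (proj₂ (proj₂ w)))
  lt' : CE.M (suc z') < CE.M z'
  lt' = ≤∧≢⇒< (CE.mono z') (\ q -> <⇒≢ (proj₁ (proj₂ (proj₂ (proj₂ w)))) (core-eq k η (suc z') & cong₂ _+_ q (cong (\ x -> L (suc (z' + suc (k ∸ x)))) q & sym flat) & sym (core-eq k η z')))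
  module R' = CE.Rem z' lt'
  s'≡1 : R'.s ≡ 1
  s'≡1 = cong suc (cong (_∸ L (suc (CE.d z'))) flat & n∸n≡0 (L (suc (CE.d z'))))
  sη : suc (sum R'.μ') ≡ sum η
  sη = sum-decAt z' η (z<s &≤ lt')
  -- Bad rows share a runner of μ, and the two cores agree in them, so they also share a runner of
  -- η; the lowest bad row m leads to z', hence all of them do.
  badUp' : ∀ i -> Bad i -> CE.Up z' i
  badUp' i bd@(_ , Ti) with CM.Up-bead (BadUp i bd) | CM.Up-bead (BadUp m bad)
  ... | ai , ei | am , em with ≤-total am ai
  ... | inj₁ le' with CE.climb (ai ∸ am) i
  ... | y , _ , ey , f = subst (\ y -> CE.Up z' y -> CE.Up z' i) (CE.bead-inj eq) (f z') upm
   where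
   n = suc k
   A = am * n
   B = (ai ∸ am) * n
   AB : ai * n ≡ A + B
   AB = cong (_* n) (sym (m+[n∸m]≡n le')) & *-distribʳ-+ n am (ai ∸ am)
   eq : L y + m ≡ L m + y
   eq = +-cancelʳ-≡ (i + B + (K z + A + z)) (L y + m) (L m + y) (l1 (L y) m i B (K z) A z &
    cong₂ (\ a b -> a + b + z) ey em &
    cong₂ (\ a b -> a + y + (b + z) + z) Ti (sym Tm) &
    l2 (K i) y (L m) z &
    cong (\ a -> L m + y + a + z) (sym ei & cong (\ a -> K z + i + a) AB) &
    l3 (L m) y (K z) i A B z)
    where l1 : ∀ a b c d e f g -> a + b + (c + d + (e + f + g)) ≡ a + c + d + (e + b + f) + g
          l1 = NRing.solve-∀
          l2 : ∀ a b c d -> a + b + (c + d) + d ≡ c + b + (a + d) + d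
          l2 = NRing.solve-∀
          l3 : ∀ a b c d e f g -> a + b + (c + d + (e + f)) + g ≡ a + b + (d + f + (c + e + g))
          l3 = NRing.solve-∀
  badUp' i bd | ai , ei | am , em | inj₂ le' with m≤n⇒m<n∨m≡n (lastm i (Bad<ℓ i bd) bd)
  ... | inj₂ refl = upm
  ... | inj₁ i<m = ⊥-elim (<⇒≱ (+-mono-≤-< (CM.K-anti (<⇒≤ i<m)) i<m) (+-cancelʳ-≤ z _ _ (eq≤ (l (K i) m z) &≤
   eq≤ (cong (\ x -> x + m) (sym ei)) &≤
   +-monoˡ-≤ m (+-monoʳ-≤ (K z + i) (*-monoˡ-≤ (suc k) le')) &≤
   eq≤ (l' (K z) i (am * suc k) m) &≤
   eq≤ (cong (\ x -> x + i) em) &≤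
   eq≤ (l (K m) z i))))
   where open ≤-Reasoning
         l : ∀ a b c -> a + b + c ≡ a + c + b
         l = NRing.solve-∀
         l' : ∀ a b c d -> a + b + c + d ≡ a + d + c + b
         l' = NRing.solve-∀
  le'' : ∀ i -> R'.K' i ≤ R.K' i
  le'' i with Bad? i
  ... | no ¬b = R'.K'≤K i &≤ ok i ¬b
  ... | yes bd = +-cancelʳ-≤ 1 _ _ (eq≤ (cong (\ x -> R'.K' i + x) (sym s'≡1) & sym (R'.Up-lower (badUp' i bd))) &≤
   le i &≤ eq≤ (R.Up-lower (BadUp i bd) & cong (\ x -> R.K' i + x) s≡1))
  ih = core-mono N k ℓ R.μ' R'.μ' (≤-pred (eq≤ sμ &≤ b)) R.par' R'.par' le''
  -- It remains to see that both boxes come from the same row. Rows below z are empty in the core of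
  -- μ. For z' above z, containment in row z' would leave no corner in a row that was lowered by one
  -- box.
  fin : R'.μ' ≡ R.μ' -> η ≡ μ
  fin e with <-cmp z' z
  ... | tri> _ _ c = ⊥-elim (<⇒≱ ((z<s &≤ lt') &≤ CE.M≤K z') (le z' &≤ eq≤ (K0 z' c)))
  ... | tri≈ _ q _ = nthN-ext η μ (CE.len & sym CM.len) (\ i -> pt i (cong (\ l -> nthN l i) e))
   where
   pt : ∀ i -> nthN R'.μ' i ≡ nthN R.μ' i -> nthN η i ≡ nthN μ i
   pt i e with i ≟ z
   ... | no ¬p = sym (nthN-decAt-≢ i z' η (\ p -> ¬p (p & q))) & e & nthN-decAt-≢ i z μ ¬p
   ... | yes refl = sym (m+[n∸m]≡n (subst (\ x -> 1 ≤ nthN η x) q (z<s &≤ lt'))) & cong suc ((sym (nthN-decAt-≡ i η) & cong (\ x -> nthN (decAt x η) i) (sym q)) & e & nthN-decAt-≡ i μ) & m+[n∸m]≡n Mz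
  ... | tri< c _ _ = ⊥-elim (bad' (R.dich y))
   where
   y = CE.d z'
   ηz : nthN η z' ≡ suc (M z')
   ηz = sym (m+[n∸m]≡n (z<s &≤ lt')) & cong suc (sym (nthN-decAt-≡ z' η) & cong (\ l -> nthN l z') e & nthN-decAt-≢ z' z μ (<⇒≢ c))
   dy : d z' ≡ suc y
   dy = cong (\ x -> z' + suc x) (go (M z') (subst (_≤ k) ηz (CE.bound z'))) & +-suc z' _ & cong (\ x -> suc (z' + suc (k ∸ x))) (sym ηz)
    where go : ∀ {k} x -> suc x ≤ k -> k ∸ x ≡ suc (k ∸ suc x)
          go {suc k} zero p = refl
          go {suc k} (suc x) (s≤s p) = go x p
   K'y : suc (R.K' y) ≤ K (suc y)
   K'y = +-cancelˡ-≤ (M z') _ _ (eq≤ (+-suc (M z') (R.K' y)) &≤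
    eq≤ (cong₂ _+_ (sym ηz) (cong (\ l -> nthN (coreL k l) y) (sym e) & R'.K'> y (i<dn k η z'))) &≤
    eq≤ (sym (core-eq k η z')) &≤
    le z' &≤
    eq≤ (core-eq k μ z' & cong (\ x -> M z' + K x) dy))
    where open ≤-Reasoning
   bad' : (CM.Up z y × K y ≡ R.K' y + R.s) ⊎ (K y ≡ R.K' y) -> ⊥
   bad' (inj₂ q) = <⇒≱ (K'y &≤ CM.K-anti (n≤1+n y)) (eq≤ q)
   bad' (inj₁ (u , q)) = <⇒≱ (R.corner u) (eq≤ (q & cong (\ x -> R.K' y + x) s≡1 & +-comm _ 1) &≤ K'y)

-- Hook lengths of cores

countGe-⇒ : ∀ c κ i -> 1 ≤ c -> Decr κ -> i < countGe c κ -> c ≤ nthN κ i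
countGe-⇐ : ∀ c κ i -> 1 ≤ c -> Decr κ -> c ≤ nthN κ i -> i < countGe c κ
nthN≤ : ∀ {x} μ i -> All (_≤ x) μ -> nthN μ i ≤ x
nthN≤ [] i _ = z≤n
nthN≤ (y ∷ μ) zero (p ∷ _) = p
nthN≤ (y ∷ μ) (suc i) (_ ∷ ps) = nthN≤ μ i ps

≤ᵇ-true⁻ : ∀ {m n} -> (m ≤ᵇ n) ≡ true -> m ≤ n
≤ᵇ-true⁻ {m} {n} e = ≤ᵇ⇒≤ m n (subst T (sym e) tt)

≤ᵇ-true⁺ : ∀ {m n} -> m ≤ n -> (m ≤ᵇ n) ≡ true
≤ᵇ-true⁺ {m} {n} p with m ≤ᵇ n | ≤⇒≤ᵇ p
... | true | _ = refl

countGe-big : ∀ c μ -> All (_< c) μ -> countGe c μ ≡ 0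
countGe-big c [] [] = refl
countGe-big c (x ∷ μ) (p ∷ ps) with c ≤ᵇ x in e
... | false = countGe-big c μ ps
... | true = ⊥-elim (<⇒≱ p (≤ᵇ-true⁻ e))

countGe-⇒ c (x ∷ κ) i p (a , d) q with c ≤ᵇ x in e
countGe-⇒ c (x ∷ κ) zero p (a , d) q | true = ≤ᵇ-true⁻ e
countGe-⇒ c (x ∷ κ) (suc i) p (a , d) (s≤s q) | true = countGe-⇒ c κ i p d q
countGe-⇒ c (x ∷ κ) i p (a , d) q | false = ⊥-elim (n≮0 (subst (i <_) (countGe-big c κ (All.map (\ y -> ≤-<-trans y x<c) a)) q))
 where x<c = ≰⇒> (\ h -> case (sym (≤ᵇ-true⁺ h) & e))
        where case : true ≡ false -> ⊥
              case ()
countGe-⇐ c [] i p d q = ⊥-elim (<⇒≱ p q)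
countGe-⇐ c (x ∷ κ) i p (a , d) q with c ≤ᵇ x in e
countGe-⇐ c (x ∷ κ) zero p (a , d) q | true = z<s
countGe-⇐ c (x ∷ κ) (suc i) p (a , d) q | true = s≤s (countGe-⇐ c κ i p d q)
countGe-⇐ c (x ∷ κ) i p (a , d) q | false with trans (sym (≤ᵇ-true⁺ (q &≤ nthN≤ (x ∷ κ) i (≤-refl ∷ a)))) e
... | ()

countB-++ : ∀ {A : Set} (p : A -> Bool) xs ys -> countB p (xs ++ ys) ≡ countB p xs + countB p ys
countB-++ p [] ys = refl
countB-++ p (x ∷ xs) ys with p x
... | true = cong suc (countB-++ p xs ys)
... | false = countB-++ p xs ys

countB-cong : ∀ {A : Set} {p q : A -> Bool} xs -> (∀ x -> x ∈ xs -> p x ≡ q x) -> countB p xs ≡ countB q xs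
countB-cong [] e = refl
countB-cong {p = p} {q} (x ∷ xs) e = cong₂ (\ b n -> if b then suc n else n) (e x (here refl)) (countB-cong xs (\ y i -> e y (there i)))

range-suc : ∀ m -> range 1 (suc m) ≡ range 1 m ++ suc m ∷ []
range-suc m = cong (map suc) (go m) & LP.map-++ suc (upTo m) (m ∷ [])
 where go : ∀ m -> upTo (suc m) ≡ upTo m ++ m ∷ []
       go m = sym (LP.applyUpTo-∷ʳ id m)

count-above : ∀ e m -> countB (\ c -> e <ᵇ c) (range 1 m) ≡ m ∸ e
count-above e zero = sym (0∸n≡0 e)
count-above e (suc m) = cong (countB (\ c -> e <ᵇ c)) (range-suc m) & countB-++ (\ c -> e <ᵇ c) (range 1 m) (suc m ∷ []) & cong (_+ countB (\ c -> e <ᵇ c) (suc m ∷ [])) (count-above e m) & last (e ≤? m)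
 where
 last : Dec (e ≤ m) -> (m ∸ e) + countB (\ c -> e <ᵇ c) (suc m ∷ []) ≡ suc m ∸ e
 last (yes p) = cong (\ b -> (m ∸ e) + (if b then 1 else 0)) (<ᵇ-true⁺ (s≤s p)) & +-comm (m ∸ e) 1 & sym (+-∸-assoc 1 p)
 last (no ¬p) = cong (\ b -> (m ∸ e) + (if b then 1 else 0)) (<ᵇ-false⁺ (≰⇒> ¬p)) & +-identityʳ _ & m≤n⇒m∸n≡0 (<⇒≤ (≰⇒> ¬p)) & sym (m≤n⇒m∸n≡0 (≰⇒> ¬p))

threshold : ∀ (p : ℕ -> Bool) m -> (∀ c -> 1 ≤ c -> c < m -> p c ≡ true -> p (suc c) ≡ true) ->
 ∃[ e ] (e ≤ m × (∀ c -> 1 ≤ c -> c ≤ m -> p c ≡ (e <ᵇ c)))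
threshold p zero h = 0 , z≤n , \ c a b -> ⊥-elim (<⇒≱ a b)
threshold p (suc m) h with threshold p m (\ c a b -> h c a (m<n⇒m<1+n b)) | p (suc m) in q
... | e , le , f | false = suc m , ≤-refl , \ c a b -> trans (off c a b) (sym (<ᵇ-false⁺ b))
 where
 off : ∀ c -> 1 ≤ c -> c ≤ suc m -> p c ≡ false
 off c a b with m≤n⇒m<n∨m≡n b
 ... | inj₂ refl = q
 ... | inj₁ lt with p c in pc
 ... | false = refl
 ... | true = sym (up (suc m ∸ c) c a (m∸n+n≡m b) pc) & q
  where up : ∀ j c -> 1 ≤ c -> j + c ≡ suc m -> p c ≡ true -> p (suc m) ≡ true
        up zero c a refl pc = pc
        up (suc j) c a eq pc = up j (suc c) z<s (+-suc j c & eq) (h c a (s≤s (m≤n+m c j) &≤ eq≤ eq) pc)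
... | e , le , f | true = e , m≤n⇒m≤1+n le , g
 where g : ∀ c -> 1 ≤ c -> c ≤ suc m -> p c ≡ (e <ᵇ c)
       g c a b with m≤n⇒m<n∨m≡n b
       ... | inj₁ lt = f c a (≤-pred lt)
       ... | inj₂ refl = q & sym (<ᵇ-true⁺ (s≤s le))

all⁺ : ∀ {A : Set} (p : A -> Bool) xs -> (∀ x -> x ∈ xs -> p x ≡ true) -> all p xs ≡ true
all⁺ p [] h = refl
all⁺ p (x ∷ xs) h = ∧-true (h x (here refl)) (all⁺ p xs (\ y i -> h y (there i)))

all⁻ : ∀ {A : Set} (p : A -> Bool) xs -> all p xs ≡ true -> ∀ x -> x ∈ xs -> p x ≡ true
all⁻ p (y ∷ xs) e x (here refl) = ∧-trueˡ e
all⁻ p (y ∷ xs) e x (there i) = all⁻ p xs (∧-trueʳ {p y} e) x i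

Normal : ℕ -> List ℕ -> Set
Normal k ν = Decr ν × All (1 ≤_) ν × All (_≤ k) ν

dropZeros-id : ∀ ν -> All (1 ≤_) ν -> dropZeros ν ≡ ν
dropZeros-id [] _ = refl
dropZeros-id (suc x ∷ ν) (_ ∷ ps) = cong (suc x ∷_) (dropZeros-id ν ps)

rowCount : ℕ -> List ℕ -> ℕ -> ℕ
rowCount k κ i = countB (\ c -> hook κ i c ≤ᵇ k) (range 1 (nthN κ (i ∸ 1)))

map-range-nthN : ∀ (f : ℕ -> ℕ) ν -> (∀ i -> i < length ν -> f (suc i) ≡ nthN ν i) -> map f (range 1 (length ν)) ≡ ν
map-range-nthN f ν h = sym (LP.map-∘ (upTo (length ν))) & go (f ∘ suc) ν h
 where
 go : ∀ (g : ℕ -> ℕ) ν -> (∀ i -> i < length ν -> g i ≡ nthN ν i) -> map g (upTo (length ν)) ≡ ν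
 go g [] h = refl
 go g (x ∷ ν) h = cong₂ _∷_ (h 0 z<s) (cong (map g) (sym (LP.map-upTo suc (length ν))) & sym (LP.map-∘ (upTo (length ν))) & go (g ∘ suc) ν (\ i p -> h (suc i) (s≤s p)))

Par-Normal : ∀ {k ν} -> Normal k ν -> Par k (length ν) ν
Par-Normal {k} {ν} (d , _ , b) = record { len = refl ; mono = mono ν d ; bound = \ i -> nthN≤ ν i b }
 where mono : ∀ ν -> Decr ν -> ∀ i -> nthN ν (suc i) ≤ nthN ν i
       mono [] _ i = z≤n
       mono (x ∷ ν) (a , _) zero = nthN≤ ν 0 a
       mono (x ∷ ν) (_ , d) (suc i) = mono ν d i

module CoreHooks (k : ℕ) (ν : List ℕ) (nm : Normal k ν) where
 open Core k (length ν) ν (Par-Normal nm)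
 κ = coreL k ν

 κ-Decr : Decr κ
 κ-Decr = Par-Decr κ (\ i -> K-anti (n≤1+n i))

 -- In the first K (d i) columns the arm is at least M i, and the column reaches row d i, so the leg
 -- is at least k+1-M i.
 hook-low : ∀ i c -> 1 ≤ c -> c ≤ K (d i) -> suc k < hook κ (suc i) c
 hook-low i c p q = eq≤ (+-comm 1 (suc k)) &≤
  eq≤ (cong (_+ 1) (+-cancelˡ-≡ i _ _ (sym (d+M i) & lem i (suc (k ∸ M i)) (M i)))) &≤
  +-monoˡ-≤ 1 (+-mono-≤ arm leg)
  where
  lem : ∀ i a m -> i + a + m ≡ i + (m + a)
  lem = NRing.solve-∀
  arm : M i ≤ K i ∸ c
  arm = eq≤ (sym (m+n∸n≡m (M i) (K (d i)))) &≤ eq≤ (cong (_∸ K (d i)) (sym (core-eq k ν i))) &≤ ∸-monoʳ-≤ (K i) q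
  leg : suc (k ∸ M i) ≤ countGe c κ ∸ suc i
  leg = eq≤ (sym (m+n∸m≡n (suc i) _)) &≤ ∸-monoˡ-≤ (suc i) (countGe-⇐ c κ (d i) p κ-Decr q)

 -- Beyond those columns the arm plus the box itself is at most M i, and the column ends before row
 -- d i, so the leg is at most k-M i.
 hook-high : ∀ i c -> 1 ≤ c -> K (d i) < c -> c ≤ K i -> hook κ (suc i) c ≤ k
 hook-high i c p q q' = eq≤ (+-comm _ 1) &≤
  +-mono-≤ arm leg &≤
  eq≤ (m+[n∸m]≡n (bound i))
  where
  arm : suc (K i ∸ c) ≤ M i
  arm = eq≤ (sym (+-∸-assoc 1 q')) &≤ ∸-monoʳ-≤ (suc (K i)) q &≤
   eq≤ (cong (_∸ K (d i)) (core-eq k ν i) & m+n∸n≡m (M i) (K (d i)))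
  leg : countGe c κ ∸ suc i ≤ k ∸ M i
  leg = ∸-monoˡ-≤ (suc i) (≮⇒≥ (\ h -> <⇒≱ q (countGe-⇒ c κ (d i) p κ-Decr h))) &≤ eq≤ (cong (_∸ suc i) (+-suc i _) & m+n∸m≡n (suc i) _)

 core-isCore : isCore k κ ≡ true
 core-isCore = all⁺ _ (range 1 (length κ)) \ i' m -> row i' (proj₁ (∈-range⁻ (length κ) m))
  where
  row : ∀ i' -> 1 ≤ i' -> all (\ c -> not (hook κ i' c ≡ᵇ suc k)) (range 1 (nthN κ (i' ∸ 1))) ≡ true
  row (suc i) _ = all⁺ _ (range 1 (K i)) \ c m -> ne c (∈-range⁻ (K i) m)
   where
   ne : ∀ c -> 1 ≤ c × c ≤ K i -> not (hook κ (suc i) c ≡ᵇ suc k) ≡ true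
   ne c (p , q) with hook κ (suc i) c ≡ᵇ suc k in e
   ... | false = refl
   ... | true with c ≤? K (d i)
   ... | yes h = ⊥-elim (<-irrefl (sym (≡ᵇ-true e)) (hook-low i c p h))
   ... | no ¬h = ⊥-elim (<-irrefl (≡ᵇ-true {hook κ (suc i) c} e) (s≤s (hook-high i c p (≰⇒> ¬h) q)))

 core-pmap : pmap k κ ≡ ν
 core-pmap = cong dropZeros (cong (\ n -> map (rowCount k κ) (range 1 n)) (length-coreL k ν) & map-range-nthN (rowCount k κ) ν (\ i _ -> row i)) & dropZeros-id ν (proj₁ (proj₂ nm))
  where
  row : ∀ i -> rowCount k κ (suc i) ≡ M i
  row i = countB-cong (range 1 (K i)) (\ c m -> cell c (∈-range⁻ (K i) m)) & count-above (K (d i)) (K i) & cong (_∸ K (d i)) (core-eq k ν i) & m+n∸n≡m (M i) (K (d i))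
   where
   cell : ∀ c -> 1 ≤ c × c ≤ K i -> (hook κ (suc i) c ≤ᵇ k) ≡ (K (d i) <ᵇ c)
   cell c (p , q) = bool-ext (\ e -> <ᵇ-true⁺ (≰⇒> (\ h -> <⇒≱ (<-trans (n<1+n k) (hook-low i c p h)) (≤ᵇ-true⁻ {hook κ (suc i) c} e))))
    (\ e -> ≤ᵇ-true⁺ (hook-high i c p (<ᵇ-true⁻ e) q))

-- The equations determine the rows from the bottom up, since each refers only to a lower row.
core-unique : ∀ k τ m -> length τ ≡ length m -> (∀ i -> nthN τ i ≡ nthN m i + nthN τ (dn k m i)) -> τ ≡ coreL k m
core-unique k [] [] q e = refl
core-unique k (x ∷ τ) (y ∷ m) q e with core-unique k τ m (suc-injective q) (e ∘ suc)
... | refl = cong (_∷ coreL k m) (e 0)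

module HooksCore (k : ℕ) (τ : List ℕ) (dτ : Decr τ) (pos : All (1 ≤_) τ) (ic : isCore k τ ≡ true) where
 K : ℕ -> ℕ
 K = nthN τ
 m : ℕ -> ℕ
 m i = rowCount k τ (suc i)

 K-anti : ∀ {i j} -> i ≤ j -> K j ≤ K i
 K-anti {i} p = go τ dτ i _ p
  where go : ∀ τ -> Decr τ -> ∀ i j -> i ≤ j -> nthN τ j ≤ nthN τ i
        go [] _ i j p = z≤n
        go (x ∷ τ) (a , _) zero j p = nthN≤ (x ∷ τ) j (≤-refl ∷ a)
        go (x ∷ τ) (_ , d) (suc i) (suc j) (s≤s p) = go τ d i j p

 -- Hooks decrease along a row, so the boxes of small hook are the last m i ones. The first of these
 -- bounds row D from above, the last box of large hook bounds it from below.
 row : ∀ i -> m i ≤ k × K i ≡ m i + K (i + suc (k ∸ m i))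
 row i with threshold (\ c -> hook τ (suc i) c ≤ᵇ k) (K i) up
  where
  up : ∀ c -> 1 ≤ c -> c < K i -> (hook τ (suc i) c ≤ᵇ k) ≡ true -> (hook τ (suc i) (suc c) ≤ᵇ k) ≡ true
  up c p q e = ≤ᵇ-true⁺ (+-monoˡ-≤ 1 (+-mono-≤ (∸-monoʳ-≤ (K i) (n≤1+n c)) (∸-monoˡ-≤ (suc i) (cg τ))) &≤ ≤ᵇ-true⁻ {hook τ (suc i) c} e)
   where cg : ∀ τ -> countGe (suc c) τ ≤ countGe c τ
         cg [] = z≤n
         cg (x ∷ τ) with suc c ≤ᵇ x in e1 | c ≤ᵇ x in e2
         ... | true | true = s≤s (cg τ)
         ... | false | true = m≤n⇒m≤1+n (cg τ)
         ... | false | false = cg τ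
         ... | true | false with trans (sym (≤ᵇ-true⁺ (<⇒≤ (≤ᵇ-true⁻ {suc c} e1)))) e2
         ... | ()
 ... | e , e≤K , spec = m≤k , ≤-antisym lo hi
  where
  m≡ : m i ≡ K i ∸ e
  m≡ = countB-cong (range 1 (K i)) (\ c q -> spec c (proj₁ (∈-range⁻ (K i) q)) (proj₂ (∈-range⁻ (K i) q))) & count-above e (K i)
  K≡ : K i ≡ m i + e
  K≡ = sym (m∸n+n≡m e≤K) & cong (_+ e) (sym m≡)
  D = i + suc (k ∸ m i)
  high : e < K i -> m i ≤ k × countGe (suc e) τ ≤ D
  high lt = ≤-trans (m≤m+n (m i) _ &≤ eq≤ (sym h1)) hk , ≤-trans (m≤n+m∸n (countGe (suc e) τ) (suc i))
   (+-monoʳ-≤ (suc i) (eq≤ (sym (m+n∸m≡n (m i) _)) &≤ ∸-monoˡ-≤ (m i) (eq≤ (sym h1) &≤ hk)) &≤ eq≤ (sym (+-suc i _)))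
   where
   g = countGe (suc e) τ ∸ suc i
   hk : hook τ (suc i) (suc e) ≤ k
   hk = ≤ᵇ-true⁻ {hook τ (suc i) (suc e)} (spec (suc e) z<s lt & <ᵇ-true⁺ {e} {suc e} ≤-refl)
   h1 : hook τ (suc i) (suc e) ≡ m i + g
   h1 = +-comm _ 1 & cong (_+ g) (sym (+-∸-assoc 1 lt) & sym m≡)
  m≤k : m i ≤ k
  m≤k with m≤n⇒m<n∨m≡n e≤K
  ... | inj₁ lt = proj₁ (high lt)
  ... | inj₂ refl = eq≤ (m≡ & n∸n≡0 (K i)) &≤ z≤n
  hi : m i + K D ≤ K i
  hi = +-monoʳ-≤ (m i) KD &≤ eq≤ (sym K≡)
   where
   KD : K D ≤ e
   KD with m≤n⇒m<n∨m≡n e≤K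
   ... | inj₂ refl = K-anti (m≤m+n i _)
   ... | inj₁ lt = ≤-pred (≰⇒> (\ h -> <⇒≱ (countGe-⇐ (suc e) τ D z<s dτ h) (proj₂ (high lt))))
  -- The core condition enters here: a hook larger than k is at least k+2, which pushes the leg past
  -- row D.
  eK : ∀ e -> 1 ≤ e -> e ≤ K i -> (hook τ (suc i) e ≤ᵇ k) ≡ false -> K i ≡ m i + e -> e ≤ K D
  eK e p q hf K≡ = countGe-⇒ e τ D p dτ (≰⇒> (\ h -> <⇒≱ big (small h)))
   where
   g = countGe e τ ∸ suc i
   h2 : hook τ (suc i) e ≡ m i + g + 1
   h2 = cong (\ x -> x + g + 1) (cong (_∸ e) K≡ & m+n∸n≡m (m i) e)
   ne : hook τ (suc i) e ≢ suc k
   ne w with all⁻ _ (range 1 (K i)) (all⁻ _ (range 1 (length τ)) ic (suc i) (∈-range⁺ _ z<s i<τ)) e (∈-range⁺ (K i) p q)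
    where i<τ : i < length τ
          i<τ with i <? length τ
          ... | yes t = t
          ... | no ¬t = ⊥-elim (<⇒≱ p (q &≤ eq≤ (nthN-beyond τ i (≮⇒≥ ¬t))))
   ... | z rewrite w | ≡ᵇ-refl k with z
   ... | ()
   big : suc k < hook τ (suc i) e
   big = ≤∧≢⇒< (≰⇒> (\ h -> case (sym (≤ᵇ-true⁺ h) & hf))) (ne ∘ sym)
    where case : true ≡ false -> ⊥
          case ()
   small : countGe e τ ≤ D -> hook τ (suc i) e ≤ suc k
   small h = eq≤ (h2 & +-comm _ 1) &≤ s≤s (+-monoʳ-≤ (m i) (∸-monoˡ-≤ (suc i) h &≤
    eq≤ (cong (_∸ suc i) (+-suc i _) & m+n∸m≡n (suc i) _)) &≤ eq≤ (m+[n∸m]≡n m≤k))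
  lo′ : ∀ e -> e ≤ K i -> (∀ c -> 1 ≤ c -> c ≤ K i -> (hook τ (suc i) c ≤ᵇ k) ≡ (e <ᵇ c)) -> K i ≡ m i + e -> K i ≤ m i + K D
  lo′ zero _ _ K≡ = eq≤ K≡ &≤ +-monoʳ-≤ (m i) z≤n
  lo′ (suc e′) le f K≡ = eq≤ K≡ &≤ +-monoʳ-≤ (m i) (eK (suc e′) z<s le (f (suc e′) z<s le & <ᵇ-false⁺ {suc e′} {suc e′} ≤-refl) K≡)
  lo : K i ≤ m i + K D
  lo = lo′ e e≤K spec K≡

 m-mono : ∀ i -> m (suc i) ≤ m i
 m-mono i = ≮⇒≥ (\ lt -> <⇒≱ (eq≤ (cong suc (proj₂ (row i))) &≤ +-mono-≤ lt (K-anti (le lt)) &≤ eq≤ (sym (proj₂ (row (suc i))))) (K-anti (n≤1+n i)))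
  where le : m i < m (suc i) -> suc i + suc (k ∸ m (suc i)) ≤ i + suc (k ∸ m i)
        le lt = eq≤ (sym (+-suc i _)) &≤ +-monoʳ-≤ i (s≤s (∸-monoʳ-< lt (proj₁ (row (suc i)))))

 m-pos : ∀ i -> i < length τ -> 1 ≤ m i
 m-pos i p = ≰⇒> (\ h -> <⇒≱ (Kpos τ pos i p) (eq≤ (zero-K (length τ) i (m≤n+m _ i) h)))
  where
  Kpos : ∀ τ -> All (1 ≤_) τ -> ∀ i -> i < length τ -> 1 ≤ nthN τ i
  Kpos (x ∷ τ) (q ∷ _) zero _ = q
  Kpos (x ∷ τ) (_ ∷ qs) (suc i) (s≤s p) = Kpos τ qs i p
  m-anti : ∀ i j -> m (i + j) ≤ m i
  m-anti i zero = eq≤ (cong m (+-identityʳ i))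
  m-anti i (suc j) = eq≤ (cong m (+-suc i j)) &≤ m-mono (i + j) &≤ m-anti i j
  zero-K : ∀ F i -> length τ ≤ i + F -> m i ≤ 0 -> K i ≡ 0
  zero-K zero i q h = nthN-beyond τ i (q &≤ eq≤ (+-identityʳ i))
  zero-K (suc F) i q h = proj₂ (row i) & cong₂ _+_ (n≤0⇒n≡0 h) (zero-K F D (q &≤ eq≤ (+-suc i F) &≤ +-monoˡ-≤ F (eq≤ (+-comm 1 i) &≤ +-monoʳ-≤ i z<s)) (m-anti i _ &≤ h))
   where D = i + suc (k ∸ m i)

 private
  η = map (rowCount k τ) (range 1 (length τ))
  lenη : length η ≡ length τ
  lenη = LP.length-map _ (range 1 (length τ)) & LP.length-map suc (upTo (length τ)) & LP.length-upTo (length τ)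
  nth-map : ∀ (f : ℕ -> ℕ) L i -> i < L -> nthN (map f (range 1 L)) i ≡ f (suc i)
  nth-map f L i p = cong (\ l -> nthN l i) (sym (LP.map-∘ (upTo L))) & go (f ∘ suc) L i p
   where go : ∀ (g : ℕ -> ℕ) L i -> i < L -> nthN (map g (upTo L)) i ≡ g i
         go g (suc L) zero _ = refl
         go g (suc L) (suc i) (s≤s p) = cong (\ l -> nthN l i) (cong (map g) (sym (LP.map-upTo suc L)) & sym (LP.map-∘ (upTo L))) & go (g ∘ suc) L i p
  m0 : ∀ i -> length τ ≤ i -> m i ≡ 0
  m0 i q = cong (\ x -> countB (\ c -> hook τ (suc i) c ≤ᵇ k) (range 1 x)) (nthN-beyond τ i q)
  nthη : ∀ i -> nthN η i ≡ m i
  nthη i with i <? length τ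
  ... | yes p = nth-map (rowCount k τ) (length τ) i p
  ... | no ¬p = nthN-beyond η i (eq≤ lenη &≤ ≮⇒≥ ¬p) & sym (m0 i (≮⇒≥ ¬p))
  allη : ∀ (P : ℕ -> Set) -> (∀ i -> i < length τ -> P (m i)) -> All P η
  allη P h = All.tabulate (\ q -> go (MP.∈-map⁻ (rowCount k τ) q))
   where go : ∀ {x} -> (∃[ y ] (y ∈ range 1 (length τ) × x ≡ rowCount k τ y)) -> P x
         go (y , i , refl) with ∈-range⁻ (length τ) i
         go (suc y , i , refl) | _ , b = h y b
  pη : pmap k τ ≡ η
  pη = dropZeros-id η (allη (1 ≤_) m-pos)

 pmap-Normal : Normal k (pmap k τ)
 pmap-Normal = subst (Normal k) (sym pη) (Par-Decr η (\ i -> subst₂ _≤_ (sym (nthη (suc i))) (sym (nthη i)) (m-mono i)) , allη (1 ≤_) m-pos , allη (_≤ k) (\ i _ -> proj₁ (row i)))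

 pmap-core : τ ≡ coreL k (pmap k τ)
 pmap-core = subst (\ x -> τ ≡ coreL k x) (sym pη) (core-unique k τ η (sym lenη) (\ i -> proj₂ (row i) & cong (\ x -> x + K (i + suc (k ∸ x))) (sym (nthη i))))

-- Strong covers with a mark in the first rows

module StrongCover (k ℓ : ℕ) (μ : List ℕ) (par : Par k ℓ μ) (r : ℕ) (r≤d : ∀ i -> r ≤ dn k μ i) where
 open Core k ℓ μ par

 -- Every step of d lands at r or lower, so a row above r is reached only from itself.
 Up-top : ∀ {x i} -> x < r -> Up x i -> i ≡ x
 Up-top p base = refl
 Up-top p (step u) = ⊥-elim (<⇒≱ p (r≤d _ &≤ Up≤ u))

 Up-pred : ∀ {x i} -> Up (d x) i -> i ≡ d x ⊎ Up x i
 Up-pred base = inj₁ refl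
 Up-pred (step u) with Up-pred u
 ... | inj₁ e = inj₂ (subst (Up _) (d-inj (sym e)) base)
 ... | inj₂ v = inj₂ (step v)

 module _ (η : List ℕ) (pη : Par k ℓ η) (T≤K : ∀ i -> nthN (coreL k η) i ≤ K i) (s≡ : suc (sum η) ≡ sum μ) where
  private
   module E = Core k ℓ η pη
   L = E.K

  -- If the core of η lies inside the core of μ-ε_z, both have the same size and strict monotonicity
  -- identifies them; the changed rows are then those on the runner above z.
  below : ∀ z (lt : M (suc z) < M z) -> (∀ i -> Up z i -> L i ≤ Rem.K' z lt i) -> η ≡ decAt z μ × (∀ y -> L y < K y -> Up z y)
  below z lt h = ηz , up
   where
   module R = Rem z lt
   T≤K' : ∀ i -> L i ≤ R.K' i
   T≤K' i with R.dich i
   ... | inj₁ (u , _) = h i u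
   ... | inj₂ e = T≤K i &≤ eq≤ e
   ηz : η ≡ decAt z μ
   ηz = proj₂ (core-mono (sum R.μ') k ℓ R.μ' η ≤-refl R.par' pη T≤K') (suc-injective (s≡ & sym (sum-decAt z μ (z<s &≤ lt))))
   up : ∀ y -> L y < K y -> Up z y
   up y p with R.dich y
   ... | inj₁ (u , _) = u
   ... | inj₂ e = ⊥-elim (<-irrefl (cong (\ l -> nthN (coreL k l) y) ηz & sym e) p)

  Goal : Set
  Goal = ∃[ z ] (M (suc z) < M z × η ≡ decAt z μ × (∀ y -> L y < K y -> Up z y))

  -- the bead of row w of η's core is that of row x of μ's core moved down by s
  walk : ∀ F s x w -> 1 ≤ s -> ℓ ≤ x + F -> L w + x + s ≡ K x + w -> (∀ i -> Up x i -> L i + s ≤ K i) -> K (suc x) + s ≤ K x -> Goal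
  walk zero s x w p b e h c = ⊥-elim (<⇒≱ p (m≤n+m s (K (suc x)) &≤ c &≤ eq≤ (K-beyond x (b &≤ eq≤ (+-identityʳ x)))))
  walk (suc F) s x w p b e h c with (K (suc (d x)) + s) ≤? K (d x)
  ... | yes c' = walk F s (d x) (E.d w) p (b &≤ eq≤ (+-suc x F) &≤ +-monoˡ-≤ F (i<dn k μ x)) e' h' c'
   where
   w' = E.d w
   e' : L w' + d x + s ≡ K (d x) + w'
   e' = +-cancelʳ-≡ (w + suc k + x) _ _ (l1 (L w') (d x) s w (suc k) x &
    cong (\ t -> t + (d x + s + x)) (E.bead-d w) &
    l2 (L w) w' (d x) s x &
    cong (\ t -> t + (w' + d x)) e &
    l3 (K x) w w' (d x) &
    cong (\ t -> t + (w + w')) (sym (bead-d x)) &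
    l4 (K (d x)) x (suc k) w w')
    where open ≡-Reasoning
          l1 : ∀ a b c d e f -> a + b + c + (d + e + f) ≡ a + d + e + (b + c + f)
          l1 = NRing.solve-∀
          l2 : ∀ a b c d e -> a + b + (c + d + e) ≡ a + e + d + (b + c)
          l2 = NRing.solve-∀
          l3 : ∀ a b c d -> a + b + (c + d) ≡ a + d + (b + c)
          l3 = NRing.solve-∀
          l4 : ∀ a b c d e -> a + b + c + (d + e) ≡ a + e + (d + c + b)
          l4 = NRing.solve-∀
   w≤ : w' ≤ d x
   w≤ = ≮⇒≥ \ lt -> <⇒≱ (+-monoʳ-< (K (d x)) lt) (eq≤ (sym e') &≤
    +-monoˡ-≤ s (+-monoˡ-≤ (d x) (T≤K w' &≤ K-anti lt)) &≤
    eq≤ (l (K (suc (d x))) (d x) s) &≤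
    +-monoˡ-≤ (d x) c')
    where open ≤-Reasoning
          l : ∀ a b c -> a + b + c ≡ a + c + b
          l = NRing.solve-∀
   at : L (d x) + s ≤ K (d x)
   at = +-cancelʳ-≤ w' _ _ (+-mono-≤ (+-monoˡ-≤ s (E.K-anti w≤)) w≤ &≤
    eq≤ (l (L w') s (d x)) &≤
    eq≤ e')
    where open ≤-Reasoning
          l : ∀ a b c -> a + b + c ≡ a + c + b
          l = NRing.solve-∀
   h' : ∀ i -> Up (d x) i -> L i + s ≤ K i
   h' i u with Up-pred u
   ... | inj₁ refl = at
   ... | inj₂ v = h i v
  ... | no ¬c = x , lt , below x lt h'
   where
   lt : M (suc x) < M x
   lt = ≤∧≢⇒< (mono x) \ q -> ¬c (+-cancelˡ-≤ (M x) _ _ (eq≤ (sym (+-assoc (M x) _ s)) &≤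
    eq≤ (cong (\ t -> t + s) (cong₂ (\ a b -> a + K (suc (x + suc (k ∸ b)))) (sym q) (sym q))) &≤
    eq≤ (cong (\ t -> t + s) (sym (core-eq k μ (suc x)))) &≤
    c &≤
    eq≤ (core-eq k μ x)))
    where open ≤-Reasoning
   module R = Rem x lt
   s≤ : R.s ≤ s
   s≤ = eq≤ (sym (+-∸-assoc 1 (K-anti (n≤1+n (d x))))) &≤ ∸-monoˡ-≤ (K (suc (d x))) (≰⇒> ¬c) &≤ eq≤ (m+n∸m≡n (K (suc (d x))) s)
   h' : ∀ i -> Up x i -> L i ≤ R.K' i
   h' i u = +-cancelʳ-≤ R.s _ _ (+-monoʳ-≤ (L i) s≤ &≤ h i u &≤ eq≤ (R.Up-lower u))

  -- If row i is shortened without passing below row i+1, its bead is followed down the runner.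
  -- Otherwise either row i is removable and contains the change, or row i+1 is shortened as well;
  -- as μ_r is smaller than μ_i, this ends before row r.
  search : ∀ F i -> r ≤ i + F -> i < r -> M r < M i -> L i < K i -> Goal
  search zero i b i<r q lt = ⊥-elim (<⇒≱ i<r (b &≤ eq≤ (+-identityʳ i)))
  search (suc F) i b i<r q lt with K (suc i) ≤? L i
  ... | yes c = walk ℓ (K i ∸ L i) i i (m<n⇒0<n∸m lt) (m≤n+m ℓ i)
   (+-assoc (L i) i _ & cong (\ x -> L i + x) (+-comm i _) & sym (+-assoc (L i) _ i) & cong (\ x -> x + i) Ts)
   (\ j u -> subst (\ j -> L j + (K i ∸ L i) ≤ K j) (sym (Up-top i<r u)) (eq≤ Ts)) (+-monoˡ-≤ _ c &≤ eq≤ Ts)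
   where Ts : L i + (K i ∸ L i) ≡ K i
         Ts = m+[n∸m]≡n (<⇒≤ lt)
  ... | no ¬c with M (suc i) <? M i
  ... | yes m = i , m , below i m (\ j u -> subst (\ j -> L j ≤ Rem.K' i m j) (sym (Up-top i<r u)) (<⇒≤ (≰⇒> ¬c) &≤ Rem.isolated i m base))
  ... | no ¬m = search F (suc i) (b &≤ eq≤ (+-suc i F)) (≤∧≢⇒< i<r (\ e -> <⇒≱ q (subst (\ x -> M i ≤ M x) e Mi)))
   (<-≤-trans q Mi) (≤-<-trans (E.K-anti (n≤1+n i)) (≰⇒> ¬c))
   where Mi : M i ≤ M (suc i)
         Mi = ≮⇒≥ ¬m

-- Column sums of words and peeling the smallest letter (columns from right to left)

-- Column words collect the letters already peeled. Columns are read bottom to top, so a larger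
-- letter goes in front of the smaller ones.
wsb : ℕ -> List (List ℕ) -> List ℕ -> List (List ℕ)
wsb n (w ∷ ws) (zero ∷ b) = w ∷ wsb n ws b
wsb n (w ∷ ws) (suc _ ∷ b) = (n ∷ w) ∷ wsb n ws b
wsb n ws _ = ws

length-wsb : ∀ n ws b -> length (wsb n ws b) ≡ length ws
length-wsb n [] b = refl
length-wsb n (w ∷ ws) [] = refl
length-wsb n (w ∷ ws) (zero ∷ b) = cong suc (length-wsb n ws b)
length-wsb n (w ∷ ws) (suc _ ∷ b) = cong suc (length-wsb n ws b)

-- The column lengths, from right to left, of the complement of μ in the rectangle with `length μ`
-- rows and width `hi`.
heights : ℕ -> List ℕ -> List ℕ
heights hi [] = replicate hi 0
heights hi (m ∷ μ) = replicate (hi ∸ m) (suc (length μ)) ++ heights m μ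

-- The x such that x/μ is a horizontal strip in this rectangle, that is, rows interlacing with μ.
boxes : ℕ -> List ℕ -> List (List ℕ)
boxes hi [] = [] ∷ []
boxes hi (m ∷ μ) = concatMap (\ x -> map (x ∷_) (boxes m μ)) (range m hi)

-- The indicator, from right to left, of the columns containing a box of x/μ.
bv : ℕ -> List ℕ -> List ℕ -> List ℕ
bv hi (m ∷ μ) (x ∷ xs) = replicate (hi ∸ x) 0 ++ replicate (x ∸ m) 1 ++ bv m μ xs
bv hi _ _ = replicate hi 0

data Has10 : List ℕ -> Set where
 here : ∀ {b} -> Has10 (1 ∷ 0 ∷ b)
 there : ∀ {x b} -> Has10 b -> Has10 (x ∷ b)

-- Either a marked column with an unmarked left neighbour of equal length, which would break weak
-- increase along the row, or a mark on an empty leftmost column.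
data Bad : List ℕ -> List ℕ -> Set where
 run : ∀ {x d b} -> Bad (x ∷ x ∷ d) (1 ∷ 0 ∷ b)
 last : Bad (0 ∷ []) (1 ∷ [])
 there : ∀ {x y d b} -> Bad d b -> Bad (x ∷ d) (y ∷ b)

Bad-run : ∀ q j d v w -> length v ≡ q -> Has10 v -> Bad (replicate q j ++ d) (v ++ w)
Bad-run (suc (suc q)) j d (1 ∷ 0 ∷ v) w e here = run
Bad-run (suc q) j d (x ∷ v) w e (there h) = there (Bad-run q j d v w (suc-injective e) h)

Bad-after : ∀ q j d v w -> length v ≡ q -> Bad d w -> Bad (replicate q j ++ d) (v ++ w)
Bad-after zero j d [] w e h = h
Bad-after (suc q) j d (x ∷ v) w e h = there (Bad-after q j d v w (suc-injective e) h)

replicate-+ : ∀ {A : Set} p q (x : A) -> replicate p x ++ replicate q x ≡ replicate (p + q) x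
replicate-+ zero q x = refl
replicate-+ (suc p) q x = cong (x ∷_) (replicate-+ p q x)

Bad-last : ∀ L x -> suc x ≤ L -> Bad (replicate L 0) (replicate (L ∸ suc x) 0 ++ replicate (suc x) 1)
Bad-last L x p = subst (\ d -> Bad d (replicate (L ∸ suc x) 0 ++ replicate (suc x) 1)) (replicate-+ (L ∸ suc x) (suc x) 0 & cong (\ (n : ℕ) -> replicate n 0) (m∸n+n≡m p))
 (Bad-after (L ∸ suc x) 0 (replicate (suc x) 0) (replicate (L ∸ suc x) 0) (replicate (suc x) 1) (LP.length-replicate (L ∸ suc x)) (ones x))
 where ones : ∀ x -> Bad (replicate (suc x) 0) (replicate (suc x) 1)
       ones zero = last
       ones (suc x) = there (ones x)

length-bits : ∀ L {b} -> b ∈ bits L -> length b ≡ L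
length-bits zero (here refl) = refl
length-bits (suc L) i with MP.∈-++⁻ (map (0 ∷_) (bits L)) i
... | inj₁ j with MP.∈-map⁻ (0 ∷_) j
... | b , j' , refl = cong suc (length-bits L j')
length-bits (suc L) i | inj₂ j with MP.∈-map⁻ (1 ∷_) j
... | b , j' , refl = cong suc (length-bits L j')

bits-split : ∀ p q (F : List ℕ -> ℤ) -> ∑ (bits (p + q)) F ≡ ∑ (bits p) (\ a -> ∑ (bits q) (\ b -> F (a ++ b)))
bits-split zero q F = sym (+0ʳ _)
bits-split (suc p) q F = ∑-bits (p + q) F & cong₂ Z._+_ (bits-split p q (\ b -> F (0 ∷ b))) (bits-split p q (\ b -> F (1 ∷ b))) &
 sym (∑-bits p (\ a -> ∑ (bits q) (\ b -> F (a ++ b))))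

bits-1 : ∀ L (F : List ℕ -> ℤ) -> (∀ b -> length b ≡ L -> Has10 (1 ∷ b) -> F b ≡ 0z) -> ∑ (bits L) F ≡ F (replicate L 1)
bits-1 zero F v = +0ʳ _
bits-1 (suc L) F v = ∑-bits L F & cong₂ Z._+_ (∑-cong∈ (bits L) (\ b i -> v (0 ∷ b) (cong suc (length-bits L i)) here) & ∑-0 (bits L))
 (bits-1 L (\ b -> F (1 ∷ b)) (\ b e h -> v (1 ∷ b) (cong suc e) (there h))) & +0ˡ _

bits-01 : ∀ L (F : List ℕ -> ℤ) -> (∀ b -> length b ≡ L -> Has10 b -> F b ≡ 0z) -> ∑ (bits L) F ≡ ∑ (upTo (suc L)) (\ x -> F (replicate (L ∸ x) 0 ++ replicate x 1))
bits-01 zero F v = refl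
bits-01 (suc L) F v = ∑-bits L F & cong₂ Z._+_ (bits-01 L (\ b -> F (0 ∷ b)) (\ b e h -> v (0 ∷ b) (cong suc e) (there h))) (bits-1 L (\ b -> F (1 ∷ b)) (\ b e h -> v (1 ∷ b) (cong suc e) h)) &
 cong₂ Z._+_ (∑-cong∈ (upTo (suc L)) (\ x i -> cong (\ y -> F (replicate y 0 ++ replicate x 1)) (sym (+-∸-assoc 1 (≤-pred (MP.∈-upTo⁻ i))))))
  (cong (\ y -> F (replicate y 0 ++ replicate (suc L) 1)) (sym (n∸n≡0 (suc L)))) & sym (∑-upTo-last (suc L) (\ x -> F (replicate (suc L ∸ x) 0 ++ replicate x 1)))

length-heights : ∀ hi μ -> Decr (hi ∷ μ) -> length (heights hi μ) ≡ hi
length-heights hi [] _ = LP.length-replicate hi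
length-heights hi (m ∷ μ) (p ∷ _ , a , d) = LP.length-++ (replicate (hi ∸ m) _) & cong₂ _+_ (LP.length-replicate (hi ∸ m)) (length-heights m μ (a , d)) & m∸n+n≡m p

-- Among columns of equal length only the patterns 0...01...1 survive, and only 0...0 among empty
-- ones; the number of ones in each run is the length of a row of the strip.
bits-heights : ∀ hi μ -> Decr (hi ∷ μ) -> (F : List ℕ -> ℤ) -> (∀ b -> Bad (heights hi μ) b -> F b ≡ 0z) ->
 ∑ (bits hi) F ≡ ∑ (boxes hi μ) (\ x -> F (bv hi μ x))
bits-heights hi [] _ F v = bits-01 hi F (\ b e h -> v b (subst₂ Bad (LP.++-identityʳ _) (LP.++-identityʳ b) (Bad-run hi 0 [] b [] e h))) &
 ∑-upTo hi f &
 cong₂ Z._+_ (cong F (LP.++-identityʳ _)) (∑-cong∈ (upTo hi) (\ x i -> v _ (Bad-last hi x (MP.∈-upTo⁻ i))) & ∑-0 (upTo hi))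
 where
 f = \ x -> F (replicate (hi ∸ x) 0 ++ replicate x 1)
bits-heights hi (m ∷ μ) (m≤ ∷ _ , a , d) F v = cong (\ n -> ∑ (bits n) F) (sym (m∸n+n≡m m≤)) &
 bits-split L m F &
 ∑-cong∈ (bits L) (\ u i -> bits-heights m μ (a , d) (\ b -> F (u ++ b)) (\ b h -> v (u ++ b) (Bad-after L (suc (length μ)) (heights m μ) u b (length-bits L i) h))) &
 bits-01 L _ (\ u e h -> ∑-cong (boxes m μ) (\ x -> v (u ++ bv m μ x) (Bad-run L _ (heights m μ) u (bv m μ x) e h)) & ∑-0 (boxes m μ)) &
 ∑-cong (upTo (suc L)) (\ y -> ∑-cong (boxes m μ) (\ x -> cong F (LP.++-assoc (replicate (L ∸ y) 0) _ _ &
   cong₂ (\ p q -> replicate p 0 ++ replicate q 1 ++ bv m μ x) (∸-+-assoc hi m y) (sym (m+n∸m≡n m y))))) &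
 cong (\ n -> ∑ (upTo n) (\ y -> g (m + y))) (sym (+-∸-assoc 1 m≤)) &
 sym (∑-map (\ x -> m + x) (upTo (suc hi ∸ m)) g) &
 ∑-cong (range m hi) (\ x -> sym (∑-map (x ∷_) (boxes m μ) (\ xs -> F (bv hi (m ∷ μ) xs)))) &
 sym (∑-concatMap (\ x -> map (x ∷_) (boxes m μ)) (range m hi) (\ xs -> F (bv hi (m ∷ μ) xs)))
 where
 L = hi ∸ m
 g : ℕ -> ℤ
 g x = ∑ (boxes m μ) (\ xs -> F (bv hi (m ∷ μ) (x ∷ xs)))

subZ-++ : ∀ a a' b b' -> length a ≡ length a' -> subZ (a ++ b) (a' ++ b') ≡ subZ a a' ++ subZ b b'
subZ-++ [] [] b b' e = refl
subZ-++ (x ∷ a) (y ∷ a') b b' e = cong (x Z.- + y ∷_) (subZ-++ a a' b b' (suc-injective e))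

toZ-++ : ∀ a b -> toZ (a ++ b) ≡ toZ a ++ toZ b
toZ-++ = LP.map-++ (\ x -> + x)

∈-rangeᵍ : ∀ m hi {x} -> x ∈ range m hi -> m ≤ x × x ≤ hi
∈-rangeᵍ m hi i with MP.∈-map⁻ (\ y -> m + y) i
... | y , j , refl = m≤m+n m y , go m hi (MP.∈-upTo⁻ j)
 where go : ∀ m hi -> y < suc hi ∸ m -> m + y ≤ hi
       go zero hi p = ≤-pred p
       go (suc m) zero p = ⊥-elim (n≮0 (subst (y <_) (0∸n≡0 m) p))
       go (suc m) (suc hi) p = s≤s (go m hi p)

∈-boxes : ∀ hi μ {x} -> x ∈ boxes hi μ -> Decr (hi ∷ μ) -> length x ≡ length μ × Decr (hi ∷ x) × (∀ i -> nthN μ i ≤ nthN x i) × (∀ i -> nthN x (suc i) ≤ nthN μ i)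
∈-boxes hi [] (here refl) d = refl , d , (\ _ -> z≤n) , (\ _ -> z≤n)
∈-boxes hi (m ∷ μ) i (_ , a , d) with ∈-concatMap⁻ (\ x -> map (x ∷_) (boxes m μ)) (range m hi) i
... | x , i₁ , i₂ with MP.∈-map⁻ (x ∷_) i₂ | MP.∈-map⁻ (\ y -> m + y) i₁
... | xs , j , refl | y , j' , refl with ∈-boxes m μ j (a , d)
... | e , (b , d') , lo , hi' = cong suc e , (x≤ ∷ All.map (\ p -> p &≤ m≤m+n m y &≤ x≤) b , All.map (\ p -> p &≤ m≤m+n m y) b , d') ,
 (\ { zero -> m≤m+n m y ; (suc i) -> lo i }) , (\ { zero -> nthN≤ xs 0 b ; (suc i) -> hi' i })
 where x≤ = proj₂ (∈-rangeᵍ m hi i₁)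

heights-split : ∀ x m xs -> Decr (m ∷ xs) -> m ≤ x -> heights x xs ≡ replicate (x ∸ m) (length xs) ++ heights m xs
heights-split x m [] _ p = sym (replicate-+ (x ∸ m) m 0 & cong (\ (n : ℕ) -> replicate n 0) (m∸n+n≡m p))
heights-split x m (x' ∷ xs) (q ∷ _ , _) p = cong (_++ heights x' xs) (cong (\ (n : ℕ) -> replicate n (suc (length xs))) eq & sym (replicate-+ (x ∸ m) (m ∸ x') _)) &
 LP.++-assoc (replicate (x ∸ m) _) _ _
 where eq : x ∸ x' ≡ (x ∸ m) + (m ∸ x')
       eq = cong (_∸ x') (sym (m∸n+n≡m p)) & +-∸-assoc (x ∸ m) q

subZ-replicate : ∀ n s b -> b ≤ s -> subZ (toZ (replicate n s)) (replicate n b) ≡ toZ (replicate n (s ∸ b))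
subZ-replicate zero s b p = refl
subZ-replicate (suc n) s b p = cong₂ _∷_ (ZP.m-n≡m⊖n s b & ZP.⊖-≥ p) (subZ-replicate n s b p)

-- Filling the top boxes of the marked columns turns the column lengths for μ into those for x.
subZ-heights : ∀ hi μ x -> Decr (hi ∷ μ) -> x ∈ boxes hi μ -> subZ (toZ (heights hi μ)) (bv hi μ x) ≡ toZ (heights hi x)
subZ-heights hi [] x d (here refl) = subZ-replicate hi 0 0 z≤n
subZ-heights hi (m ∷ μ) x∷xs d@(_ , d') i with ∈-boxes hi (m ∷ μ) i d | ∈-concatMap⁻ (\ x -> map (x ∷_) (boxes m μ)) (range m hi) i
... | _ , (x≤ ∷ _ , dx) , lo , up | x , _ , i₂ with MP.∈-map⁻ (x ∷_) i₂
... | xs , j , refl = cong (\ d -> subZ d (replicate (hi ∸ x) 0 ++ replicate (x ∸ m) 1 ++ bv m μ xs)) (cong (\ z -> toZ (z ++ heights m μ)) (cong (\ (n : ℕ) -> replicate n s) eq & sym (replicate-+ (hi ∸ x) (x ∸ m) s)) &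
   cong toZ (LP.++-assoc (replicate (hi ∸ x) s) _ _) & toZ-++ (replicate (hi ∸ x) s) _ & cong (toZ (replicate (hi ∸ x) s) ++_) (toZ-++ (replicate (x ∸ m) s) _)) &
 subZ-++ (toZ (replicate (hi ∸ x) s)) _ _ _ (len (hi ∸ x) 0) & cong (subZ (toZ (replicate (hi ∸ x) s)) (replicate (hi ∸ x) 0) ++_) (subZ-++ (toZ (replicate (x ∸ m) s)) _ _ _ (len (x ∸ m) 1)) &
 cong₂ _++_ (subZ-replicate (hi ∸ x) s 0 z≤n) (cong₂ _++_ (subZ-replicate (x ∸ m) s 1 z<s) (subZ-heights m μ xs d' j)) &
 cong₂ (\ (p : ℕ) (q : List ℤ) -> toZ (replicate (hi ∸ x) (suc p)) ++ toZ (replicate (x ∸ m) p) ++ q) (sym lx) refl &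
 cong (toZ (replicate (hi ∸ x) (suc (length xs))) ++_) (sym (toZ-++ (replicate (x ∸ m) (length xs)) _) & cong toZ (sym (heights-split x m xs (proj₁ (proj₂ xs-facts)) (lo 0)))) &
 sym (toZ-++ (replicate (hi ∸ x) (suc (length xs))) _)
 where
 s = suc (length μ)
 xs-facts = ∈-boxes m μ j d'
 lx = proj₁ xs-facts
 eq : hi ∸ m ≡ (hi ∸ x) + (x ∸ m)
 eq = cong (_∸ m) (sym (m∸n+n≡m x≤)) & +-∸-assoc (hi ∸ x) (lo 0)
 len : ∀ n (b : ℕ) -> length (toZ (replicate n s)) ≡ length (replicate n b)
 len n b = LP.length-map _ (replicate n s) & LP.length-replicate n & sym (LP.length-replicate n)

-- Column words and the determinant of elementary sums

module Columns (r : ℕ) where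

 Dz : ℕ -> ℤ -> List (List ℕ)
 Dz n (+ m) = Dec↓ (seg n (r ∸ n)) m
 Dz n -[1+ _ ] = []

 -- e_h(n, n+1, ...) = e_h(n+1, ...) + e_{h-1}(n+1, ...) n, the smallest letter coming last in a
 -- decreasing word; negative h gives 0 on both sides.
 Dz-peel : ∀ n h (f : List ℕ -> ℤ) -> n < r -> ∑ (Dz n h) f ≡ ∑ (Dz (suc n) (h Z.- + 0)) f Z.+ ∑ (Dz (suc n) (h Z.- + 1)) (\ C -> f (C ++ n ∷ []))
 Dz-peel n -[1+ m ] f p = refl
 Dz-peel n (+ zero) f p = sym (+0ʳ _)
 Dz-peel n (+ suc m) f p = cong (\ c -> ∑ (Dec↓ (seg n c) (suc m)) f) (+-∸-assoc 1 p) &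
  ∑-++ (Dec↓ ls (suc m)) _ f & cong₂ (\ a b -> ∑ (Dec↓ ls a) f Z.+ b) (sym (cong suc (+-identityʳ m))) (∑-map (\ C -> C ++ n ∷ []) (Dec↓ ls m) f)
  where ls = seg (suc n) (r ∸ suc n)

 Ok : ℕ -> List ℕ -> Set
 Ok n w = All (_< n) w × (∀ y -> countN y w ≤ 1)

 -- What can stand to the left after a columns have been read: every letter at most a times.
 Pre : ℕ -> List ℕ -> Set
 Pre a v = All (_< r) v × (∀ y -> countN y v ≤ a)

 Dz-Ok : ∀ n h {C} -> n ≤ r -> C ∈ Dz n h -> All (\ z -> n ≤ z × z < r) C × (∀ y -> countN y C ≤ 1)
 Dz-Ok n (+ m) le i with Dec↓-spec n (r ∸ n) m i
 ... | a , _ , u = All.map (\ (y : _ × _) -> proj₁ y , subst (_ <_) (m+[n∸m]≡n le) (proj₂ y)) a , u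

 All-++ : ∀ {P : ℕ -> Set} {a b} -> All P a -> All P b -> All P (a ++ b)
 All-++ [] qs = qs
 All-++ (p ∷ ps) qs = p ∷ All-++ ps qs

 count0 : ∀ {P : ℕ -> Set} y w -> All P w -> ¬ P y -> countN y w ≡ 0
 count0 y [] _ n = refl
 count0 y (z ∷ w) (p ∷ ps) n with y ≡ᵇ z in e
 ... | false = count0 y w ps n
 ... | true = ⊥-elim (n (subst _ (sym (≡ᵇ-true {y} {z} e)) p))

 Pre-add : ∀ n h {C} a v w -> n ≤ r -> C ∈ Dz n h -> Ok n w -> Pre a v -> Pre (suc a) (v ++ C ++ w)
 Pre-add n h {C} a v w le i (wa , wc) (va , vc) = All-++ va (All-++ (All.map proj₂ Ca) (All.map (\ p -> <-≤-trans p le) wa)) ,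
  \ y -> ≤-trans (eq≤ (countN-++ y v (C ++ w) & cong (\ x -> countN y v + x) (countN-++ y C w))) (+-mono-≤ (vc y) (one y) &≤ eq≤ (+-comm a 1))
  where
  Ca = proj₁ (Dz-Ok n h le i)
  Cc = proj₂ (Dz-Ok n h le i)
  one : ∀ y -> countN y C + countN y w ≤ 1
  one y with y <? n
  ... | yes p = +-monoˡ-≤ (countN y w) (eq≤ (count0 y C Ca (\ q -> <⇒≱ p (proj₁ q)))) &≤ wc y
  ... | no ¬p = eq≤ (cong (\ x -> countN y C + x) (count0 y w wa ¬p) & +-identityʳ _) &≤ Cc y

 Ok-wsb : ∀ n ws b -> All (Ok n) ws -> All (Ok (suc n)) (wsb n ws b)
 Ok-wsb n [] b [] = []
 Ok-wsb n (w ∷ ws) [] ok = All.map (\ (y : _ × _) -> All.map m<n⇒m<1+n (proj₁ y) , proj₂ y) ok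
 Ok-wsb n (w ∷ ws) (zero ∷ b) ((a , c) ∷ ok) = (All.map m<n⇒m<1+n a , c) ∷ Ok-wsb n ws b ok
 Ok-wsb n (w ∷ ws) (suc _ ∷ b) ((a , c) ∷ ok) = (≤-refl ∷ All.map m<n⇒m<1+n a , c') ∷ Ok-wsb n ws b ok
  where c' : ∀ y -> countN y (n ∷ w) ≤ 1
        c' y with y ≡ᵇ n in e
        ... | false = c y
        ... | true = s≤s (eq≤ (count0 y w a (\ lt -> <⇒≢ lt (≡ᵇ-true {y} {n} e))))

module Peel (r J : ℕ) (ev : List ℕ -> ℤ) where
 open Columns r public

 -- Σ ev(… C₂ w₂ C₁ w₁ post) over decreasing words C_c of length l_c in the letters n..r-1
 SF : ℕ -> List (List ℕ) -> List ℤ -> List ℕ -> ℤ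
 SF n [] l post = ev post
 SF n (w ∷ ws) [] post = 0z
 SF n (w ∷ ws) (h ∷ l) post = ∑ (Dz n h) (\ C -> SF n ws l (C ++ w ++ post))

 -- The dual Jacobi-Trudi determinant for column lengths d in noncommuting elementary sums, with the
 -- peeled words `ws` kept in place between its factors.
 SJ : ℕ -> List (List ℕ) -> List ℕ -> ℤ
 SJ n ws d = sG (toZ d) (\ l -> SF n ws l [])

 SF-peel : ∀ n ws l post -> n < r -> SF n ws l post ≡ ∑ (bits (length ws)) (\ b -> SF (suc n) (wsb n ws b) (subZ l b) post)
 SF-peel n [] l post p = sym (+0ʳ _)
 SF-peel n (w ∷ ws) [] post p = sym (∑-bits (length ws) _ & cong₂ Z._+_ (∑-0 (bits (length ws))) (∑-0 (bits (length ws))))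
 SF-peel n (w ∷ ws) (h ∷ l) post p = ∑-cong (Dz n h) (\ C -> SF-peel n ws l (C ++ w ++ post) p) &
  ∑-swap (Dz n h) B (\ C b -> G b (C ++ w ++ post)) &
  ∑-cong B (\ b -> Dz-peel n h (\ C -> G b (C ++ w ++ post)) p &
   cong (\ z -> ∑ (Dz (suc n) (h Z.- + 0)) (\ C -> G b (C ++ w ++ post)) Z.+ z) (∑-cong (Dz (suc n) (h Z.- + 1)) (\ C -> cong (G b) (LP.++-assoc C (n ∷ []) (w ++ post))))) &
  ∑-+ B (P 0 w) (P 1 (n ∷ w)) &
  sym (∑-bits (length ws) _)
  where
  B = bits (length ws)
  G : List ℕ -> List ℕ -> ℤ
  G b q = SF (suc n) (wsb n ws b) (subZ l b) q
  P : ℕ -> List ℕ -> List ℕ -> ℤ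
  P x w b = ∑ (Dz (suc n) (h Z.- + x)) (\ C -> G b (C ++ w ++ post))

 SF-neg : ∀ i n ws l post -> i < length ws -> nthZ l i Z.< 0z -> SF n ws l post ≡ 0z
 SF-neg i n (w ∷ ws) [] post p q = refl
 SF-neg zero n (w ∷ ws) (-[1+ x ] ∷ l) post p q = refl
 SF-neg zero n (w ∷ ws) (+ x ∷ l) post p (Z.+<+ ())
 SF-neg (suc i) n (w ∷ ws) (x ∷ l) post (s≤s p) q = ∑-cong (Dz n x) (\ C -> SF-neg i n ws l (C ++ w ++ post) p q) & ∑-0 (Dz n x)

 -- The bounds by J keep the relations inside words that stay within the budget of every letter.
 record Commutes : Set where
  field
   far : ∀ pre p q post -> All (_< r) pre -> (∀ y -> countN y (pre ++ p ∷ q ∷ []) ≤ J) -> suc p < q -> q < r -> ev (pre ++ p ∷ q ∷ post) ≡ ev (pre ++ q ∷ p ∷ post)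
   elm : ∀ n m l pre post -> n ≤ r -> All (_< r) pre -> (∀ y -> countN y pre + 2 ≤ J) ->
    ∑ (Dec↓ (seg n (r ∸ n)) m) (\ C -> ∑ (Dec↓ (seg n (r ∸ n)) l) (\ C' -> ev (pre ++ C ++ C' ++ post)))
    ≡ ∑ (Dec↓ (seg n (r ∸ n)) l) (\ C -> ∑ (Dec↓ (seg n (r ∸ n)) m) (\ C' -> ev (pre ++ C ++ C' ++ post)))

 module _ (cm : Commutes) where
  open Commutes cm

  -- Two families of tails may be exchanged under the sum over the columns further left, provided
  -- they agree behind every admissible prefix.
  SF-lift : ∀ n ws l (A A' : List (List ℕ)) -> n ≤ r -> All (Ok n) ws ->
   (∀ v -> Pre (length ws) v -> ∑ A (\ x -> ev (v ++ x)) ≡ ∑ A' (\ x -> ev (v ++ x))) -> ∑ A (SF n ws l) ≡ ∑ A' (SF n ws l)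
  SF-lift n [] l A A' le ok h = h [] ([] , \ _ -> z≤n)
  SF-lift n (w ∷ ws) [] A A' le ok h = ∑-0 A & sym (∑-0 A')
  SF-lift n (w ∷ ws) (x ∷ l) A A' le (o ∷ ok) h = ∑-swap A (Dz n x) (\ a C -> SF n ws l (C ++ w ++ a)) & ∑-cong∈ (Dz n x) one & ∑-swap (Dz n x) A' (\ C a -> SF n ws l (C ++ w ++ a))
   where
   one : ∀ C -> C ∈ Dz n x -> ∑ A (\ a -> SF n ws l (C ++ w ++ a)) ≡ ∑ A' (\ a -> SF n ws l (C ++ w ++ a))
   one C i = sym (∑-map (\ a -> C ++ w ++ a) A (SF n ws l)) & SF-lift n ws l (map (\ a -> C ++ w ++ a) A) (map (\ a -> C ++ w ++ a) A') le ok
    (\ v pv -> re A v & h (v ++ C ++ w) (Pre-add n x (length ws) v w le i o pv) & sym (re A' v)) & ∑-map (\ a -> C ++ w ++ a) A' (SF n ws l)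
    where re : ∀ A v -> ∑ (map (\ a -> C ++ w ++ a) A) (\ a -> ev (v ++ a)) ≡ ∑ A (\ a -> ev ((v ++ C ++ w) ++ a))
          re A v = ∑-map (\ a -> C ++ w ++ a) A (\ a -> ev (v ++ a)) & ∑-cong A (\ a -> cong ev (cong (v ++_) (sym (LP.++-assoc C w a)) & sym (LP.++-assoc v (C ++ w) a)))

  past-letter : ∀ pre p C post -> All (_< r) pre -> p < r -> All (\ q -> suc p < q × q < r) C -> (∀ y -> countN y pre + (countN y (p ∷ []) + countN y C) ≤ J) ->
   ev (pre ++ p ∷ C ++ post) ≡ ev (pre ++ C ++ p ∷ post)
  past-letter pre p [] post pa pr ca c = refl
  past-letter pre p (q ∷ C) post pa pr ((lt , q<r) ∷ ca) c = far pre p q (C ++ post) pa (\ y -> (eq≤ (e₁ y) &≤ +-monoʳ-≤ (countN y pre) (+-monoʳ-≤ (countN y (p ∷ [])) (m≤m+n _ (countN y C) &≤ eq≤ (sym (countN-++ y (q ∷ []) C))))) &≤ c y) lt q<r &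
   cong ev (sym (LP.++-assoc pre (q ∷ []) _)) & past-letter (pre ++ q ∷ []) p C post (All-++ pa (q<r ∷ [])) pr ca (\ y -> eq≤ (e₂ y) &≤ c y) & cong ev (LP.++-assoc pre (q ∷ []) _)
   where
   e₁ : ∀ y -> countN y (pre ++ p ∷ q ∷ []) ≡ countN y pre + (countN y (p ∷ []) + countN y (q ∷ []))
   e₁ y = countN-++ y pre (p ∷ q ∷ []) & cong (\ x -> countN y pre + x) (countN-++ y (p ∷ []) (q ∷ []))
   e₂ : ∀ y -> countN y (pre ++ q ∷ []) + (countN y (p ∷ []) + countN y C) ≡ countN y pre + (countN y (p ∷ []) + countN y (q ∷ C))
   e₂ y = cong (\ x -> x + (countN y (p ∷ []) + countN y C)) (countN-++ y pre (q ∷ [])) & lem (countN y pre) (countN y (q ∷ [])) (countN y (p ∷ [])) (countN y C) &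
    cong (\ x -> countN y pre + (countN y (p ∷ []) + x)) (sym (countN-++ y (q ∷ []) C))
    where lem : ∀ a b c d -> a + b + (c + d) ≡ a + (c + (b + d))
          lem = NRing.solve-∀

  -- All letters of u differ by at least 2 from those of C, so distant commutation moves them past
  -- each other one at a time.
  past : ∀ pre u C post -> All (_< r) pre -> All (\ p -> All (\ q -> suc p < q × q < r) C × p < r) u -> (∀ y -> countN y pre + (countN y u + countN y C) ≤ J) ->
   ev (pre ++ u ++ C ++ post) ≡ ev (pre ++ C ++ u ++ post)
  past pre [] C post pa ua c = refl
  past pre (p ∷ u) C post pa ((ca , p<r) ∷ ua) c = cong ev (sym (LP.++-assoc pre (p ∷ []) _)) & past (pre ++ p ∷ []) u C post (All-++ pa (p<r ∷ [])) ua (\ y -> eq≤ (e y) &≤ c y) &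
   cong ev (LP.++-assoc pre (p ∷ []) _) & past-letter pre p C (u ++ post) pa p<r ca (\ y -> +-monoʳ-≤ (countN y pre) (+-monoˡ-≤ (countN y C)
    (m≤m+n _ (countN y u) &≤ eq≤ (sym (countN-++ y (p ∷ []) u)))) &≤ c y)
   where
   e : ∀ y -> countN y (pre ++ p ∷ []) + (countN y u + countN y C) ≡ countN y pre + (countN y (p ∷ u) + countN y C)
   e y = cong (\ x -> x + (countN y u + countN y C)) (countN-++ y pre (p ∷ [])) & lem (countN y pre) (countN y (p ∷ [])) (countN y u) (countN y C) &
    cong (\ x -> countN y pre + (x + countN y C)) (sym (countN-++ y (p ∷ []) u))
    where lem : ∀ a b c d -> a + b + (c + d) ≡ a + (b + c + d)
          lem = NRing.solve-∀

  elm± : ∀ n x y pre post -> n ≤ r -> All (_< r) pre -> (∀ y -> countN y pre + 2 ≤ J) ->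
   ∑ (Dz n x) (\ C -> ∑ (Dz n y) (\ C' -> ev (pre ++ C ++ C' ++ post))) ≡ ∑ (Dz n y) (\ C -> ∑ (Dz n x) (\ C' -> ev (pre ++ C ++ C' ++ post)))
  elm± n (+ x) (+ y) pre post le pa c = elm n x y pre post le pa c
  elm± n (+ x) -[1+ y ] pre post le pa c = ∑-0 (Dec↓ (seg n (r ∸ n)) x)
  elm± n -[1+ x ] (+ y) pre post le pa c = sym (∑-0 (Dec↓ (seg n (r ∸ n)) y))
  elm± n -[1+ x ] -[1+ y ] pre post le pa c = refl

  -- Between two neighbouring elementary factors stands only the peeled word of the left column. If
  -- its letters are below n-1 it commutes with the letters from n on, the factors become adjacent,
  -- and they commute.
  SF-swapAt : ∀ i n ws l post -> n ≤ r -> All (Ok n) ws -> length ws ≤ J -> suc i < length ws -> All (\ p -> suc p < n) (nthL ws (suc i)) -> SF n ws (swapAt i l) post ≡ SF n ws l post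
  SF-swapAt zero n (w ∷ ws) [] post le ok J≤ _ fa = refl
  SF-swapAt (suc i) n (w ∷ ws) [] post le ok J≤ _ fa = refl
  SF-swapAt (suc i) n (w ∷ ws) (x ∷ l) post le (_ ∷ ok) J≤ (s≤s lt) fa = ∑-cong (Dz n x) (\ C -> SF-swapAt i n ws l (C ++ w ++ post) le ok (n≤1+n _ &≤ J≤) lt fa)
  SF-swapAt zero n (w ∷ []) l post le ok J≤ (s≤s ()) fa
  SF-swapAt zero n (w ∷ w' ∷ ws) (x ∷ []) post le ok J≤ _ fa = refl
  SF-swapAt zero n (w ∷ w' ∷ ws) (x ∷ y ∷ l) post le (_ ∷ (wa , wc) ∷ ok) J≤ _ fa = sym (as y x) & SF-lift n ws l (A y x) (A x y) le ok h & as x y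
   where
   g : List ℕ -> List ℕ -> List ℕ
   g C C' = C' ++ w' ++ C ++ w ++ post
   A : ℤ -> ℤ -> List (List ℕ)
   A x y = concatMap (\ C -> map (g C) (Dz n y)) (Dz n x)
   ∑A : ∀ x y (f : List ℕ -> ℤ) -> ∑ (A x y) f ≡ ∑ (Dz n x) (\ C -> ∑ (Dz n y) (\ C' -> f (g C C')))
   ∑A x y f = ∑-concatMap (\ C -> map (g C) (Dz n y)) (Dz n x) f & ∑-cong (Dz n x) (\ C -> ∑-map (g C) (Dz n y) f)
   as : ∀ x y -> ∑ (A x y) (SF n ws l) ≡ SF n (w ∷ w' ∷ ws) (x ∷ y ∷ l) post
   as x y = ∑A x y (SF n ws l)
   h : ∀ v -> Pre (length ws) v -> ∑ (A y x) (\ a -> ev (v ++ a)) ≡ ∑ (A x y) (\ a -> ev (v ++ a))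
   h v (va , vc) = norm y x & elm± n x y v (w' ++ w ++ post) le va (\ z -> +-monoˡ-≤ 2 (vc z) &≤ eq≤ (+-comm (length ws) 2) &≤ J≤) & sym (norm x y)
    where
    norm : ∀ x y -> ∑ (A x y) (\ a -> ev (v ++ a)) ≡ ∑ (Dz n y) (\ C' -> ∑ (Dz n x) (\ C -> ev (v ++ C' ++ C ++ w' ++ w ++ post)))
    norm x y = ∑A x y (\ a -> ev (v ++ a)) & ∑-swap (Dz n x) (Dz n y) (\ C C' -> ev (v ++ g C C')) & ∑-cong∈ (Dz n y) (\ C' i' -> ∑-cong∈ (Dz n x) (\ C i -> mvw C i C' i'))
     where
     mvw : ∀ C -> C ∈ Dz n x -> ∀ C' -> C' ∈ Dz n y -> ev (v ++ g C C') ≡ ev (v ++ C' ++ C ++ w' ++ w ++ post)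
     mvw C i C' i' = cong ev (sym (LP.++-assoc v C' _)) & past (v ++ C') w' C (w ++ post) (All-++ va (All.map proj₂ (proj₁ (Dz-Ok n y le i'))))
      (All.map (\ p -> All.map (\ (q : _ × _) -> <-≤-trans p (proj₁ q) , proj₂ q) (proj₁ (Dz-Ok n x le i)) , <-≤-trans (<-trans (n<1+n _) p) le) fa)
      (\ z -> eq≤ (e z) &≤ +-mono-≤ (proj₂ (Pre-add n y (length ws) v w' le i' (wa , wc) (va , vc)) z) (proj₂ (Dz-Ok n x le i) z) &≤ eq≤ (+-comm _ 1) &≤ J≤) & cong ev (LP.++-assoc v C' _)
      where
      e : ∀ z -> countN z (v ++ C') + (countN z w' + countN z C) ≡ countN z (v ++ C' ++ w') + countN z C
      e z = sym (+-assoc (countN z (v ++ C')) _ _) & cong (\ t -> t + countN z C) (sym (countN-++ z (v ++ C') w') & cong (countN z) (LP.++-assoc v C' w'))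

  -- For a mark followed by an unmarked column of equal length x, the lengths become x-1, x, fixed
  -- by the dot action, and the unmarked left column received no letter n, so its word satisfies the
  -- gap condition. A mark on an empty column gives the length -1.
  Bad-cases : ∀ n d b ws -> length ws ≡ length d -> All (Ok n) ws -> Bad d b ->
   (∃[ i ] (suc i < length d × dotAt i (subZ (toZ d) b) ≡ subZ (toZ d) b × All (\ p -> suc p < suc n) (nthL (wsb n ws b) (suc i))))
   ⊎ (∃[ i ] (suc i ≡ length d × nthZ (subZ (toZ d) b) i ≡ Z.- 1z))
  Bad-cases n (x ∷ x ∷ d) (1 ∷ 0 ∷ b) (w ∷ w' ∷ ws) e' (_ ∷ (wa , _) ∷ _) run = inj₁ (0 , s≤s z<s , cong₂ (\ p q -> p ∷ q ∷ subZ (toZ d) b) (l₁ (+ x)) (l₂ (+ x)) , All.map s≤s wa)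
   where l₁ : ∀ x -> (x Z.- 0z) Z.- 1z ≡ x Z.- 1z
         l₁ = solve-∀
         l₂ : ∀ x -> (x Z.- 1z) Z.+ 1z ≡ x Z.- 0z
         l₂ = solve-∀
  Bad-cases n .(0 ∷ []) .(1 ∷ []) ws e' ok last = inj₂ (0 , refl , refl)
  Bad-cases n (x ∷ d) (y ∷ b) (w ∷ ws) e' (_ ∷ ok) (there h) with Bad-cases n d b ws (suc-injective e') ok h
  ... | inj₂ (i , p , q) = inj₂ (suc i , cong suc p , q)
  ... | inj₁ (i , p , q , f) = inj₁ (suc i , s≤s p , cong ((+ x Z.- + y) ∷_) q , keep y f)
   where keep : ∀ y -> All (\ p -> suc p < suc n) (nthL (wsb n ws b) (suc i)) -> All (\ p -> suc p < suc n) (nthL (wsb n (w ∷ ws) (y ∷ b)) (suc (suc i)))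
         keep zero f = f
         keep (suc y) f = f

  -- Peel the letter n from all elementary factors. Marks violating the strip condition contribute
  -- 0, by antisymmetry of the determinant or by a vanishing row; the others are the horizontal
  -- strips.
  SJ-step : ∀ n ws μ -> n < r -> All (Ok n) ws -> length ws ≡ J -> Decr (J ∷ μ) -> SJ n ws (heights J μ) ≡ ∑ (boxes J μ) (\ x -> SJ (suc n) (wsb n ws (bv J μ x)) (heights J x))
  SJ-step n ws μ n<r ok lw dμ = sG-cong γ (\ l -> SF-peel n ws l [] n<r) &
   alt-∑ (iota 0z (length γ)) (offs 0z γ) (bits (length ws)) (\ b l -> G b (subZ l b)) &
   ∑-cong (bits (length ws)) (\ b -> mvb b) &
   cong (\ L -> ∑ (bits L) F) lw &
   bits-heights J μ dμ F van &
   ∑-cong∈ (boxes J μ) (\ x i -> cong (\ g -> sG g (G (bv J μ x))) (subZ-heights J μ x dμ i))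
   where
   γ = toZ (heights J μ)
   G : List ℕ -> List ℤ -> ℤ
   G b l = SF (suc n) (wsb n ws b) l []
   F : List ℕ -> ℤ
   F b = sG (subZ γ b) (G b)
   alt-subγ : ∀ cs γ b (F : List ℤ -> ℤ) -> alt cs γ (\ l -> F (subZ l b)) ≡ alt cs (subZ γ b) F
   alt-subγ cs [] [] F = refl
   alt-subγ cs [] (x ∷ b) F = refl
   alt-subγ cs (g ∷ γ) [] F = ∑±-cong cs (\ c r _ -> alt-cong r γ (\ l -> refl) & refl)
   alt-subγ cs (g ∷ γ) (x ∷ b) F = ∑±-cong cs (\ c r _ -> alt-subγ r γ b (\ l -> F (((g Z.+ c) Z.- + x) ∷ l)) & alt-cong r (subZ γ b) (\ l -> cong (\ z -> F (z ∷ l)) (lem g c (+ x))))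
    where lem : ∀ g c x -> (g Z.+ c) Z.- x ≡ (g Z.- x) Z.+ c
          lem = solve-∀
   mvb : ∀ b -> sG γ (\ l -> G b (subZ l b)) ≡ F b
   mvb b = alt-subγ (iota 0z (length γ)) (offs 0z γ) b (G b) & cong₂ (\ p q -> alt (iota 0z p) q (G b)) (sym (length-subZ γ b)) (offs-subZ 0z γ b)
   lγ : length γ ≡ J
   lγ = LP.length-map _ (heights J μ) & length-heights J μ dμ
   van : ∀ b -> Bad (heights J μ) b -> F b ≡ 0z
   van b h with Bad-cases n (heights J μ) b ws (lw & sym (length-heights J μ dμ)) ok h
   ... | inj₁ (i , p , q , f) = self-neg (F b) (cong (\ g -> sG g (G b)) (sym q) & sG-dotAt i (subZ γ b) (G b) (subst (suc i <_) (length-heights J μ dμ & sym lγ & sym (length-subZ γ b)) p)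
    (\ l -> SF-swapAt i (suc n) (wsb n ws b) l [] n<r (Ok-wsb n ws b ok) (eq≤ lwb) (subst (suc i <_) (length-heights J μ dμ & sym lwb) p) f))
    where lwb = length-wsb n ws b & lw
   ... | inj₂ (i , p , q) = sG-rowNeg (subZ γ b) i (G b) (subst (i <_) Ls ≤-refl)
    (subst₂ (\ x y -> x Z.+ + y Z.≤ + i) (sym q) Ls (ZP.≤-reflexive (cong (\ z -> Z.- 1z Z.+ z) (ZP.pos-+ 1 i) & lem (+ i))))
    (\ l a c -> SF-neg i (suc n) (wsb n ws b) l [] (subst (i <_) (p & length-heights J μ dμ & sym lw & sym (length-wsb n ws b)) ≤-refl) c)
    where Ls : suc i ≡ length (subZ γ b)
          Ls = p & length-heights J μ dμ & sym lγ & sym (length-subZ γ b)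
          lem : ∀ i -> Z.- 1z Z.+ (1z Z.+ i) ≡ i
          lem = solve-∀

 cat : List (List ℕ) -> List ℕ -> List ℕ
 cat [] post = post
 cat (w ∷ ws) post = cat ws (w ++ post)

 private
  r∸r : ∀ m -> Dec↓ (seg r (r ∸ r)) (suc m) ≡ []
  r∸r m = cong (\ c -> Dec↓ (seg r c) (suc m)) (n∸n≡0 r)

 SF-0 : ∀ ws n post -> length ws ≡ n -> SF r ws (toZ (replicate n 0)) post ≡ ev (cat ws post)
 SF-0 [] zero post e = refl
 SF-0 (w ∷ ws) (suc n) post e = +0ʳ _ & SF-0 ws n (w ++ post) (suc-injective e)

 sG-0 : ∀ n (F : List ℤ -> ℤ) -> (∀ i l -> i < n -> i < length l -> nthZ l i Z.< 0z -> F l ≡ 0z) -> sG (toZ (replicate n 0)) F ≡ F (toZ (replicate n 0))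
 sG-0 zero F v = refl
 sG-0 (suc n) F v = cong (\ g -> sG g F) snoc & sG-snoc0 γ F (\ l p q -> v (length γ) l (eq≤ (cong suc lγ)) p q) &
  sG-0 n (\ l -> F (l ++ 0z ∷ [])) (\ i l p q s -> v i (l ++ 0z ∷ []) (m<n⇒m<1+n p) (<-≤-trans q (m≤m+n _ 1 &≤ eq≤ (sym (LP.length-++ l)))) (subst (Z._< 0z) (sym (nth-++ l i q)) s)) & cong F (sym snoc)
  where
  γ = toZ (replicate n 0)
  lγ : length γ ≡ n
  lγ = LP.length-map _ (replicate n 0) & LP.length-replicate n
  snoc : toZ (replicate (suc n) 0) ≡ γ ++ 0z ∷ []
  snoc = cong toZ (cong (\ (m : ℕ) -> replicate m 0) (+-comm 1 n) & sym (replicate-+ n 1 0)) & toZ-++ (replicate n 0) (0 ∷ [])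
  nth-++ : ∀ l i -> i < length l -> nthZ (l ++ 0z ∷ []) i ≡ nthZ l i
  nth-++ (x ∷ l) zero p = refl
  nth-++ (x ∷ l) (suc i) (s≤s p) = nth-++ l i p

 SJ-end : ∀ ws -> length ws ≡ J -> SJ r ws (replicate J 0) ≡ ev (cat ws [])
 SJ-end ws e = sG-0 J (\ l -> SF r ws l []) (\ i l p q s -> SF-neg i r ws l [] (subst (i <_) (sym e) p) s) & SF-0 ws J [] e

 -- No letters are left, and the first row of the determinant contains only elementary sums of
 -- positive degree.
 SJ-end-0 : ∀ ws s d -> 0 < length ws -> SJ r ws (suc s ∷ d) ≡ 0z
 SJ-end-0 (w ∷ ws) s d _ = alt-bad (\ z -> 0z Z.< z) 0 (iota 0z (suc (length (toZ d)))) (offs 0z (toZ (suc s ∷ d))) _ z<s (\ i -> pos (iota≥ 0z _ i)) zer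
  where
  iota≥ : ∀ s n {c} -> c ∈ iota s n -> s Z.≤ c
  iota≥ s (suc n) (here refl) = ZP.≤-refl
  iota≥ s (suc n) (there i) = ZP.≤-trans (ZP.i≤i+j s 1z) (iota≥ (s Z.+ 1z) n i)
  pos : ∀ {c} -> 0z Z.≤ c -> 0z Z.< (+ suc s Z.- 0z) Z.+ c
  pos {+ c} p = Z.+<+ z<s
  zer : ∀ l -> 0 < length l -> 0z Z.< nthZ l 0 -> SF r (w ∷ ws) l [] ≡ 0z
  zer (+ suc x ∷ l) p q = cong (\ D -> ∑ D (\ C -> SF r ws l (C ++ w ++ []))) (r∸r x)
  zer (+ zero ∷ l) p (Z.+<+ ())

heights-full : ∀ hi μ -> Decr (hi ∷ μ) -> (μ ≡ replicate (length μ) hi × heights hi μ ≡ replicate hi 0) ⊎ (μ ≢ replicate (length μ) hi × 0 < hi × ∃[ s ] ∃[ d ] heights hi μ ≡ suc s ∷ d)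
heights-full hi [] _ = inj₁ (refl , refl)
heights-full hi (m ∷ μ) (p ∷ _ , d) with m ≟ hi
... | yes refl rewrite n∸n≡0 m = go (heights-full m μ d)
 where go : _ -> _
       go (inj₁ (e , q)) = inj₁ (cong (m ∷_) e , q)
       go (inj₂ (ne , pos , q)) = inj₂ ((\ e -> ne (LP.∷-injectiveʳ e)) , pos , q)
... | no ¬p = inj₂ ((\ e -> ¬p (LP.∷-injectiveˡ e)) , ≤-<-trans z≤n m<hi , length μ , _ , cong (\ n -> replicate n (suc (length μ)) ++ heights m μ) (suc-pred′ (m<n⇒0<n∸m m<hi)))
 where
 m<hi = ≤∧≢⇒< p ¬p
 suc-pred′ : ∀ {n} -> 0 < n -> n ≡ suc (n ∸ 1)
 suc-pred′ (s≤s _) = refl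

-- Tableaux row by row: removing the smallest letter

down : ℕ -> List ℕ
down zero = []
down (suc h) = suc h ∷ down h

all-cong : ∀ {A : Set} {p q : A -> Bool} xs -> (∀ x -> x ∈ xs -> p x ≡ q x) -> all p xs ≡ all q xs
all-cong [] e = refl
all-cong (x ∷ xs) e = cong₂ _∧_ (e x (here refl)) (all-cong xs (\ y i -> e y (there i)))

nthN-rep< : ∀ a (n : ℕ) t i -> i < a -> nthN (replicate a n ++ t) i ≡ n
nthN-rep< (suc a) n t zero _ = refl
nthN-rep< (suc a) n t (suc i) (s≤s p) = nthN-rep< a n t i p

nthN-rep≥ : ∀ a (n : ℕ) t i -> nthN (replicate a n ++ t) (a + i) ≡ nthN t i
nthN-rep≥ zero n t i = refl
nthN-rep≥ (suc a) n t i = nthN-rep≥ a n t i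

range-∷ : ∀ n r -> n ≤ r -> range n r ≡ n ∷ range (suc n) r
range-∷ n r p = cong (\ k -> map (\ x -> n + x) (upTo k)) (+-∸-assoc 1 p) & cong₂ _∷_ (+-identityʳ n)
 (cong (map (\ x -> n + x)) (sym (LP.map-upTo suc (r ∸ n))) & sym (LP.map-∘ (upTo (r ∸ n))) & LP.map-cong (\ x -> +-suc n x) (upTo (r ∸ n)))

∈-incr : ∀ L lo hi {t} -> t ∈ incr L lo hi -> length t ≡ L × All (lo ≤_) t
∈-incr zero lo hi (here refl) = refl , []
∈-incr (suc L) lo hi i with ∈-concatMap⁻ (\ a -> map (a ∷_) (incr L a hi)) (range lo hi) i
... | a , j , k with MP.∈-map⁻ (a ∷_) k | MP.∈-map⁻ (\ x -> lo + x) j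
... | t , k' , refl | y , _ , refl with ∈-incr L a hi k'
... | e , b = cong suc e , m≤m+n lo y ∷ All.map (≤-trans (m≤m+n lo y)) b

∑-incr : ∀ L n r (f : List ℕ -> ℤ) -> n ≤ r -> ∑ (incr L n r) f ≡ ∑ (upTo (suc L)) (\ y -> ∑ (incr (L ∸ y) (suc n) r) (\ t -> f (replicate y n ++ t)))
∑-incr zero n r f p = sym (+0ʳ _)
∑-incr (suc L) n r f p = cong (\ l -> ∑ (concatMap g l) f) (range-∷ n r p) &
 ∑-++ (map (n ∷_) (incr L n r)) _ f &
 cong (\ z -> z Z.+ ∑ (incr (suc L) (suc n) r) f) (∑-map (n ∷_) (incr L n r) f & ∑-incr L n r (\ t -> f (n ∷ t)) p) &
 ZP.+-comm _ (h 0) &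
 sym (∑-upTo (suc L) h)
 where
 g = \ a -> map (a ∷_) (incr L a r)
 h : ℕ -> ℤ
 h y = ∑ (incr (suc L ∸ y) (suc n) r) (\ t -> f (replicate y n ++ t))

∑-range : ∀ m W (g : ℕ -> ℤ) -> m ≤ W -> ∑ (range m W) g ≡ ∑ (upTo (suc (W ∸ m))) (\ y -> g (m + y))
∑-range m W g p = ∑-map (\ x -> m + x) (upTo (suc W ∸ m)) g & cong (\ k -> ∑ (upTo k) (\ y -> g (m + y))) (+-∸-assoc 1 p)

≤ᵇ-false⁺ : ∀ {m n} -> n < m -> (m ≤ᵇ n) ≡ false
≤ᵇ-false⁺ {m} {n} p with m ≤ᵇ n in e
... | false = refl
... | true = ⊥-elim (<⇒≱ p (≤ᵇ-true⁻ e))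

∑-cut : ∀ K L (g : ℕ -> ℤ) (p : ℕ -> Bool) -> L ≤ K -> (∀ y -> y ≤ L -> p y ≡ true) -> (∀ y -> L < y -> p y ≡ false) ->
 ∑ (upTo (suc K)) (\ y -> if p y then g y else 0z) ≡ ∑ (upTo (suc L)) g
∑-cut K L g p le t f with m≤n⇒m<n∨m≡n le
... | inj₂ refl = ∑-cong∈ (upTo (suc L)) (\ y i -> cong (\ b -> if b then g y else 0z) (t y (≤-pred (MP.∈-upTo⁻ i))))
∑-cut (suc K) L g p le t f | inj₁ (s≤s q) = ∑-upTo-last (suc K) (\ y -> if p y then g y else 0z) & cong₂ Z._+_ (∑-cut K L g p q t f) (cong (\ b -> if b then g (suc K) else 0z) (f (suc K) (s≤s q))) & +0ʳ _

module Tab (r W : ℕ) where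

 lt? : List ℕ -> ℕ -> List ℕ -> ℕ -> ℕ -> Bool
 lt? t m t' m' c = if m <ᵇ c then nthN t (c ∸ m ∸ 1) <ᵇ nthN t' (c ∸ m' ∸ 1) else true

 strictR : List ℕ -> List (List ℕ) -> Bool
 strictR (m ∷ m' ∷ μ) (t ∷ t' ∷ T) = all (lt? t m t' m') (range 1 W) ∧ strictR (m' ∷ μ) (t' ∷ T)
 strictR _ _ = true

 colR : List ℕ -> List (List ℕ) -> ℕ -> List ℕ
 colR (m ∷ μ) (t ∷ T) c = colR μ T c ++ (if m <ᵇ c then (nthN t (c ∸ m ∸ 1) ∸ 1) ∷ [] else [])
 colR _ _ c = []

 -- Puts the letter n into the boxes of x/μ at the beginning of the rows of T.
 prep : ℕ -> List ℕ -> List ℕ -> List (List ℕ) -> List (List ℕ)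
 prep n (m ∷ μ) (x ∷ xs) (t ∷ T) = (replicate (x ∸ m) n ++ t) ∷ prep n μ xs T
 prep n _ _ T = []

 CT : ℕ -> List ℕ -> List (List (List ℕ))
 CT n μ = cartesian (map (\ m -> incr (W ∸ m) n r) μ)

 wider : List ℕ -> List (List ℕ)
 wider [] = [] ∷ []
 wider (m ∷ μ) = concatMap (\ x -> map (x ∷_) (wider μ)) (range m W)

 inBox : ℕ -> List ℕ -> List ℕ -> Bool
 inBox hi (m ∷ μ) (x ∷ xs) = (x ≤ᵇ hi) ∧ inBox m μ xs
 inBox hi _ _ = true

 ∑-CT : ∀ n μ (g : List (List ℕ) -> ℤ) -> n ≤ r -> All (_≤ W) μ -> ∑ (CT n μ) g ≡ ∑ (wider μ) (\ x -> ∑ (CT (suc n) x) (\ T -> g (prep n μ x T)))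
 ∑-CT n [] g p _ = sym (+0ʳ _)
 ∑-CT n (m ∷ μ) g p (q ∷ qs) = ∑-prod I (CT n μ) g &
  ∑-cong I (\ t -> ∑-CT n μ (\ T -> g (t ∷ T)) p qs) &
  ∑-incr (W ∸ m) n r G p &
  ∑-cong (upTo (suc (W ∸ m))) (\ y -> cong₂ (\ a b -> ∑ (incr a (suc n) r) (\ t -> G (replicate b n ++ t))) (∸-+-assoc W m y) (sym (m+n∸m≡n m y))) &
  sym (∑-range m W E q) &
  ∑-cong (range m W) (\ x -> ∑-swap (incr (W ∸ x) (suc n) r) (wider μ) (\ t xs -> ∑ (CT (suc n) xs) (\ T -> g ((replicate (x ∸ m) n ++ t) ∷ prep n μ xs T))) &
   ∑-cong (wider μ) (\ xs -> sym (∑-prod (incr (W ∸ x) (suc n) r) (CT (suc n) xs) (\ T -> g (prep n (m ∷ μ) (x ∷ xs) T))))) &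
  sym (∑-prod (range m W) (wider μ) (\ x -> ∑ (CT (suc n) x) (\ T -> g (prep n (m ∷ μ) x T))))
  where
  I = incr (W ∸ m) n r
  ∑-prod : ∀ {A : Set} (xs : List A) (Ts : List (List A)) (f : List A -> ℤ) -> ∑ (concatMap (\ x -> map (x ∷_) Ts) xs) f ≡ ∑ xs (\ x -> ∑ Ts (\ T -> f (x ∷ T)))
  ∑-prod xs Ts f = ∑-concatMap (\ x -> map (x ∷_) Ts) xs f & ∑-cong xs (\ x -> ∑-map (x ∷_) Ts f)
  G : List ℕ -> ℤ
  G t = ∑ (wider μ) (\ xs -> ∑ (CT (suc n) xs) (\ T -> g (t ∷ prep n μ xs T)))
  E : ℕ -> ℤ
  E x = ∑ (incr (W ∸ x) (suc n) r) (\ t -> G (replicate (x ∸ m) n ++ t))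

 ∑-inBox : ∀ hi μ (f : List ℕ -> ℤ) -> hi ≤ W -> Decr (hi ∷ μ) -> ∑ (wider μ) (\ x -> if inBox hi μ x then f x else 0z) ≡ ∑ (boxes hi μ) f
 ∑-inBox hi [] f p d = refl
 ∑-inBox hi (m ∷ μ) f p (q ∷ _ , d) = ∑-concatMap (\ x -> map (x ∷_) (wider μ)) (range m W) _ & ∑-cong (range m W) (\ x -> ∑-map (x ∷_) (wider μ) _ & pull (x ≤ᵇ hi) x) &
  ∑-range m W _ (q &≤ p) & ∑-cut (W ∸ m) (hi ∸ m) (\ y -> G (m + y)) (\ y -> m + y ≤ᵇ hi) (∸-monoˡ-≤ m p) (\ y l -> ≤ᵇ-true⁺ (+-monoʳ-≤ m l &≤ eq≤ (m+[n∸m]≡n q))) (\ y l -> ≤ᵇ-false⁺ (≤-<-trans (eq≤ (sym (m+[n∸m]≡n q))) (+-monoʳ-< m l))) & sym (∑-range m hi G q) &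
  ∑-cong (range m hi) (\ x -> sym (∑-map (x ∷_) (boxes m μ) f)) & sym (∑-concatMap (\ x -> map (x ∷_) (boxes m μ)) (range m hi) f)
  where
  G : ℕ -> ℤ
  G x = ∑ (boxes m μ) (\ xs -> f (x ∷ xs))
  pull : ∀ b x -> ∑ (wider μ) (\ xs -> if b ∧ inBox m μ xs then f (x ∷ xs) else 0z) ≡ (if b then G x else 0z)
  pull true x = ∑-inBox m μ (\ xs -> f (x ∷ xs)) (q &≤ p) d
  pull false x = ∑-0 (wider μ)

 data Fill (n : ℕ) : List ℕ -> List (List ℕ) -> Set where
  [] : Fill n [] []
  _∷_ : ∀ {x xs t T} -> length t ≡ W ∸ x × All (n ≤_) t -> Fill n xs T -> Fill n (x ∷ xs) (t ∷ T)

 ∈-CT : ∀ n xs {T} -> T ∈ CT n xs -> Fill n xs T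
 ∈-CT n [] (here refl) = []
 ∈-CT n (x ∷ xs) i with ∈-concatMap⁻ (\ t -> map (t ∷_) (CT n xs)) (incr (W ∸ x) n r) i
 ... | t , j , k with MP.∈-map⁻ (t ∷_) k
 ... | T , k' , refl = ∈-incr (W ∸ x) n r j ∷ ∈-CT n xs k'

 All-nthN : ∀ {n} t i -> All (n ≤_) t -> i < length t -> n ≤ nthN t i
 All-nthN (x ∷ t) zero (p ∷ _) _ = p
 All-nthN (x ∷ t) (suc i) (_ ∷ ps) (s≤s q) = All-nthN t i ps q

 at-old : ∀ {m x c} n t -> m ≤ x -> x < c -> nthN (replicate (x ∸ m) n ++ t) (c ∸ m ∸ 1) ≡ nthN t (c ∸ x ∸ 1)
 at-old {m} {x} {c} n t p q = cong (nthN (replicate (x ∸ m) n ++ t)) eq & nthN-rep≥ (x ∸ m) n t (c ∸ x ∸ 1)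
  where eq : c ∸ m ∸ 1 ≡ (x ∸ m) + (c ∸ x ∸ 1)
        eq = cong (\ z -> z ∸ m ∸ 1) (sym (m+[n∸m]≡n (<⇒≤ q))) & cong (_∸ 1) (+-∸-comm (c ∸ x) p) & +-∸-assoc (x ∸ m) (m<n⇒0<n∸m q)

 at-new : ∀ {m x c} n t -> m < c -> c ≤ x -> nthN (replicate (x ∸ m) n ++ t) (c ∸ m ∸ 1) ≡ n
 at-new {m} {x} {c} n t p q = nthN-rep< (x ∸ m) n t (c ∸ m ∸ 1) (<-≤-trans (eq≤ (m+[n∸m]≡n (m<n⇒0<n∸m p))) (∸-monoˡ-≤ m q))

 -- A letter n in the lower row cannot lie under a box of the upper row, whose entries are at least
 -- n; hence x' ≤ m. Then the new letters create no other violation, since they are smaller than all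
 -- old entries.
 adjacent : ∀ n {m x t m' x' t'} -> m' ≤ m -> m ≤ x -> x ≤ W -> m' ≤ x' -> x' ≤ W -> length t ≡ W ∸ x × All (suc n ≤_) t -> length t' ≡ W ∸ x' × All (suc n ≤_) t' ->
  all (lt? (replicate (x ∸ m) n ++ t) m (replicate (x' ∸ m') n ++ t') m') (range 1 W) ≡ (x' ≤ᵇ m) ∧ all (lt? t x t' x') (range 1 W)
 adjacent n {m} {x} {t} {m'} {x'} {t'} m'm mx xW m'x' x'W (lt , at) (lt' , at') with x' ≤ᵇ m in e
 ... | true = all-cong (range 1 W) (\ c i -> one c (proj₂ (∈-range⁻ W i)))
  where
  x'm = ≤ᵇ-true⁻ e
  idx : ∀ {x c} -> x < c -> c ≤ W -> c ∸ x ∸ 1 < W ∸ x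
  idx {x} p q = <-≤-trans (eq≤ (m+[n∸m]≡n (m<n⇒0<n∸m p))) (∸-monoˡ-≤ x q)
  one : ∀ c -> c ≤ W -> lt? (replicate (x ∸ m) n ++ t) m (replicate (x' ∸ m') n ++ t') m' c ≡ lt? t x t' x' c
  one c cW with m <? c
  ... | no ¬p rewrite <ᵇ-false⁺ {m} {c} (≮⇒≥ ¬p) | <ᵇ-false⁺ {x} {c} (≮⇒≥ ¬p &≤ mx) = refl
  ... | yes p rewrite <ᵇ-true⁺ {m} {c} p | at-old {m'} {x'} {c} n t' m'x' (≤-<-trans x'm p) with x <? c
  ... | yes q rewrite <ᵇ-true⁺ {x} {c} q | at-old {m} {x} {c} n t mx q = refl
  ... | no ¬q rewrite <ᵇ-false⁺ {x} {c} (≮⇒≥ ¬q) | at-new {m} {x} {c} n t p (≮⇒≥ ¬q) =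
   <ᵇ-true⁺ (All-nthN t' (c ∸ x' ∸ 1) at' (subst (c ∸ x' ∸ 1 <_) (sym lt') (idx (≤-<-trans x'm p) cW)))
 ... | false with all (lt? (replicate (x ∸ m) n ++ t) m (replicate (x' ∸ m') n ++ t') m') (range 1 W) in e'
 ... | false = refl
 ... | true = ⊥-elim (bad (all⁻ _ (range 1 W) e' (suc m) (∈-range⁺ W z<s (m<x' &≤ x'W))))
  where
  m<x' : m < x'
  m<x' = ≰⇒> (\ h -> case (sym (≤ᵇ-true⁺ h) & e))
   where case : true ≡ false -> ⊥
         case ()
  bad : lt? (replicate (x ∸ m) n ++ t) m (replicate (x' ∸ m') n ++ t') m' (suc m) ≡ true -> ⊥
  bad h rewrite <ᵇ-true⁺ {m} {suc m} ≤-refl | at-new {m'} {x'} {suc m} n t' (s≤s m'm) m<x' = <⇒≱ (<ᵇ-true⁻ {nthN (replicate (x ∸ m) n ++ t) (suc m ∸ m ∸ 1)} h) ge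
   where
   ge : n ≤ nthN (replicate (x ∸ m) n ++ t) (suc m ∸ m ∸ 1)
   ge with m <? x
   ... | yes p = eq≤ (sym (at-new {m} {x} {suc m} n t ≤-refl p))
   ... | no ¬p = (n≤1+n n &≤ All-nthN t (suc m ∸ x ∸ 1) at (subst (suc m ∸ x ∸ 1 <_) (sym lt) (sub (≮⇒≥ ¬p)))) &≤ eq≤ (sym (at-old {m} {x} {suc m} n t mx (s≤s (≮⇒≥ ¬p))))
    where sub : x ≤ m -> suc m ∸ x ∸ 1 < W ∸ x
          sub q = <-≤-trans (eq≤ (m+[n∸m]≡n (m<n⇒0<n∸m (s≤s q)))) (∸-monoˡ-≤ x (m<x' &≤ x'W))

 data Wide : List ℕ -> List ℕ -> Set where
  [] : Wide [] []
  _∷_ : ∀ {m μ x xs} -> m ≤ x × x ≤ W -> Wide μ xs -> Wide (m ∷ μ) (x ∷ xs)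

 ∈-wider : ∀ μ {x} -> x ∈ wider μ -> Wide μ x
 ∈-wider [] (here refl) = []
 ∈-wider (m ∷ μ) i with ∈-concatMap⁻ (\ x -> map (x ∷_) (wider μ)) (range m W) i
 ... | x , i₁ , i₂ with MP.∈-map⁻ (x ∷_) i₂
 ... | xs , j , refl = ∈-rangeᵍ m W i₁ ∷ ∈-wider μ j

 strict-prep : ∀ n {m μ x xs T} -> Decr (m ∷ μ) -> Wide (m ∷ μ) (x ∷ xs) -> Fill (suc n) (x ∷ xs) T ->
  strictR (m ∷ μ) (prep n (m ∷ μ) (x ∷ xs) T) ≡ inBox m μ xs ∧ strictR (x ∷ xs) T
 strict-prep n _ (_ ∷ []) (_ ∷ []) = refl
 strict-prep n {m} {m' ∷ μ} {x} {x' ∷ xs} {t ∷ t' ∷ T} (p ∷ _ , d) ((mx , xW) ∷ wd@((m'x' , x'W) ∷ _)) (f ∷ fl@(f' ∷ _)) =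
  cong₂ _∧_ (adjacent n p mx xW m'x' x'W f f') (strict-prep n d wd fl) & lem (x' ≤ᵇ m) _ (inBox m' μ xs) _
  where lem : ∀ a b c d -> (a ∧ b) ∧ (c ∧ d) ≡ (a ∧ c) ∧ (b ∧ d)
        lem false b c d = refl
        lem true false false d = refl
        lem true false true d = refl
        lem true true c d = refl

 strict-prep₀ : ∀ n μ {x T} -> Decr (W ∷ μ) -> Wide μ x -> Fill (suc n) x T -> strictR μ (prep n μ x T) ≡ inBox W μ x ∧ strictR x T
 strict-prep₀ n [] d [] [] = refl
 strict-prep₀ n (m ∷ μ) {x ∷ xs} {t ∷ T} (_ , d) wd@((_ , xW) ∷ _) (f ∷ fl) = strict-prep n d wd (f ∷ fl) & cong (\ b -> (b ∧ inBox m μ xs) ∧ strictR (x ∷ xs) (t ∷ T)) (sym (≤ᵇ-true⁺ xW))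

 data In : ℕ -> List ℕ -> List ℕ -> Set where
  [] : ∀ {hi} -> In hi [] []
  _∷_ : ∀ {hi m μ x xs} -> m ≤ x × x ≤ hi × All (_≤ m) xs -> In m μ xs -> In hi (m ∷ μ) (x ∷ xs)

 ∈-In : ∀ hi μ {x} -> Decr (hi ∷ μ) -> x ∈ boxes hi μ -> In hi μ x
 ∈-In hi [] d (here refl) = []
 ∈-In hi (m ∷ μ) (_ , d) i with ∈-concatMap⁻ (\ x -> map (x ∷_) (boxes m μ)) (range m hi) i
 ... | x , i₁ , i₂ with MP.∈-map⁻ (x ∷_) i₂
 ... | xs , j , refl = (proj₁ (∈-rangeᵍ m hi i₁) , proj₂ (∈-rangeᵍ m hi i₁) , proj₁ (proj₁ (proj₂ (∈-boxes m μ j d)))) ∷ ∈-In m μ d j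

 B : List ℕ -> List ℕ -> ℕ -> Bool
 B (m ∷ μ) (x ∷ xs) c = ((m <ᵇ c) ∧ (c ≤ᵇ x)) ∨ B μ xs c
 B _ _ c = false

 B-off : ∀ μ xs c -> All (_< c) xs -> B μ xs c ≡ false
 B-off [] xs c _ = refl
 B-off (m ∷ μ) [] c _ = refl
 B-off (m ∷ μ) (x ∷ xs) c (p ∷ ps) with m <ᵇ c
 ... | false = B-off μ xs c ps
 ... | true rewrite ≤ᵇ-false⁺ {c} {x} p = B-off μ xs c ps

 colR-prep : ∀ n {hi μ x T} c -> In hi μ x -> Fill (suc n) x T -> colR μ (prep n μ x T) c ≡ colR x T c ++ (if B μ x c then (n ∸ 1) ∷ [] else [])
 colR-prep n c [] [] = refl
 colR-prep n {μ = m ∷ μ} {x ∷ xs} {t ∷ T} c ((mx , _ , xs≤) ∷ bx) (_ ∷ fl) with m <? c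
 ... | no ¬p rewrite <ᵇ-false⁺ {m} {c} (≮⇒≥ ¬p) | <ᵇ-false⁺ {x} {c} (≮⇒≥ ¬p &≤ mx) =
  LP.++-identityʳ _ & colR-prep n c bx fl & cong (_++ (if B μ xs c then (n ∸ 1) ∷ [] else [])) (sym (LP.++-identityʳ _))
 ... | yes p rewrite <ᵇ-true⁺ {m} {c} p | B-off μ xs c (All.map (\ q -> ≤-<-trans q p) xs≤) with x <? c
 ... | yes q rewrite <ᵇ-true⁺ {x} {c} q | ≤ᵇ-false⁺ {c} {x} q | at-old {m} {x} {c} n t mx q =
  cong (_++ (nthN t (c ∸ x ∸ 1) ∸ 1) ∷ []) (colR-prep n c bx fl & cong (\ b -> colR xs T c ++ (if b then (n ∸ 1) ∷ [] else [])) Boff & LP.++-identityʳ _) & sym (LP.++-identityʳ _)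
  where Boff = B-off μ xs c (All.map (\ q -> ≤-<-trans q p) xs≤)
 ... | no ¬q rewrite <ᵇ-false⁺ {x} {c} (≮⇒≥ ¬q) | ≤ᵇ-true⁺ {c} {x} (≮⇒≥ ¬q) | at-new {m} {x} {c} n t p (≮⇒≥ ¬q) =
  cong (_++ (n ∸ 1) ∷ []) (colR-prep n c bx fl & cong (\ b -> colR xs T c ++ (if b then (n ∸ 1) ∷ [] else [])) Boff)
  where Boff = B-off μ xs c (All.map (\ q -> ≤-<-trans q p) xs≤)

 bit : Bool -> ℕ
 bit b = if b then 1 else 0

 map-down : ∀ (f : ℕ -> ℕ) hi m v -> m ≤ hi -> (∀ c -> m < c -> c ≤ hi -> f c ≡ v) -> map f (down hi) ≡ replicate (hi ∸ m) v ++ map f (down m)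
 map-down f hi m v p h with m≤n⇒m<n∨m≡n p
 ... | inj₂ refl = cong (\ (n : ℕ) -> replicate n v ++ map f (down m)) (sym (n∸n≡0 m))
 map-down f (suc hi) m v p h | inj₁ (s≤s q) = cong₂ _∷_ (h (suc hi) (s≤s q) ≤-refl) (map-down f hi m v q (\ c a b -> h c a (m≤n⇒m≤1+n b))) &
  cong (\ (n : ℕ) -> replicate n v ++ map f (down m)) (sym (+-∸-assoc 1 q))

 map-down-cong : ∀ (f g : ℕ -> ℕ) m -> (∀ c -> c ≤ m -> f c ≡ g c) -> map f (down m) ≡ map g (down m)
 map-down-cong f g zero h = refl
 map-down-cong f g (suc m) h = cong₂ _∷_ (h (suc m) ≤-refl) (map-down-cong f g m (\ c p -> h c (m≤n⇒m≤1+n p)))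

 bv-B : ∀ {hi μ x} -> In hi μ x -> map (bit ∘ B μ x) (down hi) ≡ bv hi μ x
 bv-B {hi} [] = map-down (\ _ -> 0) hi 0 0 z≤n (\ _ _ _ -> refl) & LP.++-identityʳ _
 bv-B {hi} {m ∷ μ} {x ∷ xs} ((mx , xh , xs≤) ∷ bx) = map-down f hi x 0 xh hi0 & cong (replicate (hi ∸ x) 0 ++_) (map-down f x m 1 mx mid &
  cong (replicate (x ∸ m) 1 ++_) (map-down-cong f (bit ∘ B μ xs) m lo & bv-B bx))
  where
  f = bit ∘ B (m ∷ μ) (x ∷ xs)
  hi0 : ∀ c -> x < c -> c ≤ hi -> f c ≡ 0
  hi0 c p _ = cong bit (B-off (m ∷ μ) (x ∷ xs) c (p ∷ All.map (\ q -> ≤-<-trans (q &≤ mx) p) xs≤))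
  mid : ∀ c -> m < c -> c ≤ x -> f c ≡ 1
  mid c p q rewrite <ᵇ-true⁺ {m} {c} p | ≤ᵇ-true⁺ {c} {x} q = refl
  lo : ∀ c -> c ≤ m -> f c ≡ bit (B μ xs c)
  lo c p rewrite <ᵇ-false⁺ {m} {c} p = refl

 zipC : (ℕ -> List ℕ) -> List ℕ -> List (List ℕ) -> List (List ℕ)
 zipC f (c ∷ cs) (w ∷ ws) = (f c ++ w) ∷ zipC f cs ws
 zipC f _ _ = []

 zipC-wsb : ∀ n (f g : ℕ -> List ℕ) (b : ℕ -> Bool) cs ws -> (∀ c -> g c ≡ f c ++ (if b c then n ∷ [] else [])) -> zipC g cs ws ≡ zipC f cs (wsb n ws (map (bit ∘ b) cs))
 zipC-wsb n f g b [] [] h = refl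
 zipC-wsb n f g b [] (w ∷ ws) h = refl
 zipC-wsb n f g b (c ∷ cs) [] h = refl
 zipC-wsb n f g b (c ∷ cs) (w ∷ ws) h with b c in e
 ... | true = cong₂ _∷_ (cong (_++ w) (h c & cong (\ b -> f c ++ (if b then n ∷ [] else [])) e) & LP.++-assoc (f c) (n ∷ []) w) (zipC-wsb n f g b cs ws h)
 ... | false = cong₂ _∷_ (cong (_++ w) (h c & cong (\ b -> f c ++ (if b then n ∷ [] else [])) e & LP.++-identityʳ (f c))) (zipC-wsb n f g b cs ws h)

 module _ (ev : List ℕ -> ℤ) where
  open Peel r W ev

  -- The tableau counterpart of `SJ`: the words of smaller letters are already attached to the
  -- columns. Entries of tableaux count from 1, letters of words from 0.
  TJ : ℕ -> List (List ℕ) -> List ℕ -> ℤ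
  TJ n ws μ = ∑ (CT (suc n) μ) (\ T -> if strictR μ T then ev (cat (zipC (colR μ T) (down W) ws) []) else 0z)

  -- The smallest entries of a tableau form a horizontal strip at its upper left, and the rest is a
  -- tableau outside x; so the recursion is that of `SJ-step`.
  TJ-step : ∀ n ws μ -> n < r -> Decr (W ∷ μ) -> TJ n ws μ ≡ ∑ (boxes W μ) (\ x -> TJ (suc n) (wsb n ws (bv W μ x)) x)
  TJ-step n ws μ p d@(a , _) = ∑-CT (suc n) μ _ p a & ∑-cong∈ (wider μ) (\ x i -> ∑-cong∈ (CT (suc (suc n)) x) (\ T j -> split x T (strict-prep₀ (suc n) μ d (∈-wider μ i) (∈-CT (suc (suc n)) x j))) &
   outer x (inBox W μ x)) & ∑-inBox W μ _ ≤-refl d & ∑-cong∈ (boxes W μ) fin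
   where
   E : List ℕ -> List (List ℕ) -> ℤ
   E x T = ev (cat (zipC (colR μ (prep (suc n) μ x T)) (down W) ws) [])
   split : ∀ x T -> strictR μ (prep (suc n) μ x T) ≡ inBox W μ x ∧ strictR x T ->
    (if strictR μ (prep (suc n) μ x T) then E x T else 0z) ≡ (if inBox W μ x then (if strictR x T then E x T else 0z) else 0z)
   split x T e with inBox W μ x
   ... | true = cong (\ b -> if b then E x T else 0z) e
   ... | false = cong (\ b -> if b then E x T else 0z) e
   outer : ∀ x b -> ∑ (CT (suc (suc n)) x) (\ T -> if b then (if strictR x T then E x T else 0z) else 0z) ≡ (if b then ∑ (CT (suc (suc n)) x) (\ T -> if strictR x T then E x T else 0z) else 0z)
   outer x true = refl
   outer x false = ∑-0 (CT (suc (suc n)) x)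
   fin : ∀ x -> x ∈ boxes W μ -> ∑ (CT (suc (suc n)) x) (\ T -> if strictR x T then E x T else 0z) ≡ TJ (suc n) (wsb n ws (bv W μ x)) x
   fin x i = ∑-cong∈ (CT (suc (suc n)) x) (\ T j -> cong (\ w -> if strictR x T then ev (cat w []) else 0z)
    (zipC-wsb n (colR x T) (colR μ (prep (suc n) μ x T)) (B μ x) (down W) ws (\ c -> colR-prep (suc n) c (∈-In W μ d i) (∈-CT (suc (suc n)) x j)) &
     cong (\ b -> zipC (colR x T) (down W) (wsb n ws b)) (bv-B (∈-In W μ d i))))

  incr-∅ : ∀ L -> 0 < L -> incr L (suc r) r ≡ []
  incr-∅ (suc L) _ rewrite n∸n≡0 r = refl

  TJ-end : ∀ ws -> length ws ≡ W -> TJ r ws (replicate r W) ≡ ev (cat ws [])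
  TJ-end ws e = cong (\ C -> ∑ C (\ T -> if strictR (replicate r W) T then ev (cat (zipC (colR (replicate r W) T) (down W) ws) []) else 0z)) (ct r) &
   +0ʳ _ & cong (\ b -> if b then ev (cat (zipC (colR (replicate r W) (replicate r [])) (down W) ws) []) else 0z) (strict r) & cong (\ w -> ev (cat w [])) (zips W ws ≤-refl e)
   where
   ct : ∀ q -> CT (suc r) (replicate q W) ≡ replicate q [] ∷ []
   ct zero = refl
   ct (suc q) rewrite n∸n≡0 W | ct q = refl
   strict : ∀ q -> strictR (replicate q W) (replicate q []) ≡ true
   strict zero = refl
   strict (suc zero) = refl
   strict (suc (suc q)) = ∧-true (all⁺ _ (range 1 W) (\ c i -> cong (\ b -> if b then nthN [] (c ∸ W ∸ 1) <ᵇ nthN [] (c ∸ W ∸ 1) else true) (<ᵇ-false⁺ (proj₂ (∈-range⁻ W i))))) (strict (suc q))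
   col∅ : ∀ q c -> c ≤ W -> colR (replicate q W) (replicate q []) c ≡ []
   col∅ zero c p = refl
   col∅ (suc q) c p rewrite <ᵇ-false⁺ {W} {c} p | col∅ q c p = refl
   zips : ∀ h ws -> h ≤ W -> length ws ≡ h -> zipC (colR (replicate r W) (replicate r [])) (down h) ws ≡ ws
   zips zero [] p e = refl
   zips (suc h) (w ∷ ws) p e = cong₂ _∷_ (cong (_++ w) (col∅ r (suc h) p)) (zips h ws (n≤1+n h &≤ p) (suc-injective e))

  TJ-end-0 : ∀ ws μ -> Decr (W ∷ μ) -> μ ≢ replicate (length μ) W -> TJ r ws μ ≡ 0z
  TJ-end-0 ws μ d ne = cong (\ C -> ∑ C (\ T -> if strictR μ T then ev (cat (zipC (colR μ T) (down W) ws) []) else 0z)) (go μ (proj₁ d) ne)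
   where
   go : ∀ μ -> All (_≤ W) μ -> μ ≢ replicate (length μ) W -> CT (suc r) μ ≡ []
   go [] _ ne = ⊥-elim (ne refl)
   go (m ∷ μ) (p ∷ ps) ne with m ≟ W
   ... | no ¬q = cong (\ I -> concatMap (\ t -> map (t ∷_) (CT (suc r) μ)) I) (incr-∅ (W ∸ m) (m<n⇒0<n∸m (≤∧≢⇒< p ¬q)))
   ... | yes refl rewrite go μ ps (\ e -> ne (cong (m ∷_) e)) = none (incr (m ∸ m) (suc r) r)
    where none : ∀ (I : List (List ℕ)) -> concatMap (\ t -> map (t ∷_) []) I ≡ []
          none [] = refl
          none (t ∷ I) = none I

  -- Both sides satisfy the same recursion in the smallest letter, and once the letters are
  -- exhausted both vanish unless no box is left.
  SJ≡TJ : ∀ j n ws μ -> j + n ≡ r -> Commutes -> All (Ok n) ws -> length ws ≡ W -> length μ ≡ r -> Decr (W ∷ μ) -> SJ n ws (heights W μ) ≡ TJ n ws μ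
  SJ≡TJ (suc j) n ws μ e cm ok lw lμ d = SJ-step cm n ws μ n<r ok lw d & ∑-cong∈ (boxes W μ) (\ x i -> SJ≡TJ j (suc n) (wsb n ws (bv W μ x)) x (+-suc j n & e) cm
   (Ok-wsb n ws (bv W μ x) ok) (length-wsb n ws _ & lw) (proj₁ (∈-boxes W μ i d) & lμ) (proj₁ (proj₂ (∈-boxes W μ i d)))) & sym (TJ-step n ws μ n<r d)
   where n<r : n < r
         n<r = s≤s (m≤n+m n j) &≤ eq≤ e
  SJ≡TJ zero .r ws μ refl cm ok lw lμ d with heights-full W μ d
  ... | inj₁ (e , h) = cong (SJ r ws) h & SJ-end ws lw & sym (cong (TJ r ws) (e & cong (\ (n : ℕ) -> replicate n W) lμ) & TJ-end ws lw)
  ... | inj₂ (ne , pos , s , d' , h) = cong (SJ r ws) h & SJ-end-0 ws s d' (subst (0 <_) (sym lw) pos) & sym (TJ-end-0 ws μ d ne)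

-- Comparison with the enumerated tableaux and their column readings

shift : ℕ -> List ℕ -> List ℕ
shift a = map (\ x -> a + x)

module Link (r : ℕ) where
 open Tab r

 strict-suc : ∀ W t m t' m' -> all (lt? W t (suc m) t' (suc m')) (range 1 (suc W)) ≡ all (lt? W t m t' m') (range 1 W)
 strict-suc W t m t' m' = cong (all (lt? W t (suc m) t' (suc m'))) (cong (\ l -> map suc (0 ∷ l)) (sym (LP.map-upTo suc W))) & go (range 1 W)
  where go : ∀ xs -> all (lt? W t (suc m) t' (suc m')) (map suc xs) ≡ all (lt? W t m t' m') xs
        go [] = refl
        go (x ∷ xs) = cong (lt? W t m t' m' x ∧_) (go xs)

 strict-shift : ∀ a W t m t' m' -> all (lt? W t (a + m) t' (a + m')) (range 1 (a + W)) ≡ all (lt? W t m t' m') (range 1 W)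
 strict-shift zero W t m t' m' = refl
 strict-shift (suc a) W t m t' m' = strict-suc (a + W) t (a + m) t' (a + m') & strict-shift a W t m t' m'

 all-map : ∀ {A C : Set} (p : C -> Bool) (f : A -> C) xs -> all p (map f xs) ≡ all (p ∘ f) xs
 all-map p f [] = refl
 all-map p f (x ∷ xs) = cong (p (f x) ∧_) (all-map p f xs)

 strict-link : ∀ a W μ T -> length T ≡ length μ ->
  all (\ i -> all (lt? W (nthL T i) (nthN (shift a μ) i) (nthL T (suc i)) (nthN (shift a μ) (suc i))) (range 1 (a + W))) (upTo (length μ ∸ 1)) ≡ strictR W μ T
 strict-link a W [] [] e = refl
 strict-link a W (m ∷ []) (t ∷ []) e = refl
 strict-link a W (m ∷ m' ∷ μ) (t ∷ t' ∷ T) e = cong₂ _∧_ (strict-shift a W t m t' m')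
  (cong (all _) (sym (LP.map-upTo suc (length μ))) & all-map _ suc (upTo (length μ)) & strict-link a W (m' ∷ μ) (t' ∷ T) (suc-injective e))

 col : List ℕ -> List (List ℕ) -> ℕ -> List ℕ
 col μ T c = concatMap (\ i -> if nthN μ (i ∸ 1) <ᵇ c then entry T μ i c ∷ [] else []) (reverse (range 1 (length μ)))

 col-colR : ∀ W μ T c -> length T ≡ length μ -> map (_∸ 1) (col μ T c) ≡ colR W μ T c
 col-colR W μ T c e = cong (\ l -> map (_∸ 1) (concatMap (g μ T ∘ (_∸ 1)) l)) (sym (LP.reverse-map suc (upTo (length μ)))) & cong (map (_∸ 1)) (LP.concatMap-map (g μ T ∘ (_∸ 1)) suc (reverse (upTo (length μ)))) & go μ T e
  where
  g : List ℕ -> List (List ℕ) -> ℕ -> List ℕ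
  g μ T i = if nthN μ i <ᵇ c then nthN (nthL T i) (c ∸ nthN μ i ∸ 1) ∷ [] else []
  go : ∀ μ T -> length T ≡ length μ -> map (_∸ 1) (concatMap (g μ T) (reverse (upTo (length μ)))) ≡ colR W μ T c
  go [] [] e = refl
  go (m ∷ μ) (t ∷ T) e = cong (\ l -> map (_∸ 1) (concatMap G l)) (cong (\ l -> reverse (0 ∷ l)) (sym (LP.map-upTo suc (length μ))) & LP.unfold-reverse 0 (map suc (upTo (length μ)))) &
   cong (map (_∸ 1)) (LP.concatMap-++ G (reverse (map suc (upTo (length μ)))) (0 ∷ []) & cong (_++ (G 0 ++ [])) (cong (concatMap G) (sym (LP.reverse-map suc (upTo (length μ)))) & LP.concatMap-map G suc (reverse (upTo (length μ))))) &
   LP.map-++ (_∸ 1) (concatMap (g μ T) (reverse (upTo (length μ)))) _ &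
   cong₂ _++_ (go μ T (suc-injective e)) (fin (m <ᵇ c))
   where
   G = g (m ∷ μ) (t ∷ T)
   fin : ∀ b -> map (_∸ 1) ((if b then nthN t (c ∸ m ∸ 1) ∷ [] else []) ++ []) ≡ (if b then (nthN t (c ∸ m ∸ 1) ∸ 1) ∷ [] else [])
   fin true = refl
   fin false = refl

 colR-suc : ∀ W μ T c -> colR W (map suc μ) T (suc c) ≡ colR W μ T c
 colR-suc W [] T c = refl
 colR-suc W (m ∷ μ) [] c = refl
 colR-suc W (m ∷ μ) (t ∷ T) c = cong (_++ _) (colR-suc W μ T c)

 colR-1 : ∀ W μ T -> colR W (map suc μ) T 1 ≡ []
 colR-1 W [] T = refl
 colR-1 W (m ∷ μ) [] = refl
 colR-1 W (m ∷ μ) (t ∷ T) = LP.++-identityʳ _ & colR-1 W μ T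

 cols-shift : ∀ a W μ T -> concatMap (colR W (shift a μ) T) (range 1 (a + W)) ≡ concatMap (colR W μ T) (range 1 W)
 cols-shift zero W μ T = cong (\ l -> concatMap (colR W l T) (range 1 W)) (LP.map-id μ)
 cols-shift (suc a) W μ T = cong₂ (\ l k -> concatMap (colR W l T) k) (LP.map-∘ μ) (cong (\ l -> map suc (0 ∷ l)) (sym (LP.map-upTo suc (a + W)))) &
  cong (_++ concatMap (colR W (map suc (shift a μ)) T) (map suc (range 1 (a + W)))) (colR-1 W (shift a μ) T) &
   LP.concatMap-map (colR W (map suc (shift a μ)) T) suc (range 1 (a + W)) & LP.concatMap-cong (colR-suc W (shift a μ) T) (range 1 (a + W)) & cols-shift a W μ T

 cols-cat : ∀ W (ev : List ℕ -> ℤ) (h : ℕ -> List ℕ) post -> concatMap h (range 1 W) ++ post ≡ Peel.cat r W ev (zipC W h (down W) (replicate W [])) post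
 cols-cat zero ev h post = refl
 cols-cat (suc W) ev h post = cong (_++ post) (cong (concatMap h) (range-suc W) & LP.concatMap-++ h (range 1 W) (suc W ∷ [])) & LP.++-assoc (concatMap h (range 1 W)) _ post & cols-cat W ev h ((h (suc W) ++ []) ++ post)

 -- The first a columns contain no boxes, so they add neither conditions nor letters and only W
 -- columns matter.
 ssyt-TJ : ∀ a W μ (ev : List ℕ -> ℤ) -> length μ ≡ r ->
  ∑ (ssyt r (a + W) (shift a μ)) (\ T -> ev (map (_∸ 1) (creading r (a + W) (shift a μ) T))) ≡ TJ W ev 0 (replicate W []) μ
 ssyt-TJ a W μ ev e = ∑-filterᵇ (colStrict r (a + W) (shift a μ)) C _ & cong (\ D -> ∑ (cartesian D) G) rows & ∑-cong∈ (CT W 1 μ) (\ T i -> one T (len μ (∈-CT W 1 μ i)))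
  where
  C = cartesian (map (\ m -> incr ((a + W) ∸ m) 1 r) (shift a μ))
  G = \ T -> if colStrict r (a + W) (shift a μ) T then ev (map (_∸ 1) (creading r (a + W) (shift a μ) T)) else 0z
  rows : map (\ m -> incr ((a + W) ∸ m) 1 r) (shift a μ) ≡ map (\ m -> incr (W ∸ m) 1 r) μ
  rows = sym (LP.map-∘ μ) & LP.map-cong (\ m -> cong (\ L -> incr L 1 r) ([m+n]∸[m+o]≡n∸o a W m)) μ
  len : ∀ μ {T} -> Fill W 1 μ T -> length T ≡ length μ
  len [] [] = refl
  len (m ∷ μ) (_ ∷ fl) = cong suc (len μ fl)
  one : ∀ T -> length T ≡ length μ -> G T ≡ (if strictR W μ T then ev (Peel.cat r W ev (zipC W (colR W μ T) (down W) (replicate W [])) []) else 0z)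
  one T lT = cong₂ (\ b w -> if b then ev w else 0z) (all-map _ suc (upTo (r ∸ 1)) & cong (\ n -> all _ (upTo (n ∸ 1))) (sym e) & strict-link a W μ T lT)
   (LP.map-concatMap (_∸ 1) _ (range 1 (a + W)) & LP.concatMap-cong (\ c -> cong (\ n -> map (_∸ 1) (concatMap (\ i -> if nthN (shift a μ) (i ∸ 1) <ᵇ c then entry T (shift a μ) i c ∷ [] else []) (reverse (range 1 n))))
    (sym lsh) & col-colR W (shift a μ) T c (lT & e & sym lsh)) (range 1 (a + W)) &
    cols-shift a W μ T & sym (LP.++-identityʳ _) & cols-cat W ev (colR W μ T) [])
   where lsh : length (shift a μ) ≡ r
         lsh = LP.length-map _ μ & e

-- Branching: antisymmetric functions summed over interlacing rows

χ : ∀ {P : Set} -> Dec P -> ℤ -> ℤ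
χ (yes _) z = z
χ (no _) z = 0z

χ-yes : ∀ {P : Set} (d : Dec P) z -> P -> χ d z ≡ z
χ-yes (yes _) z p = refl
χ-yes (no ¬p) z p = ⊥-elim (¬p p)

χ-no : ∀ {P : Set} (d : Dec P) z -> ¬ P -> χ d z ≡ 0z
χ-no (yes p) z ¬p = ⊥-elim (¬p p)
χ-no (no _) z ¬p = refl

≤-swap : ∀ {a b c d} -> a Z.≤ b -> b Z.- a ≡ d Z.- c -> c Z.≤ d
≤-swap {a} {b} {c} {d} p e = ZP.0≤i-j⇒j≤i (subst (0z Z.≤_) e (ZP.i≤j⇒0≤j-i p))

∑-boxes : ∀ hi m μ (f : List ℕ -> ℤ) -> ∑ (boxes hi (m ∷ μ)) f ≡ ∑ (range m hi) (\ x -> ∑ (boxes m μ) (\ xs -> f (x ∷ xs)))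
∑-boxes hi m μ f = ∑-concatMap (\ x -> map (x ∷_) (boxes m μ)) (range m hi) f & ∑-cong (range m hi) (\ x -> ∑-map (x ∷_) (boxes m μ) f)

boxes-sum : ∀ hi μ {x} -> x ∈ boxes hi μ -> sum μ ≤ sum x
boxes-sum hi [] (here refl) = z≤n
boxes-sum hi (m ∷ μ) i with ∈-concatMap⁻ (\ x -> map (x ∷_) (boxes m μ)) (range m hi) i
... | x , i₁ , i₂ with MP.∈-map⁻ (x ∷_) i₂
... | xs , j , refl = +-mono-≤ (proj₁ (∈-rangeᵍ m hi i₁)) (boxes-sum m μ j)

-- Every interlacing x contains μ, so μ is the only one of size at most |μ|.
∑-min : ∀ hi μ (f : List ℕ -> ℤ) -> Decr (hi ∷ μ) -> ∑ (boxes hi μ) (\ x -> χ (sum x ≤? sum μ) (f x)) ≡ f μ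
∑-min hi [] f d = +0ʳ _
∑-min hi (m ∷ μ) f (p ∷ _ , d) = ∑-boxes hi m μ _ & cong (\ l -> ∑ l G) (range-∷ m hi p) & cong₂ Z._+_ first rest & +0ʳ _
 where
 G : ℕ -> ℤ
 G x = ∑ (boxes m μ) (\ xs -> χ (x + sum xs ≤? m + sum μ) (f (x ∷ xs)))
 first : G m ≡ f (m ∷ μ)
 first = ∑-cong (boxes m μ) (\ xs -> same xs (sum xs ≤? sum μ)) & ∑-min m μ (\ xs -> f (m ∷ xs)) d
  where same : ∀ xs (dc : Dec (sum xs ≤ sum μ)) -> χ (m + sum xs ≤? m + sum μ) (f (m ∷ xs)) ≡ χ dc (f (m ∷ xs))
        same xs (yes q) = χ-yes (m + sum xs ≤? m + sum μ) _ (+-monoʳ-≤ m q)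
        same xs (no ¬q) = χ-no (m + sum xs ≤? m + sum μ) _ (\ h -> ¬q (+-cancelˡ-≤ m _ _ h))
 rest : ∑ (range (suc m) hi) G ≡ 0z
 rest = ∑-0∈ (range (suc m) hi) (\ x i -> ∑-0∈ (boxes m μ) (\ xs j -> χ-no (x + sum xs ≤? m + sum μ) _ (\ h -> <⇒≱ (+-mono-<-≤ (proj₁ (∈-rangeᵍ (suc m) hi i)) (boxes-sum m μ j)) h)))

-- x ↦ D-x permutes the x that stay in the range together with their image, and it reverses the sign
-- of h.
∑-reflect : ∀ l hi (D : ℤ) (h : ℤ -> ℤ) -> (∀ x -> h x ≡ Z.- h (D Z.- x)) -> (dec : ∀ x -> Dec (+ l Z.≤ D Z.- x × D Z.- x Z.≤ + hi)) ->
 ∑ (range l hi) (\ x -> χ (dec (+ x)) (h (+ x))) ≡ 0z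
∑-reflect l hi D h anti dec = self-neg _ (sym (∑-map +_ (range l hi) F) &
 sym (∑-filter I) &
 ∑-↭ h (Perm.↭-sym perm) &
 ∑-map (\ x -> D Z.- x) L h &
 ∑-cong L (\ x -> sym (ZP.neg-involutive _) & cong Z.-_ (sym (anti x))) &
 ∑-neg L h &
 cong Z.-_ (∑-filter I & ∑-map +_ (range l hi) F))
 where
 F = \ x -> χ (dec x) (h x)
 S = ∑ (range l hi) (\ x -> F (+ x))
 I = map +_ (range l hi)
 L = Data.List.filter dec I
 ∑-filter : ∀ xs -> ∑ (Data.List.filter dec xs) h ≡ ∑ xs F
 ∑-filter [] = refl
 ∑-filter (x ∷ xs) with dec x
 ... | yes _ = cong (\ z -> h x Z.+ z) (∑-filter xs)
 ... | no _ = ∑-filter xs & sym (+0ˡ _)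
 ∈I⁻ : ∀ {x} -> x ∈ I -> + l Z.≤ x × x Z.≤ + hi
 ∈I⁻ i with MP.∈-map⁻ +_ i
 ... | n , j , refl = Z.+≤+ (proj₁ (∈-rangeᵍ l hi j)) , Z.+≤+ (proj₂ (∈-rangeᵍ l hi j))
 ∈I⁺ : ∀ {x} -> + l Z.≤ x -> x Z.≤ + hi -> x ∈ I
 ∈I⁺ {+ n} (Z.+≤+ p) (Z.+≤+ q) = MP.∈-map⁺ +_ (subst (_∈ range l hi) (m+[n∸m]≡n p) (MP.∈-map⁺ (\ y -> l + y) (MP.∈-upTo⁺ (s≤s (∸-monoˡ-≤ l q) &≤ eq≤ (sym (+-∸-assoc 1 (p &≤ q)))))))
 inv : ∀ x -> D Z.- (D Z.- x) ≡ x
 inv = lem D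
  where lem : ∀ D x -> D Z.- (D Z.- x) ≡ x
        lem = solve-∀
 uI : Unique L
 uI = UP.filter⁺ dec (UP.map⁺ ZP.+-injective (UP.map⁺ (\ {x} {y} -> +-cancelˡ-≡ l x y) (UP.upTo⁺ (suc hi ∸ l))))
 fwd : ∀ {x} -> x ∈ L -> (D Z.- x) ∈ L
 fwd {x} i with MP.∈-filter⁻ dec {xs = I} i
 ... | j , (p , q) = MP.∈-filter⁺ dec (∈I⁺ p q) (subst (+ l Z.≤_) (sym (inv x)) (proj₁ (∈I⁻ j)) , subst (Z._≤ + hi) (sym (inv x)) (proj₂ (∈I⁻ j)))
 perm : map (\ x -> D Z.- x) L ↭ L
 perm = unique-↭ (UP.map⁺ (\ {x} {y} e -> sym (inv x) & cong (\ z -> D Z.- z) e & inv y) uI) uI to (\ {x} i -> subst (_∈ map (\ x -> D Z.- x) L) (inv x) (MP.∈-map⁺ (\ x -> D Z.- x) (fwd i)))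
  where to : ∀ {x} -> x ∈ map (\ x -> D Z.- x) L -> x ∈ L
        to i with MP.∈-map⁻ (\ x -> D Z.- x) i
        ... | y , j , refl = fwd j

AntiR : ℕ -> (List ℤ -> ℤ) -> Set
AntiR r A = ∀ P x y Q -> length (P ++ x ∷ y ∷ Q) ≡ r -> A (P ++ x ∷ y ∷ Q) ≡ Z.- A (P ++ (y Z.- 1z) ∷ (x Z.+ 1z) ∷ Q)

module Branch (r : ℕ) (A : List ℤ -> ℤ) (anti : AntiR r A) where

 -- A transposition at distance |Q|+1 is a conjugate of an adjacent one, and the dot action shifts
 -- the two exchanged entries by that distance.
 transpose : ∀ Q P y x R -> length (P ++ y ∷ Q ++ x ∷ R) ≡ r ->
  A (P ++ y ∷ Q ++ x ∷ R) ≡ Z.- A (P ++ (x Z.- + suc (length Q)) ∷ Q ++ (y Z.+ + suc (length Q)) ∷ R)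
 transpose [] P y x R e = anti P y x R e
 transpose (q ∷ Q) P y x R e = anti P y q (Q ++ x ∷ R) e &
  cong (\ l -> Z.- A l) (sym (LP.++-assoc P (q Z.- 1z ∷ []) _)) &
  cong Z.-_ (transpose Q (P ++ q Z.- 1z ∷ []) (y Z.+ 1z) x R (len (P ++ q Z.- 1z ∷ []) (y Z.+ 1z ∷ Q ++ x ∷ R) P (y ∷ q ∷ Q ++ x ∷ R) (cong (_+ _) (length-snoc P _) & sym (+-suc (length P) _)) & e)) &
  ZP.neg-involutive _ & cong A (LP.++-assoc P (q Z.- 1z ∷ []) _) &
  anti P (q Z.- 1z) x' (Q ++ y' ∷ R) (len P (q Z.- 1z ∷ x' ∷ Q ++ y' ∷ R) P (y ∷ q ∷ Q ++ x ∷ R) (cong (\ n -> length P + suc (suc n)) (LP.length-++ Q & sym (LP.length-++ Q))) & e) &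
  cong Z.-_ (cong₂ (\ a b -> A (P ++ a ∷ b)) (l₁ x (+ length Q)) (cong₂ (\ a b -> a ∷ Q ++ b ∷ R) (l₂ q) (l₃ y (+ length Q))))
  where
  x' = x Z.- + suc (length Q)
  y' = (y Z.+ 1z) Z.+ + suc (length Q)
  len : ∀ (a b c d : List ℤ) -> length a + length b ≡ length c + length d -> length (a ++ b) ≡ length (c ++ d)
  len a b c d e = LP.length-++ a & e & sym (LP.length-++ c)
  l₁ : ∀ x n -> (x Z.- (1z Z.+ n)) Z.- 1z ≡ x Z.- (1z Z.+ (1z Z.+ n))
  l₁ = solve-∀
  l₂ : ∀ q -> (q Z.- 1z) Z.+ 1z ≡ q
  l₂ = solve-∀
  l₃ : ∀ y n -> (y Z.+ 1z) Z.+ (1z Z.+ n) ≡ y Z.+ (1z Z.+ (1z Z.+ n))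
  l₃ = solve-∀

 module _ (pre : List ℤ) where

  -- swapping the leading entry y with the entry x of row i = |Q|+1 preserves l ≤ x ≤ hi when l ≤ y + i ≤ hi
  cancel : ∀ Q l hi R (c : ℤ) -> length (pre ++ c ∷ Q ++ 0z ∷ R) ≡ r -> (dec : ∀ x -> Dec (+ l Z.≤ (c Z.+ + suc (length Q)) Z.- x × (c Z.+ + suc (length Q)) Z.- x Z.≤ + hi)) ->
   ∑ (range l hi) (\ x -> χ (dec (+ x)) (A (pre ++ (c Z.- + x) ∷ Q ++ + x ∷ R))) ≡ 0z
  cancel Q l hi R c e dec = ∑-reflect l hi (c Z.+ i) (\ x -> A (pre ++ (c Z.- x) ∷ Q ++ x ∷ R)) an dec
   where
   i = + suc (length Q)
   an : ∀ x -> A (pre ++ (c Z.- x) ∷ Q ++ x ∷ R) ≡ Z.- A (pre ++ (c Z.- ((c Z.+ i) Z.- x)) ∷ Q ++ ((c Z.+ i) Z.- x) ∷ R)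
   an x = transpose Q pre (c Z.- x) x R ((LP.length-++ pre & cong (\ n -> length pre + suc n) (LP.length-++ Q & sym (LP.length-++ Q)) & sym (LP.length-++ pre)) & e) &
    cong Z.-_ (cong₂ (\ a b -> A (pre ++ a ∷ Q ++ b ∷ R)) (l₁ c x i) (l₂ c x i))
    where l₁ : ∀ c x i -> x Z.- i ≡ c Z.- ((c Z.+ i) Z.- x)
          l₁ = solve-∀
          l₂ : ∀ c x i -> (c Z.- x) Z.+ i ≡ (c Z.+ i) Z.- x
          l₂ = solve-∀

  Y : ℤ -> List ℕ -> ℤ
  Y c xs = c Z.- + sum xs

  -- The entry x in the row at distance i = |Q|+1 has Y+i as partner under the dot action. For l ≤
  -- Y+i ≤ hi the exchange stays in range and cancels; for Y+i below l the next row takes over, with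
  -- l as the new bound. After the last row the condition contradicts the bound on c.
  low : ∀ Q hi μ (c : ℤ) -> Decr (hi ∷ μ) -> length (pre ++ c ∷ Q ++ toZ μ) ≡ r -> + (hi + sum μ) Z.≤ c Z.+ + length Q ->
   ∑ (boxes hi μ) (\ xs -> χ (Y c xs Z.+ + suc (length Q) ZP.≤? + hi) (A (pre ++ Y c xs ∷ Q ++ toZ xs))) ≡ 0z
  low Q hi [] c d e inv = +0ʳ _ & χ-no (Y c [] Z.+ + suc (length Q) ZP.≤? + hi) _ (\ h -> ZP.<⇒≱ (ZP.suc[i]≤j⇒i<j (≤-swap inv (lem (+ hi) c (+ length Q)))) h)
   where lem : ∀ h c q -> (c Z.+ q) Z.- (h Z.+ 0z) ≡ ((c Z.- 0z) Z.+ (1z Z.+ q)) Z.- (1z Z.+ h)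
         lem = solve-∀
  low Q hi (l ∷ μ) c (l≤ ∷ _ , d) e inv = ∑-boxes hi l μ _ &
   ∑-cong I (\ x -> ∑-cong B (\ R -> split x R) & ∑-+ B (M x) (N x)) &
   ∑-+ I (\ x -> ∑ B (M x)) (\ x -> ∑ B (N x)) &
   cong₂ Z._+_ (∑-swap I B M & ∑-0∈ B mid) (∑-0∈ I below)
   where
   i = + suc (length Q)
   I = range l hi
   B = boxes l μ
   F : List ℕ -> ℤ
   F xs = A (pre ++ Y c xs ∷ Q ++ toZ xs)
   D : List ℕ -> ℤ
   D R = (c Z.- + sum R) Z.+ i
   dec : ∀ R x -> Dec (+ l Z.≤ D R Z.- x × D R Z.- x Z.≤ + hi)
   dec R x with + l ZP.≤? D R Z.- x | D R Z.- x ZP.≤? + hi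
   ... | yes p | yes q = yes (p , q)
   ... | no ¬p | _ = no (¬p ∘ proj₁)
   ... | yes _ | no ¬q = no (¬q ∘ proj₂)
   M N : ℕ -> List ℕ -> ℤ
   M x R = χ (dec R (+ x)) (F (x ∷ R))
   N x R = χ (Y c (x ∷ R) Z.+ i ZP.<? + l) (F (x ∷ R))
   Ye : ∀ x R -> Y c (x ∷ R) ≡ (c Z.- + sum R) Z.- + x
   Ye x R = cong (\ z -> c Z.- z) (ZP.pos-+ x (sum R)) & lem c (+ x) (+ sum R)
    where lem : ∀ c x s -> c Z.- (x Z.+ s) ≡ (c Z.- s) Z.- x
          lem = solve-∀
   De : ∀ x R -> D R Z.- + x ≡ Y c (x ∷ R) Z.+ i
   De x R = lem (c Z.- + sum R) i (+ x) & cong (\ z -> z Z.+ i) (sym (Ye x R))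
    where lem : ∀ c i x -> (c Z.+ i) Z.- x ≡ (c Z.- x) Z.+ i
          lem = solve-∀
   split : ∀ x R -> χ (Y c (x ∷ R) Z.+ i ZP.≤? + hi) (F (x ∷ R)) ≡ M x R Z.+ N x R
   split x R with Y c (x ∷ R) Z.+ i ZP.<? + l | Y c (x ∷ R) Z.+ i ZP.≤? + hi
   ... | no ¬p | yes q = sym (+0ʳ _ & χ-yes (dec R (+ x)) _ (subst (+ l Z.≤_) (sym (De x R)) (ZP.≮⇒≥ ¬p) , subst (Z._≤ + hi) (sym (De x R)) q))
   ... | no ¬p | no ¬q = sym (+0ʳ _ & χ-no (dec R (+ x)) _ (\ h -> ¬q (subst (Z._≤ + hi) (De x R) (proj₂ h))))
   ... | yes p | yes q = sym (cong (\ z -> z Z.+ F (x ∷ R)) (χ-no (dec R (+ x)) _ (\ h -> ZP.<⇒≱ p (subst (+ l Z.≤_) (De x R) (proj₁ h)))) & +0ˡ _)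
   ... | yes p | no ¬q = ⊥-elim (¬q (ZP.≤-trans (ZP.<⇒≤ p) (Z.+≤+ l≤)))
   sameLen : ∀ a b a' b' R R' -> length R ≡ length R' -> length (pre ++ a ∷ Q ++ a' ∷ R) ≡ length (pre ++ b ∷ Q ++ b' ∷ R')
   sameLen a b a' b' R R' q = LP.length-++ pre & cong (\ n -> length pre + suc n) (LP.length-++ Q & cong (\ n -> length Q + suc n) q & sym (LP.length-++ Q)) & sym (LP.length-++ pre)
   mid : ∀ R -> R ∈ B -> ∑ I (\ x -> M x R) ≡ 0z
   mid R j = ∑-cong I (\ x -> cong (\ z -> χ (dec R (+ x)) (A (pre ++ z ∷ Q ++ + x ∷ toZ R))) (Ye x R)) & cancel Q l hi (toZ R) (c Z.- + sum R) (sameLen (c Z.- + sum R) c 0z (+ l) (toZ R) (toZ μ) (LP.length-map _ R & proj₁ (∈-boxes l μ j d) & sym (LP.length-map _ μ)) & e) (dec R)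
   below : ∀ x -> x ∈ I -> ∑ B (N x) ≡ 0z
   below x j = ∑-cong B (\ R -> same R (Y c (x ∷ R) Z.+ i ZP.<? + l)) & low (Q ++ + x ∷ []) l μ (c Z.- + x) d
    (cong (\ L -> length (pre ++ (c Z.- + x) ∷ L)) (LP.++-assoc Q (+ x ∷ []) (toZ μ)) & sameLen (c Z.- + x) c (+ x) (+ l) (toZ μ) (toZ μ) refl & e)
    (ZP.≤-trans (≤-swap (ZP.+-mono-≤ inv (Z.+≤+ (proj₂ (∈-rangeᵍ l hi j)))) (cong (\ u -> (c Z.+ + length Q Z.+ + hi) Z.- (u Z.+ + x)) (ZP.pos-+ hi (l + sum μ)) & lem (+ hi) (+ (l + sum μ)) (+ x) c (+ length Q)))
     (ZP.+-monoʳ-≤ (c Z.- + x) (Z.+≤+ (n≤1+n _ &≤ eq≤ (sym (length-snoc Q (+ x)))))))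
    where
    lem : ∀ h s x c q -> (c Z.+ q Z.+ h) Z.- ((h Z.+ s) Z.+ x) ≡ ((c Z.- x) Z.+ q) Z.- s
    lem = solve-∀
    same : ∀ R (dc : Dec (Y c (x ∷ R) Z.+ i Z.< + l)) -> χ dc (F (x ∷ R)) ≡ χ (Y (c Z.- + x) R Z.+ + suc (length (Q ++ + x ∷ [])) ZP.≤? + l) (A (pre ++ Y (c Z.- + x) R ∷ (Q ++ + x ∷ []) ++ toZ R))
    same R dc = go dc & cong₂ (\ a b -> χ (Y (c Z.- + x) R Z.+ + suc (length (Q ++ + x ∷ [])) ZP.≤? + l) (A (pre ++ a ∷ b))) (Ye x R & lem₂ c (+ sum R) (+ x)) (sym (LP.++-assoc Q (+ x ∷ []) (toZ R)))
     where
     lem₂ : ∀ c s x -> (c Z.- s) Z.- x ≡ (c Z.- x) Z.- s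
     lem₂ = solve-∀
     eq : Y (c Z.- + x) R Z.+ + suc (length (Q ++ + x ∷ [])) ≡ Z.suc (Y c (x ∷ R) Z.+ i)
     eq = cong₂ Z._+_ (sym (lem₂ c (+ sum R) (+ x)) & sym (Ye x R)) (cong (\ n -> + suc n) (length-snoc Q (+ x))) & lem₃ (Y c (x ∷ R)) i
      where lem₃ : ∀ y i -> y Z.+ (1z Z.+ i) ≡ 1z Z.+ (y Z.+ i)
            lem₃ = solve-∀
     go : (dc : Dec (Y c (x ∷ R) Z.+ i Z.< + l)) -> χ dc (F (x ∷ R)) ≡ χ (Y (c Z.- + x) R Z.+ + suc (length (Q ++ + x ∷ [])) ZP.≤? + l) (F (x ∷ R))
     go (yes p) = sym (χ-yes (_ ZP.≤? + l) _ (subst (Z._≤ + l) (sym eq) (ZP.i<j⇒suc[i]≤j p)))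
     go (no ¬p) = sym (χ-no (_ ZP.≤? + l) _ (\ h -> ¬p (ZP.suc[i]≤j⇒i<j (subst (Z._≤ + l) eq h))))

  -- The term xs = μ has leading entry m. Every other xs is larger, its leading entry is below m,
  -- and these terms cancel.
  branch : ∀ m μ -> Decr (m ∷ μ) -> length (pre ++ + m ∷ toZ μ) ≡ r ->
   ∑ (boxes m μ) (\ xs -> A (pre ++ (+ (m + sum μ) Z.- + sum xs) ∷ toZ xs)) ≡ A (pre ++ + m ∷ toZ μ)
  branch m μ d e = ∑-cong B (\ xs -> split xs (sum xs ≤? sum μ) (Y c xs Z.+ 1z ZP.≤? + m)) &
   ∑-+ B _ _ &
   cong₂ Z._+_ (∑-min m μ F d) (low [] m μ c d (LP.length-++ pre & sym (LP.length-++ pre) & e) (ZP.≤-reflexive (sym (+0ʳ c)))) &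
   +0ʳ _ &
   cong (\ z -> A (pre ++ z ∷ toZ μ)) (cong (\ z -> z Z.- + sum μ) (ZP.pos-+ m (sum μ)) & lem (+ m) (+ sum μ))
   where
   B = boxes m μ
   c = + (m + sum μ)
   F : List ℕ -> ℤ
   F xs = A (pre ++ Y c xs ∷ toZ xs)
   lem : ∀ m s -> (m Z.+ s) Z.- s ≡ m
   lem = solve-∀
   diff : ∀ a -> c Z.- + a Z.+ 1z Z.- + m ≡ + suc (sum μ) Z.- + a
   diff a = cong (\ z -> z Z.- + a Z.+ 1z Z.- + m) (ZP.pos-+ m (sum μ)) & l (+ m) (+ sum μ) (+ a)
    where l : ∀ m s a -> (m Z.+ s) Z.- a Z.+ 1z Z.- m ≡ (1z Z.+ s) Z.- a
          l = solve-∀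
   split : ∀ xs (p : Dec (sum xs ≤ sum μ)) (q : Dec (Y c xs Z.+ 1z Z.≤ + m)) -> F xs ≡ χ p (F xs) Z.+ χ q (F xs)
   split xs (yes p) (no _) = sym (+0ʳ _)
   split xs (no _) (yes q) = sym (+0ˡ _)
   split xs (yes p) (yes q) = ⊥-elim (<⇒≱ (s≤s p) (ZP.drop‿+≤+ (ZP.i-j≤0⇒i≤j (subst (Z._≤ 0z) (diff (sum xs)) (ZP.i≤j⇒i-j≤0 q)))))
   split xs (no ¬p) (no ¬q) = ⊥-elim (¬q (ZP.i-j≤0⇒i≤j (subst (Z._≤ 0z) (sym (diff (sum xs))) (ZP.i≤j⇒i-j≤0 (Z.+≤+ (≰⇒> ¬p))))))

-- The sum over tableaux of an antisymmetric function of the weight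

sub : List ℕ -> List ℤ -> List ℤ
sub [] γ = γ
sub (z ∷ w) γ = sub w (addAt z (Z.- 1z) γ)

Xw-sub : ∀ w Φ γ n -> Xw w Φ γ n ≡ Φ (sub w γ) n
Xw-sub [] Φ γ n = refl
Xw-sub (z ∷ w) Φ γ n = Xw-sub w Φ (addAt z (Z.- 1z) γ) n

sub-++ : ∀ v w γ -> sub (v ++ w) γ ≡ sub w (sub v γ)
sub-++ [] w γ = refl
sub-++ (z ∷ v) w γ = sub-++ v w (addAt z (Z.- 1z) γ)

sub-addAt : ∀ w z a γ -> sub w (addAt z a γ) ≡ addAt z a (sub w γ)
sub-addAt [] z a γ = refl
sub-addAt (y ∷ w) z a γ = cong (sub w) (addAt-comm y z (Z.- 1z) a γ) & sub-addAt w z a (addAt y (Z.- 1z) γ)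

sub-comm : ∀ v w γ -> sub v (sub w γ) ≡ sub w (sub v γ)
sub-comm [] w γ = refl
sub-comm (z ∷ v) w γ = cong (sub v) (sym (sub-addAt w z (Z.- 1z) γ)) & sub-comm v w (addAt z (Z.- 1z) γ)

cnt : List ℕ -> ℕ
cnt [] = 0
cnt (zero ∷ b) = cnt b
cnt (suc _ ∷ b) = suc (cnt b)

cnt-++ : ∀ a b -> cnt (a ++ b) ≡ cnt a + cnt b
cnt-++ [] b = refl
cnt-++ (zero ∷ a) b = cnt-++ a b
cnt-++ (suc _ ∷ a) b = cong suc (cnt-++ a b)

cnt-0 : ∀ n -> cnt (replicate n 0) ≡ 0
cnt-0 zero = refl
cnt-0 (suc n) = cnt-0 n

cnt-1 : ∀ n -> cnt (replicate n 1) ≡ n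
cnt-1 zero = refl
cnt-1 (suc n) = cong suc (cnt-1 n)

bv-facts : ∀ hi μ x -> Decr (hi ∷ μ) -> x ∈ boxes hi μ -> length (bv hi μ x) ≡ hi × cnt (bv hi μ x) + sum μ ≡ sum x
bv-facts hi [] .[] d (here refl) = LP.length-replicate hi , trans (+-identityʳ _) (cnt-0 hi)
bv-facts hi (m ∷ μ) x∷xs (_ , d) i with ∈-concatMap⁻ (\ x -> map (x ∷_) (boxes m μ)) (range m hi) i
... | x , i₁ , i₂ with MP.∈-map⁻ (x ∷_) i₂ | ∈-rangeᵍ m hi i₁
... | xs , j , refl | mx , xh with bv-facts m μ xs d j
... | l , c = trans (LP.length-++ (replicate (hi ∸ x) 0)) (cong₂ _+_ (LP.length-replicate (hi ∸ x)) (LP.length-++ (replicate (x ∸ m) 1) & cong₂ _+_ (LP.length-replicate (x ∸ m)) l & m∸n+n≡m mx) & m∸n+n≡m xh) ,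
 trans (cong (_+ (m + sum μ)) (cnt-++ (replicate (hi ∸ x) 0) _ & cong₂ _+_ (cnt-0 (hi ∸ x)) (cnt-++ (replicate (x ∸ m) 1) _ & cong (_+ cnt (bv m μ xs)) (cnt-1 (x ∸ m)))))
  (lem (x ∸ m) (cnt (bv m μ xs)) m (sum μ) & cong₂ _+_ (m∸n+n≡m mx) c)
 where lem : ∀ a b c d -> a + b + (c + d) ≡ (a + c) + (b + d)
       lem = NRing.solve-∀

∑-last : ∀ m J (g : ℕ -> ℤ) -> m ≤ J -> (∀ x -> x < J -> g x ≡ 0z) -> ∑ (range m J) g ≡ g J
∑-last m J g p z = ∑-range m J g p & ∑-upTo-last (J ∸ m) (\ y -> g (m + y)) & cong₂ Z._+_ (∑-0∈ (upTo (J ∸ m)) (\ y i -> z (m + y) (<-≤-trans (+-monoʳ-< m (MP.∈-upTo⁻ i)) (eq≤ (m+[n∸m]≡n p)))))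
 (cong g (m+[n∸m]≡n p)) & +0ˡ _

∑-boxes-full : ∀ n J μ (f : List ℕ -> ℤ) -> ∑ (boxes J (replicate n J ++ μ)) f ≡ ∑ (boxes J μ) (\ y -> f (replicate n J ++ y))
∑-boxes-full zero J μ f = refl
∑-boxes-full (suc n) J μ f = ∑-boxes J J (replicate n J ++ μ) f & cong (\ k -> ∑ (map (\ x -> J + x) (upTo k)) G) (+-∸-assoc 1 {J} ≤-refl & cong suc (n∸n≡0 J)) &
 +0ʳ _ & cong G (+-identityʳ J) & ∑-boxes-full n J μ (\ x -> f (J ∷ x))
 where G = \ x -> ∑ (boxes J (replicate n J ++ μ)) (\ xs -> f (x ∷ xs))

-- The determinant is computed here where every word merely lowers a weight, so the commutations are
-- immediate.
module Weight (r J : ℕ) (A : List ℤ -> ℤ) (anti : AntiR r A) where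

 U : List ℤ
 U = toZ (replicate r J)

 ev : List ℕ -> ℤ
 ev v = A (sub v U)

 open Peel r J ev

 commutes : Commutes
 commutes = record
  { far = \ pre p q post _ _ _ _ -> cong A (sub-++ pre (p ∷ q ∷ post) U & cong (sub post) (addAt-comm q p (Z.- 1z) (Z.- 1z) (sub pre U)) & sym (sub-++ pre (q ∷ p ∷ post) U))
  ; elm = \ n m l pre post _ _ _ -> trans (∑-swap (Dec↓ (seg n (r ∸ n)) m) (Dec↓ (seg n (r ∸ n)) l) (\ C C' -> ev (pre ++ C ++ C' ++ post)))
   (∑-cong (Dec↓ (seg n (r ∸ n)) l) (\ C' -> ∑-cong (Dec↓ (seg n (r ∸ n)) m) (\ C -> cong A (three pre C C' post & cong (sub post) (sub-comm C' C (sub pre U)) & sym (three pre C' C post))))) }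
  where three : ∀ p a b c -> sub (p ++ a ++ b ++ c) U ≡ sub c (sub b (sub a (sub p U)))
        three p a b c = sub-++ p (a ++ b ++ c) U & sub-++ a (b ++ c) (sub p U) & sub-++ b c _

 cat-++ : ∀ ws p q -> cat ws (p ++ q) ≡ cat ws p ++ q
 cat-++ [] p q = refl
 cat-++ (w ∷ ws) p q = cong (cat ws) (sym (LP.++-assoc w p q)) & cat-++ ws (w ++ p) q

 sub-wsb : ∀ n ws b post γ -> length b ≡ length ws -> sub (cat (wsb n ws b) post) γ ≡ addAt n (Z.- + cnt b) (sub (cat ws post) γ)
 sub-wsb n [] [] post γ e = sym (addAt-0 n _)
 sub-wsb n (w ∷ ws) (zero ∷ b) post γ e = sub-wsb n ws b (w ++ post) γ (suc-injective e)
 sub-wsb n (w ∷ ws) (suc _ ∷ b) post γ e = sub-wsb n ws b (n ∷ w ++ post) γ (suc-injective e) & cong (addAt n (Z.- + cnt b)) one &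
  addAt-+ n (Z.- + cnt b) (Z.- 1z) _ & cong (\ z -> addAt n z (sub (cat ws (w ++ post)) γ)) (sym (ZP.neg-distrib-+ 1z (+ cnt b)))
  where
  one : sub (cat ws (n ∷ w ++ post)) γ ≡ addAt n (Z.- 1z) (sub (cat ws (w ++ post)) γ)
  one = cong (\ v -> sub v γ) (cat-++ ws [] (n ∷ w ++ post)) & sub-++ (cat ws []) (n ∷ w ++ post) γ & sub-addAt (w ++ post) n (Z.- 1z) (sub (cat ws []) γ) &
   cong (addAt n (Z.- 1z)) (sym (sub-++ (cat ws []) (w ++ post) γ) & cong (\ v -> sub v γ) (sym (cat-++ ws [] (w ++ post))))

 -- If row i < n is not full, some column has more than r-n boxes to be filled with r-n letters; the
 -- defect moves down one row with each peeled letter until no letters are left.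
 SJ-zero : ∀ j n ws ξ i -> j + n ≡ r -> All (Ok n) ws -> length ws ≡ J -> length ξ ≡ r -> Decr (J ∷ ξ) -> i < n -> nthN ξ i < J -> SJ n ws (heights J ξ) ≡ 0z
 SJ-zero (suc j) n ws ξ i e ok lw lξ d p q = SJ-step commutes n ws ξ n<r ok lw d & ∑-0∈ (boxes J ξ) (\ x m -> SJ-zero j (suc n) (wsb n ws (bv J ξ x)) x (suc i) (+-suc j n & e)
  (Ok-wsb n ws (bv J ξ x) ok) (length-wsb n ws _ & lw) (proj₁ (∈-boxes J ξ m d) & lξ) (proj₁ (proj₂ (∈-boxes J ξ m d))) (s≤s p) (≤-<-trans (proj₂ (proj₂ (proj₂ (∈-boxes J ξ m d))) i) q))
  where n<r = s≤s (m≤n+m n j) &≤ eq≤ e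
 SJ-zero zero n ws ξ i refl ok lw lξ d p q with heights-full J ξ d
 ... | inj₂ (_ , pos , s , d' , h) = cong (SJ r ws) h & SJ-end-0 ws s d' (subst (0 <_) (sym lw) pos)
 ... | inj₁ (e , _) = ⊥-elim (<-irrefl (cong (\ l -> nthN l i) e & nth-rep (length ξ) i (subst (i <_) (sym lξ) p)) q)
  where nth-rep : ∀ n i -> i < n -> nthN (replicate n J) i ≡ J
        nth-rep (suc n) zero _ = refl
        nth-rep (suc n) (suc i) (s≤s p) = nth-rep n i p

 addAt-mid : ∀ (P : List ℤ) a x Q -> addAt (length P) a (P ++ x ∷ Q) ≡ P ++ (x Z.+ a) ∷ Q
 addAt-mid [] a x Q = refl
 addAt-mid (y ∷ P) a x Q = cong (y ∷_) (addAt-mid P a x Q)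

 replicate-Decr : ∀ n μ -> Decr (J ∷ μ) -> Decr (J ∷ replicate n J ++ μ)
 replicate-Decr zero μ d = d
 replicate-Decr (suc n) μ d with replicate-Decr n μ d
 ... | a , d' = ≤-refl ∷ a , a , d'

 -- P holds the final weight in the first n rows. Filling with the letter n must complete row n, so
 -- the strip is determined by the interlacing rows below it, and summing over these is the
 -- branching identity.
 SJ-sum : ∀ j n ws P μ -> j + n ≡ r -> All (Ok n) ws -> length ws ≡ J -> length P ≡ n -> sub (cat ws []) U ≡ P ++ toZ (replicate j J) -> length μ ≡ j -> Decr (J ∷ μ) ->
  SJ n ws (heights J (replicate n J ++ μ)) ≡ A (P ++ toZ μ)
 SJ-sum zero n ws P [] refl ok lw lP st lμ d with heights-full J (replicate n J ++ []) (replicate-Decr n [] d)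
 ... | inj₁ (_ , h) = cong (SJ n ws) h & SJ-end ws lw & cong A st
 ... | inj₂ (ne , _) = ⊥-elim (ne (subst (\ l -> l ≡ replicate (length l) J) (sym (LP.++-identityʳ _)) (cong (\ (m : ℕ) -> replicate m J) (sym (LP.length-replicate n)))))
 SJ-sum (suc j) n ws P (m ∷ μ) e ok lw lP st lμ d@(m≤ ∷ _ , d') = SJ-step commutes n ws ξ n<r ok lw dξ &
  ∑-boxes-full n J (m ∷ μ) G &
  ∑-boxes J m μ _ &
  ∑-cong∈ (range m J) (\ x i -> ∑-cong∈ (boxes m μ) (\ xs k -> sym (χ≡ x i xs k (x ≟ J)))) &
  ∑-last m J _ m≤ (\ x x<J -> ∑-0∈ (boxes m μ) (\ xs _ -> χ-no (x ≟ J) _ (<⇒≢ x<J))) &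
  ∑-cong∈ (boxes m μ) (\ xs k -> χ-yes (J ≟ J) _ refl & last′ xs k) &
  Branch.branch r A anti P m μ d' (LP.length-++ P & cong₂ _+_ lP (cong suc (LP.length-map _ μ & suc-injective lμ)) & +-comm n (suc j) & e)
  where
  R = replicate n J
  ξ = R ++ m ∷ μ
  n<r : n < r
  n<r = s≤s (m≤n+m n j) &≤ eq≤ e
  dξ = replicate-Decr n (m ∷ μ) d
  G : List ℕ -> ℤ
  G x = SJ (suc n) (wsb n ws (bv J ξ x)) (heights J x)
  mem : ∀ {x xs} -> x ∈ range m J -> xs ∈ boxes m μ -> (R ++ x ∷ xs) ∈ boxes J ξ
  mem {x} {xs} i k = go n
   where
   y∈ : (x ∷ xs) ∈ boxes J (m ∷ μ)
   y∈ = ∈-concatMap⁺ (\ x -> map (x ∷_) (boxes m μ)) i (MP.∈-map⁺ (x ∷_) k)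
   go : ∀ n -> (replicate n J ++ x ∷ xs) ∈ boxes J (replicate n J ++ m ∷ μ)
   go zero = y∈
   go (suc n) = ∈-concatMap⁺ (\ x -> map (x ∷_) (boxes J (replicate n J ++ m ∷ μ))) {x = J} (subst (J ∈_) (sym (range-∷ J J ≤-refl)) (here refl)) (MP.∈-map⁺ (J ∷_) (go n))
  ok' = \ x -> Ok-wsb n ws (bv J ξ x) ok
  lw' = \ x -> trans (length-wsb n ws (bv J ξ x)) lw
  χ≡ : ∀ x -> x ∈ range m J -> ∀ xs -> xs ∈ boxes m μ -> (dc : Dec (x ≡ J)) -> χ dc (G (R ++ x ∷ xs)) ≡ G (R ++ x ∷ xs)
  χ≡ x i xs k (yes _) = refl
  χ≡ x i xs k (no ne) = sym (SJ-zero j (suc n) (wsb n ws (bv J ξ y)) y n (+-suc j n & e) (ok' y) (lw' y) (proj₁ fy & LP.length-++ R & cong₂ _+_ (LP.length-replicate n) lμ & +-comm n (suc j) & e)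
   (proj₁ (proj₂ fy)) ≤-refl (subst (_< J) (sym (nth-mid n)) (≤∧≢⇒< (proj₂ (∈-rangeᵍ m J i)) ne)))
   where
   y = R ++ x ∷ xs
   fy = ∈-boxes J ξ (mem i k) dξ
   nth-mid : ∀ n -> nthN (replicate n J ++ x ∷ xs) n ≡ x
   nth-mid zero = refl
   nth-mid (suc n) = nth-mid n
  last′ : ∀ xs -> xs ∈ boxes m μ -> G (R ++ J ∷ xs) ≡ A (P ++ (+ (m + sum μ) Z.- + sum xs) ∷ toZ xs)
  last′ xs k = cong (SJ (suc n) ws' ∘ heights J) shiftJ & SJ-sum j (suc n) ws' (P ++ g ∷ []) xs (+-suc j n & e) (ok' y) (lw' y) (length-snoc P g & cong suc lP) st'
   (proj₁ fx & suc-injective lμ) (All.map (\ p -> p &≤ m≤) (proj₁ (proj₁ (proj₂ fx))) , proj₂ (proj₁ (proj₂ fx))) & cong A (LP.++-assoc P (g ∷ []) (toZ xs) & cong (\ z -> P ++ z ∷ toZ xs) g≡)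
   where
   y = R ++ J ∷ xs
   ws' = wsb n ws (bv J ξ y)
   fx = ∈-boxes m μ k d'
   i = subst (_∈ range m J) (m+[n∸m]≡n m≤) (MP.∈-map⁺ (\ y -> m + y) (MP.∈-upTo⁺ (eq≤ (sym (+-∸-assoc 1 m≤)))))
   fb = bv-facts J ξ y dξ (mem i k)
   b = bv J ξ y
   -- Entry n of the weight: J minus the size of the strip, that is, the number of letters n.
   g = + J Z.+ (Z.- + cnt b)
   shiftJ : y ≡ replicate (suc n) J ++ xs
   shiftJ = sym (LP.++-assoc R (J ∷ []) xs) & cong (_++ xs) (replicate-+ n 1 J & cong (\ (m : ℕ) -> replicate m J) (+-comm n 1))
   st' : sub (cat ws' []) U ≡ (P ++ g ∷ []) ++ toZ (replicate j J)
   st' = sub-wsb n ws b [] U (proj₁ fb & sym lw) & cong₂ (\ k -> addAt k (Z.- + cnt b)) (sym lP) st & addAt-mid P _ (+ J) (toZ (replicate j J)) & sym (LP.++-assoc P (g ∷ []) _)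
   sum-++ : ∀ (a b : List ℕ) -> sum (a ++ b) ≡ sum a + sum b
   sum-++ [] b = refl
   sum-++ (x ∷ a) b = cong (\ z -> x + z) (sum-++ a b) & sym (+-assoc x (sum a) (sum b))
   c≡ : cnt b + (m + sum μ) ≡ J + sum xs
   c≡ = +-cancelˡ-≡ (sum R) _ _ (lem (sum R) (cnt b) (m + sum μ) & cong (\ z -> cnt b + z) (sym (sum-++ R (m ∷ μ))) & proj₂ fb & sum-++ R (J ∷ xs))
    where lem : ∀ a b c -> a + (b + c) ≡ b + (a + c)
          lem = NRing.solve-∀
   g≡ : g ≡ + (m + sum μ) Z.- + sum xs
   g≡ = ZP.i-j≡0⇒i≡j _ _ (lem (+ J) (+ cnt b) (+ (m + sum μ)) (+ sum xs) & cong₂ Z._-_ (sym (ZP.pos-+ J (sum xs))) (sym (ZP.pos-+ (cnt b) (m + sum μ))) & ZP.i≡j⇒i-j≡0 (cong +_ (sym c≡)))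
    where lem : ∀ j c m s -> (j Z.+ (Z.- c)) Z.- (m Z.- s) ≡ (j Z.+ s) Z.- (c Z.+ m)
          lem = solve-∀

 SJ-weight : ∀ μ -> length μ ≡ r -> Decr (J ∷ μ) -> SJ 0 (replicate J []) (heights J μ) ≡ A (toZ μ)
 SJ-weight μ lμ d = SJ-sum r 0 (replicate J []) [] μ (+-identityʳ r) (oks J) (LP.length-replicate J) refl (cong (\ v -> sub v U) (cat∅ J)) lμ d
  where
  oks : ∀ J -> All (Ok 0) (replicate J [])
  oks zero = []
  oks (suc J) = ([] , \ _ -> z≤n) ∷ oks J
  cat∅ : ∀ J -> cat (replicate J []) [] ≡ []
  cat∅ zero = refl
  cat∅ (suc J) = cat∅ J

-- Enlarging the root ideal to full rows (the weight has equal first r entries)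

module Demazure (k r W : ℕ) (ν : List ℕ) (Wr : W + r ≡ suc k) (W≤k : W ≤ k) where

 μ₀ = replicate r W ++ ν
 ℓ = r + length ν

 len₀ : length μ₀ ≡ ℓ
 len₀ = LP.length-++ (replicate r W) & cong (_+ length ν) (LP.length-replicate r)

 nth-lo : ∀ i -> i < r -> nthN μ₀ i ≡ W
 nth-lo = go r
  where go : ∀ r i -> i < r -> nthN (replicate r W ++ ν) i ≡ W
        go (suc r) zero _ = refl
        go (suc r) (suc i) (s≤s p) = go r i p

 nth-hi : ∀ i -> nthN μ₀ (r + i) ≡ nthN ν i
 nth-hi = nthN-rep≥ r W ν

 -- Interpolates between the full rows (s = 0), where each of the first r rows starts in column r,
 -- and the staircase starts r+i of Δ^k(Uν) (s = r).
 level : ℕ -> ℕ -> ℕ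
 level s i = if i <ᵇ r then r + (i ⊓ s) else dn k μ₀ i

 mixed : ℕ -> ℕ -> ℕ -> ℕ
 mixed s t i = if i <ᵇ t then level s i else level (suc s) i

 level-lo : ∀ s i -> i < r -> level s i ≡ r + (i ⊓ s)
 level-lo s i p rewrite <ᵇ-true⁺ {i} {r} p = refl

 level≥ : ∀ s i -> r ≤ level s i
 level≥ s i with i <ᵇ r in e
 ... | true = m≤m+n r _
 ... | false = <ᵇ-false⁻ e &≤ m≤m+n i _

 mixed-new : ∀ s t i -> i < t -> mixed s t i ≡ level s i
 mixed-new s t i p rewrite <ᵇ-true⁺ {i} {t} p = refl

 mixed-old : ∀ s t i -> t ≤ i -> mixed s t i ≡ level (suc s) i
 mixed-old s t i p rewrite <ᵇ-false⁺ {i} {t} p = refl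

 RS-≗ : ∀ {st st'} -> (∀ i -> i < ℓ -> st i ≡ st' i) -> RS st ℓ ↭ RS st' ℓ
 RS-≗ {st} {st'} e = RS-ext st st' ℓ (\ i j p _ -> subst (_≤ j) (e i p)) (\ i j p _ -> subst (_≤ j) (sym (e i p)))

 full↭ : RS (level 0) ℓ ↭ roots (fullRoot k r ν) ℓ
 full↭ = unique-↭ (Unique-roots (rs (level 0)) ℓ) (Unique-roots (fullRoot k r ν) ℓ) to from
  where
  eq : ∀ i j -> rs (level 0) (suc i) j ≡ fullRoot k r ν (suc i) j
  eq i j with i <? r
  ... | yes p rewrite <ᵇ-true⁺ {i} {r} p | ⊓-zeroʳ i | +-identityʳ r = refl
  ... | no ¬p rewrite <ᵇ-false⁺ {i} {r} (≮⇒≥ ¬p) = bool-ext fw bw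
   where
   i' = i ∸ r
   i≡ : i ≡ r + i'
   i≡ = sym (m+[n∸m]≡n (≮⇒≥ ¬p))
   si : suc i ∸ r ≡ suc i'
   si = +-∸-assoc 1 (≮⇒≥ ¬p)
   a = k ∸ nthN ν i'
   dn≡ : dn k μ₀ i ≡ r + (a + suc i')
   dn≡ = cong (\ x -> x + suc (k ∸ nthN μ₀ x)) i≡ & cong (\ x -> r + i' + suc (k ∸ x)) (nth-hi i') & lem r i' a
    where lem : ∀ r i a -> r + i + suc a ≡ r + (a + suc i)
          lem = NRing.solve-∀
   fw : (dn k μ₀ i <ᵇ j) ≡ true -> kRoot k ν (suc i ∸ r) (j ∸ r) ≡ true
   fw t = cong (\ x -> kRoot k ν x (j ∸ r)) si & ∧-true (<ᵇ-true⁺ (≤-<-trans (m≤n+m (suc i') a) lt)) (<ᵇ-true⁺ lt)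
    where lt : a + suc i' < j ∸ r
          lt = ≤-<-trans (eq≤ (sym (m+n∸m≡n r _))) (∸-monoˡ-< (≤-<-trans (eq≤ (sym dn≡)) (<ᵇ-true⁻ t)) (m≤m+n r _))
   bw : kRoot k ν (suc i ∸ r) (j ∸ r) ≡ true -> (dn k μ₀ i <ᵇ j) ≡ true
   bw t = <ᵇ-true⁺ (≤-<-trans (eq≤ dn≡) (<-≤-trans (+-monoʳ-< r lt) (eq≤ (m+[n∸m]≡n r≤j))))
    where lt : a + suc i' < j ∸ r
          lt = <ᵇ-true⁻ (∧-trueʳ (cong (\ x -> kRoot k ν x (j ∸ r)) (sym si) & t))
          r≤j : r ≤ j
          r≤j = <⇒≤ (m∸n≢0⇒n<m (\ e -> n≮0 (subst (a + suc i' <_) e lt)))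
  to : ∀ {β} -> β ∈ RS (level 0) ℓ -> β ∈ roots (fullRoot k r ν) ℓ
  to {i , j} m with ∈-roots⁻ (rs (level 0)) ℓ m
  to {suc i , j} m | a , b , c , d , t = ∈-roots⁺ (fullRoot k r ν) ℓ a b c d (sym (eq i j) & t)
  from : ∀ {β} -> β ∈ roots (fullRoot k r ν) ℓ -> β ∈ RS (level 0) ℓ
  from {i , j} m with ∈-roots⁻ (fullRoot k r ν) ℓ m
  from {suc i , j} m | a , b , c , d , t = ∈-roots⁺ (rs (level 0)) ℓ a b c d (eq i j & t)

 module _ (Φ : GF) (an : ∀ i -> suc i < r -> Anti ℓ Φ i) where
  γ₀ = toZ μ₀
  lenγ : length γ₀ ≡ ℓ
  lenγ = LP.length-map _ μ₀ & len₀

  -- The only new root is in row t and column r+s; with it row t starts where row t-1 does. Spending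
  -- it on the weight gives entries W, W+1 in these two rows, a fixed point of the reflection, so
  -- the extra term is 0.
  row : ∀ s t -> t < r -> ∀ n -> H (RS (mixed s (suc t)) ℓ) Φ γ₀ n ≡ H (RS (mixed s t) ℓ) Φ γ₀ n
  row s t t<r n with t ≤? s
  ... | yes p = H-↭ Φ (RS-≗ {mixed s (suc t)} {mixed s t} (\ i _ -> same i)) γ₀ n
   where
   same : ∀ i -> mixed s (suc t) i ≡ mixed s t i
   same i with <-cmp i t
   ... | tri< a _ _ = mixed-new s (suc t) i (m<n⇒m<1+n a) & sym (mixed-new s t i a)
   ... | tri> _ _ c = mixed-old s (suc t) i c & sym (mixed-old s t i (<⇒≤ c))
   ... | tri≈ _ refl _ = mixed-new s (suc t) t ≤-refl & level-lo s t t<r & cong (\ x -> r + x) (m≤n⇒m⊓n≡m p & sym (m≤n⇒m⊓n≡m (m≤n⇒m≤1+n p))) &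
    sym (level-lo (suc s) t t<r) & sym (mixed-old s t t ≤-refl)
  ... | no ¬p with ≰⇒> ¬p
  row s (suc t) t<r n | no ¬p | s≤s s≤t = add (r + s <? ℓ)
   where
   st = mixed s (suc t)
   st' = mixed s (suc (suc t))
   st-t : st (suc t) ≡ suc (r + s)
   st-t = mixed-old s (suc t) (suc t) ≤-refl & level-lo (suc s) (suc t) t<r & cong (\ x -> r + suc x) (m≥n⇒m⊓n≡n s≤t) & +-suc r s
   st'-t : st' (suc t) ≡ r + s
   st'-t = mixed-new s (suc (suc t)) (suc t) ≤-refl & level-lo s (suc t) t<r & cong (\ x -> r + x) (m≥n⇒m⊓n≡n (m≤n⇒m≤1+n s≤t))
   st'-t- : st' t ≡ r + s
   st'-t- = mixed-new s (suc (suc t)) t (m≤n⇒m≤1+n ≤-refl) & level-lo s t (<-trans ≤-refl t<r) & cong (\ x -> r + x) (m≥n⇒m⊓n≡n s≤t)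
   other : ∀ i -> i ≢ suc t -> st' i ≡ st i
   other i ne with <-cmp i (suc t)
   ... | tri< a _ _ = mixed-new s (suc (suc t)) i (m<n⇒m<1+n a) & sym (mixed-new s (suc t) i a)
   ... | tri≈ _ b _ = ⊥-elim (ne b)
   ... | tri> _ _ c = mixed-old s (suc (suc t)) i c & sym (mixed-old s (suc t) i (<⇒≤ c))
   t<ℓ : suc t < ℓ
   t<ℓ = <-≤-trans t<r (m≤m+n r _)
   big : ∀ i -> st' i ≢ suc t
   big i e = <⇒≱ t<r (r≤ &≤ eq≤ e)
    where r≤ : r ≤ st' i
          r≤ with i <ᵇ suc (suc t)
          ... | true = level≥ s i
          ... | false = level≥ (suc s) i
   add : Dec (r + s < ℓ) -> H (RS st' ℓ) Φ γ₀ n ≡ H (RS st ℓ) Φ γ₀ n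
   add (no ¬q) = H-↭ Φ (RS-ext st' st ℓ (\ i j _ j<ℓ -> f i j j<ℓ (i ≟ suc t)) (\ i j _ j<ℓ -> g i j j<ℓ (i ≟ suc t))) γ₀ n
    where
    f : ∀ i j -> j < ℓ -> Dec (i ≡ suc t) -> st' i ≤ j -> st i ≤ j
    f i j j<ℓ (no ne) le = subst (_≤ j) (other i ne) le
    f i j j<ℓ (yes refl) le = ⊥-elim (<⇒≱ j<ℓ (≮⇒≥ ¬q &≤ eq≤ (sym st'-t) &≤ le))
    g : ∀ i j -> j < ℓ -> Dec (i ≡ suc t) -> st i ≤ j -> st' i ≤ j
    g i j j<ℓ (no ne) le = subst (_≤ j) (sym (other i ne)) le
    g i j j<ℓ (yes refl) le = ⊥-elim (<⇒≱ j<ℓ (≮⇒≥ ¬q &≤ n≤1+n _ &≤ eq≤ (sym st-t) &≤ le))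
   add (yes q) = drop n
    where
    β : Root
    β = suc (suc t) , suc (r + s)
    perm : RS st' ℓ ↭ β ∷ RS st ℓ
    perm = RS-upd st st' ℓ (suc t) (r + s) t<ℓ q st-t st'-t other
    γ₁ = mv β 1 γ₀
    away : ∀ i -> i < r -> nthZ (addAt (r + s) (Z.- 1z) γ₀) i ≡ + W
    away i p = nthZ-addAt-≢ i (r + s) (Z.- 1z) γ₀ (<⇒≢ (<-≤-trans p (m≤m+n r s))) & nthZ-toZ μ₀ i & cong +_ (nth-lo i p)
    wt : nthZ γ₁ (suc t) ≡ nthZ γ₁ t Z.+ 1z
    wt = nthZ-addAt-≡ (suc t) (+ 1) (addAt (r + s) (Z.- 1z) γ₀) (subst (suc t <_) (sym (length-addAt (r + s) (Z.- 1z) γ₀ & lenγ)) t<ℓ) & cong (Z._+ 1z) (away (suc t) t<r &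
     sym (away t (<-trans ≤-refl t<r)) & sym (nthZ-addAt-≢ t (suc t) (+ 1) (addAt (r + s) (Z.- 1z) γ₀) (<⇒≢ ≤-refl)))
    zero₁ : ∀ n -> H (β ∷ RS st ℓ) Φ γ₁ n ≡ 0z
    zero₁ n = sym (H-↭ Φ perm γ₁ n) & Anti-zero ℓ _ t γ₁ n t<ℓ (length-mv β 1 γ₀ & lenγ) (RS-Anti ℓ st' t Φ t<ℓ (an t t<r) (st'-t- & sym st'-t) big) wt
    drop : ∀ n -> H (RS st' ℓ) Φ γ₀ n ≡ H (RS st ℓ) Φ γ₀ n
    drop zero = H-↭ Φ perm γ₀ zero
    drop (suc n) = H-↭ Φ perm γ₀ (suc n) & cong (\ z -> H (RS st ℓ) Φ γ₀ (suc n) Z.+ z) (zero₁ n) & +0ʳ _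

  rows : ∀ s t -> t ≤ r -> ∀ n -> H (RS (mixed s t) ℓ) Φ γ₀ n ≡ H (RS (mixed s 0) ℓ) Φ γ₀ n
  rows s zero p n = refl
  rows s (suc t) p n = row s t p n & rows s t (<⇒≤ p) n

  levels : ∀ s n -> H (RS (level 0) ℓ) Φ γ₀ n ≡ H (RS (level s) ℓ) Φ γ₀ n
  levels zero n = refl
  levels (suc s) n = levels s n & H-↭ Φ (RS-≗ {level s} {mixed s r} (\ i _ -> same i)) γ₀ n & rows s r ≤-refl n
   where
   same : ∀ i -> level s i ≡ mixed s r i
   same i with i <ᵇ r
   ... | true = refl
   ... | false = refl

  dn-level : ∀ i -> dn k μ₀ i ≡ level r i
  dn-level i with i <ᵇ r in e
  ... | false = refl
  ... | true = cong (\ x -> i + suc (k ∸ x)) (nth-lo i p) & cong (\ x -> i + x) kW & +-comm i r & cong (\ x -> r + x) (sym (m≤n⇒m⊓n≡m (<⇒≤ p)))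
   where
   p = <ᵇ-true⁻ {i} {r} e
   kW : suc (k ∸ W) ≡ r
   kW = sym (+-∸-assoc 1 W≤k) & cong (_∸ W) (sym Wr) & m+n∸m≡n W r

  demazure : ∀ n -> H (kRoots k μ₀) Φ γ₀ n ≡ H (roots (fullRoot k r ν) ℓ) Φ γ₀ n
  demazure n = sym (H-↭ Φ (subst (\ L -> RS (dn k μ₀) L ↭ kRoots k μ₀) len₀ (kRoots↭ k μ₀)) γ₀ n) & H-↭ Φ (RS-≗ {dn k μ₀} {level r} (\ i _ -> dn-level i)) γ₀ n &
   sym (levels r n) & H-↭ Φ full↭ γ₀ n

 full-Anti : ∀ Φ i -> suc i < r -> Anti ℓ Φ i -> Anti ℓ (H (roots (fullRoot k r ν) ℓ) Φ) i
 full-Anti Φ i p an = Anti-cong ℓ i (\ γ _ n -> H-↭ Φ full↭ γ n) (RS-Anti ℓ (level 0) i Φ (<-≤-trans p (m≤m+n r _)) an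
  (level-lo 0 i (<-trans ≤-refl p) & cong (\ x -> r + x) (⊓-zeroʳ i & sym (⊓-zeroʳ (suc i))) & sym (level-lo 0 (suc i) p))
  (\ j e -> <⇒≱ p (level≥ 0 j &≤ eq≤ e)))

-- Enumerating the strong covers

all-0 : ∀ μ -> All (_≤ 0) μ -> dropZeros μ ≡ [] × μ ≡ replicate (length μ) 0
all-0 [] _ = refl , refl
all-0 (zero ∷ μ) (_ ∷ ps) = proj₁ (all-0 μ ps) , cong (0 ∷_) (proj₂ (all-0 μ ps))

dropZeros-spec : ∀ μ -> Decr μ -> μ ≡ dropZeros μ ++ replicate (length μ ∸ length (dropZeros μ)) 0 × Decr (dropZeros μ) × All (1 ≤_) (dropZeros μ) × length (dropZeros μ) ≤ length μ
dropZeros-spec [] d = refl , tt , [] , z≤n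
dropZeros-spec (suc x ∷ μ) (a , d) with dropZeros-spec μ d
... | e , d' , p , l = cong (suc x ∷_) e , (keep μ a , d') , z<s ∷ p , s≤s l
 where keep : ∀ {x} μ -> All (_≤ x) μ -> All (_≤ x) (dropZeros μ)
       keep [] _ = []
       keep (zero ∷ μ) (_ ∷ ps) = keep μ ps
       keep (suc y ∷ μ) (p ∷ ps) = p ∷ keep μ ps
dropZeros-spec (zero ∷ μ) (a , d) rewrite proj₁ (all-0 μ a) = cong (0 ∷_) (proj₂ (all-0 μ a)) , tt , [] , z≤n

dropZeros-pad : ∀ ν m -> All (1 ≤_) ν -> dropZeros (ν ++ replicate m 0) ≡ ν
dropZeros-pad [] zero _ = refl
dropZeros-pad [] (suc m) _ = dropZeros-pad [] m []
dropZeros-pad (suc x ∷ ν) m (_ ∷ ps) = cong (suc x ∷_) (dropZeros-pad ν m ps)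

nthN-pad : ∀ ν m i -> nthN (ν ++ replicate m 0) i ≡ nthN ν i
nthN-pad [] zero i = refl
nthN-pad [] (suc m) zero = refl
nthN-pad [] (suc m) (suc i) = nthN-pad [] m i
nthN-pad (x ∷ ν) m zero = refl
nthN-pad (x ∷ ν) m (suc i) = nthN-pad ν m i

coreL-pad : ∀ k ν m -> coreL k (ν ++ replicate m 0) ≡ coreL k ν ++ replicate m 0
coreL-pad k [] zero = refl
coreL-pad k [] (suc m) = cong₂ _∷_ (cong (\ l -> nthN l k) (coreL-pad k [] m) & nthN-pad [] m k) (coreL-pad k [] m)
coreL-pad k (x ∷ ν) m = cong₂ _∷_ (cong (\ y -> x + y) (cong (\ l -> nthN l (k ∸ x)) (coreL-pad k ν m) & nthN-pad (coreL k ν) m (k ∸ x))) (coreL-pad k ν m)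

sum-pad : ∀ ν m -> sum (ν ++ replicate m 0) ≡ sum ν
sum-pad [] zero = refl
sum-pad [] (suc m) = sum-pad [] m
sum-pad (x ∷ ν) m = cong (\ y -> x + y) (sum-pad ν m)

∑-select : ∀ {A : Set} (p : A -> Bool) (L R : List A) (g : A -> ℤ) -> Unique L -> Unique R ->
 (∀ {x} -> x ∈ L -> p x ≡ true -> x ∈ R) -> (∀ {x} -> x ∈ R -> x ∈ L × p x ≡ true) -> ∑ L (\ x -> if p x then g x else 0z) ≡ ∑ R g
∑-select p L R g uL uR f h = sym (∑-filterᵇ p L g) & ∑-↭ g (unique-↭ (UP.filter⁺ P? uL) uR (\ i -> f (proj₁ (MP.∈-filter⁻ P? {xs = L} i)) (T-true (proj₂ (MP.∈-filter⁻ P? {xs = L} i))))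
 (\ i -> MP.∈-filter⁺ P? (proj₁ (h i)) (subst T (sym (proj₂ (h i))) tt)))
 where
 P? = \ x -> T? (p x)
 T-true : ∀ {b} -> T b -> b ≡ true
 T-true {true} _ = refl

∈-decr⁻ : ∀ n m {x} -> x ∈ decr n m -> length x ≡ n × Decr (m ∷ x)
∈-decr⁻ zero m (here refl) = refl , [] , tt
∈-decr⁻ (suc n) m i with ∈-concatMap⁻ (\ a -> map (a ∷_) (decr n a)) (upTo (suc m)) i
... | a , j , k with MP.∈-map⁻ (a ∷_) k
... | x , k' , refl with ∈-decr⁻ n a k'
... | l , b , d = cong suc l , ≤-pred (MP.∈-upTo⁻ j) ∷ All.map (\ p -> p &≤ ≤-pred (MP.∈-upTo⁻ j)) b , b , d

∈-decr⁺ : ∀ n m {x} -> length x ≡ n -> Decr (m ∷ x) -> x ∈ decr n m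
∈-decr⁺ zero m {[]} _ _ = here refl
∈-decr⁺ (suc n) m {a ∷ x} l (p ∷ _ , d) = ∈-concatMap⁺ (\ a -> map (a ∷_) (decr n a)) (MP.∈-upTo⁺ (s≤s p)) (MP.∈-map⁺ (a ∷_) (∈-decr⁺ n a (suc-injective l) d))

Unique-decr : ∀ n m -> Unique (decr n m)
Unique-decr zero m = [] AllPairs.∷ AllPairs.[]
Unique-decr (suc n) m = Unique-concatMap (\ a -> map (a ∷_) (decr n a)) (UP.upTo⁺ (suc m)) (\ a -> UP.map⁺ LP.∷-injectiveʳ (Unique-decr n a)) (\ i j -> same (MP.∈-map⁻ _ i) (MP.∈-map⁻ _ j))
 where same : ∀ {a b y} {L L' : List (List ℕ)} -> ∃[ u ] (u ∈ L × y ≡ a ∷ u) -> ∃[ v ] (v ∈ L' × y ≡ b ∷ v) -> a ≡ b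
       same (_ , _ , e) (_ , _ , e') = LP.∷-injectiveˡ (sym e & e')

Unique-partsBox : ∀ n m -> Unique (partsBox n m)
Unique-partsBox n m = UP.map⁻ {f = \ l -> l ++ replicate (n ∸ length l) 0} (subst Unique (sym (sym (LP.map-∘ (decr n m)) & ids (decr n m) (\ i -> i))) (Unique-decr n m))
 where
 ids : ∀ L -> (∀ {x} -> x ∈ L -> x ∈ decr n m) -> map (\ x -> dropZeros x ++ replicate (n ∸ length (dropZeros x)) 0) L ≡ L
 ids [] s = refl
 ids (x ∷ L) s = cong₂ _∷_ (sym (subst (\ l -> x ≡ dropZeros x ++ replicate (l ∸ length (dropZeros x)) 0) (proj₁ sp) (proj₁ (dropZeros-spec x (proj₂ (proj₂ sp)))))) (ids L (s ∘ there))
  where sp = ∈-decr⁻ n m (s (here refl))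

∈-partsBox⁻ : ∀ n m {x} -> x ∈ partsBox n m -> Decr x × All (1 ≤_) x × length x ≤ n
∈-partsBox⁻ n m i with MP.∈-map⁻ dropZeros i
... | y , j , refl with dropZeros-spec y (proj₂ (proj₂ (∈-decr⁻ n m j)))
... | _ , d , p , l = d , p , ≤-trans l (eq≤ (proj₁ (∈-decr⁻ n m j)))

∈-partsBox⁺ : ∀ n m {x} -> Decr (m ∷ x) -> All (1 ≤_) x -> length x ≤ n -> x ∈ partsBox n m
∈-partsBox⁺ n m {x} d p l = subst (_∈ partsBox n m) (dropZeros-pad x (n ∸ length x) p) (MP.∈-map⁺ dropZeros (∈-decr⁺ n m (LP.length-++ x & cong (\ y -> length x + y) (LP.length-replicate _) & m+[n∸m]≡n l) (pad (n ∸ length x) x d)))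
 where
 zs : ∀ m j -> All (_≤ m) (replicate j 0)
 zs m zero = []
 zs m (suc j) = z≤n ∷ zs m j
 pad : ∀ {m} j x -> Decr (m ∷ x) -> Decr (m ∷ x ++ replicate j 0)
 pad {m} zero [] d = [] , tt
 pad {m} (suc j) [] d = z≤n ∷ zs m j , pad j [] ([] , tt)
 pad j (y ∷ x) (q ∷ qs , d) with pad j x d
 ... | a , d' = q ∷ All.map (\ r -> r &≤ q) a , a , d'

-- components of κ/τ when every changed row is isolated: single rows
module Comps (τ κ : ℕ -> ℕ) where

 rows : ℕ -> ℕ -> List (ℕ × ℕ × ℕ)
 rows a zero = []
 rows a (suc c) = (suc a , τ a , κ a) ∷ rows (suc a) c

 changed : ℕ -> ℕ -> List (ℕ × ℕ)
 changed a zero = []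
 changed a (suc c) = if τ a <ᵇ κ a then (suc a , suc a) ∷ changed (suc a) c else changed (suc a) c

 module _ (iso : ∀ i -> τ i < κ i -> κ (suc i) ≤ τ i) where
  go-nothing : ∀ a c -> compsGo (rows a c) nothing ≡ changed a c
  go-just : ∀ a c b t -> κ a ≤ t -> compsGo (rows a c) (just (b , b , t)) ≡ (b , b) ∷ changed a c
  go-nothing a zero = refl
  go-nothing a (suc c) with τ a <ᵇ κ a in e
  ... | true = go-just (suc a) c (suc a) (τ a) (iso a (<ᵇ-true⁻ e))
  ... | false = go-nothing (suc a) c
  go-just a zero b t p = refl
  go-just a (suc c) b t p with τ a <ᵇ κ a in e
  ... | false = cong ((b , b) ∷_) (go-nothing (suc a) c)
  ... | true rewrite <ᵇ-false⁺ {t} {κ a} p = cong ((b , b) ∷_) (go-just (suc a) c (suc a) (τ a) (iso a (<ᵇ-true⁻ e)))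

 changed-++ : ∀ a c c' -> changed a (c + c') ≡ changed a c ++ changed (a + c) c'
 changed-++ a zero c' = cong (\ x -> changed x c') (sym (+-identityʳ a))
 changed-++ a (suc c) c' with τ a <ᵇ κ a
 ... | true = cong ((suc a , suc a) ∷_) (changed-++ (suc a) c c' & cong (\ x -> changed (suc a) c ++ changed x c') (sym (+-suc a c)))
 ... | false = changed-++ (suc a) c c' & cong (\ x -> changed (suc a) c ++ changed x c') (sym (+-suc a c))

 changed-none : ∀ a c -> (∀ i -> a ≤ i -> i < a + c -> ¬ (τ i < κ i)) -> changed a c ≡ []
 changed-none a zero h = refl
 changed-none a (suc c) h with τ a <ᵇ κ a in e
 ... | true = ⊥-elim (h a ≤-refl (s≤s (m≤m+n a c) &≤ eq≤ (sym (+-suc a c))) (<ᵇ-true⁻ e))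
 ... | false = changed-none (suc a) c (\ i p q -> h i (<⇒≤ p) (q &≤ eq≤ (sym (+-suc a c))))

 changed-here : ∀ a c -> τ a < κ a -> changed a (suc c) ≡ (suc a , suc a) ∷ changed (suc a) c
 changed-here a c p rewrite <ᵇ-true⁺ {τ a} {κ a} p = refl

 ∈-changed : ∀ a c {x y} -> (x , y) ∈ changed a c -> x ≡ y × a < x × x ≤ a + c
 ∈-changed a (suc c) i with τ a <ᵇ κ a
 ... | false = wk (∈-changed (suc a) c i)
  where wk : ∀ {x y} -> x ≡ y × suc a < x × x ≤ suc a + c -> x ≡ y × a < x × x ≤ a + suc c
        wk (e , p , q) = e , <⇒≤ p , ≤-trans q (eq≤ (sym (+-suc a c)))
 ∈-changed a (suc c) (here refl) | true = refl , ≤-refl , ≤-trans (s≤s (m≤m+n a c)) (eq≤ (sym (+-suc a c)))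
 ∈-changed a (suc c) (there i) | true with ∈-changed (suc a) c i
 ... | e , p , q = e , <⇒≤ p , ≤-trans q (eq≤ (sym (+-suc a c)))

 ∈-compsGo : ∀ R o {x y} -> (∀ {i t c} -> (i , t , c) ∈ R -> ∃[ j ] (i ≡ suc j × t ≡ τ j × c ≡ κ j)) -> (x , y) ∈ compsGo R o ->
  (∃[ j ] (x ≡ suc j × τ j < κ j)) ⊎ (∃[ b ] ∃[ t ] o ≡ just (x , b , t))
 ∈-compsGo [] (just (a , b , t)) s (here refl) = inj₂ (b , t , refl)
 ∈-compsGo ((i , t , c) ∷ R) nothing s m with t <ᵇ c in e
 ... | false = ∈-compsGo R nothing (s ∘ there) m
 ... | true with ∈-compsGo R (just (i , i , t)) (s ∘ there) m | s (here refl)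
 ... | inj₁ x | _ = inj₁ x
 ... | inj₂ (_ , _ , refl) | j , refl , refl , refl = inj₁ (j , refl , <ᵇ-true⁻ e)
 ∈-compsGo ((i , t , c) ∷ R) (just (a , b , u)) s m with t <ᵇ c in e | u <ᵇ c
 ∈-compsGo ((i , t , c) ∷ R) (just (a , b , u)) s (here refl) | false | _ = inj₂ (b , u , refl)
 ∈-compsGo ((i , t , c) ∷ R) (just (a , b , u)) s (there m) | false | _ with ∈-compsGo R nothing (s ∘ there) m
 ... | inj₁ x = inj₁ x
 ∈-compsGo ((i , t , c) ∷ R) (just (a , b , u)) s m | true | true with ∈-compsGo R (just (a , i , t)) (s ∘ there) m
 ... | inj₁ x = inj₁ x
 ... | inj₂ (_ , _ , refl) = inj₂ (b , u , refl)
 ∈-compsGo ((i , t , c) ∷ R) (just (a , b , u)) s (here refl) | true | false = inj₂ (b , u , refl)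
 ∈-compsGo ((i , t , c) ∷ R) (just (a , b , u)) s (there m) | true | false with ∈-compsGo R (just (i , i , t)) (s ∘ there) m | s (here refl)
 ... | inj₁ x | _ = inj₁ x
 ... | inj₂ (_ , _ , refl) | j , refl , refl , refl = inj₁ (j , refl , <ᵇ-true⁻ e)

rows-range : ∀ τ κ L -> map (\ i -> (i , nthN τ (i ∸ 1) , nthN κ (i ∸ 1))) (range 1 L) ≡ Comps.rows (nthN τ) (nthN κ) 0 L
rows-range τ κ L = sym (LP.map-∘ (upTo L)) & go 0 L (\ i -> i) (\ _ -> refl)
 where
 go : ∀ a c (f : ℕ -> ℕ) -> (∀ i -> f i ≡ a + i) -> map (\ i -> (suc i , nthN τ i , nthN κ i)) (applyUpTo f c) ≡ Comps.rows (nthN τ) (nthN κ) a c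
 go a zero f e = refl
 go a (suc c) f e = cong₂ _∷_ (cong (\ i -> (suc i , nthN τ i , nthN κ i)) (e 0 & +-identityʳ a)) (go (suc a) c (f ∘ suc) (\ i -> e (suc i) & +-suc a i))

any⁺ : ∀ {A : Set} (p : A -> Bool) xs {x} -> x ∈ xs -> p x ≡ true -> any p xs ≡ true
any⁺ p (x ∷ xs) (here refl) e rewrite e = refl
any⁺ p (y ∷ xs) (there i) e with p y
... | true = refl
... | false = any⁺ p xs i e

any⁻ : ∀ {A : Set} (p : A -> Bool) xs -> any p xs ≡ true -> ∃[ x ] (x ∈ xs × p x ≡ true)
any⁻ p (x ∷ xs) e with p x in q
... | true = x , here refl , q
... | false with any⁻ p xs e
... | y , i , q' = y , there i , q'

countB-all : ∀ {A : Set} (p : A -> Bool) xs -> (∀ {x} -> x ∈ xs -> p x ≡ true) -> countB p xs ≡ length xs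
countB-all p [] h = refl
countB-all p (x ∷ xs) h rewrite h (here refl) = cong suc (countB-all p xs (h ∘ there))

countB-split : ∀ {A : Set} (p : A -> Bool) xs y ys -> (∀ {x} -> x ∈ xs -> p x ≡ false) -> p y ≡ false -> (∀ {x} -> x ∈ ys -> p x ≡ true) -> countB p (xs ++ y ∷ ys) ≡ length ys
countB-split p [] y ys h e h' rewrite e = countB-all p ys h'
countB-split p (x ∷ xs) y ys h e h' rewrite h (here refl) = countB-split p xs y ys (h ∘ there) e h'

foldr-≤1 : ∀ (g : ℕ × ℕ -> ℕ -> ℕ) cs -> (∀ a acc -> acc ≤ 1 -> g (a , a) acc ≤ 1) -> (∀ {x y} -> (x , y) ∈ cs -> x ≡ y) -> foldr g 0 cs ≤ 1
foldr-≤1 g [] h e = z≤n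
foldr-≤1 g ((a , b) ∷ cs) h e with e (here refl)
... | refl = h a _ (foldr-≤1 g cs h (e ∘ there))

eqList-true : ∀ a b -> eqList a b ≡ true -> a ≡ b
eqList-true [] [] e = refl
eqList-true (x ∷ a) (y ∷ b) e = cong₂ _∷_ (≡ᵇ-true {x} {y} (∧-trueˡ e)) (eqList-true a b (∧-trueʳ {x ≡ᵇ y} e))

eqList-refl : ∀ a -> eqList a a ≡ true
eqList-refl [] = refl
eqList-refl (x ∷ a) = ∧-true (≡ᵇ-refl x) (eqList-refl a)

Unique-map∈ : ∀ {A B : Set} (f : A -> B) L -> (∀ {x y} -> x ∈ L -> y ∈ L -> f x ≡ f y -> x ≡ y) -> Unique L -> Unique (map f L)
Unique-map∈ f [] h _ = AllPairs.[]
Unique-map∈ f (x ∷ L) h (n AllPairs.∷ u) = All.tabulate (\ i -> ne (MP.∈-map⁻ f i)) AllPairs.∷ Unique-map∈ f L (\ i j -> h (there i) (there j)) u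
 where ne : ∀ {y} -> ∃[ z ] (z ∈ L × y ≡ f z) -> f x ≢ y
       ne (z , j , refl) e = All.lookup n j (h (here refl) (there j) e)

All-nthN⁺ : ∀ ν {b} -> (∀ i -> nthN ν i ≤ b) -> All (_≤ b) ν
All-nthN⁺ [] h = []
All-nthN⁺ (x ∷ ν) h = h 0 ∷ All-nthN⁺ ν (h ∘ suc)

Par⇒Normal : ∀ {k ℓ μ} -> Par k ℓ μ -> Normal k (dropZeros μ)
Par⇒Normal {k} {ℓ} {μ} par with dropZeros-spec μ (Par-Decr μ (Par.mono par))
... | e , d , p , _ = d , p , All-nthN⁺ (dropZeros μ) (\ i -> eq≤ (sym (nthN-pad (dropZeros μ) _ i) & cong (\ l -> nthN l i) (sym e)) &≤ Par.bound par i)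

pad : ∀ {k ℓ μ} -> Par k ℓ μ -> μ ≡ dropZeros μ ++ replicate (length μ ∸ length (dropZeros μ)) 0
pad {μ = μ} par = proj₁ (dropZeros-spec μ (Par-Decr μ (Par.mono par)))

nth-core : ∀ {k ℓ μ} -> Par k ℓ μ -> ∀ i -> nthN (coreL k (dropZeros μ)) i ≡ nthN (coreL k μ) i
nth-core {k} {μ = μ} par i = sym (nthN-pad (coreL k (dropZeros μ)) _ i) & cong (\ l -> nthN l i) (sym (coreL-pad k (dropZeros μ) _) & cong (coreL k) (sym (pad par)))

coreL-pos : ∀ k ν -> All (1 ≤_) ν -> All (1 ≤_) (coreL k ν)
coreL-pos k [] _ = []
coreL-pos k (x ∷ ν) (p ∷ ps) = ≤-trans p (m≤m+n x _) ∷ coreL-pos k ν ps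

coreL≤sum : ∀ k ν i -> nthN (coreL k ν) i ≤ sum ν
coreL≤sum k [] i = z≤n
coreL≤sum k (x ∷ ν) zero = +-monoʳ-≤ x (coreL≤sum k ν (k ∸ x))
coreL≤sum k (x ∷ ν) (suc i) = coreL≤sum k ν i &≤ m≤n+m (sum ν) x

-- `coreL k ν` is the only core over ν, and it fits into the box that is searched.
cores-sum : ∀ k ν (g : List ℕ -> ℤ) -> Normal k ν -> ∑ (coresFor k ν) g ≡ g (coreL k ν)
cores-sum k ν g nm@(_ , pos , _) = ∑-filterᵇ p L g & ∑-select p L (κ ∷ []) g (Unique-partsBox N N) ([] AllPairs.∷ AllPairs.[]) to from & +0ʳ _
 where
 N = sum ν
 L = partsBox N N
 κ = coreL k ν
 p = \ κ -> isCore k κ ∧ eqList (pmap k κ) (dropZeros ν)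
 to : ∀ {x} -> x ∈ L -> p x ≡ true -> x ∈ κ ∷ []
 to {x} i e with ∈-partsBox⁻ N N i
 ... | d , ps , _ = here (HooksCore.pmap-core k x d ps (∧-trueˡ e) & cong (coreL k) (eqList-true _ _ (∧-trueʳ {isCore k x} e) & dropZeros-id ν pos))
 len : ∀ ν -> All (1 ≤_) ν -> length ν ≤ sum ν
 len [] _ = z≤n
 len (x ∷ ν) (p ∷ ps) = +-mono-≤ p (len ν ps)
 from : ∀ {x} -> x ∈ κ ∷ [] -> x ∈ L × p x ≡ true
 from (here refl) = ∈-partsBox⁺ N N (All-nthN⁺ κ (coreL≤sum k ν) , CoreHooks.κ-Decr k ν nm) (coreL-pos k ν pos) (eq≤ (length-coreL k ν) &≤ len ν pos) ,
  ∧-true (CoreHooks.core-isCore k ν nm) (cong₂ eqList (CoreHooks.core-pmap k ν nm) (dropZeros-id ν pos) & eqList-refl ν)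

Par-pad : ∀ {k ℓ ν} -> Normal k ν -> length ν ≤ ℓ -> Par k ℓ (ν ++ replicate (ℓ ∸ length ν) 0)
Par-pad {k} {ℓ} {ν} nm le = record { len = trans (LP.length-++ ν) (cong (\ y -> length ν + y) (LP.length-replicate _) & m+[n∸m]≡n le)
 ; mono = \ i -> subst₂ _≤_ (sym (nthN-pad ν _ (suc i))) (sym (nthN-pad ν _ i)) (Par.mono (Par-Normal nm) i) ; bound = \ i -> subst (_≤ k) (sym (nthN-pad ν _ i)) (Par.bound (Par-Normal nm) i) }

-- The strong covers below one core

raw : ℕ -> ℕ -> (List ℕ -> Seq) -> List ℕ -> Seq
raw k p f ν n = ∑ (coresFor k ν) (\ κ -> ∑ (subParts κ) (\ τ -> if coverOK k p τ κ then sh (spin p τ κ) (f (pmap k τ)) n else 0z))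

module Covers (k ℓ : ℕ) (μ : List ℕ) (par : Par k ℓ μ) (r : ℕ) (r≤d : ∀ i -> r ≤ dn k μ i) (y : ℕ) (y<r : y < r) (My : nthN μ r < nthN μ y) where
 open Core k ℓ μ par
 open StrongCover k ℓ μ par r r≤d

 ν κ : List ℕ
 ν = dropZeros μ
 κ = coreL k ν

 nmν : Normal k ν
 nmν = Par⇒Normal par

 Kκ : ∀ i -> nthN κ i ≡ K i
 Kκ = nth-core par

 <ℓ : ∀ z -> 0 < M z -> z < ℓ
 <ℓ z p with z <? ℓ
 ... | yes q = q
 ... | no ¬q = ⊥-elim (<⇒≱ p (eq≤ (M-beyond z (≮⇒≥ ¬q))))

 <κ : ∀ i -> 0 < K i -> i < length κ
 <κ i p with i <? length κ
 ... | yes q = q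
 ... | no ¬q = ⊥-elim (<⇒≱ p (eq≤ (sym (Kκ i) & nthN-beyond κ i (≮⇒≥ ¬q))))

 -- `Up` with the number of steps recorded, which turns out to be the spin of the marked cover.
 data UpJ (z : ℕ) : ℕ -> ℕ -> Set where
  base : UpJ z 0 z
  step : ∀ {j i} -> UpJ z j (d i) -> UpJ z (suc j) i

 UpJ⇒Up : ∀ {z j i} -> UpJ z j i -> Up z i
 UpJ⇒Up base = base
 UpJ⇒Up (step u) = step (UpJ⇒Up u)

 UpJ-unique : ∀ {z j j' i} -> UpJ z j i -> UpJ z j' i -> j ≡ j'
 UpJ-unique base base = refl
 UpJ-unique base (step v) = ⊥-elim (<⇒≱ (i<dn k μ _) (Up≤ (UpJ⇒Up v)))
 UpJ-unique (step u) base = ⊥-elim (<⇒≱ (i<dn k μ _) (Up≤ (UpJ⇒Up u)))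
 UpJ-unique (step u) (step v) = cong suc (UpJ-unique u v)

 next : ℕ × ℕ -> ℕ × ℕ
 next (j , z) = suc j , z

 path : ℕ -> ℕ -> List (ℕ × ℕ)
 path zero x = []
 path (suc F) x = (0 , x) ∷ (if d x <ᵇ length μ then map next (path F (d x)) else [])

 ∈-path⁻ : ∀ F x {j z} -> (j , z) ∈ path F x -> UpJ z j x
 ∈-path⁻ (suc F) x (here refl) = base
 ∈-path⁻ (suc F) x (there i) with d x <ᵇ length μ
 ... | true with MP.∈-map⁻ next i
 ... | (j , z) , i' , refl = step (∈-path⁻ F (d x) i')

 fuel : ∀ {x F} -> ℓ ≤ x + suc F -> ℓ ≤ d x + F
 fuel {x} {F} b = b &≤ eq≤ (+-suc x F) &≤ +-monoˡ-≤ F (i<dn k μ x)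

 ∈-path⁺ : ∀ F x {z} -> ℓ ≤ x + F -> z < ℓ -> Up z x -> ∃[ j ] (j , z) ∈ path F x
 ∈-path⁺ zero x b p u = ⊥-elim (<⇒≱ p ((b &≤ eq≤ (+-identityʳ x)) &≤ Up≤ u))
 ∈-path⁺ (suc F) x b p base = 0 , here refl
 ∈-path⁺ (suc F) x b p (step u) with ∈-path⁺ F (d x) (fuel b) p u
 ... | j , i rewrite <ᵇ-true⁺ {d x} {length μ} (≤-<-trans (Up≤ u) (subst (_ <_) (sym len) p)) = suc j , there (MP.∈-map⁺ next i)

 Unique-path : ∀ F x -> Unique (path F x)
 Unique-path zero x = AllPairs.[]
 Unique-path (suc F) x with d x <ᵇ length μ
 ... | false = [] AllPairs.∷ AllPairs.[]
 ... | true = All.tabulate (\ i -> ne (MP.∈-map⁻ next i)) AllPairs.∷ UP.map⁺ (\ { refl -> refl }) (Unique-path F (d x))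
  where ne : ∀ {q} -> ∃[ z ] (z ∈ path F (d x) × q ≡ next z) -> (0 , x) ≢ q
        ne (_ , _ , refl) ()

 PS-path : ∀ (f : List ℕ -> Seq) F x n -> x < ℓ -> ℓ ≤ x + F -> PS k f μ x n ≡ ∑ (path F x) (\ jz -> sh (proj₁ jz) (Rm f μ (proj₂ jz)) n)
 PS-path f zero x n p b = ⊥-elim (<⇒≱ p (b &≤ eq≤ (+-identityʳ x)))
 PS-path f (suc F) x zero p b = sym (cong (\ z -> Rm f μ x 0 Z.+ z) (tail0 (d x <ᵇ length μ)) & +0ʳ _)
  where tail0 : ∀ c -> ∑ (if c then map next (path F (d x)) else []) (\ jz -> sh (proj₁ jz) (Rm f μ (proj₂ jz)) 0) ≡ 0z
        tail0 false = refl
        tail0 true = ∑-map next (path F (d x)) _ & ∑-0 (path F (d x))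
 PS-path f (suc F) x (suc n) p b = cong (\ z -> Rm f μ x (suc n) Z.+ z) tail1
  where
  tail1 : (if d x <ᵇ length μ then PS k f μ (d x) n else 0z) ≡ ∑ (if d x <ᵇ length μ then map next (path F (d x)) else []) (\ jz -> sh (proj₁ jz) (Rm f μ (proj₂ jz)) (suc n))
  tail1 with d x <ᵇ length μ in e
  ... | false = refl
  ... | true = PS-path f F (d x) n (subst (d x <_) len (<ᵇ-true⁻ e)) (fuel b) & sym (∑-map next (path F (d x)) _)

 module At (j z : ℕ) (lt : M (suc z) < M z) (uj : UpJ z j y) where
  open Rem z lt
  τ = coreL k (dropZeros μ')
  nmτ = Par⇒Normal par'
  Tτ : ∀ i -> nthN τ i ≡ K' i
  Tτ = nth-core par'
  T<K : ∀ {i} -> Up z i -> nthN τ i < nthN κ i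
  T<K {i} u = subst₂ _<_ (sym (Tτ i)) (sym (Kκ i & Up-lower u)) (eq≤ (+-comm 1 (K' i)) &≤ +-monoʳ-≤ (K' i) z<s)
  changed-Up : ∀ {i} -> nthN τ i < nthN κ i -> Up z i
  changed-Up {i} p with dich i
  ... | inj₁ (u , _) = u
  ... | inj₂ e = ⊥-elim (<-irrefl (Tτ i & sym e & sym (Kκ i)) p)
  open Comps (nthN τ) (nthN κ)
  iso : ∀ i -> nthN τ i < nthN κ i -> nthN κ (suc i) ≤ nthN τ i
  iso i p = subst₂ _≤_ (sym (Kκ (suc i))) (sym (Tτ i)) (isolated (changed-Up p))
  L = length κ
  comps≡ : comps τ κ ≡ changed 0 L
  comps≡ = cong (\ R -> compsGo R nothing) (rows-range τ κ L) & go-nothing iso 0 L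
  <L : ∀ {i} -> Up z i -> i < L
  <L {i} u = <κ i (≤-<-trans z≤n (subst (nthN τ i <_) (Kκ i) (T<K u)))
  rest : ∀ {i} -> Up z i -> suc i + (L ∸ suc i) ≡ L
  rest u = m+[n∸m]≡n (<L u)
  gap : ∀ {i x} -> Up z x -> Up z i -> x < i -> d x ≤ i
  gap {x = x} base u p = ⊥-elim (<⇒≱ p (Up≤ u))
  gap (step v) base p = Up≤ v
  gap {i} {x} (step v) (step u) p = ≮⇒≥ (\ q -> <⇒≱ (d-mono< q) (gap v u (d-mono< p)))
  -- The changed rows below x are exactly the later points of its d-orbit up to z, because no
  -- changed row lies strictly between x and d x.
  depth : ∀ {j x} c -> UpJ z j x -> suc x + c ≡ L -> length (changed (suc x) c) ≡ j
  depth c base e = cong length (changed-none (suc z) c (\ i p _ q -> <⇒≱ p (Up≤ (changed-Up q))))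
  depth {suc j} {x} c (step u) e = cong (length ∘ changed (suc x)) c≡ & cong length (changed-++ (suc x) g (suc c')) & cong (\ l -> length (l ++ changed (suc x + g) (suc c'))) none &
   cong (\ a -> length (changed a (suc c'))) (m+[n∸m]≡n (i<dn k μ x)) & cong length (changed-here (d x) c' (T<K (UpJ⇒Up u))) & cong suc (depth c' u (rest (UpJ⇒Up u)))
   where
   g = d x ∸ suc x
   c' = L ∸ suc (d x)
   c≡ : c ≡ g + suc c'
   c≡ = +-cancelˡ-≡ (suc x) _ _ (e & sym (rest (UpJ⇒Up u)) & sym (+-suc (d x) c') & cong (_+ suc c') (sym (m+[n∸m]≡n (i<dn k μ x))) & +-assoc (suc x) g (suc c'))
   none : changed (suc x) g ≡ []
   none = changed-none (suc x) g (\ i p q w -> <⇒≱ (<-≤-trans q (eq≤ (m+[n∸m]≡n (i<dn k μ x)))) (gap (step (UpJ⇒Up u)) (changed-Up w) p))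
  uy = UpJ⇒Up uj
  cy = L ∸ suc y
  parts : changed 0 L ≡ changed 0 y ++ (suc y , suc y) ∷ changed (suc y) cy
  parts = cong (changed 0) (sym (rest uy) & sym (+-suc y cy)) & changed-++ 0 y (suc cy) & cong (changed 0 y ++_) (changed-here y cy (T<K uy))

  cover : coverOK k (suc y) τ κ ≡ true
  cover = ∧-true (CoreHooks.core-isCore k (dropZeros μ') nmτ) (∧-true (cong (_≡ᵇ sum (pmap k κ)) s≡ & ≡ᵇ-refl (sum (pmap k κ)))
   (any⁺ _ (comps τ κ) {suc y , suc y} (subst ((suc y , suc y) ∈_) (sym (comps≡ & parts)) (MP.∈-++⁺ʳ (changed 0 y) (here refl))) (≡ᵇ-refl y)))
   where
   s≡ : suc (sum (pmap k τ)) ≡ sum (pmap k κ)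
   s≡ = cong (suc ∘ sum) (CoreHooks.core-pmap k (dropZeros μ') nmτ) & cong suc (sum-dropZeros μ') & sum-decAt z μ (z<s &≤ lt) & sym (sum-dropZeros μ) & cong sum (sym (CoreHooks.core-pmap k ν nmν))

  -- Components are single rows, so the height term vanishes and the spin counts the components
  -- below the marked row.
  spin≡ : spin (suc y) τ κ ≡ j
  spin≡ = cong₂ _+_ (cong (\ h -> length (comps τ κ) * h) (h0 _ (foldr-≤1 _ (comps τ κ) (\ a acc p -> one a acc p) diag)) & *-zeroʳ (length (comps τ κ)))
   (cong (countB _) (comps≡ & parts) & countB-split _ (changed 0 y) _ (changed (suc y) cy) (\ i -> <ᵇ-false⁺ (m≤n⇒m≤1+n (proj₂ (proj₂ (∈-changed 0 y i))))) (<ᵇ-false⁺ {y} {y} ≤-refl)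
    (\ i -> <ᵇ-true⁺ (proj₁ (proj₂ (∈-changed (suc y) cy i)))) & depth cy uj (rest uy))
   where
   h0 : ∀ x -> x ≤ 1 -> x ∸ 1 ≡ 0
   h0 zero _ = refl
   h0 (suc zero) _ = refl
   h0 (suc (suc x)) (s≤s ())
   diag : ∀ {x y} -> (x , y) ∈ comps τ κ -> x ≡ y
   diag i = proj₁ (∈-changed 0 L (subst (_ ∈_) comps≡ i))
   one : ∀ a acc -> acc ≤ 1 -> (if a ≡ᵇ suc y then suc a ∸ a else acc) ≤ 1
   one a acc p with a ≡ᵇ suc y
   ... | true = eq≤ (+-∸-assoc 1 {a} ≤-refl & cong suc (n∸n≡0 a))
   ... | false = p

  within : τ ∈ subParts κ
  within = MP.∈-filter⁺ (\ τ -> T? (contained τ κ)) (∈-partsBox⁺ L (nthN κ 0) (All-nthN⁺ τ (\ i -> le i &≤ Core.K-anti k _ ν (Par-Normal nmν) z≤n) , CoreHooks.κ-Decr k (dropZeros μ') nmτ) pos (len-τ))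
   (subst T (sym (all⁺ _ (range 1 (length τ ⊔ L)) (\ i _ -> ≤ᵇ-true⁺ (le (i ∸ 1))))) tt)
   where
   le : ∀ i -> nthN τ i ≤ nthN κ i
   le i = subst₂ _≤_ (sym (Tτ i)) (sym (Kκ i)) (K'≤K i)
   pos = coreL-pos k (dropZeros μ') (proj₁ (proj₂ nmτ))
   len-τ : length τ ≤ L
   len-τ with length τ ≤? L
   ... | yes p = p
   ... | no ¬p = ⊥-elim (<⇒≱ (All-nthN τ L pos (≰⇒> ¬p)) (le L &≤ eq≤ (nthN-beyond κ L ≤-refl)))
    where All-nthN : ∀ t i -> All (1 ≤_) t -> i < length t -> 1 ≤ nthN t i
          All-nthN (x ∷ t) zero (p ∷ _) _ = p
          All-nthN (x ∷ t) (suc i) (_ ∷ ps) (s≤s q) = All-nthN t i ps q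

 rem : ℕ × ℕ -> Bool
 rem (_ , z) = M (suc z) <ᵇ M z

 RZ : List (ℕ × ℕ)
 RZ = filterᵇ rem (path ℓ y)

 τ⟨_⟩ : ℕ × ℕ -> List ℕ
 τ⟨ _ , z ⟩ = coreL k (dropZeros (decAt z μ))

 ∈-RZ : ∀ {j z} -> (j , z) ∈ RZ -> M (suc z) < M z × UpJ z j y
 ∈-RZ i with MP.∈-filter⁻ (\ x -> T? (rem x)) {xs = path ℓ y} i
 ... | i' , t = <ᵇ⇒< _ _ t , ∈-path⁻ ℓ y i'

 -- A cover marked in row y changes row y, so it comes from removing a box of μ in some row of the
 -- path of y; conversely every removable row of the path gives such a cover, and different rows
 -- give different cores.
 covers : ∀ (g : List ℕ -> ℤ) -> ∑ (subParts κ) (\ τ -> if coverOK k (suc y) τ κ then g τ else 0z) ≡ ∑ (map τ⟨_⟩ RZ) g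
 covers g = ∑-select (\ τ -> coverOK k (suc y) τ κ) (subParts κ) (map τ⟨_⟩ RZ) g (UP.filter⁺ (\ τ -> T? (contained τ κ)) (Unique-partsBox (length κ) (nthN κ 0)))
  (Unique-map∈ τ⟨_⟩ RZ inj (UP.filter⁺ (\ x -> T? (rem x)) (Unique-path ℓ y))) to from
  where
  inj : ∀ {a b} -> a ∈ RZ -> b ∈ RZ -> τ⟨ a ⟩ ≡ τ⟨ b ⟩ -> a ≡ b
  inj {j , z} {j' , z'} i i' e with ∈-RZ i | ∈-RZ i'
  ... | lt , u | lt' , u' = same (z ≟ z')
   where
   pz = Par-decAt z par lt
   pz' = Par-decAt z' par lt'
   de : dropZeros (decAt z μ) ≡ dropZeros (decAt z' μ)
   de = sym (CoreHooks.core-pmap k _ (Par⇒Normal pz)) & cong (pmap k) e & CoreHooks.core-pmap k _ (Par⇒Normal pz')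
   dd : decAt z μ ≡ decAt z' μ
   dd = pad pz & cong₂ (\ a l -> a ++ replicate (l ∸ length a) 0) de (length-decAt z μ & sym (length-decAt z' μ)) & sym (pad pz')
   same : Dec (z ≡ z') -> (j , z) ≡ (j' , z')
   same (yes refl) = cong (_, z) (UpJ-unique u u')
   same (no ne) = ⊥-elim (<-irrefl (sym (nthN-decAt-≡ z μ) & cong (\ l -> nthN l z) dd & nthN-decAt-≢ z z' μ ne) (eq≤ (m+[n∸m]≡n (z<s &≤ lt))))
  from : ∀ {x} -> x ∈ map τ⟨_⟩ RZ -> x ∈ subParts κ × coverOK k (suc y) x κ ≡ true
  from i with MP.∈-map⁻ τ⟨_⟩ i
  ... | (j , z) , i' , refl with ∈-RZ i'
  ... | lt , u = At.within j z lt u , At.cover j z lt u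
  to : ∀ {x} -> x ∈ subParts κ -> coverOK k (suc y) x κ ≡ true -> x ∈ map τ⟨_⟩ RZ
  to {x} i c with MP.∈-filter⁻ (\ τ -> T? (contained τ κ)) {xs = partsBox (length κ) (nthN κ 0)} i
  ... | i' , ct with ∈-partsBox⁻ (length κ) (nthN κ 0) i'
  ... | dx , px , lx = subst (_∈ map τ⟨_⟩ RZ) xz (MP.∈-map⁺ τ⟨_⟩ {x = proj₁ jz , z} (MP.∈-filter⁺ (\ x -> T? (rem x)) (proj₂ jz) (<⇒<ᵇ ltz)))
   where
   ic = ∧-trueˡ c
   η = pmap k x
   nmη = HooksCore.pmap-Normal k x dx px ic
   x≡ : x ≡ coreL k η
   x≡ = HooksCore.pmap-core k x dx px ic
   ν≤ℓ : length ν ≤ ℓ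
   ν≤ℓ = proj₂ (proj₂ (proj₂ (dropZeros-spec μ (Par-Decr μ mono)))) &≤ eq≤ len
   η≤ℓ : length η ≤ ℓ
   η≤ℓ = eq≤ (sym (length-coreL k η) & cong length (sym x≡)) &≤ lx &≤ eq≤ (length-coreL k ν) &≤ ν≤ℓ
   η' = η ++ replicate (ℓ ∸ length η) 0
   pη' = Par-pad nmη η≤ℓ
   dη : dropZeros η' ≡ η
   dη = dropZeros-pad η _ (proj₁ (proj₂ nmη))
   Tx : ∀ i -> nthN (coreL k η') i ≡ nthN x i
   Tx i = sym (nth-core pη' i) & cong (\ l -> nthN l i) (cong (coreL k) dη & sym x≡)
   x≤κ : ∀ i -> nthN x i ≤ nthN κ i
   x≤κ i with i <? length x ⊔ length κ
   ... | yes p = ≤ᵇ-true⁻ (all⁻ _ (range 1 (length x ⊔ length κ)) (T⇒true ct) (suc i) (∈-range⁺ _ z<s p))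
    where T⇒true : ∀ {b} -> T b -> b ≡ true
          T⇒true {true} _ = refl
   ... | no ¬p = eq≤ (nthN-beyond x i (m≤m⊔n (length x) (length κ) &≤ ≮⇒≥ ¬p)) &≤ z≤n
   Ty : nthN (coreL k η') y < K y
   Ty with any⁻ _ (comps x κ) (∧-trueʳ {suc (sum (pmap k x)) ≡ᵇ sum (pmap k κ)} (∧-trueʳ {isCore k x} c))
   ... | (a , b) , m , e with Comps.∈-compsGo (nthN x) (nthN κ) _ nothing (rowsOK (length κ)) m
    where rowsOK : ∀ L {i t c} -> (i , t , c) ∈ map (\ i -> (i , nthN x (i ∸ 1) , nthN κ (i ∸ 1))) (range 1 L) -> ∃[ j ] (i ≡ suc j × t ≡ nthN x j × c ≡ nthN κ j)
          rowsOK L m with MP.∈-map⁻ (\ i -> (i , nthN x (i ∸ 1) , nthN κ (i ∸ 1))) m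
          ... | i , m' , refl with MP.∈-map⁻ suc m'
          ... | j , _ , refl = j , refl , refl , refl
   ... | inj₁ (j , refl , lt) with ≡ᵇ-true {suc j} {suc y} e
   ... | refl = subst₂ _<_ (sym (Tx y)) (Kκ y) lt
   s≡ : suc (sum η') ≡ sum μ
   s≡ = cong suc (sum-pad η _) & ≡ᵇ-true {suc (sum η)} (∧-trueˡ (∧-trueʳ {isCore k x} c)) & cong sum (CoreHooks.core-pmap k ν nmν) & sum-dropZeros μ
   res = search η' pη' (\ i -> subst₂ _≤_ (sym (Tx i)) (Kκ i) (x≤κ i)) s≡ r y (m≤n+m r y) y<r My Ty
   z = proj₁ res
   ltz = proj₁ (proj₂ res)
   jz = ∈-path⁺ ℓ y (m≤n+m ℓ y) (<ℓ z (z<s &≤ ltz)) (proj₂ (proj₂ (proj₂ res)) y Ty)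
   xz : coreL k (dropZeros (decAt z μ)) ≡ x
   xz = cong (coreL k ∘ dropZeros) (sym (proj₁ (proj₂ (proj₂ res)))) & cong (coreL k) dη & sym x≡

 raw-PS : ∀ (f : List ℕ -> Seq) n -> raw k (suc y) f ν n ≡ PS k (f ∘ dropZeros) μ y n
 raw-PS f n = cores-sum k ν _ nmν & covers (\ τ -> sh (spin (suc y) τ κ) (f (pmap k τ)) n) & ∑-map τ⟨_⟩ RZ _ & ∑-cong∈ RZ one &
  ∑-filterᵇ rem (path ℓ y) (\ jz -> sh (proj₁ jz) (f (dropZeros (decAt (proj₂ jz) μ))) n) & ∑-cong (path ℓ y) two & sym (PS-path (f ∘ dropZeros) ℓ y n (<ℓ y (z<s &≤ My)) (m≤n+m ℓ y))
  where
  one : ∀ jz -> jz ∈ RZ -> sh (spin (suc y) τ⟨ jz ⟩ κ) (f (pmap k τ⟨ jz ⟩)) n ≡ sh (proj₁ jz) (f (dropZeros (decAt (proj₂ jz) μ))) n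
  one (j , z) i with ∈-RZ i
  ... | lt , u = cong₂ (\ s l -> sh s (f l) n) (At.spin≡ j z lt u) (CoreHooks.core-pmap k _ (Par⇒Normal (Par-decAt z par lt)))
  two : ∀ jz -> (if rem jz then sh (proj₁ jz) (f (dropZeros (decAt (proj₂ jz) μ))) n else 0z) ≡ sh (proj₁ jz) (Rm (f ∘ dropZeros) μ (proj₂ jz)) n
  two (j , z) with M (suc z) <ᵇ M z
  ... | true = refl
  ... | false = sym (sh-0 j n)

-- Trailing zeros

addAt-snoc : ∀ i a (γ : List ℤ) z -> i < length γ -> addAt i a (γ ++ z ∷ []) ≡ addAt i a γ ++ z ∷ []
addAt-snoc zero a (x ∷ γ) z _ = refl
addAt-snoc (suc i) a (x ∷ γ) z (s≤s p) = cong (x ∷_) (addAt-snoc i a γ z p)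

H-snoc : ∀ ℓ Ψ Φ -> (∀ {β} -> β ∈ Ψ -> PosRoot ℓ β) -> ∀ γ -> length γ ≡ ℓ -> ∀ n -> H Ψ Φ (γ ++ 0z ∷ []) n ≡ H Ψ (\ γ -> Φ (γ ++ 0z ∷ [])) γ n
H-snoc ℓ [] Φ P γ e n = refl
H-snoc ℓ (β@(suc i , suc j) ∷ Ψ) Φ P = go
 where
 b : PosRoot ℓ β
 b = P (here refl)
 mv-snoc : ∀ γ -> length γ ≡ ℓ -> mv β 1 (γ ++ 0z ∷ []) ≡ mv β 1 γ ++ 0z ∷ []
 mv-snoc γ e = cong (addAt i (+ 1)) (addAt-snoc j (Z.- 1z) γ 0z (subst (j <_) (sym e) (proj₂ (proj₂ b)))) &
  addAt-snoc i (+ 1) (addAt j (Z.- 1z) γ) 0z (subst (i <_) (sym (length-addAt j (Z.- 1z) γ & e)) (<-trans (≤-pred (proj₁ (proj₂ b))) (proj₂ (proj₂ b))))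
 go : ∀ γ -> length γ ≡ ℓ -> ∀ n -> H (β ∷ Ψ) Φ (γ ++ 0z ∷ []) n ≡ H (β ∷ Ψ) (\ γ -> Φ (γ ++ 0z ∷ [])) γ n
 go γ e zero = H-snoc ℓ Ψ Φ (P ∘ there) γ e zero
 go γ e (suc n) = cong₂ Z._+_ (H-snoc ℓ Ψ Φ (P ∘ there) γ e (suc n)) (cong (\ g -> H (β ∷ Ψ) Φ g n) (mv-snoc γ e) & go (mv β 1 γ) (length-mv β 1 γ & e) n)
H-snoc ℓ ((zero , _) ∷ Ψ) Φ P with P (here refl)
... | () , _
H-snoc ℓ ((suc i , zero) ∷ Ψ) Φ P with P (here refl)
... | _ , () , _

-- Using a root into the last column lowers the last entry from 0 to a negative value, which no
-- further root raises.
H-last : ∀ ℓ E G -> (∀ {i j} -> (i , j) ∈ E -> (1 ≤ i × i ≤ ℓ) × j ≡ suc ℓ) -> LastNeg ℓ G -> ∀ γ -> length γ ≡ suc ℓ -> nthZ γ ℓ ≡ 0z -> ∀ n -> H E G γ n ≡ G γ n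
H-last ℓ [] G P ln γ e z n = refl
H-last ℓ ((i , j) ∷ E) G P ln γ e z zero = H-last ℓ E G (P ∘ there) ln γ e z zero
H-last ℓ ((zero , j) ∷ E) G P ln γ e z (suc n) with P (here refl)
... | (() , _) , _
H-last ℓ ((suc i , j) ∷ E) G P ln γ e z (suc n) with P (here refl)
... | (_ , i≤) , refl = cong₂ Z._+_ (H-last ℓ E G (P ∘ there) ln γ e z (suc n)) (H-LastNeg ℓ ((suc i , suc ℓ) ∷ E) G (\ m -> proj₁ (P m)) ln (mv (suc i , suc ℓ) 1 γ) (length-mv (suc i , suc ℓ) 1 γ & e) neg n) & +0ʳ _
 where neg : nthZ (mv (suc i , suc ℓ) 1 γ) ℓ Z.< 0z
       neg = subst (Z._< 0z) (sym (nthZ-addAt-≢ ℓ i (+ 1) (addAt ℓ (Z.- 1z) γ) (>⇒≢ i≤) & nthZ-addAt-≡ ℓ (Z.- 1z) γ (eq≤ (sym e)) & cong (Z._+ (Z.- 1z)) z)) Z.-<+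

sF-LastNeg : ∀ ψ ℓ -> LastNeg ℓ (sF ψ)
sF-LastNeg ψ ℓ γ e lt n = sF-rowNeg ψ γ ℓ n (eq≤ (sym e)) (subst (\ L -> nthZ γ ℓ Z.+ + L Z.≤ + ℓ) (sym e)
 (ZP.≤-trans (ZP.≤-reflexive (lem (nthZ γ ℓ) (+ ℓ))) (ZP.≤-trans (ZP.+-monoˡ-≤ (+ ℓ) (ZP.i<j⇒suc[i]≤j lt)) (ZP.≤-reflexive (+0ˡ _)))))
 where lem : ∀ x l -> x Z.+ (1z Z.+ l) ≡ (1z Z.+ x) Z.+ l
       lem = solve-∀

-- The ideal of μ0 is that of μ together with roots in the last column; these contribute nothing,
-- and the last row of the determinant then splits off.
Sk-snoc : ∀ k ψ μ n -> Sk k (sF ψ) (μ ++ 0 ∷ []) n ≡ Sk k (sF ψ) μ n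
Sk-snoc k ψ μ n = cong (\ g -> H (kRoots k μ′) Φ g n) (toZ-++ μ (0 ∷ [])) &
 H-↭ Φ perm γ′ n &
 H-++ E (kRoots k μ) Φ γ′ n &
 H-last L E (H (kRoots k μ) Φ) E-last (H-LastNeg L (kRoots k μ) Φ (\ m -> low (kRoots-pos k μ m)) (sF-LastNeg ψ L)) γ′
  (length-snoc (toZ μ) 0z & cong suc lγ) (cong (nthZ γ′) (sym lγ) & nthZ-snoc (toZ μ) 0z) n &
 H-snoc L (kRoots k μ) Φ (kRoots-pos k μ) (toZ μ) lγ n &
 H-cong (kRoots k μ) L (\ γ _ -> sF-snoc0 ψ γ) (toZ μ) lγ n
 where
 Φ = sF ψ
 L = length μ
 μ′ = μ ++ 0 ∷ []
 γ′ = toZ μ ++ 0z ∷ []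
 lγ = LP.length-map (\ x -> + x) μ
 lμ′ = length-snoc μ 0
 low : ∀ {i j} -> PosRoot L (i , j) -> 1 ≤ i × i ≤ L
 low (a , b , c) = a , ≤-trans (<⇒≤ b) c
 E? : ∀ (β : Root) -> Dec (proj₂ β ≡ suc L)
 E? β = proj₂ β ≟ suc L
 E = Data.List.filter E? (kRoots k μ′)
 E-last : ∀ {i j} -> (i , j) ∈ E -> (1 ≤ i × i ≤ L) × j ≡ suc L
 E-last m with MP.∈-filter⁻ E? {xs = kRoots k μ′} m
 ... | m' , refl with kRoots-pos k μ′ m'
 ... | a , b , _ = (a , ≤-pred b) , refl
 same : ∀ i j -> 1 ≤ i -> kRoot k μ′ i j ≡ kRoot k μ i j
 same (suc i) j _ = cong (\ x -> (suc i <ᵇ j) ∧ (((k ∸ x) + suc i) <ᵇ j)) (nthN-pad μ 1 i)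
 perm : kRoots k μ′ ↭ E ++ kRoots k μ
 perm = unique-↭ (Unique-roots (kRoot k μ′) (length μ′)) (UP.++⁺ (UP.filter⁺ E? (Unique-roots (kRoot k μ′) (length μ′))) (Unique-roots (kRoot k μ) L) disj) to from
  where
  disj : ∀ {β} -> β ∈ E × β ∈ kRoots k μ -> ⊥
  disj {i , j} (m , m') with E-last m | kRoots-pos k μ m'
  ... | _ , refl | _ , _ , c = <-irrefl refl c
  to : ∀ {β} -> β ∈ kRoots k μ′ -> β ∈ E ++ kRoots k μ
  to {i , j} m with ∈-roots⁻ (kRoot k μ′) (length μ′) m | j ≟ suc L
  ... | _ | yes e = MP.∈-++⁺ˡ (MP.∈-filter⁺ E? m e)
  ... | a , _ , c , d , t | no ne = MP.∈-++⁺ʳ E (∈-roots⁺ (kRoot k μ) L a (<⇒≤ (<ᵇ-true⁻ (∧-trueˡ t)) &≤ j≤) c j≤ (sym (same i j a) & t))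
   where j≤ : j ≤ L
         j≤ = ≤-pred (≤∧≢⇒< (d &≤ eq≤ lμ′) ne)
  from : ∀ {β} -> β ∈ E ++ kRoots k μ -> β ∈ kRoots k μ′
  from {i , j} m with MP.∈-++⁻ E m
  ... | inj₁ m' = proj₁ (MP.∈-filter⁻ E? {xs = kRoots k μ′} m')
  ... | inj₂ m' with ∈-roots⁻ (kRoot k μ) L m'
  ... | a , b , c , d , t = ∈-roots⁺ (kRoot k μ′) (length μ′) a (wk b) c (wk d) (same i j a & t)
   where wk : ∀ {x} -> x ≤ L -> x ≤ length μ′
         wk p = p &≤ n≤1+n L &≤ eq≤ (sym lμ′)

Sk-pad : ∀ k ψ μ m n -> Sk k (sF ψ) (μ ++ replicate m 0) n ≡ Sk k (sF ψ) μ n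
Sk-pad k ψ μ zero n = cong (\ l -> Sk k (sF ψ) l n) (LP.++-identityʳ μ)
Sk-pad k ψ μ (suc m) n = cong (\ l -> Sk k (sF ψ) l n) (sym (LP.++-assoc μ (0 ∷ []) (replicate m 0))) & Sk-pad k ψ (μ ++ 0 ∷ []) m n & Sk-snoc k ψ μ n

Sk-dropZeros : ∀ {ℓ} k ψ {μ} -> Par k ℓ μ -> ∀ n -> Sk k (sF ψ) (dropZeros μ) n ≡ Sk k (sF ψ) μ n
Sk-dropZeros k ψ {μ} par n = sym (Sk-pad k ψ (dropZeros μ) _ n) & cong (\ l -> Sk k (sF ψ) l n) (sym (pad par))

-- Evaluating the column sums

module Eval (r J : ℕ) where
 open Columns r

 SF : (List ℕ -> ℤ) -> ℕ -> List ℤ -> List ℕ -> ℤ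
 SF ev m = Peel.SF r J ev 0 (replicate m [])

 SF-cong : ∀ m l p {ev ev' : List ℕ -> ℤ} -> (∀ v -> Pre m v -> ev (v ++ p) ≡ ev' (v ++ p)) -> SF ev m l p ≡ SF ev' m l p
 SF-cong zero l p h = h [] ([] , \ _ -> z≤n)
 SF-cong (suc m) [] p h = refl
 SF-cong (suc m) (x ∷ l) p {ev} {ev'} h = ∑-cong∈ (Dz 0 x) (\ C i -> SF-cong m l (C ++ p) (\ v pv ->
  cong ev (as v C) & h (v ++ C ++ []) (Pre-add 0 x m v [] z≤n i ([] , \ _ -> z≤n) pv) & sym (cong ev' (as v C))))
  where as : ∀ v C -> v ++ C ++ p ≡ (v ++ C ++ []) ++ p
        as v C = cong (\ D -> v ++ D ++ p) (sym (LP.++-identityʳ C)) & sym (LP.++-assoc v (C ++ []) p)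

 SF-shift : ∀ ev m l p q -> SF ev m l (p ++ q) ≡ SF (\ v -> ev (v ++ q)) m l p
 SF-shift ev zero l p q = refl
 SF-shift ev (suc m) [] p q = refl
 SF-shift ev (suc m) (x ∷ l) p q = ∑-cong (Dz 0 x) (\ C -> cong (SF ev m l) (sym (LP.++-assoc C p q)) & SF-shift ev m l (C ++ p) q)

 SF-∑ : ∀ {A : Set} (xs : List A) (ev : A -> List ℕ -> ℤ) m l p -> ∑ xs (\ x -> SF (ev x) m l p) ≡ SF (\ v -> ∑ xs (\ x -> ev x v)) m l p
 SF-∑ xs ev zero l p = refl
 SF-∑ xs ev (suc m) [] p = ∑-0 xs
 SF-∑ xs ev (suc m) (x ∷ l) p = ∑-swap xs (Dz 0 x) (\ a C -> SF (ev a) m l (C ++ p)) & ∑-cong (Dz 0 x) (\ C -> SF-∑ xs ev m l (C ++ p))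

 SF-step : ∀ ev m x l -> SF ev (suc m) (x ∷ l) [] ≡ SF (\ v -> ∑ (Dz 0 x) (\ C -> ev (v ++ C))) m l []
 SF-step ev m x l = ∑-cong (Dz 0 x) (\ C -> cong (SF ev m l) (LP.++-identityʳ C) & SF-shift ev m l [] C) & SF-∑ (Dz 0 x) (\ C v -> ev (v ++ C)) m l []

 SF-cong[] : ∀ m l {ev ev' : List ℕ -> ℤ} -> (∀ v -> Pre m v -> ev v ≡ ev' v) -> SF ev m l [] ≡ SF ev' m l []
 SF-cong[] m l {ev} {ev'} h = SF-cong m l [] (\ v pv -> cong ev (LP.++-identityʳ v) & h v pv & cong ev' (sym (LP.++-identityʳ v)))

 EEz : ℤ -> GF -> GF
 EEz (+ h) Φ = EE (seg 0 r) h Φ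
 EEz -[1+ _ ] Φ = \ _ _ -> 0z

 -- The product of the elementary sums of degrees l in the lowerings: what `SF` with empty peeled
 -- words becomes on weights.
 EEs : ℕ -> List ℤ -> GF -> GF
 EEs zero l Φ = Φ
 EEs (suc m) [] Φ = \ _ _ -> 0z
 EEs (suc m) (x ∷ l) Φ = EEs m l (EEz x Φ)

 EEs-Anti : ∀ ℓ -> r ≤ ℓ -> ∀ m l Φ -> (∀ i -> suc i < r -> Anti ℓ Φ i) -> ∀ i -> suc i < r -> Anti ℓ (EEs m l Φ) i
 EEs-Anti ℓ le zero l Φ an = an
 EEs-Anti ℓ le (suc m) [] Φ an i p γ q n = refl
 EEs-Anti ℓ le (suc m) (+ h ∷ l) Φ an = EEs-Anti ℓ le m l _ (\ i p -> Anti-EE ℓ 0 r h Φ i (<-≤-trans p le) z≤n p (\ j _ q -> an j q))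
 EEs-Anti ℓ le (suc m) (-[1+ h ] ∷ l) Φ an = EEs-Anti ℓ le m l _ (\ i p γ q n -> refl)

 SF-H : ∀ Ψ m l Φ γ n -> SF (\ v -> H Ψ (Xw v Φ) γ n) m l [] ≡ H Ψ (EEs m l Φ) γ n
 SF-H Ψ zero l Φ γ n = refl
 SF-H Ψ (suc m) [] Φ γ n = sym (H-0 Ψ γ n)
 SF-H Ψ (suc m) (x ∷ l) Φ γ n = SF-step (\ v -> H Ψ (Xw v Φ) γ n) m x l & SF-cong[] m l (\ v _ -> one x v) & SF-H Ψ m l (EEz x Φ) γ n
  where
  one : ∀ x v -> ∑ (Dz 0 x) (\ C -> H Ψ (Xw (v ++ C) Φ) γ n) ≡ H Ψ (Xw v (EEz x Φ)) γ n
  one (+ h) v = sym (H-∑ Ψ (Dec↓ (seg 0 r) h) (\ C -> Xw (v ++ C) Φ) γ n) & H-cong Ψ (length γ) (\ γ' _ n' -> ∑-cong (Dec↓ (seg 0 r) h) (\ C ->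
   Xw-sub (v ++ C) Φ γ' n' & cong (\ g -> Φ g n') (sub-++ v C γ') & sym (Xw-sub C Φ (sub v γ') n')) & ∑-Dec↓ (seg 0 r) h Φ (sub v γ') n' & sym (Xw-sub v (EE (seg 0 r) h Φ) γ' n')) γ refl n
  one -[1+ h ] v = sym (H-0 Ψ γ n) & H-cong Ψ (length γ) (\ γ' _ n' -> sym (Xw-sub v (\ _ _ -> 0z) γ' n')) γ refl n

 module _ (k ℓ' W b : ℕ) (Wr : W + r ≡ suc k) (r≤ℓ : r ≤ suc ℓ') (b<k : b < k) where
  open V k r ℓ' W b Wr r≤ℓ b<k

  Full-EEz : ∀ x Φ -> Full 0 Φ -> Full 0 (EEz x Φ)
  Full-EEz (+ h) Φ fu = Full-EE 0 r h Φ refl fu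
  Full-EEz -[1+ _ ] Φ fu = record { anti≥ = \ _ _ _ _ _ _ -> refl ; anti< = \ _ _ _ _ _ _ -> refl ; lneg = \ _ _ _ _ -> refl }

  -- The rightmost column is applied last, so it is turned into an elementary lowering first; the
  -- result is again antisymmetric in the rows that matter, and the next column follows. Each letter
  -- is used at most once per column, so J columns stay within the budget.
  SF-Uw : ∀ {μ} m l Φ i -> m ≤ J -> St (\ _ -> J) μ -> Full 0 Φ -> SF (\ v -> Uw k v (Sk k Φ) μ i) m l [] ≡ Sk k (EEs m l Φ) μ i
  SF-Uw {μ} zero l Φ i le s fu = refl
  SF-Uw {μ} (suc m) [] Φ i le s fu = sym (H-0 (kRoots k μ) (toZ μ) i)
  SF-Uw {μ} (suc m) (x ∷ l) Φ i le s fu = SF-step (\ v -> Uw k v (Sk k Φ) μ i) m x l & SF-cong[] m l (\ v pv -> one x v pv) & SF-Uw m l (EEz x Φ) i (n≤1+n m &≤ le) s (Full-EEz x Φ fu)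
   where
   one : ∀ x v -> Pre m v -> ∑ (Dz 0 x) (\ C -> Uw k (v ++ C) (Sk k Φ) μ i) ≡ Uw k v (Sk k (EEz x Φ)) μ i
   one x v (va , vc) = ∑-cong (Dz 0 x) (\ C -> Uw-++ k v C (Sk k Φ) μ i) & sym (Uw-∑ k v (Dz 0 x) (\ C -> Uw k C (Sk k Φ)) μ i) &
    Uw-congr v _ (Sk k (EEz x Φ)) s (va , \ z -> vc z &≤ n≤1+n m &≤ le) (step x) i
    where
    step : ∀ x ν -> St ((\ _ -> J) ⊖ v) ν -> ∀ n -> ∑ (Dz 0 x) (\ C -> Uw k C (Sk k Φ) ν n) ≡ Sk k (EEz x Φ) ν n
    step (+ h) ν sν n = ∑U-Sk 0 r h Φ refl sν (\ y _ _ -> m<n⇒0<n∸m (s≤s (vc y) &≤ le)) fu n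
    step -[1+ h ] ν sν n = sym (H-0 (kRoots k ν) (toZ ν) n)

-- Evaluating words in the operators u_p

rawW : ℕ -> List ℕ -> (List ℕ -> Seq) -> List ℕ -> Seq
rawW k [] f = f
rawW k (p ∷ w) f ν n = raw k p (rawW k w f) ν n

sumK : KComb -> (List ℕ -> Seq) -> Seq
sumK X f n = ∑ X (\ x -> act (proj₁ x) (f (proj₂ x)) n)

evalS-evalK : ∀ k X ψ n -> evalS (evalK k X) ψ n ≡ sumK X (\ ν -> evalS (kSchur k ν) ψ) n
evalS-evalK k [] ψ n = refl
evalS-evalK k ((q , ν) ∷ X) ψ n = evalS-++ (scaleS q (kSchur k ν)) (evalK k X) ψ n & cong₂ Z._+_ (evalS-scaleS q (kSchur k ν) ψ n) (evalS-evalK k X ψ n)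

sumK-uAct : ∀ k p X f n -> sumK (uAct k p X) f n ≡ sumK X (raw k p f) n
sumK-uAct k p [] f n = refl
sumK-uAct k p ((q , ν) ∷ X) f n = ∑-++ (concatMap outer (coresFor k ν)) (uAct k p X) F & cong₂ Z._+_ one (sumK-uAct k p X f n)
 where
 F : Poly × List ℕ -> ℤ
 F x = act (proj₁ x) (f (proj₂ x)) n
 inner : List ℕ -> List ℕ -> KComb
 inner κ τ = if coverOK k p τ κ then (mulP q (tpow (spin p τ κ)) , pmap k τ) ∷ [] else []
 outer : List ℕ -> KComb
 outer κ = concatMap (inner κ) (subParts κ)
 cell : ∀ κ τ -> ∑ (inner κ τ) F ≡ act q (\ m -> if coverOK k p τ κ then sh (spin p τ κ) (f (pmap k τ)) m else 0z) n
 cell κ τ with coverOK k p τ κ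
 ... | true = +0ʳ _ & act-mulP q (tpow (spin p τ κ)) (f (pmap k τ)) n & act-cong q n (\ m -> act-tpow (spin p τ κ) (f (pmap k τ)) m)
 ... | false = sym (act-0 q n)
 one : ∑ (concatMap outer (coresFor k ν)) F ≡ act q (raw k p f ν) n
 one = ∑-concatMap outer (coresFor k ν) F & ∑-cong (coresFor k ν) (\ κ -> ∑-concatMap (inner κ) (subParts κ) F & ∑-cong (subParts κ) (cell κ) & sym (act-∑ q (subParts κ) _ n)) &
  sym (act-∑ q (coresFor k ν) _ n)

sumK-uWord : ∀ k w X f n -> sumK (uWord k w X) f n ≡ sumK X (rawW k w f) n
sumK-uWord k [] X f n = refl
sumK-uWord k (p ∷ w) X f n = sumK-uWord k w (uAct k p X) f n & sumK-uAct k p X (rawW k w f) n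

module RawUw (k r ℓ' W b : ℕ) (Wr : W + r ≡ suc k) (r≤ℓ : r ≤ suc ℓ') (b<k : b < k) where
 open V k r ℓ' W b Wr r≤ℓ b<k

 -- While the budget lasts, row z is longer than row r, which is the condition under which strong
 -- covers marked there match the path of z.
 raw-Uw : ∀ {B μ} v w g -> St B μ -> Leg B v -> ∀ n -> rawW k (map suc v ++ w) g (dropZeros μ) n ≡ Uw k v (\ η -> rawW k w g (dropZeros η)) μ n
 raw-Uw [] w g s l n = refl
 raw-Uw {B} {μ} (z ∷ v) w g s l n with Leg-hd B z v l
 ... | z<r , bz , l' = Covers.raw-PS k ℓ μ (St.par s) r (r≤dn s) z z<r (≤-<-trans (St.low s r ≤-refl) ((eq≤ (+-comm 1 b) &≤ +-monoʳ-≤ b bz) &≤ St.bud s z z<r)) (rawW k (map suc v ++ w) g) n &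
  PS-congr _ _ z s bz (\ η sη -> raw-Uw v w g sη l') n

 module _ {J μ} (s : St (\ _ -> J) μ) (g : List ℕ -> Seq) (i : ℕ) where
  ev : List ℕ -> ℤ
  ev v = rawW k (map suc v) g (dropZeros μ) i

  private
   G : List ℕ -> List ℕ -> Seq
   G w η = rawW k (map suc w) g (dropZeros η)

  ev-++ : ∀ v w -> Leg (\ _ -> J) v -> ev (v ++ w) ≡ Uw k v (G w) μ i
  ev-++ v w l = cong (\ u -> rawW k u g (dropZeros μ) i) (LP.map-++ suc v w) & raw-Uw v (map suc w) g s l i

  G-++ : ∀ {B η} v w -> St B η -> Leg B v -> ∀ n -> G (v ++ w) η n ≡ Uw k v (G w) η n
  G-++ {η = η} v w sη l n = cong (\ u -> rawW k u g (dropZeros η) n) (LP.map-++ suc v w) & raw-Uw v (map suc w) g sη l n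

  commutes : Peel.Commutes r J ev
  commutes = record { far = far ; elm = elm }
   where
   far : ∀ pre p q post -> All (_< r) pre -> (∀ y -> countN y (pre ++ p ∷ q ∷ []) ≤ J) -> suc p < q -> q < r -> ev (pre ++ p ∷ q ∷ post) ≡ ev (pre ++ q ∷ p ∷ post)
   far pre p q post pa c lt q<r = ev-++ pre (p ∷ q ∷ post) lp & Uw-congr pre (G (p ∷ q ∷ post)) (G (q ∷ p ∷ post)) s lp (\ η sη n -> G-++ (p ∷ q ∷ []) post sη pq n &
    far-comm p q sη lt q<r (proj₁ (proj₂ (Leg-hd _ p (q ∷ []) pq))) (proj₁ (proj₂ (Leg-hd _ q (p ∷ []) qp))) (G post) n & sym (G-++ (q ∷ p ∷ []) post sη qp n)) i & sym (ev-++ pre (q ∷ p ∷ post) lp)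
    where
    p<r = <-trans (n<1+n p) (<-trans lt q<r)
    lp : Leg (\ _ -> J) pre
    lp = pa , \ y -> ≤-trans (m≤m+n _ _ &≤ eq≤ (sym (countN-++ y pre (p ∷ q ∷ [])))) (c y)
    pq : Leg ((\ _ -> J) ⊖ pre) (p ∷ q ∷ [])
    pq = p<r ∷ q<r ∷ [] , \ y -> ≤-trans (eq≤ (sym (m+n∸m≡n (countN y pre) _))) (∸-monoˡ-≤ (countN y pre) (eq≤ (sym (countN-++ y pre (p ∷ q ∷ []))) &≤ c y))
    qp : Leg ((\ _ -> J) ⊖ pre) (q ∷ p ∷ [])
    qp = q<r ∷ p<r ∷ [] , \ y -> ≤-trans (eq≤ (countN-++ y (q ∷ []) (p ∷ []) & +-comm (countN y (q ∷ [])) _ & sym (countN-++ y (p ∷ []) (q ∷ [])))) (proj₂ pq y)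
   elm : ∀ n m l pre post -> n ≤ r -> All (_< r) pre -> (∀ y -> countN y pre + 2 ≤ J) ->
    ∑ (Dec↓ (seg n (r ∸ n)) m) (\ C -> ∑ (Dec↓ (seg n (r ∸ n)) l) (\ C' -> ev (pre ++ C ++ C' ++ post)))
    ≡ ∑ (Dec↓ (seg n (r ∸ n)) l) (\ C -> ∑ (Dec↓ (seg n (r ∸ n)) m) (\ C' -> ev (pre ++ C ++ C' ++ post)))
   elm n m l pre post le pa c = value m l & Uw-congr pre _ _ s lp (\ η sη -> e-comm n (r ∸ n) m l (m+[n∸m]≡n le) sη (\ y _ _ -> two y) (G post)) i & sym (value l m)
    where
    D = Dec↓ (seg n (r ∸ n))
    two : ∀ y -> 2 ≤ ((\ _ -> J) ⊖ pre) y
    two y = eq≤ (sym (m+n∸m≡n (countN y pre) 2)) &≤ ∸-monoˡ-≤ (countN y pre) (c y)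
    lp : Leg (\ _ -> J) pre
    lp = pa , \ y -> ≤-trans (m≤m+n _ 2) (c y)
    flat : ∀ m l (f : List ℕ -> ℤ) -> ∑ (D m) (\ C -> ∑ (D l) (\ C' -> f (C ++ C' ++ post))) ≡ ∑ (prod (D m) (D l)) (\ w -> f (w ++ post))
    flat m l f = sym (∑-concatMap (\ w -> map (w ++_) (D l)) (D m) (\ w -> f (w ++ post)) & ∑-cong (D m) (\ C -> ∑-map (C ++_) (D l) (\ w -> f (w ++ post)) & ∑-cong (D l) (\ C' -> cong f (LP.++-assoc C C' post))))
    leg : ∀ m l {w} -> w ∈ prod (D m) (D l) -> Leg ((\ _ -> J) ⊖ pre) w
    leg m l w∈ with ∈-concatMap⁻ (\ w -> map (w ++_) (D l)) (D m) w∈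
    ... | C , i , w∈' with MP.∈-map⁻ (C ++_) w∈'
    ... | C' , i' , refl with Dec↓-spec n (r ∸ n) m i | Dec↓-spec n (r ∸ n) l i'
    ... | a , _ , u | a' , _ , u' = app C (All.map (\ (z : _ × _) -> subst (_ <_) (m+[n∸m]≡n le) (proj₂ z)) a) (All.map (\ (z : _ × _) -> subst (_ <_) (m+[n∸m]≡n le) (proj₂ z)) a') ,
     \ y -> ≤-trans (eq≤ (countN-++ y C C') &≤ +-mono-≤ (u y) (u' y)) (two y)
     where app : ∀ C {C'} -> All (_< r) C -> All (_< r) C' -> All (_< r) (C ++ C')
           app [] [] qs = qs
           app (x ∷ C) (p ∷ ps) qs = p ∷ app C ps qs
    value : ∀ m l -> ∑ (D m) (\ C -> ∑ (D l) (\ C' -> ev (pre ++ C ++ C' ++ post))) ≡ Uw k pre (∑U (prod (D m) (D l)) (G post)) μ i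
    value m l = flat m l (\ w -> ev (pre ++ w)) & ∑-cong (prod (D m) (D l)) (\ w -> ev-++ pre (w ++ post) lp) & sym (Uw-∑ k pre (prod (D m) (D l)) (\ w -> G (w ++ post)) μ i) &
     Uw-congr pre _ _ s lp (\ η sη n -> ∑-cong∈ (prod (D m) (D l)) (\ w w∈ -> G-++ w post sη (leg m l w∈) n)) i

-- The theorem for one coefficient functional

Linked⇒Decr : ∀ {μ} -> Decreasing μ -> Decr μ
Linked⇒Decr [] = tt
Linked⇒Decr [-] = [] , tt
Linked⇒Decr (p ∷ l) with Linked⇒Decr l
... | a , d = (p ∷ All.map (\ q -> q &≤ p) a) , a , d

Decr-++ : ∀ μ ν -> Decr (μ ++ ν) -> Decr μ × Decr ν × All (\ x -> All (_≤ x) ν) μ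
Decr-++ [] ν d = tt , d , []
Decr-++ (x ∷ μ) ν (a , d) with Decr-++ μ ν d
... | dμ , dν , h = (front μ a , dμ) , dν , back μ a ∷ h
 where front : ∀ μ -> All (_≤ x) (μ ++ ν) -> All (_≤ x) μ
       front [] _ = []
       front (y ∷ μ) (p ∷ ps) = p ∷ front μ ps
       back : ∀ μ -> All (_≤ x) (μ ++ ν) -> All (_≤ x) ν
       back [] ps = ps
       back (y ∷ μ) (_ ∷ ps) = back μ ps

All-nth : ∀ {P : ℕ -> Set} μ i -> i < length μ -> All P μ -> P (nthN μ i)
All-nth (x ∷ μ) zero _ (p ∷ _) = p
All-nth (x ∷ μ) (suc i) (s≤s q) (_ ∷ ps) = All-nth μ i q ps

last-min : ∀ μ i -> length μ ≡ suc i -> Decr μ -> All (nthN μ i ≤_) μ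
last-min (x ∷ []) zero e d = ≤-refl ∷ []
last-min (x ∷ y ∷ μ) (suc i) e (a , d) = All-nth (y ∷ μ) i (eq≤ (sym (suc-injective e))) a ∷ last-min (y ∷ μ) i (suc-injective e) d

creading-pos : ∀ r W μ T -> length μ ≡ r -> T ∈ ssyt r W μ -> All (1 ≤_) (creading r W μ T)
creading-pos r W μ T e T∈ = All.tabulate go
 where
 fill : Tab.Fill r W 1 μ T
 fill = Tab.∈-CT r W 1 μ (proj₁ (MP.∈-filter⁻ (\ T -> T? (colStrict r W μ T)) {xs = cartesian (map (\ m -> incr (W ∸ m) 1 r) μ)} T∈))
 row : ∀ {μ T} i -> Tab.Fill r W 1 μ T -> i < length μ -> length (nthL T i) ≡ W ∸ nthN μ i × All (1 ≤_) (nthL T i)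
 row zero (f Tab.∷ _) _ = f
 row (suc i) (_ Tab.∷ fl) (s≤s p) = row i fl p
 go : ∀ {x} -> x ∈ creading r W μ T -> 1 ≤ x
 go x∈ with ∈-concatMap⁻ _ (range 1 W) x∈
 ... | c , c∈ , x∈' with ∈-concatMap⁻ _ (reverse (range 1 r)) x∈'
 ... | i , i∈ , x∈'' with nthN μ (i ∸ 1) <ᵇ c in q
 go x∈ | c , c∈ , _ | i , i∈ , here refl | true = Tab.All-nthN r W (nthL T (i ∸ 1)) (c ∸ m ∸ 1) (proj₂ fr) (subst (c ∸ m ∸ 1 <_) (sym (proj₁ fr))
  (<-≤-trans (eq≤ (m+[n∸m]≡n (m<n⇒0<n∸m (<ᵇ-true⁻ {m} q)))) (∸-monoˡ-≤ m (proj₂ (∈-range⁻ W c∈)))))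
  where
  m = nthN μ (i ∸ 1)
  i-bounds = ∈-range⁻ r (AnyP.reverse⁻ i∈)
  fr = row (i ∸ 1) fill (<-≤-trans (eq≤ (m+[n∸m]≡n (proj₁ i-bounds))) (proj₂ i-bounds &≤ eq≤ (sym e)))

dotAt-mid : ∀ (P : List ℤ) x y Q -> dotAt (length P) (P ++ x ∷ y ∷ Q) ≡ P ++ (y Z.- 1z) ∷ (x Z.+ 1z) ∷ Q
dotAt-mid [] x y Q = refl
dotAt-mid (z ∷ P) x y Q = cong (z ∷_) (dotAt-mid P x y Q)

H-Xw : ∀ Ψ v Φ γ n -> H Ψ (Xw v Φ) γ n ≡ H Ψ Φ (sub v γ) n
H-Xw Ψ v Φ γ n = H-cong Ψ (length γ) (\ γ' _ -> Xw-sub v Φ γ') γ refl n & H-natural (sub v) id Ψ Φ (\ β _ γ -> sub-addAt v _ (+ 1) _ & cong (addAt _ (+ 1)) (sub-addAt v _ (Z.- 1z) γ)) γ n &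
 cong (\ R -> H R Φ (sub v γ) n) (LP.map-id Ψ)

module Coefficient (k r' W J m₀ : ℕ) (ν : List ℕ) (Wr : W + suc r' ≡ suc k) (mJ : m₀ + J ≡ W) (pν : All (1 ≤_) ν) (dν : Decr ν) (ν≤m : All (_≤ m₀) ν)
 (ψ : Fun) (n : ℕ) (sψ : Symm ψ) where
 r = suc r'
 ℓ' = r' + length ν
 Φ = sF ψ

 W≤k : W ≤ k
 W≤k = ≤-pred ((eq≤ (+-comm 1 W) &≤ +-monoʳ-≤ W z<s) &≤ eq≤ Wr)

 an : ∀ ℓ i -> suc i < ℓ -> Anti ℓ Φ i
 an ℓ i p γ q n = sF-dotAt ψ sψ i γ n (subst (suc i <_) (sym q) p)

 open Demazure k r W ν Wr W≤k using (μ₀; ℓ; len₀; nth-lo; nth-hi; demazure; full-Anti)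
 open Eval r J using (SF-cong[]; SF-H; SF-Uw; EEs; EEs-Anti)

 γ₀ : List ℤ
 γ₀ = toZ μ₀

 full : List Root
 full = roots (fullRoot k r ν) ℓ

 g : List ℕ -> Seq
 g η = evalS (kSchur k η) ψ

 ev : List ℕ -> ℤ
 ev v = rawW k (map suc v) g μ₀ n

 -- Weights of the first r rows are measured from m₀, so that the rectangle U becomes J columns
 -- wide.
 up : List ℤ -> List ℤ
 up x = map (\ z -> z Z.+ + m₀) x ++ toZ ν

 A : List ℤ -> ℤ
 A x = H full Φ (up x) n

 anti : AntiR r A
 anti P x y Q e = sym (cong Z.-_ (cong (\ γ -> H full Φ γ n) eq & full-Anti Φ (length P) i<r (an ℓ (length P) (<-≤-trans i<r (m≤m+n r _))) (up (P ++ x ∷ y ∷ Q)) lup n) & ZP.neg-involutive _)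
  where
  f = \ z -> z Z.+ + m₀
  lP = LP.length-map f P
  i<r : suc (length P) < r
  i<r = (eq≤ (+-comm 2 (length P)) &≤ +-monoʳ-≤ (length P) (s≤s z<s)) &≤ eq≤ (sym (LP.length-++ P) & e)
  lup : length (up (P ++ x ∷ y ∷ Q)) ≡ ℓ
  lup = LP.length-++ (map f (P ++ x ∷ y ∷ Q)) & cong₂ _+_ (LP.length-map f (P ++ x ∷ y ∷ Q) & e) (LP.length-map _ ν)
  split : ∀ a b -> up (P ++ a ∷ b ∷ Q) ≡ map f P ++ f a ∷ f b ∷ map f Q ++ toZ ν
  split a b = cong (_++ toZ ν) (LP.map-++ f P (a ∷ b ∷ Q)) & LP.++-assoc (map f P) _ _
  eq : up (P ++ (y Z.- 1z) ∷ (x Z.+ 1z) ∷ Q) ≡ dotAt (length P) (up (P ++ x ∷ y ∷ Q))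
  eq = split (y Z.- 1z) (x Z.+ 1z) & cong₂ (\ a b -> map f P ++ a ∷ b ∷ map f Q ++ toZ ν) (l y (Z.- 1z) (+ m₀)) (l x 1z (+ m₀)) & sym (dotAt-mid (map f P) (f x) (f y) _) &
   cong₂ dotAt lP (sym (split x y))
   where l : ∀ y a m -> (y Z.+ a) Z.+ m ≡ (y Z.+ m) Z.+ a
         l = solve-∀

 module Wt = Weight r J A anti

 γ₀-up : γ₀ ≡ up Wt.U
 γ₀-up = toZ-++ (replicate r W) ν & cong (_++ toZ ν) (go r)
  where go : ∀ r -> toZ (replicate r W) ≡ map (\ z -> z Z.+ + m₀) (toZ (replicate r J))
        go zero = refl
        go (suc r) = cong₂ _∷_ (cong +_ (sym mJ & +-comm m₀ J)) (go r)

 sub-up : ∀ v x -> All (_< length x) v -> sub v (up x) ≡ up (sub v x)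
 sub-up [] x _ = refl
 sub-up (z ∷ v) x (p ∷ ps) = cong (sub v) (mvU z x p) & sub-up v (addAt z (Z.- 1z) x) (All.map (\ q -> <-≤-trans q (eq≤ (sym (length-addAt z (Z.- 1z) x)))) ps)
  where mvU : ∀ z x -> z < length x -> addAt z (Z.- 1z) (up x) ≡ up (addAt z (Z.- 1z) x)
        mvU zero (y ∷ x) _ = cong (_∷ up x) (l y (+ m₀))
         where l : ∀ y m -> (y Z.+ m) Z.+ (Z.- 1z) ≡ (y Z.+ (Z.- 1z)) Z.+ m
               l = solve-∀
        mvU (suc z) (y ∷ x) (s≤s p) = cong (_ ∷_) (mvU z x p)

 -- Each letter gets budget J above the floor b = m₀. A positive J is what makes m₀ < W ≤ k.
 ev≡Uw : ∀ j -> J ≡ suc j -> ∃[ b ] ∃[ b<k ] Σ (V.St k r ℓ' W b Wr (s≤s (m≤m+n r' _)) b<k (\ _ -> J) μ₀) (\ s -> dropZeros μ₀ ≡ μ₀)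
 ev≡Uw j refl = m₀ , m<k , record { par = subst (\ L -> Par k L μ₀) len₀ (Par-Normal nm) ; hd = ≤-refl ; low = low ; bud = \ z p -> eq≤ (mJ & sym (nth-lo z p)) } , dropZeros-id μ₀ (proj₁ (proj₂ nm))
  where
  m<W : m₀ < W
  m<W = (s≤s (m≤m+n m₀ j) &≤ eq≤ (sym (+-suc m₀ j))) &≤ eq≤ mJ
  m<k = <-≤-trans m<W W≤k
  allr : ∀ (P : ℕ -> Set) -> P W -> All P ν -> ∀ r -> All P (replicate r W ++ ν)
  allr P p ps zero = ps
  allr P p ps (suc r) = p ∷ allr P p ps r
  decr₀ : ∀ r -> Decr (replicate r W ++ ν)
  decr₀ zero = dν
  decr₀ (suc r) = allr (_≤ W) ≤-refl (All.map (\ p -> p &≤ <⇒≤ m<W) ν≤m) r , decr₀ r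
  nm : Normal k μ₀
  nm = decr₀ r , allr (1 ≤_) (z<s &≤ m<W) pν r , allr (_≤ k) W≤k (All.map (\ p -> p &≤ <⇒≤ m<k) ν≤m) r
  low : ∀ i -> r ≤ i -> nthN μ₀ i ≤ m₀
  low i p = eq≤ (cong (nthN μ₀) (sym (m+[n∸m]≡n p)) & nth-hi (i ∸ r)) &≤ nthN≤ ν (i ∸ r) ν≤m

 commutes : Peel.Commutes r J ev
 commutes = go J refl
  where
  go : ∀ j -> J ≡ j -> Peel.Commutes r J ev
  go zero refl = record
   -- For J = 0 no letter may occur at all, so both relations are vacuous.
   { far = \ pre p q post _ c _ _ -> ⊥-elim (n≮0 ((one p q &≤ m≤n+m _ (countN p pre) &≤ eq≤ (sym (countN-++ p pre (p ∷ q ∷ [])))) &≤ c p))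
   ; elm = \ n m l pre post _ _ c -> ⊥-elim (n≮0 ((z<s &≤ m≤n+m 2 (countN 0 pre)) &≤ c 0)) }
   where one : ∀ p q -> 1 ≤ countN p (p ∷ q ∷ [])
         one p q rewrite ≡ᵇ-refl p = z<s
  go (suc j) e with ev≡Uw j e
  ... | b , b<k , s , d = subst (\ μ -> Peel.Commutes r J (\ v -> rawW k (map suc v) g μ n)) d (RawUw.commutes k r ℓ' W b Wr _ b<k s g n)

 column-sum : ∀ l -> Peel.SF r J ev 0 (replicate J []) l [] ≡ Sk k (EEs J l Φ) μ₀ n
 column-sum l = go J refl
  where
  go : ∀ j -> J ≡ j -> Peel.SF r J ev 0 (replicate J []) l [] ≡ Sk k (EEs J l Φ) μ₀ n
  go zero refl = evalS-kSchur k μ₀ ψ n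
  go (suc j) e with ev≡Uw j e
  ... | b , b<k , s , d = SF-cong[] J l one & SF-Uw k ℓ' W b Wr _ b<k J l Φ n ≤-refl s (record { anti≥ = \ i _ p -> an ℓ i p ; anti< = \ i _ p -> an ℓ i (<-≤-trans p (m≤m+n r _)) ; lneg = sF-LastNeg ψ ℓ' })
   where
   one : ∀ v -> Columns.Pre r J v -> ev v ≡ Uw k v (Sk k Φ) μ₀ n
   one v pv = cong₂ (\ w μ -> rawW k w g μ n) (sym (LP.++-identityʳ (map suc v))) (sym d) & RawUw.raw-Uw k r ℓ' W b Wr _ b<k v [] g s pv n &
    V.Uw-congr k r ℓ' W b Wr _ b<k v _ (Sk k Φ) s pv (\ η sη i -> evalS-kSchur k (dropZeros η) ψ i & Sk-dropZeros k ψ (V.St.par sη) i) n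

 -- A product of elementary lowerings is symmetric in the first r rows, so the function stays
 -- antisymmetric there and the ideal of Uν may be replaced by full rows, where reflections of the
 -- first r weights act.
 weight-sum : ∀ l -> Sk k (EEs J l Φ) μ₀ n ≡ Peel.SF r J Wt.ev 0 (replicate J []) l []
 weight-sum l = demazure (EEs J l Φ) (EEs-Anti ℓ (m≤m+n r _) J l Φ (\ i p -> an ℓ i (<-≤-trans p (m≤m+n r _)))) n &
  sym (SF-H full J l Φ γ₀ n) & SF-cong[] J l (\ v pv -> H-Xw full v Φ γ₀ n & cong (\ γ -> H full Φ γ n) (cong (sub v) γ₀-up & sub-up v Wt.U (All.map (\ p -> <-≤-trans p (eq≤ (sym lU))) (proj₁ pv))))
  where lU : length Wt.U ≡ r
        lU = LP.length-map _ (replicate r J) & LP.length-replicate r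

 -- The determinant is formed from the noncommuting words, transferred term by term to weights, and
 -- there summed to the single weight μ.
 tableau-sum : ∀ μ' -> length μ' ≡ r -> Decr (J ∷ μ') ->
  ∑ (ssyt r (m₀ + J) (shift m₀ μ')) (\ T -> ev (map (_∸ 1) (creading r (m₀ + J) (shift m₀ μ') T))) ≡ H full Φ (toZ (shift m₀ μ') ++ toZ ν) n
 tableau-sum μ' e d = Link.ssyt-TJ r m₀ J μ' ev e & sym (Tab.SJ≡TJ r J ev r 0 (replicate J []) μ' (+-identityʳ r) commutes (oks J) (LP.length-replicate J) e d) &
  sG-cong (toZ (heights J μ')) (\ l -> column-sum l & weight-sum l) & Wt.SJ-weight μ' e d & cong (\ γ -> H full Φ (γ ++ toZ ν) n) (sym (LP.map-∘ μ') & LP.map-cong (\ x -> cong +_ (+-comm x m₀)) μ' & LP.map-∘ μ')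
  where oks : ∀ J -> All (Columns.Ok r 0) (replicate J [])
        oks zero = []
        oks (suc J) = ([] , \ _ -> z≤n) ∷ oks J

theorem5p1 : (k r : ℕ) → 1 ≤ k → 1 ≤ r → r ≤ suc k →
    (μ ν : List ℕ) →
    length μ ≡ r → Decreasing μ → All (λ x → x ≤ suc k ∸ r) μ →
    IsPartition ν → All (λ x → x ≤ k) ν →
    Decreasing (μ ++ ν) →
    Bcal (map (λ x → + x) μ) (kSchur k ν)
      ≈S sumS (map (λ T → evalK k (uWord k (creading r (suc k ∸ r) μ T)
                                      ((oneP , replicate r (suc k ∸ r) ++ ν) ∷ [])))
                   (ssyt r (suc k ∸ r) μ))
theorem5p1 k (suc r') _ _ r≤ μ ν lμ _ μ≤ (_ , pν) _ dec mono n = lhs & sym rhs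
 where
 r = suc r'
 W = suc k ∸ r
 ψ = coeffFun mono
 -- The last and smallest part of μ: the first m₀ columns of U/μ are empty, and no part of ν exceeds
 -- m₀.
 m₀ = nthN μ r'
 J = W ∸ m₀
 X₀ = (oneP , replicate r W ++ ν) ∷ []
 facts = Decr-++ μ ν (Linked⇒Decr dec)
 m₀≤W : m₀ ≤ W
 m₀≤W = All-nth μ r' (eq≤ (sym lμ)) μ≤
 mJ : m₀ + J ≡ W
 mJ = m+[n∸m]≡n m₀≤W
 module C = Coefficient k r' W J m₀ ν (m∸n+n≡m r≤) mJ pν (proj₁ (proj₂ facts)) (All-nth μ r' (eq≤ (sym lμ)) (proj₂ (proj₂ facts))) ψ n (Symm-coeff mono)
 μ′ = map (_∸ m₀) μ
 shift≡ : shift m₀ μ′ ≡ μ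
 shift≡ = sym (LP.map-∘ μ) & go μ (last-min μ r' lμ (proj₁ facts))
  where go : ∀ l -> All (m₀ ≤_) l -> map (\ x -> m₀ + (x ∸ m₀)) l ≡ l
        go [] _ = refl
        go (x ∷ l) (p ∷ ps) = cong₂ _∷_ (m+[n∸m]≡n p) (go l ps)
 dμ′ : Decr (J ∷ μ′)
 dμ′ = sub≤ μ μ≤ , dm μ (proj₁ facts)
  where sub≤ : ∀ {b} l -> All (_≤ b) l -> All (_≤ b ∸ m₀) (map (_∸ m₀) l)
        sub≤ [] _ = []
        sub≤ (x ∷ l) (p ∷ ps) = ∸-monoˡ-≤ m₀ p ∷ sub≤ l ps
        dm : ∀ l -> Decr l -> Decr (map (_∸ m₀) l)
        dm [] _ = tt
        dm (x ∷ l) (a , d) = sub≤ l a , dm l d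
 value : ℤ
 value = H (roots (fullRoot k r ν) (r + length ν)) (sF ψ) (toZ μ ++ toZ ν) n
 lhs : coeffS (Bcal (toZ μ) (kSchur k ν)) mono n ≡ value
 lhs = coeffS-evalS (Bcal (toZ μ) (kSchur k ν)) mono n & evalS-Bcal k μ ν ψ n (ZI-coeff mono) & cong (\ r -> H (roots (fullRoot k r ν) (r + length ν)) (sF ψ) (toZ μ ++ toZ ν) n) lμ
 S = ssyt r W μ
 f = \ T -> evalK k (uWord k (creading r W μ T) X₀)
 word : ∀ T -> T ∈ S -> evalS (f T) ψ n ≡ C.ev (map (_∸ 1) (creading r W μ T))
 word T T∈ = evalS-evalK k (uWord k (creading r W μ T) X₀) ψ n & sumK-uWord k (creading r W μ T) X₀ C.g n & +0ʳ _ & act-oneP (rawW k (creading r W μ T) C.g (replicate r W ++ ν)) n &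
  cong (\ w -> rawW k w C.g (replicate r W ++ ν) n) (sym (sucs (creading r W μ T) (creading-pos r W μ T lμ T∈)))
  where sucs : ∀ w -> All (1 ≤_) w -> map suc (map (_∸ 1) w) ≡ w
        sucs [] _ = refl
        sucs (suc x ∷ w) (_ ∷ ps) = cong (suc x ∷_) (sucs w ps)
 rhs : coeffS (sumS (map f S)) mono n ≡ value
 rhs = coeffS-evalS (sumS (map f S)) mono n & evalS-sumS (map f S) ψ n & ∑-map f S (\ s -> evalS s ψ n) & ∑-cong∈ S word &
  subst₂ (\ W μ -> ∑ (ssyt r W μ) (\ T -> C.ev (map (_∸ 1) (creading r W μ T))) ≡ H (roots (fullRoot k r ν) (r + length ν)) (sF ψ) (toZ μ ++ toZ ν) n) mJ shift≡
   (C.tableau-sum μ′ (LP.length-map _ μ & lμ) dμ′)
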